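{- Among the positive integers $n$, $\overline{b}_5(n)$ is $0$ for at least $30\%$, greater than $0$ for at least $52\%$, and less than $0$ for at least $10\%$. That is, $$\liminf_{N\to\infty}\frac{\#\{1\le n\le N:\overline{b}_5(n)=0\}}{N}\ge \frac{30}{100},\qquad \liminf_{N\to\infty}\frac{\#\{1\le n\le N:\overline{b}_5(n)>0\}}{N}\ge \frac{52}{100},$$ $$\liminf_{N\to\infty}\frac{\#\{1\le n\le N:\overline{b}_5(n)<0\}}{N}\ge \frac{10}{100}.$$
   Context: For $j\ge1$ let $f_j:=\prod_{k\ge 1}(1-q^{jk})$ (for $|q|<1$, or as a formal power series). Let $\psi(-q):=\sum_{n=0}^{\infty}(-q)^{n(n+1)/2}=f_1f_4/f_2$, so that $\psi(-q^5)=f_5f_{20}/f_{10}$. The integers $\overline{b}_5(n)$ are defined by $$\sum_{n=0}^\infty \overline{b}_5(n)q^n=\frac{\psi^5(-q^5)}{\psi(-q)}=1+q+q^2+2q^3+3q^4-q^5+2q^7-2q^9+6q^{10}+\cdots .$$ Percentages of positive integers are understood in the sense of (lower) asymptotic density. -}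

module Defs where

open import Data.Bool.Base using (if_then_else_)
open import Data.Fin.Base using (toℕ; zero; suc)
open import Data.Integer.Base as ℤ using (ℤ; +_; 0ℤ; 1ℤ; -1ℤ; _+_; _*_; _-_)
import Data.Integer.Properties as ℤ
open import Data.Integer.Tactic.RingSolver using (solve-∀)
open import Data.List.Base using (List; []; _∷_; applyUpTo; filter; length)
open import Data.Nat.Base as ℕ using (ℕ; zero; suc; NonZero)
import Data.Nat.DivMod as ℕ
import Data.Nat.Divisibility as ℕ
import Data.Nat.Properties as ℕ
open import Data.Product.Base using (∃-syntax)
open import Data.Rational.Base as ℚ using (ℚ; 0ℚ)
open import Data.Vec.Base using (Vec; []; _∷_; head; lookup)
open import Function.Base using (_∘_)
open import Level using (Level)
open import Relation.Binary.PropositionalEquality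
open import Relation.Nullary.Decidable.Core using (⌊_⌋)
open import Relation.Unary using (Pred; Decidable)

open import Algebra.Properties.Semiring.Sum ℤ.+-*-semiring public
  using (sum; sum-syntax; sum-cong-≗)

private
  variable
    ℓ : Level
    P : Pred ℕ ℓ

------------------------------------------------------------------------
-- Formal power series over ℤ, given by their coefficients

Series : Set
Series = ℕ → ℤ

one : Series
one zero    = 1ℤ
one (suc _) = 0ℤ

infixl 7 _⊛_ _⊘_
infixr 8 _^ˢ_

_⊛_ : Series → Series → Series
(a ⊛ b) n = ∑[ i < suc n ] (a (toℕ i) * b (n ℕ.∸ toℕ i))

_^ˢ_ : Series → ℕ → Series
a ^ˢ zero  = one
a ^ˢ suc k = a ⊛ a ^ˢ k

-- a(q) ↦ a(-q)
negVar : Series → Series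
negVar a n = (-1ℤ ℤ.^ n) * a n

-- a(q) ↦ a(qᵏ)
powVar : (k : ℕ) .{{_ : NonZero k}} → Series → Series
powVar k a n = if ⌊ k ℕ.∣? n ⌋ then a (n ℕ./ k) else 0ℤ

-- Division by a series g with constant term 1.  The vector
-- quotientPrefix f g n lists the first n coefficients of the quotient,
-- the latest one first; each is forced by comparing coefficients in
-- g ⊛ (f ⊘ g) = f.

nextCoeff : Series → Series → (n : ℕ) → Vec ℤ n → ℤ
nextCoeff f g n v = f n - ∑[ i < n ] (g (suc (toℕ i)) * lookup v i)

quotientPrefix : Series → Series → (n : ℕ) → Vec ℤ n
quotientPrefix f g zero    = []
quotientPrefix f g (suc n) =
  nextCoeff f g n (quotientPrefix f g n) ∷ quotientPrefix f g n

_⊘_ : Series → Series → Series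
(f ⊘ g) n = nextCoeff f g n (quotientPrefix f g n)

lookup-quotientPrefix : ∀ f g n i →
  lookup (quotientPrefix f g n) i ≡ (f ⊘ g) (n ℕ.∸ suc (toℕ i))
lookup-quotientPrefix f g (suc n) zero    = refl
lookup-quotientPrefix f g (suc n) (suc i) =
  lookup-quotientPrefix f g n i

⊘-correct : ∀ f g → g 0 ≡ 1ℤ → g ⊛ (f ⊘ g) ≗ f
⊘-correct f g g₀≡1 n = begin
  g 0 * (f ⊘ g) n + S  ≡⟨ cong (λ z → z * (f ⊘ g) n + S) g₀≡1 ⟩
  1ℤ * (f n - T) + S   ≡⟨ cong (λ z → 1ℤ * (f n - T) + z) (sym T≡S) ⟩
  1ℤ * (f n - T) + T   ≡⟨ cancel (f n) T ⟩
  f n                  ∎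
  where
  open ≡-Reasoning
  S T : ℤ
  S = ∑[ i < n ] (g (suc (toℕ i)) * (f ⊘ g) (n ℕ.∸ suc (toℕ i)))
  T = ∑[ i < n ] (g (suc (toℕ i)) * lookup (quotientPrefix f g n) i)
  T≡S : T ≡ S
  T≡S = sum-cong-≗ {n} λ i →
    cong (g (suc (toℕ i)) *_) (lookup-quotientPrefix f g n i)
  cancel : ∀ x t → 1ℤ * (x - t) + t ≡ x
  cancel = solve-∀

------------------------------------------------------------------------
-- ψ(q) = Σ q^(n(n+1)/2) and the coefficients b̄₅(n)

triangular : ℕ → ℕ
triangular n = n ℕ.* suc n ℕ./ 2

-- As n ≤ triangular n, only the terms with n ≤ m can contribute to the
-- coefficient of qᵐ.
ψ : Series
ψ m = ∑[ n < suc m ] (if ⌊ triangular (toℕ n) ℕ.≟ m ⌋ then 1ℤ else 0ℤ)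

ψ[-q] : Series
ψ[-q] = negVar ψ

ψ[-q⁵] : Series
ψ[-q⁵] = powVar 5 ψ[-q]

b̄₅ : ℕ → ℤ
b̄₅ = ψ[-q⁵] ^ˢ 5 ⊘ ψ[-q]

b̄₅-defining : ψ[-q] ⊛ b̄₅ ≗ ψ[-q⁵] ^ˢ 5
b̄₅-defining = ⊘-correct (ψ[-q⁵] ^ˢ 5) ψ[-q] refl

b̄₅-initial : applyUpTo b̄₅ 11 ≡
  + 1 ∷ + 1 ∷ + 1 ∷ + 2 ∷ + 3 ∷ -1ℤ ∷ + 0 ∷ + 2 ∷ + 0 ∷ ℤ.- + 2 ∷ + 6 ∷ []
b̄₅-initial = refl

------------------------------------------------------------------------
-- Lower density

-- #{1 ≤ n ≤ N : P n}
count : Decidable P → ℕ → ℕ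
count P? N = length (filter P? (applyUpTo suc N))

frequency : Decidable P → (N : ℕ) .{{_ : NonZero N}} → ℚ
frequency P? N = + count P? N ℚ./ N

-- c ≤ liminf x.  The limit inferior sup_M inf_{N ≥ M} x N is a real number
-- with no representative in ℚ in general, so the inequality is spelled
-- out: every c - ε with ε > 0 is a lower bound of some tail of x.
infix 4 _≤liminf_

_≤liminf_ : ℚ → ((N : ℕ) .{{_ : NonZero N}} → ℚ) → Set
c ≤liminf x = ∀ (ε : ℚ) → 0ℚ ℚ.< ε →
  ∃[ M ] (∀ (N : ℕ) .{{_ : NonZero N}} → M ℕ.≤ N → c ℚ.- ε ℚ.≤ x N)

{-# OPTIONS --safe #-}

-- Let c(N) be the coefficient of q^N in q³ψ⁵(q⁵)/ψ(q), so that b̄₅(n) = (-1)ⁿ c(n + 3).  By Kronecker's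
-- formula for Σ zⁿ/(1 - q^(5(2n+1))) at z = q² and z = q⁴, together with Jacobi's triple product, this
-- quotient is a product of two Eisenstein series of weight 1,
--   (Σ ε₁(x) q^(ax)) (Σ ε₂(y) q^(by)),  a, b odd,  ε₁ = [1] - [4],  ε₂ = [2] - [3] modulo 5.
-- Liouville's elementary rearrangements of a x + b y = N turn the convolution into divisor sums,
--   4 c(N) = A(N) - 3 A(N/2) - B(N) + B(N/2),  A(N) = Σ χ(N/d) d,  B(N) = Σ χ(d) d,  χ = (·/5).
-- As A > 0, B = χ A away from 5, A(5N) = 5 A(N) and B(5N) = B(N), the sign of c(N) is constant on 19 of
-- the 20 classes modulo 20: b̄₅ vanishes on 6 of them, is positive on 11 and negative on 2.

module Submission where

open import Defs hiding (_⊛_)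
import Defs
open import Algebra.Bundles using (AbelianGroup; CommutativeMonoid; CommutativeRing; CommutativeSemiring)
import Algebra.Properties.Group as GroupProperties
import Algebra.Solver.CommutativeMonoid as CommutativeMonoidSolver
import Algebra.Solver.Ring.NaturalCoefficients.Default as NaturalCoefficients
open import Data.Bool.Base using (Bool; true; false; if_then_else_)
open import Data.Fin.Base as Fin using (Fin)
open import Data.Fin.Patterns
open import Data.Fin.Properties as Fin using (all?)
open import Data.Integer.Base as ℤ using (ℤ; +_; -[1+_]; 0ℤ; 1ℤ; -1ℤ; _+_; _*_; _-_; -_; ∣_∣)
open import Data.Integer.Properties as ℤ using (_≟_; _<?_)
open import Data.Integer.Tactic.RingSolver using (solve-∀)
open import Data.List.Base using (List; []; _∷_; applyUpTo; filter; length)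
open import Data.List.Relation.Unary.All as All using (All; []; _∷_)
open import Data.Nat.Base as ℕ using (ℕ; zero; suc; z≤n; s≤s)
open import Data.Nat.Divisibility using (_∣_; _∣?_; divides; ∣⇒≤; ∣m+n∣m⇒∣n; ∣-refl; ∣-trans; m∣m*n; n∣m*n)
import Data.Nat.DivMod as ℕ
open import Data.Nat.Induction using (<-rec)
import Data.Nat.ListAction as List
open import Data.Nat.Primality using (Prime; euclidsLemma; prime?; prime⇒nonTrivial)
open import Data.Nat.Primality.Factorisation using (factorise)
import Data.Nat.Properties as ℕ
import Data.Nat.Tactic.RingSolver as ℕ-Solver
open import Data.Product.Base using (_×_; _,_; proj₁; proj₂; ∃-syntax)
open import Data.Rational.Base as ℚ using (ℚ; mkℚ; _/_)
import Data.Rational.Properties as ℚ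
open import Data.Rational.Unnormalised.Base as ℚᵘ using (mkℚᵘ)
import Data.Rational.Unnormalised.Properties as ℚᵘ
open import Data.Sum.Base using (_⊎_; inj₁; inj₂)
open import Data.Vec.Base using ([]; _∷_)
open import Function.Base using (_∘_; _$_)
open import Level using (0ℓ)
open import Relation.Binary.PropositionalEquality
import Relation.Binary.Reasoning.Setoid as SetoidReasoning
open import Relation.Nullary using (¬_; yes; no; contradiction)
open import Relation.Nullary.Decidable using (from-yes; _→-dec_)
open import Relation.Nullary.Decidable.Core using (⌊_⌋)
open import Relation.Unary using (Pred; Decidable)
open import Data.List.Membership.DecPropositional ℕ._≟_ using (_∈?_)

-- Formal power series

-- Kronecker's formula makes `F` a quotient of theta series times a factor `S` free of z, so `S` has
-- to be evaluated only once, as ψ². The formula does this itself: its instances at z = -q in base q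
-- and at z = q in base q² show that S(q)/ψ(q)² is invariant under q ↦ q², hence equal to its
-- constant term 1. With θ_a for `Θ -1ℤ 5 a`, the quotients at z = q² and z = q⁴ are θ₃/θ₂ and
-- θ₁/θ₄, and ψ(q) θ₁ θ₃ = ψ(q⁵) θ₂ θ₄ raises the power ψ⁴(q⁵) that comes from `S` to the fifth. The
-- convolution carries different characters on x and y, so it has no symmetry to exploit directly.
-- Sums over a x + b y = N are decomposed twice, by comparing x with y and a with b; a function `u`
-- on (ℤ/5)² is arranged so that the off-diagonal parts of the two decompositions agree, and only
-- sums over divisors survive. The inequalities behind the signs, A > 0 and B ≤ A, come from
-- recursions at one prime at a time, without multiplicativity of A. The class 20 ∣ N is the one
-- left undecided.

+-cancelʳ : ∀ x y z → y + x ≡ z + x → y ≡ z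
+-cancelʳ = GroupProperties.∙-cancelʳ (AbelianGroup.group ℤ.+-0-abelianGroup)

+-congˡ : ∀ x {y z} → y ≡ z → x + y ≡ x + z
+-congˡ x = cong (λ y → x + y)

tail : Series → Series
tail a n = a (suc n)

infixl 6 _⊕_
infixl 7 _·_

_⊕_ : Series → Series → Series
(a ⊕ b) n = a n + b n

_·_ : ℤ → Series → Series
(x · a) n = x * a n

𝟎 : Series
𝟎 _ = 0ℤ

infix 4 _≈[_]_

-- Congruence modulo q^(m+1). Every limit below, such as an infinite product or the iteration of q ↦
-- q², is taken at a finite order, so no topology on series is involved.
_≈[_]_ : Series → ℕ → Series → Set
a ≈[ m ] b = ∀ i → i ℕ.≤ m → a i ≡ b i

≗⇒≈ : ∀ {m a b} → a ≗ b → a ≈[ m ] b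
≗⇒≈ p i _ = p i

≈-refl : ∀ {a m} → a ≈[ m ] a
≈-refl _ _ = refl

≈-trans : ∀ {a b c m} → a ≈[ m ] b → b ≈[ m ] c → a ≈[ m ] c
≈-trans p q i i≤m = trans (p i i≤m) (q i i≤m)

≈-tail : ∀ {a b m} → a ≈[ suc m ] b → tail a ≈[ m ] tail b
≈-tail p i i≤m = p (suc i) (s≤s i≤m)

≈-≤ : ∀ {a b m n} → n ℕ.≤ m → a ≈[ m ] b → a ≈[ n ] b
≈-≤ n≤m p i i≤n = p i (ℕ.≤-trans i≤n n≤m)

infixl 7 _⊛_

-- Opaque, so that comparing two products never unfolds their coefficients.
opaque
  _⊛_ : Series → Series → Series
  a ⊛ b = a Defs.⊛ b

opaque
  unfolding _⊛_

  ⊛-0 : ∀ a b → (a ⊛ b) 0 ≡ a 0 * b 0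
  ⊛-0 a b = ℤ.+-identityʳ _

  ⊛-suc : ∀ a b n → (a ⊛ b) (suc n) ≡ a 0 * b (suc n) + (tail a ⊛ b) n
  ⊛-suc a b n = refl

  ⊛-cong-at : ∀ {a a′ b b′} n → a ≈[ n ] a′ → b ≈[ n ] b′ → (a ⊛ b) n ≡ (a′ ⊛ b′) n
  ⊛-cong-at zero    p q = cong₂ (λ x y → x * y + 0ℤ) (p 0 z≤n) (q 0 z≤n)
  ⊛-cong-at (suc n) p q = cong₂ _+_
    (cong₂ _*_ (p 0 z≤n) (q (suc n) ℕ.≤-refl))
    (⊛-cong-at n (≈-tail p) (≈-≤ (ℕ.n≤1+n n) q))

  ⊛-cong≈ : ∀ {a a′ b b′ m} → a ≈[ m ] a′ → b ≈[ m ] b′ → a ⊛ b ≈[ m ] a′ ⊛ b′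
  ⊛-cong≈ p q i i≤m = ⊛-cong-at i (≈-≤ i≤m p) (≈-≤ i≤m q)

  ⊛-cong : ∀ {a a′ b b′} → a ≗ a′ → b ≗ b′ → a ⊛ b ≗ a′ ⊛ b′
  ⊛-cong p q n = ⊛-cong-at n (≗⇒≈ p) (≗⇒≈ q)

  ⊛-distribʳ : ∀ c a b → (a ⊕ b) ⊛ c ≗ a ⊛ c ⊕ b ⊛ c
  ⊛-distribʳ c a b zero    = lemma (a 0) (b 0) (c 0)
    where
    lemma : ∀ x y z → (x + y) * z + 0ℤ ≡ (x * z + 0ℤ) + (y * z + 0ℤ)
    lemma = solve-∀
  ⊛-distribʳ c a b (suc n) = trans
    (+-congˡ ((a 0 + b 0) * c (suc n)) (⊛-distribʳ c (tail a) (tail b) n))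
    (lemma (a 0) (b 0) (c (suc n)) _ _)
    where
    lemma : ∀ x y z s t → (x + y) * z + (s + t) ≡ (x * z + s) + (y * z + t)
    lemma = solve-∀

  ⊛-distribˡ : ∀ c a b → c ⊛ (a ⊕ b) ≗ c ⊛ a ⊕ c ⊛ b
  ⊛-distribˡ c a b zero    = lemma (a 0) (b 0) (c 0)
    where
    lemma : ∀ x y z → z * (x + y) + 0ℤ ≡ (z * x + 0ℤ) + (z * y + 0ℤ)
    lemma = solve-∀
  ⊛-distribˡ c a b (suc n) = trans
    (+-congˡ (c 0 * (a (suc n) + b (suc n))) (⊛-distribˡ (tail c) a b n))
    (lemma (a (suc n)) (b (suc n)) (c 0) _ _)
    where
    lemma : ∀ x y z s t → z * (x + y) + (s + t) ≡ (z * x + s) + (z * y + t)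
    lemma = solve-∀

  ·-⊛ : ∀ x a b → (x · a) ⊛ b ≗ x · (a ⊛ b)
  ·-⊛ x a b zero    = lemma x (a 0) (b 0)
    where
    lemma : ∀ x y z → x * y * z + 0ℤ ≡ x * (y * z + 0ℤ)
    lemma = solve-∀
  ·-⊛ x a b (suc n) = trans
    (+-congˡ (x * a 0 * b (suc n)) (·-⊛ x (tail a) b n))
    (lemma x (a 0) (b (suc n)) _)
    where
    lemma : ∀ x y z s → x * y * z + x * s ≡ x * (y * z + s)
    lemma = solve-∀

  ⊛-assoc : ∀ a b c → (a ⊛ b) ⊛ c ≗ a ⊛ (b ⊛ c)
  ⊛-assoc a b c zero    = lemma (a 0) (b 0) (c 0)
    where
    lemma : ∀ x y z → (x * y + 0ℤ) * z + 0ℤ ≡ x * (y * z + 0ℤ) + 0ℤ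
    lemma = solve-∀
  ⊛-assoc a b c (suc n) = begin
    (a 0 * b 0 + 0ℤ) * c (suc n) + (((a 0 · tail b) ⊕ (tail a ⊛ b)) ⊛ c) n
      ≡⟨ +-congˡ ((a 0 * b 0 + 0ℤ) * c (suc n))
           (⊛-distribʳ c (a 0 · tail b) (tail a ⊛ b) n) ⟩
    (a 0 * b 0 + 0ℤ) * c (suc n) + (((a 0 · tail b) ⊛ c) n + ((tail a ⊛ b) ⊛ c) n)
      ≡⟨ cong₂ (λ s t → (a 0 * b 0 + 0ℤ) * c (suc n) + (s + t))
           (·-⊛ (a 0) (tail b) c n) (⊛-assoc (tail a) b c n) ⟩
    (a 0 * b 0 + 0ℤ) * c (suc n) + (a 0 * (tail b ⊛ c) n + (tail a ⊛ (b ⊛ c)) n)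
      ≡⟨ lemma (a 0) (b 0) (c (suc n)) _ _ ⟩
    a 0 * (b 0 * c (suc n) + (tail b ⊛ c) n) + (tail a ⊛ (b ⊛ c)) n ∎
    where
    open ≡-Reasoning
    lemma : ∀ x y z s t → (x * y + 0ℤ) * z + (x * s + t) ≡ x * (y * z + s) + t
    lemma = solve-∀

  ⊛-sucʳ : ∀ a b n → (a ⊛ b) (suc n) ≡ a (suc n) * b 0 + (a ⊛ tail b) n
  ⊛-sucʳ a b zero    = lemma (a 0) (b 1) (a 1) (b 0)
    where
    lemma : ∀ x y z w → x * y + (z * w + 0ℤ) ≡ z * w + (x * y + 0ℤ)
    lemma = solve-∀
  ⊛-sucʳ a b (suc n) = trans
    (+-congˡ (a 0 * b (suc (suc n))) (⊛-sucʳ (tail a) b n))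
    (lemma (a 0 * b (suc (suc n))) (a (suc (suc n)) * b 0) _)
    where
    lemma : ∀ x y z → x + (y + z) ≡ y + (x + z)
    lemma = solve-∀

  ⊛-comm : ∀ a b → a ⊛ b ≗ b ⊛ a
  ⊛-comm a b zero    = cong (_+ 0ℤ) (ℤ.*-comm (a 0) (b 0))
  ⊛-comm a b (suc n) = trans (⊛-sucʳ a b n)
    (cong₂ _+_ (ℤ.*-comm (a (suc n)) (b 0)) (⊛-comm a (tail b) n))

  ⊛-zeroˡ : ∀ a → 𝟎 ⊛ a ≗ 𝟎
  ⊛-zeroˡ a zero    = refl
  ⊛-zeroˡ a (suc n) = trans (ℤ.+-identityˡ _) (⊛-zeroˡ a n)

  ⊛-identityˡ : ∀ a → one ⊛ a ≗ a
  ⊛-identityˡ a zero    = trans (ℤ.+-identityʳ _) (ℤ.*-identityˡ (a 0))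
  ⊛-identityˡ a (suc n) = trans
    (cong₂ _+_ (ℤ.*-identityˡ (a (suc n))) (⊛-zeroˡ a n)) (ℤ.+-identityʳ _)

  ⊛-identityʳ : ∀ a → a ⊛ one ≗ a
  ⊛-identityʳ a n = trans (⊛-comm a one n) (⊛-identityˡ a n)

seriesRing : CommutativeRing 0ℓ 0ℓ
seriesRing = record
  { Carrier = Series ; _≈_ = _≗_ ; _+_ = _⊕_ ; _*_ = _⊛_
  ; -_ = λ a n → - a n ; 0# = 𝟎 ; 1# = one
  ; isCommutativeRing = record
    { isRing = record
      { +-isAbelianGroup = record
        { isGroup = record
          { isMonoid = record
            { isSemigroup = record
              { isMagma = record
                { isEquivalence = record
                  { refl = λ _ → refl
                  ; sym = λ p n → sym (p n)
                  ; trans = λ p q n → trans (p n) (q n) }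
                ; ∙-cong = λ p q n → cong₂ _+_ (p n) (q n) }
              ; assoc = λ a b c n → ℤ.+-assoc (a n) (b n) (c n) }
            ; identity = (λ a n → ℤ.+-identityˡ (a n)) , (λ a n → ℤ.+-identityʳ (a n)) }
          ; inverse = (λ a n → ℤ.+-inverseˡ (a n)) , (λ a n → ℤ.+-inverseʳ (a n))
          ; ⁻¹-cong = λ p n → cong -_ (p n) }
        ; comm = λ a b n → ℤ.+-comm (a n) (b n) }
      ; *-cong = ⊛-cong
      ; *-assoc = ⊛-assoc
      ; *-identity = ⊛-identityˡ , ⊛-identityʳ
      ; distrib = ⊛-distribˡ , ⊛-distribʳ }
    ; *-comm = ⊛-comm } }

open CommutativeRing seriesRing public using () renaming
  ( refl to ≗-refl; sym to ≗-sym; trans to ≗-trans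
  ; *-commutativeMonoid to ⊛-commutativeMonoid; commutativeSemiring to seriesSemiring)

-- The coefficient of q^(m+1) in `u ⊛ a` is `u 0 * a (suc m)` plus terms in lower coefficients of
-- `a`, so agreement propagates upwards. The truncated form serves the doubling argument for `S` and
-- the limit of the Gaussian binomials.
⊛-cancelˡ≈ : ∀ {a b m} u → u 0 ≡ 1ℤ → u ⊛ a ≈[ m ] u ⊛ b → a ≈[ m ] b
⊛-cancelˡ≈ {a} {b} {m} u u₀≡1 = go m
  where
  open ≡-Reasoning
  head-cancel : ∀ x y t → u 0 * x + t ≡ u 0 * y + t → x ≡ y
  head-cancel x y t p = begin
    x          ≡⟨ ℤ.*-identityˡ x ⟨
    1ℤ * x     ≡⟨ cong (_* x) u₀≡1 ⟨
    u 0 * x    ≡⟨ +-cancelʳ t _ _ p ⟩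
    u 0 * y    ≡⟨ cong (_* y) u₀≡1 ⟩
    1ℤ * y     ≡⟨ ℤ.*-identityˡ y ⟩
    y          ∎
  go : ∀ m → u ⊛ a ≈[ m ] u ⊛ b → a ≈[ m ] b
  go zero    p zero z≤n = head-cancel (a 0) (b 0) 0ℤ
    (trans (sym (trans (⊛-0 u a) (sym (ℤ.+-identityʳ _)))) (trans (p 0 z≤n) (trans (⊛-0 u b) (sym (ℤ.+-identityʳ _)))))
  go (suc m) p i i≤1+m with ℕ.m≤n⇒m<n∨m≡n i≤1+m
  ... | inj₁ i<1+m = go m (≈-≤ (ℕ.n≤1+n m) p) i (ℕ.≤-pred i<1+m)
  ... | inj₂ refl  = head-cancel (a (suc m)) (b (suc m)) ((tail u ⊛ b) m)
    (trans (+-congˡ (u 0 * a (suc m)) (sym (⊛-cong-at m (≈-refl {tail u}) (go m (≈-≤ (ℕ.n≤1+n m) p)))))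
           (trans (sym (⊛-suc u a m)) (trans (p (suc m) ℕ.≤-refl) (⊛-suc u b m))))

⊛-cancelˡ : ∀ {a b} u → u 0 ≡ 1ℤ → u ⊛ a ≗ u ⊛ b → a ≗ b
⊛-cancelˡ u u₀≡1 p n = ⊛-cancelˡ≈ {m = n} u u₀≡1 (≗⇒≈ p) n ℕ.≤-refl

-- Sums over ℕ and ℤ

∑ℕ : ℕ → (ℕ → ℤ) → ℤ
∑ℕ zero    f = 0ℤ
∑ℕ (suc n) f = f 0 + ∑ℕ n (f ∘ suc)

∑ℕ-cong< : ∀ n {f g} → (∀ i → i ℕ.< n → f i ≡ g i) → ∑ℕ n f ≡ ∑ℕ n g
∑ℕ-cong< zero    p = refl
∑ℕ-cong< (suc n) p = cong₂ _+_ (p 0 (s≤s z≤n)) (∑ℕ-cong< n λ i i<n → p (suc i) (s≤s i<n))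

∑ℕ-cong : ∀ n {f g} → (∀ i → f i ≡ g i) → ∑ℕ n f ≡ ∑ℕ n g
∑ℕ-cong n p = ∑ℕ-cong< n λ i _ → p i

∑ℕ-zero : ∀ n {f} → (∀ i → f i ≡ 0ℤ) → ∑ℕ n f ≡ 0ℤ
∑ℕ-zero zero    p = refl
∑ℕ-zero (suc n) p = cong₂ _+_ (p 0) (∑ℕ-zero n (p ∘ suc))

interchange : ∀ x y z w → (x + y) + (z + w) ≡ (x + z) + (y + w)
interchange = solve-∀

∑ℕ-+ : ∀ n f g → ∑ℕ n (λ i → f i + g i) ≡ ∑ℕ n f + ∑ℕ n g
∑ℕ-+ zero    f g = refl
∑ℕ-+ (suc n) f g = trans (+-congˡ (f 0 + g 0) (∑ℕ-+ n (f ∘ suc) (g ∘ suc)))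
  (interchange (f 0) (g 0) _ _)

∑ℕ-* : ∀ n x f → ∑ℕ n (λ i → x * f i) ≡ x * ∑ℕ n f
∑ℕ-* zero    x f = sym (ℤ.*-zeroʳ x)
∑ℕ-* (suc n) x f = trans (+-congˡ (x * f 0) (∑ℕ-* n x (f ∘ suc)))
  (sym (ℤ.*-distribˡ-+ x (f 0) _))

∑ℕ-swap : ∀ m n (f : ℕ → ℕ → ℤ) →
  ∑ℕ m (λ i → ∑ℕ n (λ j → f i j)) ≡ ∑ℕ n (λ j → ∑ℕ m (λ i → f i j))
∑ℕ-swap zero    n f = sym (∑ℕ-zero n λ _ → refl)
∑ℕ-swap (suc m) n f = trans (+-congˡ (∑ℕ n (f 0)) (∑ℕ-swap m n (f ∘ suc)))
  (sym (∑ℕ-+ n (f 0) _))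

∑ℕ-last : ∀ n f → ∑ℕ (suc n) f ≡ ∑ℕ n f + f n
∑ℕ-last zero    f = ℤ.+-comm (f 0) 0ℤ
∑ℕ-last (suc n) f = trans (+-congˡ (f 0) (∑ℕ-last n (f ∘ suc))) (sym (ℤ.+-assoc (f 0) _ _))

∑ℕ-extend : ∀ {m n f} → (∀ i → m ℕ.≤ i → f i ≡ 0ℤ) → m ℕ.≤ n → ∑ℕ n f ≡ ∑ℕ m f
∑ℕ-extend {n = n} p z≤n       = ∑ℕ-zero n λ i → p i z≤n
∑ℕ-extend {f = f} p (s≤s m≤n) = +-congˡ (f 0) (∑ℕ-extend (λ i m≤i → p (suc i) (s≤s m≤i)) m≤n)

∑ℕ-double : ∀ n f → ∑ℕ (n ℕ.* 2) f ≡ ∑ℕ n (λ i → f (i ℕ.* 2)) + ∑ℕ n (λ i → f (suc (i ℕ.* 2)))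
∑ℕ-double zero    f = refl
∑ℕ-double (suc n) f = trans
  (cong (λ s → f 0 + (f 1 + s)) (∑ℕ-double n (λ i → f (suc (suc i)))))
  (lemma (f 0) (f 1) _ _)
  where
  lemma : ∀ x y z w → x + (y + (z + w)) ≡ (x + z) + (y + w)
  lemma = solve-∀

-- The window is -n ≤ i < n. It is lopsided, and its exact symmetry is i ↦ -1 - i rather than i ↦
-- -i.
∑ℤ : ℕ → (ℤ → ℤ) → ℤ
∑ℤ n g = ∑ℕ n (λ i → g (+ i)) + ∑ℕ n (λ i → g -[1+ i ])

Supp : ℕ → (ℤ → ℤ) → Set
Supp b g = ∀ n → b ℕ.≤ ∣ n ∣ → g n ≡ 0ℤ

module _ where
  private
    variable
      f g : ℤ → ℤ

  ∑ℤ-cong≤ : ∀ n → (∀ i → ∣ i ∣ ℕ.≤ n → f i ≡ g i) → ∑ℤ n f ≡ ∑ℤ n g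
  ∑ℤ-cong≤ n p = cong₂ _+_ (∑ℕ-cong< n λ i i<n → p (+ i) (ℕ.<⇒≤ i<n))
                           (∑ℕ-cong< n λ i i<n → p -[1+ i ] i<n)

  ∑ℤ-cong : ∀ n → (∀ i → f i ≡ g i) → ∑ℤ n f ≡ ∑ℤ n g
  ∑ℤ-cong n p = ∑ℤ-cong≤ n λ i _ → p i

  ∑ℤ-zero : ∀ n → (∀ i → f i ≡ 0ℤ) → ∑ℤ n f ≡ 0ℤ
  ∑ℤ-zero n p = cong₂ _+_ (∑ℕ-zero n λ i → p (+ i)) (∑ℕ-zero n λ i → p -[1+ i ])

  ∑ℤ-+ : ∀ n f g → ∑ℤ n (λ i → f i + g i) ≡ ∑ℤ n f + ∑ℤ n g
  ∑ℤ-+ n f g = trans (cong₂ _+_ (∑ℕ-+ n (f ∘ +_) (g ∘ +_)) (∑ℕ-+ n (f ∘ -[1+_]) (g ∘ -[1+_])))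
    (interchange (∑ℕ n (f ∘ +_)) _ _ _)

  ∑ℤ-* : ∀ n x f → ∑ℤ n (λ i → x * f i) ≡ x * ∑ℤ n f
  ∑ℤ-* n x f = trans (cong₂ _+_ (∑ℕ-* n x (f ∘ +_)) (∑ℕ-* n x (f ∘ -[1+_])))
    (sym (ℤ.*-distribˡ-+ x _ _))

  ∑ℤ-neg : ∀ n f → ∑ℤ n (λ i → - f i) ≡ - ∑ℤ n f
  ∑ℤ-neg n f = trans (∑ℤ-cong n λ i → sym (ℤ.-1*i≡-i (f i)))
    (trans (∑ℤ-* n -1ℤ f) (ℤ.-1*i≡-i _))

  ∑ℤ-ℕ-swap : ∀ m n (f : ℤ → ℕ → ℤ) →
    ∑ℤ m (λ i → ∑ℕ n (f i)) ≡ ∑ℕ n (λ j → ∑ℤ m (λ i → f i j))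
  ∑ℤ-ℕ-swap m n f = trans
    (cong₂ _+_ (∑ℕ-swap m n (λ i → f (+ i))) (∑ℕ-swap m n (λ i → f -[1+ i ])))
    (sym (∑ℕ-+ n _ _))

  ∑ℤ-swap : ∀ m n (f : ℤ → ℤ → ℤ) →
    ∑ℤ m (λ i → ∑ℤ n (f i)) ≡ ∑ℤ n (λ j → ∑ℤ m (λ i → f i j))
  ∑ℤ-swap m n f = trans
    (∑ℤ-+ m (λ i → ∑ℕ n (f i ∘ +_)) (λ i → ∑ℕ n (f i ∘ -[1+_])))
    (cong₂ _+_ (∑ℤ-ℕ-swap m n (λ i → f i ∘ +_)) (∑ℤ-ℕ-swap m n (λ i → f i ∘ -[1+_])))

  ∑ℤ-extend : ∀ {m n} → Supp m f → m ℕ.≤ n → ∑ℤ n f ≡ ∑ℤ m f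
  ∑ℤ-extend p m≤n = cong₂ _+_
    (∑ℕ-extend (λ i → p (+ i)) m≤n)
    (∑ℕ-extend (λ i m≤i → p -[1+ i ] (ℕ.m≤n⇒m≤1+n m≤i)) m≤n)

  suc-neg : ∀ i → ℤ.suc -[1+ i ] ≡ - + i
  suc-neg zero    = refl
  suc-neg (suc i) = refl

  -- Both sides are the sum of `g` over -n ≤ i ≤ n.
  ∑ℤ-suc : ∀ n g → ∑ℤ n (g ∘ ℤ.suc) + g (- + n) ≡ ∑ℤ n g + g (+ n)
  ∑ℤ-suc n g = trans
    (cong (λ s → ∑ℕ n (λ i → g (+ suc i)) + s + g (- + n))
      (∑ℕ-cong n λ i → cong g (suc-neg i)))
    (lemma (g 0ℤ) _ _ (∑ℕ n (λ i → g (+ i))) (∑ℕ n (λ i → g -[1+ i ])) (g (+ n)) _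
      (∑ℕ-last n (λ i → g (+ i))) (∑ℕ-last n (λ i → g (- + i))))
    where
    rearrange : ∀ z p q v w → (z + p) + (q + w) + (- z) ≡ p + q + w
    rearrange = solve-∀
    rearrange′ : ∀ z s t v → (s + v) + (z + t) + (- z) ≡ s + t + v
    rearrange′ = solve-∀
    lemma : ∀ z p q s t v w → z + p ≡ s + v → z + t ≡ q + w → p + q + w ≡ s + t + v
    lemma z p q s t v w e₁ e₂ = begin
      p + q + w                     ≡⟨ rearrange z p q v w ⟨
      (z + p) + (q + w) + (- z)     ≡⟨ cong₂ (λ x y → x + y + (- z)) e₁ (sym e₂) ⟩
      (s + v) + (z + t) + (- z)     ≡⟨ rearrange′ z s t v ⟩
      s + t + v                     ∎
      where open ≡-Reasoning

  cancel-zero : ∀ {x y v w} → x + v ≡ y + w → v ≡ 0ℤ → w ≡ 0ℤ → x ≡ y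
  cancel-zero {x} {y} p refl refl = trans (sym (ℤ.+-identityʳ x)) (trans p (ℤ.+-identityʳ y))

  ∣-+∣ : ∀ n → ∣ - + n ∣ ≡ n
  ∣-+∣ n = ℤ.∣-i∣≡∣i∣ (+ n)

  shift-Supp : ∀ {b} s → Supp b g → Supp (b ℕ.+ ∣ s ∣) (λ n → g (s + n))
  shift-Supp {b = b} s p n b+s≤n = p (s + n) $ ℕ.+-cancelʳ-≤ _ b _ $ begin
    b ℕ.+ ∣ s ∣                 ≤⟨ b+s≤n ⟩
    ∣ n ∣                       ≡⟨ cong ∣_∣ (lemma s n) ⟩
    ∣ (s + n) + (- s) ∣         ≤⟨ ℤ.∣i+j∣≤∣i∣+∣j∣ (s + n) (- s) ⟩
    ∣ s + n ∣ ℕ.+ ∣ - s ∣       ≡⟨ cong (∣ s + n ∣ ℕ.+_) (ℤ.∣-i∣≡∣i∣ s) ⟩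
    ∣ s + n ∣ ℕ.+ ∣ s ∣         ∎
    where
    open ℕ.≤-Reasoning
    lemma : ∀ s n → n ≡ (s + n) + (- s)
    lemma = solve-∀

  private
    shift⁺ : ∀ {b n} k → Supp b g → b ℕ.+ k ℕ.≤ n → ∑ℤ n (λ i → g (+ k + i)) ≡ ∑ℤ n g
    shift⁺ {g = g} {n = n} zero    p b≤n = ∑ℤ-cong n λ i → cong g (ℤ.+-identityˡ i)
    shift⁺ {g = g} {b} {n} (suc k) p b≤n = begin
      ∑ℤ n (λ i → g (+ suc k + i))     ≡⟨ ∑ℤ-cong n (λ i → cong g (ℤ.+-assoc 1ℤ (+ k) i)) ⟩
      ∑ℤ n (λ i → g (1ℤ + (+ k + i)))  ≡⟨ shift⁺ k (shift-Supp 1ℤ p) (subst (ℕ._≤ n) (sym (ℕ.+-assoc b 1 k)) b≤n) ⟩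
      ∑ℤ n (g ∘ ℤ.suc)                 ≡⟨ cancel-zero (∑ℤ-suc n g) (p (- + n) (subst (b ℕ.≤_) (sym (∣-+∣ n)) b≤n′)) (p (+ n) b≤n′) ⟩
      ∑ℤ n g                           ∎
      where
      open ≡-Reasoning
      b≤n′ : b ℕ.≤ n
      b≤n′ = ℕ.≤-trans (ℕ.m≤m+n b (suc k)) b≤n

    pred⁻ : ∀ {b n} → Supp b g → suc b ℕ.≤ n → ∑ℤ n (g ∘ ℤ.pred) ≡ ∑ℤ n g
    pred⁻ {g = g} {b} {n} p b<n = sym $ trans
      (∑ℤ-cong n λ i → cong g (sym (ℤ.pred-suc i)))
      (cancel-zero (∑ℤ-suc n (g ∘ ℤ.pred)) (p (ℤ.pred (- + n)) (below n b<n)) (p (ℤ.pred (+ n)) (above n b<n)))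
      where
      below : ∀ n → b ℕ.< n → b ℕ.≤ ∣ ℤ.pred (- + n) ∣
      below (suc n) b<n = ℕ.m≤n⇒m≤1+n (ℕ.<⇒≤ b<n)
      above : ∀ n → b ℕ.< n → b ℕ.≤ ∣ ℤ.pred (+ n) ∣
      above (suc n) b<n = ℕ.≤-pred b<n

    shift⁻ : ∀ {b n} k → Supp b g → b ℕ.+ suc k ℕ.≤ n → ∑ℤ n (λ i → g (-[1+ k ] + i)) ≡ ∑ℤ n g
    shift⁻ {g = g} {b} {n} zero    p b≤n = pred⁻ p (subst (ℕ._≤ n) (ℕ.+-comm b 1) b≤n)
    shift⁻ {g = g} {b} {n} (suc k) p b≤n = begin
      ∑ℤ n (λ i → g (-[1+ suc k ] + i))     ≡⟨ ∑ℤ-cong n (λ i → cong g (ℤ.+-assoc -1ℤ -[1+ k ] i)) ⟩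
      ∑ℤ n (λ i → g (-1ℤ + (-[1+ k ] + i))) ≡⟨ shift⁻ k (shift-Supp -1ℤ p) (subst (ℕ._≤ n) (sym (ℕ.+-assoc b 1 (suc k))) b≤n) ⟩
      ∑ℤ n (g ∘ ℤ.pred)                     ≡⟨ pred⁻ p (ℕ.≤-trans (ℕ.≤-reflexive (ℕ.+-comm 1 b)) (ℕ.≤-trans (ℕ.+-monoʳ-≤ b (s≤s z≤n)) b≤n)) ⟩
      ∑ℤ n g                                ∎
      where open ≡-Reasoning

  ∑ℤ-shift : ∀ {b n} s → Supp b g → b ℕ.+ ∣ s ∣ ℕ.≤ n → ∑ℤ n (λ i → g (s + i)) ≡ ∑ℤ b g
  ∑ℤ-shift (+ k)    p b≤n = trans (shift⁺ k p b≤n) (∑ℤ-extend p (ℕ.m+n≤o⇒m≤o _ b≤n))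
  ∑ℤ-shift -[1+ k ] p b≤n = trans (shift⁻ k p b≤n) (∑ℤ-extend p (ℕ.m+n≤o⇒m≤o _ b≤n))

  ∑ℤ-flip : ∀ n g → ∑ℤ n (λ i → g (-1ℤ - i)) ≡ ∑ℤ n g
  ∑ℤ-flip n g = trans (ℤ.+-comm (∑ℕ n (λ i → g (-1ℤ - + i))) _)
    (cong₂ _+_ (∑ℕ-cong n λ i → cong g (lemma i)) (∑ℕ-cong n λ i → cong g (lemma′ i)))
    where
    lemma : ∀ i → -1ℤ - -[1+ i ] ≡ + i
    lemma i = refl
    lemma′ : ∀ i → -1ℤ - + i ≡ -[1+ i ]
    lemma′ zero    = refl
    lemma′ (suc i) = refl

  -- The map i ↦ -i is the symmetry i ↦ -1 - i of the window followed by a unit shift; the shift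
  -- costs the extra place in `suc b`.
  ∑ℤ-negate : ∀ {b} → Supp b g → ∑ℤ (suc b) (λ i → g (- i)) ≡ ∑ℤ b g
  ∑ℤ-negate {g = g} {b} p = begin
    ∑ℤ (suc b) (λ i → g (- i))            ≡⟨ ∑ℤ-cong (suc b) (λ i → cong g (lemma i)) ⟩
    ∑ℤ (suc b) (λ i → g (1ℤ + (-1ℤ - i))) ≡⟨ ∑ℤ-flip (suc b) (λ i → g (1ℤ + i)) ⟩
    ∑ℤ (suc b) (λ i → g (1ℤ + i))         ≡⟨ ∑ℤ-shift 1ℤ p (ℕ.≤-reflexive (ℕ.+-comm b 1)) ⟩
    ∑ℤ b g                                ∎
    where
    open ≡-Reasoning
    lemma : ∀ i → - i ≡ 1ℤ + (-1ℤ - i)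
    lemma = solve-∀

  self-neg⇒zero : ∀ x → x ≡ - x → x ≡ 0ℤ
  self-neg⇒zero (+ zero) p = refl

  -- A reflection preserves a bilateral sum of finite support, so a term that it negates sums to its
  -- own negative. The centre is a parameter because in Kronecker's identity it moves with j.
  ∑ℤ-antisym : ∀ {b} s → Supp b g → (∀ i → g (s + (-1ℤ - i)) ≡ - g i) → ∑ℤ b g ≡ 0ℤ
  ∑ℤ-antisym {g = g} {b} s p anti = self-neg⇒zero _ $ begin
    ∑ℤ b g                              ≡⟨ ∑ℤ-shift s p ℕ.≤-refl ⟨
    ∑ℤ w (λ i → g (s + i))              ≡⟨ ∑ℤ-flip w (λ i → g (s + i)) ⟨
    ∑ℤ w (λ i → g (s + (-1ℤ - i)))      ≡⟨ ∑ℤ-cong w anti ⟩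
    ∑ℤ w (λ i → - g i)                  ≡⟨ ∑ℤ-neg w g ⟩
    - ∑ℤ w g                            ≡⟨ cong -_ (∑ℤ-extend p (ℕ.m≤m+n b ∣ s ∣)) ⟩
    - ∑ℤ b g                            ∎
    where
    open ≡-Reasoning
    w = b ℕ.+ ∣ s ∣

  ∑ℤ-double : ∀ n g → ∑ℤ (n ℕ.* 2) g ≡ ∑ℤ n (λ i → g (i * + 2)) + ∑ℤ n (λ i → g (1ℤ + i * + 2))
  ∑ℤ-double n g = trans
    (cong₂ _+_ (∑ℕ-double n (λ i → g (+ i))) (∑ℕ-double n (λ i → g -[1+ i ])))
    (trans (lemma (∑ℕ n (λ i → g (+ (i ℕ.* 2)))) (∑ℕ n (λ i → g (+ suc (i ℕ.* 2)))) _ _)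
      (cong₂ _+_
        (cong₂ _+_ (∑ℕ-cong n λ i → cong g (ℤ.pos-* i 2)) refl)
        (cong₂ _+_ (∑ℕ-cong n λ i → cong (λ e → g (1ℤ + e)) (ℤ.pos-* i 2))
                   refl)))
    where
    lemma : ∀ x y z w → (x + y) + (z + w) ≡ (x + w) + (y + z)
    lemma = solve-∀

-- Monomials and bilateral sums of monomials

X : ℤ → Series
X (+ zero)    zero    = 1ℤ
X (+ zero)    (suc m) = 0ℤ
X (+ (suc k)) zero    = 0ℤ
X (+ (suc k)) (suc m) = X (+ k) m
X -[1+ k ]    m       = 0ℤ

X-diag : ∀ m → X (+ m) m ≡ 1ℤ
X-diag zero    = refl
X-diag (suc m) = X-diag m

X-off : ∀ e m → e ≢ + m → X e m ≡ 0ℤ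
X-off (+ zero)    zero    p = contradiction refl p
X-off (+ zero)    (suc m) p = refl
X-off (+ (suc k)) zero    p = refl
X-off (+ (suc k)) (suc m) p = X-off (+ k) m λ { refl → p refl }
X-off -[1+ k ]    m       p = refl

X-zero : X 0ℤ ≗ one
X-zero zero    = refl
X-zero (suc m) = refl

-- Restricted to natural exponents: a negative power is read as 0, so the rule fails for exponents
-- of opposite sign. Integer exponents are kept elsewhere because identities between them are then
-- polynomial identities for the ring solver.
X-+ℕ : ∀ k l → X (+ k) ⊛ X (+ l) ≗ X (+ (k ℕ.+ l))
X-+ℕ zero    l m       = trans (⊛-cong X-zero (≗-refl {X (+ l)}) m) (⊛-identityˡ (X (+ l)) m)
X-+ℕ (suc k) l zero    = trans (⊛-0 (X (+ suc k)) (X (+ l))) refl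
X-+ℕ (suc k) l (suc m) = trans (⊛-suc (X (+ suc k)) (X (+ l)) m) (trans (ℤ.+-identityˡ _) (X-+ℕ k l m))

infixl 9 _↑_

-- The n-th power of a unit ε = ±1 for n in ℤ, so that the sign of the exponent is immaterial.
_↑_ : ℤ → ℤ → ℤ
ε ↑ n = ε ℤ.^ ∣ n ∣

module _ (ε : ℤ) (ε²≡1 : ε * ε ≡ 1ℤ) where

  private
    ε-cancel : ∀ x → x ≡ ε * (ε * x)
    ε-cancel x = begin
      x             ≡⟨ ℤ.*-identityˡ x ⟨
      1ℤ * x        ≡⟨ cong (_* x) ε²≡1 ⟨
      ε * ε * x     ≡⟨ ℤ.*-assoc ε ε x ⟩
      ε * (ε * x)   ∎
      where open ≡-Reasoning

  ↑-suc : ∀ n → ε ↑ (1ℤ + n) ≡ ε * ε ↑ n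
  ↑-suc (+ n)          = refl
  ↑-suc -[1+ zero ]    = ε-cancel 1ℤ
  ↑-suc -[1+ suc n ]   = ε-cancel _

  ↑-pred : ∀ n → ε ↑ (-1ℤ + n) ≡ ε * ε ↑ n
  ↑-pred (+ zero)  = refl
  ↑-pred (+ suc n) = ε-cancel _
  ↑-pred -[1+ n ]  = refl

  ↑-+ : ∀ m n → ε ↑ (m + n) ≡ ε ↑ m * ε ↑ n
  ↑-+ (+ zero) n = trans (cong (ε ↑_) (ℤ.+-identityˡ n)) (sym (ℤ.*-identityˡ _))
  ↑-+ (+ suc m) n = begin
    ε ↑ (+ suc m + n)        ≡⟨ cong (ε ↑_) (ℤ.+-assoc 1ℤ (+ m) n) ⟩
    ε ↑ (1ℤ + (+ m + n))     ≡⟨ ↑-suc (+ m + n) ⟩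
    ε * ε ↑ (+ m + n)        ≡⟨ cong (ε *_) (↑-+ (+ m) n) ⟩
    ε * (ε ↑ (+ m) * ε ↑ n)  ≡⟨ ℤ.*-assoc ε _ _ ⟨
    ε * ε ↑ (+ m) * ε ↑ n    ∎
    where open ≡-Reasoning
  ↑-+ -[1+ zero ] n = trans (↑-pred n) (cong (_* ε ↑ n) (sym (ℤ.*-identityʳ ε)))
  ↑-+ -[1+ suc m ] n = begin
    ε ↑ (-[1+ suc m ] + n)       ≡⟨ cong (ε ↑_) (ℤ.+-assoc -1ℤ -[1+ m ] n) ⟩
    ε ↑ (-1ℤ + (-[1+ m ] + n))   ≡⟨ ↑-pred (-[1+ m ] + n) ⟩
    ε * ε ↑ (-[1+ m ] + n)       ≡⟨ cong (ε *_) (↑-+ -[1+ m ] n) ⟩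
    ε * (ε ↑ -[1+ m ] * ε ↑ n)   ≡⟨ ℤ.*-assoc ε _ _ ⟨
    ε * ε ↑ -[1+ m ] * ε ↑ n     ∎
    where open ≡-Reasoning

  ↑-square : ∀ n → ε ↑ n * ε ↑ n ≡ 1ℤ
  ↑-square n = begin
    ε ↑ n * ε ↑ n        ≡⟨ cong (λ k → ε ↑ n * ε ℤ.^ k) (ℤ.∣-i∣≡∣i∣ n) ⟨
    ε ↑ n * ε ↑ (- n)    ≡⟨ ↑-+ n (- n) ⟨
    ε ↑ (n + - n)        ≡⟨ cong (ε ↑_) (ℤ.+-inverseʳ n) ⟩
    1ℤ                   ∎
    where open ≡-Reasoning

↑-neg : ∀ ε n → ε ↑ (- n) ≡ ε ↑ n
↑-neg ε n = cong (ε ℤ.^_) (ℤ.∣-i∣≡∣i∣ n)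

1↑ : ∀ n → 1ℤ ↑ n ≡ 1ℤ
1↑ n = ℤ.^-zeroˡ ∣ n ∣

^-distribʳ-* : ∀ x y n → (x * y) ℤ.^ n ≡ x ℤ.^ n * y ℤ.^ n
^-distribʳ-* x y zero    = refl
^-distribʳ-* x y (suc n) = trans (cong (x * y *_) (^-distribʳ-* x y n)) (lemma x y _ _)
  where
  lemma : ∀ x y z w → x * y * (z * w) ≡ x * z * (y * w)
  lemma = solve-∀

↑-negˡ : ∀ ε n → (- ε) ↑ n ≡ -1ℤ ↑ n * ε ↑ n
↑-negˡ ε n = trans (cong (_↑ n) (sym (ℤ.-1*i≡-i ε))) (^-distribʳ-* -1ℤ ε ∣ n ∣)

-- The bounds say that the coefficient of q^m in a sum over ℤ or ℤ² only involves |n|, |j| ≤ m + 1.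

Bound₁ : (ℤ → ℤ) → Set
Bound₁ e = ∀ n → ∃[ k ] (e n ≡ + k × ∣ n ∣ ℕ.≤ suc k)

Bound₂ : (ℤ → ℤ → ℤ) → (ℤ → ℤ → ℤ) → Set
Bound₂ w e = ∀ n j → w n j ≡ 0ℤ ⊎ ∃[ k ] (e n j ≡ + k × ∣ n ∣ ℕ.≤ suc k × ∣ j ∣ ℕ.≤ suc k)

⟪_,_⟫₁ : (ℤ → ℤ) → (ℤ → ℤ) → Series
⟪ w , e ⟫₁ m = ∑ℤ (2 ℕ.+ m) λ n → w n * X (e n) m

⟪_,_⟫₂ : (ℤ → ℤ → ℤ) → (ℤ → ℤ → ℤ) → Series
⟪ w , e ⟫₂ m = ∑ℤ (2 ℕ.+ m) λ n → ∑ℤ (2 ℕ.+ m) λ j → w n j * X (e n j) m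

*-zeroʳ′ : ∀ {x y} → y ≡ 0ℤ → x * y ≡ 0ℤ
*-zeroʳ′ {x} refl = ℤ.*-zeroʳ x

*-zeroˡ′ : ∀ {y x} → x ≡ 0ℤ → x * y ≡ 0ℤ
*-zeroˡ′ refl = refl

X-off-≤ : ∀ {e k m} s → e ≡ + k → s ℕ.≤ suc k → 2 ℕ.+ m ℕ.≤ s → X e m ≡ 0ℤ
X-off-≤ {k = k} {m = m} s refl s≤1+k 2+m≤s = X-off (+ k) m λ { refl → ℕ.<-irrefl refl (ℕ.≤-trans 2+m≤s s≤1+k) }

module _ {w e : ℤ → ℤ} (bound : Bound₁ e) where

  Supp₁ : ∀ {i m} → i ℕ.≤ m → Supp (2 ℕ.+ m) (λ n → w n * X (e n) i)
  Supp₁ {i} {m} i≤m n m<n with k , p , q ← bound n =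
    *-zeroʳ′ {w n} (X-off-≤ ∣ n ∣ p q (ℕ.≤-trans (s≤s (s≤s i≤m)) m<n))

  ⟪⟫₁-extend : ∀ {m W} → 2 ℕ.+ m ℕ.≤ W → ⟪ w , e ⟫₁ m ≡ ∑ℤ W λ n → w n * X (e n) m
  ⟪⟫₁-extend {m} m<W = sym (∑ℤ-extend {λ n → w n * X (e n) m} (Supp₁ ℕ.≤-refl) m<W)

module _ {w e : ℤ → ℤ → ℤ} (bound : Bound₂ w e) where

  Supp₂ˡ : ∀ {m} j → Supp (2 ℕ.+ m) (λ n → w n j * X (e n j) m)
  Supp₂ˡ j n m<n with bound n j
  ... | inj₁ p               = *-zeroˡ′ {X (e n j) _} p
  ... | inj₂ (k , p , q , r) = *-zeroʳ′ {w n j} (X-off-≤ ∣ n ∣ p q m<n)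

  Supp₂ʳ : ∀ {m} n → Supp (2 ℕ.+ m) (λ j → w n j * X (e n j) m)
  Supp₂ʳ n j m<j with bound n j
  ... | inj₁ p               = *-zeroˡ′ {X (e n j) _} p
  ... | inj₂ (k , p , q , r) = *-zeroʳ′ {w n j} (X-off-≤ ∣ j ∣ p r m<j)

  ⟪⟫₂-extend : ∀ {m W} → 2 ℕ.+ m ℕ.≤ W →
    ⟪ w , e ⟫₂ m ≡ ∑ℤ W λ n → ∑ℤ W λ j → w n j * X (e n j) m
  ⟪⟫₂-extend {m} {W} m<W = sym $ trans
    (∑ℤ-cong W λ n → ∑ℤ-extend {λ j → w n j * X (e n j) m} (Supp₂ʳ n) m<W)
    (∑ℤ-extend {λ n → ∑ℤ (2 ℕ.+ m) λ j → w n j * X (e n j) m} (λ n m<n → ∑ℤ-zero (2 ℕ.+ m) λ j → Supp₂ˡ j n m<n) m<W)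

∑ℕ-⊛ : ∀ W (c : ℕ → Series) b m →
  ((λ i → ∑ℕ W λ n → c n i) ⊛ b) m ≡ ∑ℕ W λ n → (c n ⊛ b) m
∑ℕ-⊛ zero    c b m = ⊛-zeroˡ b m
∑ℕ-⊛ (suc W) c b m = trans
  (⊛-distribʳ b (c 0) (λ i → ∑ℕ W λ n → c (suc n) i) m)
  (+-congˡ ((c 0 ⊛ b) m) (∑ℕ-⊛ W (c ∘ suc) b m))

∑ℤ-⊛ : ∀ W (c : ℤ → Series) b m →
  ((λ i → ∑ℤ W λ n → c n i) ⊛ b) m ≡ ∑ℤ W λ n → (c n ⊛ b) m
∑ℤ-⊛ W c b m = trans (⊛-distribʳ b (λ i → ∑ℕ W λ n → c (+ n) i) (λ i → ∑ℕ W λ n → c -[1+ n ] i) m)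
  (cong₂ _+_ (∑ℕ-⊛ W (c ∘ +_) b m) (∑ℕ-⊛ W (c ∘ -[1+_]) b m))

⟪⟫₁-⊛ : ∀ {w e} → Bound₁ e → ∀ b {m W} → 2 ℕ.+ m ℕ.≤ W →
  (⟪ w , e ⟫₁ ⊛ b) m ≡ ∑ℤ W λ n → w n * (X (e n) ⊛ b) m
⟪⟫₁-⊛ {w} {e} bound b {m} {W} m<W = begin
  (⟪ w , e ⟫₁ ⊛ b) m
    ≡⟨ ⊛-cong-at m (λ i i≤m → ⟪⟫₁-extend {w} {e} bound (ℕ.≤-trans (s≤s (s≤s i≤m)) m<W)) (≈-refl {b} {m}) ⟩
  ((λ i → ∑ℤ W λ n → w n * X (e n) i) ⊛ b) m  ≡⟨ ∑ℤ-⊛ W (λ n → w n · X (e n)) b m ⟩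
  (∑ℤ W λ n → ((w n · X (e n)) ⊛ b) m)        ≡⟨ ∑ℤ-cong W (λ n → ·-⊛ (w n) (X (e n)) b m) ⟩
  (∑ℤ W λ n → w n * (X (e n) ⊛ b) m)          ∎
  where open ≡-Reasoning

⟪⟫₂-⊛ : ∀ {w e} → Bound₂ w e → ∀ b {m W} → 2 ℕ.+ m ℕ.≤ W →
  (⟪ w , e ⟫₂ ⊛ b) m ≡ ∑ℤ W λ n → ∑ℤ W λ j → w n j * (X (e n j) ⊛ b) m
⟪⟫₂-⊛ {w} {e} bound b {m} {W} m<W = begin
  (⟪ w , e ⟫₂ ⊛ b) m
    ≡⟨ ⊛-cong-at m (λ i i≤m → ⟪⟫₂-extend {w} {e} bound (ℕ.≤-trans (s≤s (s≤s i≤m)) m<W)) (≈-refl {b} {m}) ⟩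
  ((λ i → ∑ℤ W λ n → ∑ℤ W λ j → w n j * X (e n j) i) ⊛ b) m
    ≡⟨ ∑ℤ-⊛ W (λ n i → ∑ℤ W λ j → w n j * X (e n j) i) b m ⟩
  (∑ℤ W λ n → ((λ i → ∑ℤ W λ j → w n j * X (e n j) i) ⊛ b) m)
    ≡⟨ ∑ℤ-cong W (λ n → trans (∑ℤ-⊛ W (λ j → w n j · X (e n j)) b m)
         (∑ℤ-cong W λ j → ·-⊛ (w n j) (X (e n j)) b m)) ⟩
  (∑ℤ W λ n → ∑ℤ W λ j → w n j * (X (e n j) ⊛ b) m) ∎
  where open ≡-Reasoning

module _ {w e : ℤ → ℤ} {v f : ℤ → ℤ → ℤ} (bound₁ : Bound₁ e) (bound₂ : Bound₂ v f) where

  private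
    term : ∀ m l n j →
      v n j * (X (e l) ⊛ X (f n j)) m ≡ v n j * X (e l + f n j) m
    term m l n j with bound₁ l | bound₂ n j
    ... | _          | inj₁ p               = trans (*-zeroˡ′ {(X (e l) ⊛ X (f n j)) m} p) (sym (*-zeroˡ′ {X (e l + f n j) m} p))
    ... | k , p , _  | inj₂ (k′ , q , _ , _) rewrite p | q = cong (v n j *_) (X-+ℕ k k′ m)

  ⟪⟫₁⊛⟪⟫₂ : ∀ {m W} → 2 ℕ.+ m ℕ.≤ W →
    (⟪ w , e ⟫₁ ⊛ ⟪ v , f ⟫₂) m ≡
    ∑ℤ W λ l → ∑ℤ W λ n → ∑ℤ W λ j → w l * (v n j * X (e l + f n j) m)
  ⟪⟫₁⊛⟪⟫₂ {m} {W} m<W = trans (⟪⟫₁-⊛ {w} {e} bound₁ ⟪ v , f ⟫₂ m<W) $ ∑ℤ-cong W λ l → begin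
    w l * (X (e l) ⊛ ⟪ v , f ⟫₂) m
      ≡⟨ cong (w l *_) (⊛-comm (X (e l)) ⟪ v , f ⟫₂ m) ⟩
    w l * (⟪ v , f ⟫₂ ⊛ X (e l)) m
      ≡⟨ cong (w l *_) (⟪⟫₂-⊛ {v} {f} bound₂ (X (e l)) m<W) ⟩
    w l * (∑ℤ W λ n → ∑ℤ W λ j → v n j * (X (f n j) ⊛ X (e l)) m)
      ≡⟨ cong (w l *_) (∑ℤ-cong W λ n → ∑ℤ-cong W λ j →
           trans (cong (v n j *_) (⊛-comm (X (f n j)) (X (e l)) m)) (term m l n j)) ⟩
    w l * (∑ℤ W λ n → ∑ℤ W λ j → v n j * X (e l + f n j) m)
      ≡⟨ ∑ℤ-* W (w l) (λ n → ∑ℤ W λ j → v n j * X (e l + f n j) m) ⟨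
    (∑ℤ W λ n → w l * (∑ℤ W λ j → v n j * X (e l + f n j) m))
      ≡⟨ ∑ℤ-cong W (λ n → sym (∑ℤ-* W (w l) (λ j → v n j * X (e l + f n j) m))) ⟩
    (∑ℤ W λ n → ∑ℤ W λ j → w l * (v n j * X (e l + f n j) m)) ∎
    where open ≡-Reasoning

  private
    term-off : ∀ {m} l n j s → 2 ℕ.+ m ℕ.≤ s →
      (∀ {k} → ∣ l ∣ ℕ.≤ suc k → s ℕ.≤ suc k) ⊎ (∀ {k} → ∣ n ∣ ℕ.≤ suc k × ∣ j ∣ ℕ.≤ suc k → s ℕ.≤ suc k) →
      w l * (v n j * X (e l + f n j) m) ≡ 0ℤ
    term-off {m} l n j s m<s select with bound₁ l | bound₂ n j
    ... | _          | inj₁ p = *-zeroʳ′ {w l} (*-zeroˡ′ {X (e l + f n j) m} p)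
    ... | k , p , r  | inj₂ (k′ , q , s≤) =
      *-zeroʳ′ {w l} $ *-zeroʳ′ {v n j} $ X-off-≤ s (cong₂ _+_ p q) (large select) m<s
      where
      large : _ ⊎ _ → s ℕ.≤ suc (k ℕ.+ k′)
      large (inj₁ g) = ℕ.≤-trans (g r) (s≤s (ℕ.m≤m+n k k′))
      large (inj₂ g) = ℕ.≤-trans (g s≤) (s≤s (ℕ.m≤n+m k′ k))

  Supp-outer : ∀ {m} n j → Supp (2 ℕ.+ m) (λ l → w l * (v n j * X (e l + f n j) m))
  Supp-outer n j l m<l = term-off l n j ∣ l ∣ m<l (inj₁ λ p → p)

  Supp-middle : ∀ {m} l j → Supp (2 ℕ.+ m) (λ n → w l * (v n j * X (e l + f n j) m))
  Supp-middle l j n m<n = term-off l n j ∣ n ∣ m<n (inj₂ proj₁)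

  Supp-inner : ∀ {m} l n → Supp (2 ℕ.+ m) (λ j → w l * (v n j * X (e l + f n j) m))
  Supp-inner l n j m<j = term-off l n j ∣ j ∣ m<j (inj₂ proj₂)

-- Theta functions and Kronecker's identity

θ-exp : ℕ → ℕ → ℤ → ℤ
θ-exp h a n = + h * (n * (n - 1ℤ)) + + a * n

-- Ramanujan's f(ε q^a, ε q^(2h-a)) = Σ εⁿ q^(h n (n - 1) + a n).
Θ : ℤ → ℕ → ℕ → Series
Θ ε h a = ⟪ (λ n → ε ↑ n) , θ-exp h a ⟫₁

θ-exp⁺ : ∀ h a k → θ-exp h a (+ suc k) ≡ + (suc k ℕ.* (h ℕ.* k ℕ.+ a))
θ-exp⁺ h a k = trans (lemma (+ h) (+ a) (+ k)) (sym $ trans (ℤ.pos-* (suc k) _)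
  (cong (λ e → + suc k * (e + + a)) (ℤ.pos-* h k)))
  where
  lemma : ∀ h a k → h * ((1ℤ + k) * ((1ℤ + k) - 1ℤ)) + a * (1ℤ + k) ≡ (1ℤ + k) * (h * k + a)
  lemma = solve-∀

θ-exp⁻ : ∀ h a a′ k → a ℕ.+ a′ ≡ h ℕ.+ h → θ-exp h a -[1+ k ] ≡ + (suc k ℕ.* (h ℕ.* k ℕ.+ a′))
θ-exp⁻ h a a′ k p = begin
  + h * (-[1+ k ] * (-[1+ k ] - 1ℤ)) + + a * -[1+ k ]
    ≡⟨ lemma (+ h) (+ a) (+ a′) (+ k) ⟩
  (1ℤ + + k) * (+ h * + k + + a′) + (1ℤ + + k) * ((+ h + + h) - (+ a + + a′))
    ≡⟨ cong (λ x → (1ℤ + + k) * (+ h * + k + + a′) + (1ℤ + + k) * (+ (h ℕ.+ h) - + x)) p ⟩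
  (1ℤ + + k) * (+ h * + k + + a′) + (1ℤ + + k) * ((+ h + + h) - (+ h + + h))
    ≡⟨ lemma′ (1ℤ + + k) _ (+ h + + h) ⟩
  (1ℤ + + k) * (+ h * + k + + a′)
    ≡⟨ cong (λ e → + suc k * (e + + a′)) (ℤ.pos-* h k) ⟨
  + suc k * + (h ℕ.* k ℕ.+ a′)
    ≡⟨ ℤ.pos-* (suc k) _ ⟨
  + (suc k ℕ.* (h ℕ.* k ℕ.+ a′)) ∎
  where
  open ≡-Reasoning
  lemma : ∀ h a a′ k → h * ((- (1ℤ + k)) * ((- (1ℤ + k)) - 1ℤ)) + a * (- (1ℤ + k)) ≡
                       (1ℤ + k) * (h * k + a′) + (1ℤ + k) * ((h + h) - (a + a′))
  lemma = solve-∀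
  lemma′ : ∀ x y z → x * y + x * (z - z) ≡ x * y
  lemma′ = solve-∀

θ-bound : ∀ {h a} → 1 ℕ.≤ h → 1 ℕ.≤ a → a ℕ.≤ h ℕ.+ h → Bound₁ (θ-exp h a)
θ-bound {h} {a} 1≤h 1≤a a≤2h (+ zero) = 0 , lemma (+ h) (+ a) , z≤n
  where
  lemma : ∀ h a → h * (0ℤ * (0ℤ - 1ℤ)) + a * 0ℤ ≡ 0ℤ
  lemma = solve-∀
θ-bound {h} {a} 1≤h 1≤a a≤2h (+ suc k) = _ , θ-exp⁺ h a k , (begin
  suc k                               ≡⟨ ℕ.*-identityʳ (suc k) ⟨
  suc k ℕ.* 1                         ≤⟨ ℕ.*-monoʳ-≤ (suc k) (ℕ.≤-trans 1≤a (ℕ.m≤n+m a (h ℕ.* k))) ⟩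
  suc k ℕ.* (h ℕ.* k ℕ.+ a)           ≤⟨ ℕ.n≤1+n _ ⟩
  suc (suc k ℕ.* (h ℕ.* k ℕ.+ a))     ∎)
  where open ℕ.≤-Reasoning
θ-bound {h} {a} 1≤h 1≤a a≤2h -[1+ k ] =
  _ , θ-exp⁻ h a a′ k (ℕ.m+[n∸m]≡n a≤2h) , s≤s (begin
  k                                   ≡⟨ ℕ.*-identityˡ k ⟨
  1 ℕ.* k                             ≤⟨ ℕ.*-monoˡ-≤ k 1≤h ⟩
  h ℕ.* k                             ≤⟨ ℕ.m≤m+n (h ℕ.* k) a′ ⟩
  h ℕ.* k ℕ.+ a′                      ≤⟨ ℕ.m≤m+n _ (k ℕ.* (h ℕ.* k ℕ.+ a′)) ⟩
  suc k ℕ.* (h ℕ.* k ℕ.+ a′)          ∎)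
  where
  open ℕ.≤-Reasoning
  a′ = (h ℕ.+ h) ℕ.∸ a

pos : ℤ → ℤ
pos (+ _)    = 1ℤ
pos -[1+ _ ] = 0ℤ

-- 1 if n, j ≥ 0, -1 if n, j < 0, and 0 if the signs differ.
sgn : ℤ → ℤ → ℤ
sgn n j = pos n + pos j - 1ℤ

F-exp : ℕ → ℕ → ℤ → ℤ → ℤ
F-exp h a n j = + a * n + + h * ((+ 2 * n + 1ℤ) * j)

S-exp : ℕ → ℤ → ℤ → ℤ
S-exp h n j = + h * (n * (n + 1ℤ) + (+ 2 * n + 1ℤ) * j)

-- With z = η q^a, Q = q^h:  F = Σ zⁿ / (1 - Q^(2n+1)),  S = Σ (-1)ⁿ Q^(n (n + 1)) / (1 - Q^(2n+1)),
-- bilateral sums whose denominators are expanded in powers of Q for every sign of 2n+1.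
F : ℤ → ℕ → ℕ → Series
F η h a = ⟪ (λ n j → sgn n j * η ↑ n) , F-exp h a ⟫₂

S : ℕ → Series
S h = ⟪ (λ n j → sgn n j * -1ℤ ↑ n) , S-exp h ⟫₂

private
  pos-odd : ∀ k → + (2 ℕ.* k ℕ.+ 1) ≡ + 2 * + k + 1ℤ
  pos-odd k = cong (λ x → x + 1ℤ) (ℤ.pos-* 2 k)

  m≤[2k+1]m : ∀ k m → m ℕ.≤ (2 ℕ.* k ℕ.+ 1) ℕ.* m
  m≤[2k+1]m k m = subst (ℕ._≤ (2 ℕ.* k ℕ.+ 1) ℕ.* m) (ℕ.*-identityˡ m) (ℕ.*-monoˡ-≤ m (ℕ.m≤n+m 1 (2 ℕ.* k)))

  m≤hm : ∀ {h} → 1 ℕ.≤ h → ∀ m → m ℕ.≤ h ℕ.* m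
  m≤hm {h} 1≤h m = subst (ℕ._≤ h ℕ.* m) (ℕ.*-identityˡ m) (ℕ.*-monoˡ-≤ m 1≤h)

F-bound : ∀ {h a} {w : ℤ → ℤ} → 1 ℕ.≤ a → a ℕ.≤ h → Bound₂ (λ n j → sgn n j * w n) (F-exp h a)
F-bound {h} {a} {w} 1≤a a≤h (+ k) (+ i) = inj₂
  ( a ℕ.* k ℕ.+ h ℕ.* ((2 ℕ.* k ℕ.+ 1) ℕ.* i)
  , sym (cong₂ _+_ (ℤ.pos-* a k) (trans (ℤ.pos-* h _) (cong (+ h *_)
      (trans (ℤ.pos-* (2 ℕ.* k ℕ.+ 1) i) (cong (_* + i) (pos-odd k))))))
  , ℕ.m≤n⇒m≤1+n (ℕ.≤-trans (m≤hm 1≤a k) (ℕ.m≤m+n _ _))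
  , ℕ.m≤n⇒m≤1+n (ℕ.≤-trans (m≤[2k+1]m k i) (ℕ.≤-trans (m≤hm (ℕ.≤-trans 1≤a a≤h) _) (ℕ.m≤n+m _ (a ℕ.* k)))) )
F-bound {w = w} 1≤a a≤h (+ k) -[1+ i ] = inj₁ (ℤ.*-zeroˡ (w (+ k)))
F-bound {w = w} 1≤a a≤h -[1+ k ] (+ i) = inj₁ (ℤ.*-zeroˡ (w -[1+ k ]))
-- The exponent here is h (2k+1)(i+1) - a (k+1). Writing h = a + d turns it into a sum of natural
-- numbers, which is where a ≤ h enters.
F-bound {h} {a} 1≤a a≤h -[1+ k ] -[1+ i ] = inj₂
  ( a ℕ.* (k ℕ.+ (2 ℕ.* k ℕ.+ 1) ℕ.* i) ℕ.+ d ℕ.* ((2 ℕ.* k ℕ.+ 1) ℕ.* suc i)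
  , exponent
  , s≤s (ℕ.≤-trans (ℕ.≤-trans (ℕ.m≤m+n k _) (m≤hm 1≤a _)) (ℕ.m≤m+n _ _))
  , s≤s (ℕ.≤-trans (ℕ.≤-trans (m≤[2k+1]m k i) (ℕ.≤-trans (ℕ.m≤n+m _ k) (m≤hm 1≤a _))) (ℕ.m≤m+n _ _)) )
  where
  open ≡-Reasoning
  d = h ℕ.∸ a
  lemma : ∀ a d k i → a * (- (1ℤ + k)) + (a + d) * ((+ 2 * (- (1ℤ + k)) + 1ℤ) * (- (1ℤ + i))) ≡
                      a * (k + (+ 2 * k + 1ℤ) * i) + d * ((+ 2 * k + 1ℤ) * (1ℤ + i))
  lemma = solve-∀
  exponent : F-exp h a -[1+ k ] -[1+ i ] ≡
    + (a ℕ.* (k ℕ.+ (2 ℕ.* k ℕ.+ 1) ℕ.* i) ℕ.+ d ℕ.* ((2 ℕ.* k ℕ.+ 1) ℕ.* suc i))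
  exponent = begin
    F-exp h a -[1+ k ] -[1+ i ]
      ≡⟨ cong (λ h → F-exp h a -[1+ k ] -[1+ i ]) (ℕ.m+[n∸m]≡n a≤h) ⟨
    F-exp (a ℕ.+ d) a -[1+ k ] -[1+ i ]
      ≡⟨ lemma (+ a) (+ d) (+ k) (+ i) ⟩
    + a * (+ k + (+ 2 * + k + 1ℤ) * + i) + + d * ((+ 2 * + k + 1ℤ) * + suc i)
      ≡⟨ cong₂ (λ x y → + a * (+ k + x) + + d * y)
           (trans (ℤ.pos-* (2 ℕ.* k ℕ.+ 1) i) (cong (_* + i) (pos-odd k)))
           (trans (ℤ.pos-* (2 ℕ.* k ℕ.+ 1) (suc i)) (cong (_* + suc i) (pos-odd k))) ⟨
    + a * + (k ℕ.+ (2 ℕ.* k ℕ.+ 1) ℕ.* i) + + d * + ((2 ℕ.* k ℕ.+ 1) ℕ.* suc i)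
      ≡⟨ cong₂ _+_ (ℤ.pos-* a _) (ℤ.pos-* d _) ⟨
    + (a ℕ.* (k ℕ.+ (2 ℕ.* k ℕ.+ 1) ℕ.* i) ℕ.+ d ℕ.* ((2 ℕ.* k ℕ.+ 1) ℕ.* suc i)) ∎

S-bound : ∀ {h} {w : ℤ → ℤ} → 1 ℕ.≤ h → Bound₂ (λ n j → sgn n j * w n) (S-exp h)
S-bound {h} {w} 1≤h (+ k) (+ i) = inj₂
  ( h ℕ.* (k ℕ.* (k ℕ.+ 1) ℕ.+ (2 ℕ.* k ℕ.+ 1) ℕ.* i)
  , sym (trans (ℤ.pos-* h _) (cong (+ h *_) (cong₂ _+_ (ℤ.pos-* k _)
      (trans (ℤ.pos-* (2 ℕ.* k ℕ.+ 1) i) (cong (_* + i) (pos-odd k))))))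
  , ℕ.m≤n⇒m≤1+n (ℕ.≤-trans (ℕ.≤-trans (ℕ.≤-trans (ℕ.≤-reflexive (sym (ℕ.*-identityʳ k)))
      (ℕ.*-monoʳ-≤ k (ℕ.m≤n+m 1 k))) (ℕ.m≤m+n _ _)) (m≤hm 1≤h _))
  , ℕ.m≤n⇒m≤1+n (ℕ.≤-trans (ℕ.≤-trans (m≤[2k+1]m k i) (ℕ.m≤n+m _ (k ℕ.* (k ℕ.+ 1)))) (m≤hm 1≤h _)) )
S-bound {w = w} 1≤h (+ k) -[1+ i ] = inj₁ (ℤ.*-zeroˡ (w (+ k)))
S-bound {w = w} 1≤h -[1+ k ] (+ i) = inj₁ (ℤ.*-zeroˡ (w -[1+ k ]))
S-bound {h} 1≤h -[1+ k ] -[1+ i ] = inj₂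
  ( h ℕ.* (k ℕ.* (k ℕ.+ 1) ℕ.+ (2 ℕ.* k ℕ.+ 1) ℕ.* suc i)
  , sym (trans (trans (ℤ.pos-* h _) (cong (+ h *_) (cong₂ _+_ (ℤ.pos-* k _)
      (trans (ℤ.pos-* (2 ℕ.* k ℕ.+ 1) (suc i)) (cong (_* + suc i) (pos-odd k))))))
      (lemma (+ h) (+ k) (+ i)))
  , s≤s (ℕ.≤-trans (ℕ.≤-trans (ℕ.≤-trans (ℕ.≤-reflexive (sym (ℕ.*-identityʳ k)))
      (ℕ.*-monoʳ-≤ k (ℕ.m≤n+m 1 k))) (ℕ.m≤m+n _ _)) (m≤hm 1≤h _))
  , ℕ.m≤n⇒m≤1+n (ℕ.≤-trans (ℕ.≤-trans (m≤[2k+1]m k (suc i)) (ℕ.m≤n+m _ (k ℕ.* (k ℕ.+ 1)))) (m≤hm 1≤h _)) )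
  where
  lemma : ∀ h k i → h * (k * (k + 1ℤ) + (+ 2 * k + 1ℤ) * (1ℤ + i)) ≡
    h * ((- (1ℤ + k)) * ((- (1ℤ + k)) + 1ℤ) + (+ 2 * (- (1ℤ + k)) + 1ℤ) * (- (1ℤ + i)))
  lemma = solve-∀

-- Substituting l = k - n and then j ↦ k + j matches the exponents of the two sides for every
-- (k, n, j); only the signs sgn differ, by the amount pos (k + j) - pos j, which does not involve n,
-- and the sum over n then cancels under n ↦ -1 - 2j - n.
module _ (η : ℤ) (η²≡1 : η * η ≡ 1ℤ) (h a : ℕ) (1≤a : 1 ℕ.≤ a) (a≤h : a ℕ.≤ h) where

  private
    1≤h : 1 ℕ.≤ h
    1≤h = ℕ.≤-trans 1≤a a≤h

    boundθ : Bound₁ (θ-exp h a)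
    boundθ = θ-bound 1≤h 1≤a (ℕ.≤-trans a≤h (ℕ.m≤m+n h h))

    boundθ′ : Bound₁ (θ-exp h (a ℕ.+ h))
    boundθ′ = θ-bound 1≤h (ℕ.≤-trans 1≤a (ℕ.m≤m+n a h)) (ℕ.+-monoˡ-≤ h a≤h)

    w v : ℤ → ℤ → ℤ
    w n j = sgn n j * η ↑ n
    v n j = sgn n j * -1ℤ ↑ n

    boundF : Bound₂ w (F-exp h a)
    boundF = F-bound {w = η ↑_} 1≤a a≤h

    boundS : Bound₂ v (S-exp h)
    boundS = S-bound {w = -1ℤ ↑_} 1≤h

    -η²≡1 : (- η) * (- η) ≡ 1ℤ
    -η²≡1 = trans (lemma η) η²≡1
      where
      lemma : ∀ x → (- x) * (- x) ≡ x * x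
      lemma = solve-∀

    module _ (m : ℕ) where
      open ≡-Reasoning

      B : ℕ
      B = 2 ℕ.+ m

      σ : ℤ → ℤ
      σ l = (- η) ↑ l

      E : ℤ → ℤ → ℤ → ℤ
      E k n j = θ-exp h (a ℕ.+ h) k + S-exp h n j

      T T′ R : ℤ → ℤ → ℤ → ℤ
      T l n j = σ l * (w n j * X (θ-exp h a l + F-exp h a n j) m)
      T′ k n j = T (- n + k) n (k + j)
      R k n j = σ k * (v n j * X (E k n j) m)

      core : ℤ → ℤ → ℤ → ℤ
      core k j n = -1ℤ ↑ n * X (E k n j) m

      sign : ∀ k n → σ (- n + k) * η ↑ n ≡ σ k * -1ℤ ↑ n
      sign k n = begin
        σ (- n + k) * η ↑ n              ≡⟨ cong (_* η ↑ n) (↑-+ (- η) -η²≡1 (- n) k) ⟩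
        σ (- n) * σ k * η ↑ n            ≡⟨ cong (λ s → s * σ k * η ↑ n) (trans (↑-neg (- η) n) (↑-negˡ η n)) ⟩
        -1ℤ ↑ n * η ↑ n * σ k * η ↑ n    ≡⟨ lemma (-1ℤ ↑ n) (η ↑ n) (σ k) ⟩
        σ k * -1ℤ ↑ n * (η ↑ n * η ↑ n)  ≡⟨ cong (σ k * -1ℤ ↑ n *_) (↑-square η η²≡1 n) ⟩
        σ k * -1ℤ ↑ n * 1ℤ               ≡⟨ ℤ.*-identityʳ _ ⟩
        σ k * -1ℤ ↑ n                    ∎
        where
        lemma : ∀ x y z → x * y * z * y ≡ z * x * (y * y)
        lemma = solve-∀

      exponent : ∀ k n j → θ-exp h a (- n + k) + F-exp h a n (k + j) ≡ E k n j
      exponent k n j = trans (lemma (+ h) (+ a) k n j)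
        (cong (λ b → (+ h * (k * (k - 1ℤ)) + b * k) + S-exp h n j) (sym (ℤ.pos-+ a h)))
        where
        lemma : ∀ h a k n j →
          (h * ((- n + k) * ((- n + k) - 1ℤ)) + a * (- n + k)) + (a * n + h * ((+ 2 * n + 1ℤ) * (k + j))) ≡
          (h * (k * (k - 1ℤ)) + (a + h) * k) + h * (n * (n + 1ℤ) + (+ 2 * n + 1ℤ) * j)
        lemma = solve-∀

      T′≡ : ∀ k n j → T′ k n j ≡ σ k * sgn n (k + j) * core k j n
      T′≡ k n j = begin
        σ (- n + k) * (sgn n (k + j) * η ↑ n * X (θ-exp h a (- n + k) + F-exp h a n (k + j)) m)
          ≡⟨ cong (λ e → σ (- n + k) * (sgn n (k + j) * η ↑ n * X e m)) (exponent k n j) ⟩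
        σ (- n + k) * (sgn n (k + j) * η ↑ n * X (E k n j) m)
          ≡⟨ lemma (σ (- n + k)) (sgn n (k + j)) (η ↑ n) _ ⟩
        (σ (- n + k) * η ↑ n) * (sgn n (k + j) * X (E k n j) m)
          ≡⟨ cong (_* (sgn n (k + j) * X (E k n j) m)) (sign k n) ⟩
        (σ k * -1ℤ ↑ n) * (sgn n (k + j) * X (E k n j) m)
          ≡⟨ lemma′ (σ k) (-1ℤ ↑ n) (sgn n (k + j)) _ ⟩
        σ k * sgn n (k + j) * (-1ℤ ↑ n * X (E k n j) m) ∎
        where
        lemma : ∀ x y z t → x * (y * z * t) ≡ (x * z) * (y * t)
        lemma = solve-∀
        lemma′ : ∀ x y z t → (x * y) * (z * t) ≡ x * z * (y * t)
        lemma′ = solve-∀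

      D : ℤ → ℤ → ℤ → ℤ
      D k j n = T′ k n j + - R k n j

      D≡ : ∀ k j n → D k j n ≡ σ k * (pos (k + j) - pos j) * core k j n
      D≡ k j n = trans (cong (_+ - R k n j) (T′≡ k n j))
        (lemma (σ k) (pos n) (pos (k + j)) (pos j) (-1ℤ ↑ n) (X (E k n j) m))
        where
        lemma : ∀ s n k j e x →
          s * (n + k - 1ℤ) * (e * x) + - (s * ((n + j - 1ℤ) * e * x)) ≡ s * (k - j) * (e * x)
        lemma = solve-∀

      core-anti : ∀ k j n → core k j ((- j + - j) + (-1ℤ - n)) ≡ - core k j n
      core-anti k j n = begin
        -1ℤ ↑ (- j + - j + (-1ℤ - n)) * X (E k (- j + - j + (-1ℤ - n)) j) m
          ≡⟨ cong₂ (λ s e → s * X e m) signs (+-congˡ (θ-exp h (a ℕ.+ h) k) (lemma (+ h) n j)) ⟩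
        - -1ℤ ↑ n * X (E k n j) m
          ≡⟨ ℤ.neg-distribˡ-* (-1ℤ ↑ n) _ ⟨
        - (-1ℤ ↑ n * X (E k n j) m) ∎
        where
        lemma : ∀ h n j →
          h * ((- j + - j + (-1ℤ - n)) * ((- j + - j + (-1ℤ - n)) + 1ℤ) + (+ 2 * (- j + - j + (-1ℤ - n)) + 1ℤ) * j) ≡
          h * (n * (n + 1ℤ) + (+ 2 * n + 1ℤ) * j)
        lemma = solve-∀
        signs : -1ℤ ↑ (- j + - j + (-1ℤ - n)) ≡ - -1ℤ ↑ n
        signs = begin
          -1ℤ ↑ (- j + - j + (-1ℤ - n))        ≡⟨ ↑-+ -1ℤ refl (- j + - j) _ ⟩
          -1ℤ ↑ (- j + - j) * -1ℤ ↑ (-1ℤ - n)  ≡⟨ cong₂ _*_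
            (trans (↑-+ -1ℤ refl (- j) (- j)) (↑-square -1ℤ refl (- j)))
            (trans (↑-pred -1ℤ refl (- n)) (cong (-1ℤ *_) (↑-neg -1ℤ n))) ⟩
          1ℤ * (-1ℤ * -1ℤ ↑ n)                 ≡⟨ trans (ℤ.*-identityˡ _) (ℤ.-1*i≡-i _) ⟩
          - -1ℤ ↑ n                            ∎

      D-anti : ∀ k j n → D k j ((- j + - j) + (-1ℤ - n)) ≡ - D k j n
      D-anti k j n = begin
        D k j (- j + - j + (-1ℤ - n))                                ≡⟨ D≡ k j (- j + - j + (-1ℤ - n)) ⟩
        σ k * (pos (k + j) - pos j) * core k j (- j + - j + (-1ℤ - n)) ≡⟨ cong (σ k * (pos (k + j) - pos j) *_) (core-anti k j n) ⟩
        σ k * (pos (k + j) - pos j) * - core k j n                   ≡⟨ ℤ.neg-distribʳ-* (σ k * (pos (k + j) - pos j)) _ ⟨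
        - (σ k * (pos (k + j) - pos j) * core k j n)                 ≡⟨ cong -_ (D≡ k j n) ⟨
        - D k j n                                                    ∎

      D-Supp : ∀ k j → Supp B (D k j)
      D-Supp k j n B≤n = cong₂ (λ x y → x + - y)
        (Supp-middle {λ n → σ n} boundθ boundF (- n + k) (k + j) n B≤n)
        (Supp-middle {λ n → σ n} boundθ′ boundS k j n B≤n)

      inner : ∀ k j → ∑ℤ B (λ n → T′ k n j) ≡ ∑ℤ B (λ n → R k n j)
      inner k j = ℤ.i-j≡0⇒i≡j _ _ $ begin
        ∑ℤ B (λ n → T′ k n j) - ∑ℤ B (λ n → R k n j)     ≡⟨ +-congˡ (∑ℤ B (λ n → T′ k n j)) (∑ℤ-neg B (λ n → R k n j)) ⟨
        ∑ℤ B (λ n → T′ k n j) + ∑ℤ B (λ n → - R k n j)   ≡⟨ ∑ℤ-+ B (λ n → T′ k n j) (λ n → - R k n j) ⟨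
        ∑ℤ B (D k j)                                     ≡⟨ ∑ℤ-antisym {D k j} (- j + - j) (D-Supp k j) (D-anti k j) ⟩
        0ℤ                                               ∎

      -- Window bookkeeping: l = k - n with |n| ≤ B spreads k over a window of size 2B, and j ↦ k +
      -- j then needs size 3B for j. The sum over n is brought innermost, where the cancellation
      -- takes place.
      left : (Θ (- η) h a ⊛ F η h a) m ≡ ∑ℤ (B ℕ.+ B) (λ k → ∑ℤ (B ℕ.+ (B ℕ.+ B)) λ j → ∑ℤ B λ n → T′ k n j)
      left = begin
        (Θ (- η) h a ⊛ F η h a) m
          ≡⟨ ⟪⟫₁⊛⟪⟫₂ {w = σ} {v = w} boundθ boundF ℕ.≤-refl ⟩
        (∑ℤ B λ l → ∑ℤ B λ n → ∑ℤ B λ j → T l n j)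
          ≡⟨ ∑ℤ-swap B B (λ l n → ∑ℤ B λ j → T l n j) ⟩
        (∑ℤ B λ n → ∑ℤ B λ l → ∑ℤ B λ j → T l n j)
          ≡⟨ ∑ℤ-cong B (λ n → ∑ℤ-swap B B (λ l j → T l n j)) ⟩
        (∑ℤ B λ n → ∑ℤ B λ j → ∑ℤ B λ l → T l n j)
          ≡⟨ ∑ℤ-cong≤ B (λ n n≤B → ∑ℤ-cong B λ j → sym (∑ℤ-shift {λ l → T l n j} (- n)
               (Supp-outer {w = σ} boundθ boundF n j) (ℕ.+-monoʳ-≤ B (subst (ℕ._≤ B) (sym (ℤ.∣-i∣≡∣i∣ n)) n≤B)))) ⟩
        (∑ℤ B λ n → ∑ℤ B λ j → ∑ℤ (B ℕ.+ B) λ k → T (- n + k) n j)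
          ≡⟨ ∑ℤ-cong B (λ n → ∑ℤ-swap B (B ℕ.+ B) (λ j k → T (- n + k) n j)) ⟩
        (∑ℤ B λ n → ∑ℤ (B ℕ.+ B) λ k → ∑ℤ B λ j → T (- n + k) n j)
          ≡⟨ ∑ℤ-swap B (B ℕ.+ B) (λ n k → ∑ℤ B λ j → T (- n + k) n j) ⟩
        (∑ℤ (B ℕ.+ B) λ k → ∑ℤ B λ n → ∑ℤ B λ j → T (- n + k) n j)
          ≡⟨ ∑ℤ-cong≤ (B ℕ.+ B) (λ k k≤2B → ∑ℤ-cong B λ n → sym (∑ℤ-shift {T (- n + k) n} k
               (Supp-inner {w = σ} boundθ boundF (- n + k) n) (ℕ.+-monoʳ-≤ B k≤2B))) ⟩
        (∑ℤ (B ℕ.+ B) λ k → ∑ℤ B λ n → ∑ℤ (B ℕ.+ (B ℕ.+ B)) λ j → T′ k n j)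
          ≡⟨ ∑ℤ-cong (B ℕ.+ B) (λ k → ∑ℤ-swap B (B ℕ.+ (B ℕ.+ B)) (T′ k)) ⟩
        (∑ℤ (B ℕ.+ B) λ k → ∑ℤ (B ℕ.+ (B ℕ.+ B)) λ j → ∑ℤ B λ n → T′ k n j) ∎

      right : (Θ (- η) h (a ℕ.+ h) ⊛ S h) m ≡ ∑ℤ (B ℕ.+ B) (λ k → ∑ℤ (B ℕ.+ (B ℕ.+ B)) λ j → ∑ℤ B λ n → R k n j)
      right = begin
        (Θ (- η) h (a ℕ.+ h) ⊛ S h) m
          ≡⟨ ⟪⟫₁⊛⟪⟫₂ {w = σ} {v = v} boundθ′ boundS ℕ.≤-refl ⟩
        (∑ℤ B λ k → ∑ℤ B λ n → ∑ℤ B λ j → R k n j)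
          ≡⟨ ∑ℤ-extend {λ k → ∑ℤ B λ n → ∑ℤ B λ j → R k n j} (λ k B≤k → ∑ℤ-zero B λ n → ∑ℤ-zero B λ j →
               Supp-outer {w = σ} boundθ′ boundS n j k B≤k) (ℕ.m≤m+n B B) ⟨
        (∑ℤ (B ℕ.+ B) λ k → ∑ℤ B λ n → ∑ℤ B λ j → R k n j)
          ≡⟨ ∑ℤ-cong (B ℕ.+ B) (λ k → ∑ℤ-cong B λ n → sym (∑ℤ-extend {R k n}
               (Supp-inner {w = σ} boundθ′ boundS k n) (ℕ.m≤m+n B (B ℕ.+ B)))) ⟩
        (∑ℤ (B ℕ.+ B) λ k → ∑ℤ B λ n → ∑ℤ (B ℕ.+ (B ℕ.+ B)) λ j → R k n j)
          ≡⟨ ∑ℤ-cong (B ℕ.+ B) (λ k → ∑ℤ-swap B (B ℕ.+ (B ℕ.+ B)) (R k)) ⟩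
        (∑ℤ (B ℕ.+ B) λ k → ∑ℤ (B ℕ.+ (B ℕ.+ B)) λ j → ∑ℤ B λ n → R k n j) ∎

  kronecker : Θ (- η) h a ⊛ F η h a ≗ Θ (- η) h (a ℕ.+ h) ⊛ S h
  kronecker m = trans (left m) (trans
    (∑ℤ-cong (B m ℕ.+ B m) λ k → ∑ℤ-cong (B m ℕ.+ (B m ℕ.+ B m)) λ j → inner m k j) (sym (right m)))

module _ {w v e f : ℤ → ℤ} (bound₁ : Bound₁ e) (bound₂ : Bound₁ f) where

  ⟪⟫₁⊛⟪⟫₁ : ∀ {m W} → 2 ℕ.+ m ℕ.≤ W →
    (⟪ w , e ⟫₁ ⊛ ⟪ v , f ⟫₁) m ≡ ∑ℤ W λ x → ∑ℤ W λ y → w x * (v y * X (e x + f y) m)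
  ⟪⟫₁⊛⟪⟫₁ {m} {W} m<W = trans (⟪⟫₁-⊛ {w} {e} bound₁ ⟪ v , f ⟫₁ m<W) $ ∑ℤ-cong W λ x → begin
    w x * (X (e x) ⊛ ⟪ v , f ⟫₁) m
      ≡⟨ cong (w x *_) (⊛-comm (X (e x)) ⟪ v , f ⟫₁ m) ⟩
    w x * (⟪ v , f ⟫₁ ⊛ X (e x)) m
      ≡⟨ cong (w x *_) (⟪⟫₁-⊛ {v} {f} bound₂ (X (e x)) m<W) ⟩
    w x * (∑ℤ W λ y → v y * (X (f y) ⊛ X (e x)) m)
      ≡⟨ cong (w x *_) (∑ℤ-cong W λ y → cong (v y *_) (term x y)) ⟩
    w x * (∑ℤ W λ y → v y * X (e x + f y) m)
      ≡⟨ ∑ℤ-* W (w x) (λ y → v y * X (e x + f y) m) ⟨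
    (∑ℤ W λ y → w x * (v y * X (e x + f y) m)) ∎
    where
    open ≡-Reasoning
    term : ∀ x y → (X (f y) ⊛ X (e x)) m ≡ X (e x + f y) m
    term x y with bound₁ x | bound₂ y
    ... | k , p , _ | k′ , q , _ rewrite p | q =
      trans (X-+ℕ k′ k m) (cong (λ s → X (+ s) m) (ℕ.+-comm k′ k))

  Supp-left : ∀ {m} y → Supp (2 ℕ.+ m) (λ x → w x * (v y * X (e x + f y) m))
  Supp-left y x m<x with bound₁ x | bound₂ y
  ... | k , p , r | k′ , q , _ = *-zeroʳ′ {w x} $ *-zeroʳ′ {v y} $
    X-off-≤ ∣ x ∣ (cong₂ _+_ p q) (ℕ.≤-trans r (s≤s (ℕ.m≤m+n k k′))) m<x

  Supp-right : ∀ {m} x → Supp (2 ℕ.+ m) (λ y → w x * (v y * X (e x + f y) m))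
  Supp-right x y m<y with bound₁ x | bound₂ y
  ... | k , p , _ | k′ , q , r = *-zeroʳ′ {w x} $ *-zeroʳ′ {v y} $
    X-off-≤ ∣ y ∣ (cong₂ _+_ p q) (ℕ.≤-trans r (s≤s (ℕ.m≤n+m k′ k))) m<y

module _ (ε : ℤ) {h a a′ : ℕ} (1≤h : 1 ℕ.≤ h) (1≤a : 1 ℕ.≤ a) (1≤a′ : 1 ℕ.≤ a′) (a+a′≡2h : a ℕ.+ a′ ≡ h ℕ.+ h) where

  private
    bound : Bound₁ (θ-exp h a)
    bound = θ-bound 1≤h 1≤a (subst (a ℕ.≤_) a+a′≡2h (ℕ.m≤m+n a a′))

    bound′ : Bound₁ (θ-exp h a′)
    bound′ = θ-bound 1≤h 1≤a′ (subst (a′ ℕ.≤_) a+a′≡2h (ℕ.m≤n+m a′ a))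

  -- The substitution n ↦ -n replaces a by 2h - a in the exponent and leaves the sign `ε ↑ n` alone.
  Θ-reflect : Θ ε h a ≗ Θ ε h a′
  Θ-reflect m = begin
    Θ ε h a m
      ≡⟨ ∑ℤ-negate {λ n → ε ↑ n * X (θ-exp h a n) m} (Supp₁ {λ n → ε ↑ n} bound ℕ.≤-refl) ⟨
    (∑ℤ (3 ℕ.+ m) λ n → ε ↑ (- n) * X (θ-exp h a (- n)) m)
      ≡⟨ ∑ℤ-cong (3 ℕ.+ m) (λ n → cong₂ (λ s e → s * X e m) (↑-neg ε n) (exponent n)) ⟩
    (∑ℤ (3 ℕ.+ m) λ n → ε ↑ n * X (θ-exp h a′ n) m)
      ≡⟨ ⟪⟫₁-extend {λ n → ε ↑ n} bound′ (ℕ.n≤1+n _) ⟨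
    Θ ε h a′ m ∎
    where
    open ≡-Reasoning
    lemma : ∀ h a a′ n → h * ((- n) * ((- n) - 1ℤ)) + a * (- n) ≡ h * (n * (n - 1ℤ)) + a′ * n + n * ((h + h) - (a + a′))
    lemma = solve-∀
    lemma′ : ∀ x n z → x + n * (z - z) ≡ x
    lemma′ = solve-∀
    exponent : ∀ n → θ-exp h a (- n) ≡ θ-exp h a′ n
    exponent n = trans (lemma (+ h) (+ a) (+ a′) n) (trans
      (cong (λ s → θ-exp h a′ n + n * ((+ h + + h) - (+ s))) a+a′≡2h)
      (lemma′ (θ-exp h a′ n) n (+ h + + h)))

  Θ-low : ∀ {i} → i ℕ.< a → i ℕ.< a′ → Θ ε h a i ≡ one i
  Θ-low {i} i<a i<a′ = trans (∑ℤ-extend {g} {1} {2 ℕ.+ i} supp (s≤s z≤n)) (trans (cong (λ x → (g 0ℤ + 0ℤ) + (x + 0ℤ)) (supp -[1+ 0 ] ℕ.≤-refl)) (trans (lemma (g 0ℤ)) g₀))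
    where
    g : ℤ → ℤ
    g n = ε ↑ n * X (θ-exp h a n) i
    lemma : ∀ x → (x + 0ℤ) + (0ℤ + 0ℤ) ≡ x
    lemma = solve-∀
    lemma₀ : ∀ h a → h * (0ℤ * (0ℤ - 1ℤ)) + a * 0ℤ ≡ 0ℤ
    lemma₀ = solve-∀
    g₀ : g 0ℤ ≡ one i
    g₀ = trans (ℤ.*-identityˡ (X (θ-exp h a 0ℤ) i)) (trans (cong (λ e → X e i) (lemma₀ (+ h) (+ a))) (X-zero i))
    large : ∀ b k → i ℕ.< b → + (suc k ℕ.* (h ℕ.* k ℕ.+ b)) ≢ + i
    large b k i<b p = ℕ.<-irrefl (sym (ℤ.+-injective p))
      (ℕ.≤-trans i<b (ℕ.≤-trans (ℕ.m≤n+m b (h ℕ.* k)) (ℕ.m≤m+n _ _)))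
    supp : Supp 1 g
    supp (+ suc k) _ = *-zeroʳ′ {ε ↑ (+ suc k)} (X-off _ i λ p → large a k i<a (trans (sym (θ-exp⁺ h a k)) p))
    supp -[1+ k ]  _ = *-zeroʳ′ {ε ↑ -[1+ k ]} (X-off _ i λ p → large a′ k i<a′ (trans (sym (θ-exp⁻ h a a′ k a+a′≡2h)) p))

-- φ(q^h) and ψ(q^h): the values 2n² - n for n in ℤ are the triangular numbers.
φᵗ ψᵗ : ℕ → Series
φᵗ h = Θ 1ℤ h h
ψᵗ h = Θ 1ℤ (h ℕ.+ h) h

module _ {h : ℕ} (1≤h : 1 ℕ.≤ h) where

  private
    1≤2h : 1 ℕ.≤ h ℕ.+ h
    1≤2h = ℕ.≤-trans 1≤h (ℕ.m≤m+n h h)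

    boundφ : Bound₁ (θ-exp h h)
    boundφ = θ-bound 1≤h 1≤h (ℕ.m≤m+n h h)

    boundψ : Bound₁ (θ-exp (h ℕ.+ h) h)
    boundψ = θ-bound 1≤2h 1≤h (ℕ.≤-trans (ℕ.m≤m+n h h) (ℕ.m≤m+n _ _))

    boundψ₂ : Bound₁ (θ-exp (h ℕ.+ h ℕ.+ (h ℕ.+ h)) (h ℕ.+ h))
    boundψ₂ = θ-bound (ℕ.≤-trans 1≤2h (ℕ.m≤m+n _ _)) 1≤2h (ℕ.≤-trans (ℕ.m≤m+n _ _) (ℕ.m≤m+n _ _))

    boundψ₂′ : Bound₁ (θ-exp h (h ℕ.+ h))
    boundψ₂′ = θ-bound 1≤h 1≤2h ℕ.≤-refl

    ℕ-double : ∀ n → n ℕ.+ n ≡ n ℕ.* 2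
    ℕ-double n = trans (cong (n ℕ.+_) (sym (ℕ.+-identityʳ n))) (ℕ.*-comm 2 n)

  -- The substitution x = y + r turns 2x² - x + 2y² - y into r² + 4s² - 2s, where
  -- s = y + t if r = 2t, and s = - (y + t) if r = 1 + 2t.
  ψ²≗φψ : ψᵗ h ⊛ ψᵗ h ≗ φᵗ h ⊛ ψᵗ (h ℕ.+ h)
  ψ²≗φψ m = begin
    (ψᵗ h ⊛ ψᵗ h) m
      ≡⟨ ⟪⟫₁⊛⟪⟫₁ {λ n → 1ℤ ↑ n} {λ n → 1ℤ ↑ n} boundψ boundψ ℕ.≤-refl ⟩
    (∑ℤ B λ x → ∑ℤ B λ y → G x y)
      ≡⟨ ∑ℤ-swap B B G ⟩
    (∑ℤ B λ y → ∑ℤ B λ x → G x y)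
      ≡⟨ ∑ℤ-cong≤ B (λ y y≤B → sym (∑ℤ-shift {λ x → G x y} y (Supp-left {λ n → 1ℤ ↑ n} {λ n → 1ℤ ↑ n} boundψ boundψ y) (ℕ.+-monoʳ-≤ B y≤B))) ⟩
    (∑ℤ B λ y → ∑ℤ (B ℕ.+ B) λ r → G (y + r) y)
      ≡⟨ ∑ℤ-swap B (B ℕ.+ B) (λ y r → G (y + r) y) ⟩
    (∑ℤ (B ℕ.+ B) λ r → ∑ℤ B λ y → G (y + r) y)
      ≡⟨ trans (cong (λ W → ∑ℤ W λ r → ∑ℤ B λ y → G (y + r) y) (ℕ-double B)) (∑ℤ-double B (λ r → ∑ℤ B λ y → G (y + r) y)) ⟩
    (∑ℤ B λ t → ∑ℤ B λ y → G (y + t * + 2) y) + (∑ℤ B λ t → ∑ℤ B λ y → G (y + (1ℤ + t * + 2)) y)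
      ≡⟨ cong₂ _+_ (∑ℤ-cong≤ B even) (∑ℤ-cong≤ B odd) ⟩
    (∑ℤ B λ t → ∑ℤ (suc (B ℕ.+ B)) λ s → H (t * + 2) s) + (∑ℤ B λ t → ∑ℤ (suc (B ℕ.+ B)) λ s → H (1ℤ + t * + 2) s)
      ≡⟨ trans (cong (λ W → ∑ℤ W λ r → ∑ℤ (suc (B ℕ.+ B)) λ s → H r s) (ℕ-double B)) (∑ℤ-double B (λ r → ∑ℤ (suc (B ℕ.+ B)) λ s → H r s)) ⟨
    (∑ℤ (B ℕ.+ B) λ r → ∑ℤ (suc (B ℕ.+ B)) λ s → H r s)
      ≡⟨ ∑ℤ-extend {λ r → ∑ℤ (suc (B ℕ.+ B)) λ s → H r s} (λ r B≤r → ∑ℤ-zero (suc (B ℕ.+ B)) λ s → Supp-left {λ n → 1ℤ ↑ n} {λ n → 1ℤ ↑ n} boundφ boundψ₂ s r B≤r) (ℕ.m≤m+n B B) ⟩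
    (∑ℤ B λ r → ∑ℤ (suc (B ℕ.+ B)) λ s → H r s)
      ≡⟨ ∑ℤ-cong B (λ r → ∑ℤ-extend {H r} (Supp-right {λ n → 1ℤ ↑ n} {λ n → 1ℤ ↑ n} boundφ boundψ₂ r) (ℕ.m≤n⇒m≤1+n (ℕ.m≤m+n B B))) ⟩
    (∑ℤ B λ r → ∑ℤ B λ s → H r s)
      ≡⟨ ⟪⟫₁⊛⟪⟫₁ {λ n → 1ℤ ↑ n} {λ n → 1ℤ ↑ n} boundφ boundψ₂ ℕ.≤-refl ⟨
    (φᵗ h ⊛ ψᵗ (h ℕ.+ h)) m ∎
    where
    open ≡-Reasoning
    B : ℕ
    B = 2 ℕ.+ m
    G H : ℤ → ℤ → ℤ
    G x y = 1ℤ ↑ x * (1ℤ ↑ y * X (θ-exp (h ℕ.+ h) h x + θ-exp (h ℕ.+ h) h y) m)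
    H r s = 1ℤ ↑ r * (1ℤ ↑ s * X (θ-exp h h r + θ-exp (h ℕ.+ h ℕ.+ (h ℕ.+ h)) (h ℕ.+ h) s) m)

    G≡H : ∀ x y r s → θ-exp (h ℕ.+ h) h x + θ-exp (h ℕ.+ h) h y ≡ θ-exp h h r + θ-exp (h ℕ.+ h ℕ.+ (h ℕ.+ h)) (h ℕ.+ h) s → G x y ≡ H r s
    G≡H x y r s p = trans (drop x y _) (trans (cong (λ e → X e m) p) (sym (drop r s _)))
      where
      drop : ∀ x y z → 1ℤ ↑ x * (1ℤ ↑ y * z) ≡ z
      drop x y z = trans (cong₂ (λ s t → s * (t * z)) (1↑ x) (1↑ y)) (trans (ℤ.*-identityˡ _) (ℤ.*-identityˡ z))

    supp : ∀ r → Supp B (λ y → G (y + r) y)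
    supp r y = Supp-right {λ n → 1ℤ ↑ n} {λ n → 1ℤ ↑ n} boundψ boundψ (y + r) y

    even-exp : ∀ t s → θ-exp (h ℕ.+ h) h ((- t + s) + t * + 2) + θ-exp (h ℕ.+ h) h (- t + s) ≡
                       θ-exp h h (t * + 2) + θ-exp (h ℕ.+ h ℕ.+ (h ℕ.+ h)) (h ℕ.+ h) s
    even-exp t s = lemma (+ h) t s
      where
      lemma : ∀ h t s →
        ((h + h) * (((- t + s) + t * + 2) * (((- t + s) + t * + 2) - 1ℤ)) + h * ((- t + s) + t * + 2)) +
        ((h + h) * ((- t + s) * ((- t + s) - 1ℤ)) + h * (- t + s)) ≡
        (h * ((t * + 2) * ((t * + 2) - 1ℤ)) + h * (t * + 2)) +
        ((h + h + (h + h)) * (s * (s - 1ℤ)) + (h + h) * s)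
      lemma = solve-∀

    odd-exp : ∀ t s → θ-exp (h ℕ.+ h) h ((- t + - s) + (1ℤ + t * + 2)) + θ-exp (h ℕ.+ h) h (- t + - s) ≡
                      θ-exp h h (1ℤ + t * + 2) + θ-exp (h ℕ.+ h ℕ.+ (h ℕ.+ h)) (h ℕ.+ h) s
    odd-exp t s = lemma (+ h) t s
      where
      lemma : ∀ h t s →
        ((h + h) * (((- t + - s) + (1ℤ + t * + 2)) * (((- t + - s) + (1ℤ + t * + 2)) - 1ℤ)) + h * ((- t + - s) + (1ℤ + t * + 2))) +
        ((h + h) * ((- t + - s) * ((- t + - s) - 1ℤ)) + h * (- t + - s)) ≡
        (h * ((1ℤ + t * + 2) * ((1ℤ + t * + 2) - 1ℤ)) + h * (1ℤ + t * + 2)) +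
        ((h + h + (h + h)) * (s * (s - 1ℤ)) + (h + h) * s)
      lemma = solve-∀

    bound-t : ∀ t → ∣ t ∣ ℕ.≤ B → B ℕ.+ ∣ - t ∣ ℕ.≤ B ℕ.+ B
    bound-t t t≤B = ℕ.+-monoʳ-≤ B (subst (ℕ._≤ B) (sym (ℤ.∣-i∣≡∣i∣ t)) t≤B)

    even : ∀ t → ∣ t ∣ ℕ.≤ B →
      ∑ℤ B (λ y → G (y + t * + 2) y) ≡ ∑ℤ (suc (B ℕ.+ B)) λ s → H (t * + 2) s
    even t t≤B = trans (sym (∑ℤ-shift {λ y → G (y + t * + 2) y} (- t) (supp (t * + 2)) (ℕ.m≤n⇒m≤1+n (bound-t t t≤B))))
      (∑ℤ-cong (suc (B ℕ.+ B)) λ s → G≡H ((- t + s) + t * + 2) (- t + s) (t * + 2) s (even-exp t s))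

    odd : ∀ t → ∣ t ∣ ℕ.≤ B →
      ∑ℤ B (λ y → G (y + (1ℤ + t * + 2)) y) ≡ ∑ℤ (suc (B ℕ.+ B)) λ s → H (1ℤ + t * + 2) s
    odd t t≤B = begin
      ∑ℤ B g                                   ≡⟨ ∑ℤ-shift {g} (- t) (supp (1ℤ + t * + 2)) (bound-t t t≤B) ⟨
      ∑ℤ (B ℕ.+ B) (λ s → g (- t + s))
        ≡⟨ ∑ℤ-negate {λ s → g (- t + s)} (λ s 2B≤s → shift-Supp {g} (- t) (supp (1ℤ + t * + 2)) s (ℕ.≤-trans (bound-t t t≤B) 2B≤s)) ⟨
      ∑ℤ (suc (B ℕ.+ B)) (λ s → g (- t + - s)) ≡⟨ ∑ℤ-cong (suc (B ℕ.+ B)) (λ s → G≡H ((- t + - s) + (1ℤ + t * + 2)) (- t + - s) (1ℤ + t * + 2) s (odd-exp t s)) ⟩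
      ∑ℤ (suc (B ℕ.+ B)) (λ s → H (1ℤ + t * + 2) s) ∎
      where
      g : ℤ → ℤ
      g y = G (y + (1ℤ + t * + 2)) y

  -- The exponents are h n (n + 1), each taken twice since n ↦ -1 - n fixes them. The even n = 2i
  -- and the odd n = 1 + 2i each run once through the exponents of ψ(q^(2h)), with index -i and 1 +
  -- i there.
  Θ-double : Θ 1ℤ h (h ℕ.+ h) ≗ + 2 · ψᵗ (h ℕ.+ h)
  Θ-double m = begin
    Θ 1ℤ h (h ℕ.+ h) m
      ≡⟨ ⟪⟫₁-extend {λ n → 1ℤ ↑ n} boundψ₂′ (ℕ.m≤m*n B 2) ⟩
    ∑ℤ (B ℕ.* 2) f
      ≡⟨ ∑ℤ-double B f ⟩
    ∑ℤ B (λ i → f (i * + 2)) + ∑ℤ B (λ i → f (1ℤ + i * + 2))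
      ≡⟨ cong₂ _+_ (∑ℤ-cong B λ i → f≡g (i * + 2) (- i) (exp₁ (+ h) i))
                   (∑ℤ-cong B λ i → f≡g (1ℤ + i * + 2) (1ℤ + i) (exp₂ (+ h) i)) ⟩
    ∑ℤ B (λ i → g (- i)) + ∑ℤ B (λ i → g (1ℤ + i))
      ≡⟨ cong₂ _+_ (sym (∑ℤ-extend {λ i → g (- i)} (λ i B≤i → f-off (- i) (i * + 2) (sym (exp₁ (+ h) i)) (far i B≤i)) (ℕ.n≤1+n B)))
                   (sym (∑ℤ-extend {λ i → g (1ℤ + i)} (λ i B≤i → f-off (1ℤ + i) (1ℤ + i * + 2) (sym (exp₂ (+ h) i)) (far′ i B≤i)) (ℕ.m≤m+n B 1))) ⟩
    ∑ℤ (suc B) (λ i → g (- i)) + ∑ℤ (B ℕ.+ 1) (λ i → g (1ℤ + i))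
      ≡⟨ cong₂ _+_ (∑ℤ-negate {g} (Supp₁ {λ n → 1ℤ ↑ n} boundψ₂ ℕ.≤-refl))
                   (∑ℤ-shift {g} 1ℤ (Supp₁ {λ n → 1ℤ ↑ n} boundψ₂ ℕ.≤-refl) ℕ.≤-refl) ⟩
    ψᵗ (h ℕ.+ h) m + ψᵗ (h ℕ.+ h) m
      ≡⟨ lemma (ψᵗ (h ℕ.+ h) m) ⟩
    + 2 * ψᵗ (h ℕ.+ h) m ∎
    where
    open ≡-Reasoning
    B : ℕ
    B = 2 ℕ.+ m
    f g : ℤ → ℤ
    f n = 1ℤ ↑ n * X (θ-exp h (h ℕ.+ h) n) m
    g n = 1ℤ ↑ n * X (θ-exp (h ℕ.+ h ℕ.+ (h ℕ.+ h)) (h ℕ.+ h) n) m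
    lemma : ∀ x → x + x ≡ + 2 * x
    lemma = solve-∀
    exp₁ : ∀ h i → h * ((i * + 2) * (i * + 2 - 1ℤ)) + (h + h) * (i * + 2) ≡
                   (h + h + (h + h)) * ((- i) * ((- i) - 1ℤ)) + (h + h) * (- i)
    exp₁ = solve-∀
    exp₂ : ∀ h i → h * ((1ℤ + i * + 2) * ((1ℤ + i * + 2) - 1ℤ)) + (h + h) * (1ℤ + i * + 2) ≡
                   (h + h + (h + h)) * ((1ℤ + i) * ((1ℤ + i) - 1ℤ)) + (h + h) * (1ℤ + i)
    exp₂ = solve-∀
    f≡g : ∀ i j → θ-exp h (h ℕ.+ h) i ≡ θ-exp (h ℕ.+ h ℕ.+ (h ℕ.+ h)) (h ℕ.+ h) j → f i ≡ g j
    f≡g i j p = cong₂ (λ s e → s * X e m) (trans (1↑ i) (sym (1↑ j))) p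
    f-off : ∀ j i → θ-exp (h ℕ.+ h ℕ.+ (h ℕ.+ h)) (h ℕ.+ h) j ≡ θ-exp h (h ℕ.+ h) i → B ℕ.≤ ∣ i ∣ → g j ≡ 0ℤ
    f-off j i p B≤i = trans (sym (f≡g i j (sym p))) (Supp₁ {λ n → 1ℤ ↑ n} boundψ₂′ ℕ.≤-refl i B≤i)
    far : ∀ i → B ℕ.≤ ∣ i ∣ → B ℕ.≤ ∣ i * + 2 ∣
    far i B≤i = ℕ.≤-trans B≤i (subst (∣ i ∣ ℕ.≤_) (sym (ℤ.abs-* i (+ 2))) (ℕ.m≤m*n ∣ i ∣ 2))
    far′ : ∀ i → B ℕ.≤ ∣ i ∣ → B ℕ.≤ ∣ 1ℤ + i * + 2 ∣
    far′ (+ suc k)       B≤i = ℕ.≤-trans B≤i (ℕ.m≤n⇒m≤1+n (ℕ.m≤m*n (suc k) 2))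
    far′ -[1+ zero ]     (s≤s ())
    far′ -[1+ suc k ]    B≤i = ℕ.≤-trans B≤i (s≤s (s≤s (ℕ.m≤n⇒m≤1+n (ℕ.m≤m*n k 2))))

sgn-split : ∀ (w : ℤ → ℤ) (e : ℤ → ℤ → ℤ) W m →
  (∑ℤ W λ n → ∑ℤ W λ j → sgn n j * w n * X (e n j) m) ≡
  (∑ℕ W λ n → ∑ℕ W λ j → w (+ n) * X (e (+ n) (+ j)) m) +
  (∑ℕ W λ n → ∑ℕ W λ j → - w -[1+ n ] * X (e -[1+ n ] -[1+ j ]) m)
sgn-split w e W m = cong₂ _+_
  (∑ℕ-cong W λ n → trans (cong₂ _+_
    (∑ℕ-cong W λ j → cong (_* X (e (+ n) (+ j)) m) (ℤ.*-identityˡ (w (+ n))))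
    (∑ℕ-zero W λ j → ℤ.*-zeroˡ (X (e (+ n) -[1+ j ]) m))) (ℤ.+-identityʳ _))
  (∑ℕ-cong W λ n → trans (cong₂ _+_
    (∑ℕ-zero W λ j → ℤ.*-zeroˡ (X (e -[1+ n ] (+ j)) m))
    (∑ℕ-cong W λ j → cong (_* X (e -[1+ n ] -[1+ j ]) m) (ℤ.-1*i≡-i (w -[1+ n ])))) (ℤ.+-identityˡ _))

module _ {h : ℕ} (1≤h : 1 ℕ.≤ h) where

  private
    1≤2h : 1 ℕ.≤ h ℕ.+ h
    1≤2h = ℕ.≤-trans 1≤h (ℕ.m≤m+n h h)

    q : ℕ → ℕ → ℕ
    q n j = h ℕ.* (n ℕ.+ j ℕ.+ 2 ℕ.* (n ℕ.* j))

    pos-q : ∀ n j → + h * (+ n + + j + + 2 * (+ n * + j)) ≡ + q n j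
    pos-q n j = sym (trans (ℤ.pos-* h _) (cong (λ x → + h * (+ n + + j + x))
      (trans (ℤ.pos-* 2 (n ℕ.* j)) (cong (+ 2 *_) (ℤ.pos-* n j)))))

    module _ (m : ℕ) where
      open ≡-Reasoning

      B : ℕ
      B = 2 ℕ.+ m

      Q : ℕ → ℕ → ℤ
      Q n j = X (+ q n j) m

      Q-sym : ∀ n j → Q n j ≡ Q j n
      Q-sym n j = cong (λ e → X (+ (h ℕ.* e)) m) (cong₂ ℕ._+_ (ℕ.+-comm n j) (cong (2 ℕ.*_) (ℕ.*-comm n j)))

      Q-off : ∀ n j → B ℕ.≤ j → Q n j ≡ 0ℤ
      Q-off n j B≤j = X-off _ m λ p → ℕ.<-irrefl (sym (ℤ.+-injective p))
        (ℕ.≤-trans (ℕ.≤-trans (ℕ.n≤1+n _) B≤j) (ℕ.≤-trans (ℕ.≤-trans (ℕ.m≤n+m j n) (ℕ.m≤m+n _ _))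
          (ℕ.m≤n*m _ h {{ℕ.>-nonZero 1≤h}})))

      -- The exponent `q n j` is h ((2n+1)(2j+1) - 1)/2, symmetric in n and j. In `F -1ℤ h h` each
      -- of the two quadrants gives `alt`. In `F 1ℤ (h ℕ.+ h) h` the quadrants give the even and the
      -- odd second indices of the sum with sign (-1)^j, and the symmetry moves this sign to n.
      alt : ℤ
      alt = ∑ℕ B λ n → ∑ℕ B λ j → -1ℤ ℤ.^ n * Q n j

      F⁻ : F -1ℤ h h m ≡ alt + alt
      F⁻ = begin
        F -1ℤ h h m
          ≡⟨ sgn-split (-1ℤ ↑_) (F-exp h h) B m ⟩
        (∑ℕ B λ n → ∑ℕ B λ j → -1ℤ ℤ.^ n * X (F-exp h h (+ n) (+ j)) m) +
        (∑ℕ B λ n → ∑ℕ B λ j → - (-1ℤ * -1ℤ ℤ.^ n) * X (F-exp h h -[1+ n ] -[1+ j ]) m)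
          ≡⟨ cong₂ _+_
               (∑ℕ-cong B λ n → ∑ℕ-cong B λ j → cong (λ e → -1ℤ ℤ.^ n * X e m)
                 (trans (exp₁ (+ h) (+ n) (+ j)) (pos-q n j)))
               (∑ℕ-cong B λ n → ∑ℕ-cong B λ j → cong₂ (λ s e → s * X e m)
                 (sign (-1ℤ ℤ.^ n)) (trans (exp₂ (+ h) (+ n) (+ j)) (pos-q n j))) ⟩
        alt + alt ∎
        where
        exp₁ : ∀ h n j → h * n + h * ((+ 2 * n + 1ℤ) * j) ≡ h * (n + j + + 2 * (n * j))
        exp₁ = solve-∀
        exp₂ : ∀ h n j → h * (- (1ℤ + n)) + h * ((+ 2 * (- (1ℤ + n)) + 1ℤ) * (- (1ℤ + j))) ≡ h * (n + j + + 2 * (n * j))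
        exp₂ = solve-∀
        sign : ∀ x → - (-1ℤ * x) ≡ x
        sign x = trans (cong -_ (ℤ.-1*i≡-i x)) (ℤ.neg-involutive x)

      F⁺ : F 1ℤ (h ℕ.+ h) h m ≡ alt
      F⁺ = begin
        F 1ℤ (h ℕ.+ h) h m
          ≡⟨ sgn-split (1ℤ ↑_) (F-exp (h ℕ.+ h) h) B m ⟩
        (∑ℕ B λ n → ∑ℕ B λ j → 1ℤ ↑ (+ n) * X (F-exp (h ℕ.+ h) h (+ n) (+ j)) m) +
        (∑ℕ B λ n → ∑ℕ B λ j → - 1ℤ ↑ -[1+ n ] * X (F-exp (h ℕ.+ h) h -[1+ n ] -[1+ j ]) m)
          ≡⟨ cong₂ _+_
               (∑ℕ-cong B λ n → ∑ℕ-cong B λ j → cong₂ (λ s e → s * X e m)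
                 (trans (1↑ (+ n)) (sym (even-sign j)))
                 (trans (trans (exp₁ (+ h) (+ n) (+ j)) (cong (λ i → + h * (+ n + i + + 2 * (+ n * i))) (sym (ℤ.pos-* j 2)))) (pos-q n (j ℕ.* 2))))
               (∑ℕ-cong B λ n → ∑ℕ-cong B λ j → cong₂ (λ s e → s * X e m)
                 (trans (cong -_ (1↑ -[1+ n ])) (cong (-1ℤ *_) (sym (even-sign j))))
                 (trans (trans (exp₂ (+ h) (+ n) (+ j)) (cong (λ i → + h * (+ n + (1ℤ + i) + + 2 * (+ n * (1ℤ + i)))) (sym (ℤ.pos-* j 2)))) (pos-q n (suc (j ℕ.* 2))))) ⟩
        (∑ℕ B λ n → ∑ℕ B λ j → -1ℤ ℤ.^ (j ℕ.* 2) * Q n (j ℕ.* 2)) +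
        (∑ℕ B λ n → ∑ℕ B λ j → -1ℤ ℤ.^ suc (j ℕ.* 2) * Q n (suc (j ℕ.* 2)))
          ≡⟨ ∑ℕ-+ B (λ n → ∑ℕ B λ j → -1ℤ ℤ.^ (j ℕ.* 2) * Q n (j ℕ.* 2)) (λ n → ∑ℕ B λ j → -1ℤ ℤ.^ suc (j ℕ.* 2) * Q n (suc (j ℕ.* 2))) ⟨
        (∑ℕ B λ n → (∑ℕ B λ j → -1ℤ ℤ.^ (j ℕ.* 2) * Q n (j ℕ.* 2)) + (∑ℕ B λ j → -1ℤ ℤ.^ suc (j ℕ.* 2) * Q n (suc (j ℕ.* 2))))
          ≡⟨ ∑ℕ-cong B (λ n → ∑ℕ-double B (λ i → -1ℤ ℤ.^ i * Q n i)) ⟨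
        (∑ℕ B λ n → ∑ℕ (B ℕ.* 2) λ i → -1ℤ ℤ.^ i * Q n i)
          ≡⟨ ∑ℕ-cong B (λ n → ∑ℕ-extend {f = λ i → -1ℤ ℤ.^ i * Q n i} (λ i B≤i → *-zeroʳ′ { -1ℤ ℤ.^ i} (Q-off n i B≤i)) (ℕ.m≤m*n B 2)) ⟩
        (∑ℕ B λ n → ∑ℕ B λ i → -1ℤ ℤ.^ i * Q n i)
          ≡⟨ ∑ℕ-swap B B (λ n i → -1ℤ ℤ.^ i * Q n i) ⟩
        (∑ℕ B λ i → ∑ℕ B λ n → -1ℤ ℤ.^ i * Q n i)
          ≡⟨ ∑ℕ-cong B (λ i → ∑ℕ-cong B λ n → cong (-1ℤ ℤ.^ i *_) (Q-sym n i)) ⟩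
        alt ∎
        where
        exp₁ : ∀ h n j → h * n + (h + h) * ((+ 2 * n + 1ℤ) * j) ≡ h * (n + j * + 2 + + 2 * (n * (j * + 2)))
        exp₁ = solve-∀
        exp₂ : ∀ h n j → h * (- (1ℤ + n)) + (h + h) * ((+ 2 * (- (1ℤ + n)) + 1ℤ) * (- (1ℤ + j))) ≡
                         h * (n + (1ℤ + j * + 2) + + 2 * (n * (1ℤ + j * + 2)))
        exp₂ = solve-∀
        even-sign : ∀ j → -1ℤ ℤ.^ (j ℕ.* 2) ≡ 1ℤ
        even-sign zero    = refl
        even-sign (suc j) = cong (λ x → -1ℤ * (-1ℤ * x)) (even-sign j)

  F⁻≗2F⁺ : F -1ℤ h h ≗ + 2 · F 1ℤ (h ℕ.+ h) h
  F⁻≗2F⁺ m = trans (F⁻ m) (trans (lemma (alt m)) (cong (+ 2 *_) (sym (F⁺ m))))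
    where
    lemma : ∀ x → x + x ≡ + 2 * x
    lemma = solve-∀

  ψᵗ-low : ∀ {i} → i ℕ.< h → ψᵗ h i ≡ one i
  ψᵗ-low i<h = Θ-low 1ℤ {a′ = h ℕ.+ h ℕ.+ h} 1≤2h 1≤h (ℕ.≤-trans 1≤h (ℕ.m≤n+m h _))
    (trans (sym (ℕ.+-assoc h (h ℕ.+ h) h)) (trans (cong (ℕ._+ h) (ℕ.+-comm h (h ℕ.+ h))) (ℕ.+-assoc (h ℕ.+ h) h h)))
    i<h (ℕ.≤-trans i<h (ℕ.m≤n+m h _))

  S-low : ∀ {i} → i ℕ.< h → S h i ≡ one i
  S-low {i} i<h = begin
    S h i
      ≡⟨ sgn-split (-1ℤ ↑_) (S-exp h) (2 ℕ.+ i) i ⟩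
    (∑ℕ (2 ℕ.+ i) λ n → ∑ℕ (2 ℕ.+ i) λ j → -1ℤ ↑ (+ n) * X (S-exp h (+ n) (+ j)) i) +
    (∑ℕ (2 ℕ.+ i) λ n → ∑ℕ (2 ℕ.+ i) λ j → - -1ℤ ↑ -[1+ n ] * X (S-exp h -[1+ n ] -[1+ j ]) i)
      ≡⟨ cong₂ _+_
           (∑ℕ-extend {1} {2 ℕ.+ i} {λ n → ∑ℕ (2 ℕ.+ i) λ j → -1ℤ ↑ (+ n) * X (S-exp h (+ n) (+ j)) i} (λ { (suc n) _ → ∑ℕ-zero (2 ℕ.+ i) λ j → *-zeroʳ′ { -1ℤ ↑ (+ suc n)} (off (s≤s z≤n) (exp₁ (suc n) j)) }) (s≤s z≤n))
           (∑ℕ-zero (2 ℕ.+ i) λ n → ∑ℕ-zero (2 ℕ.+ i) λ j → *-zeroʳ′ {(- (-1ℤ ↑ -[1+ n ]))} (off (stuff n j) (exp₂ n j))) ⟩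
    ((∑ℕ (2 ℕ.+ i) λ j → 1ℤ * X (S-exp h 0ℤ (+ j)) i) + 0ℤ) + 0ℤ
      ≡⟨ cong (λ x → (x + 0ℤ) + 0ℤ) (∑ℕ-extend {1} {2 ℕ.+ i} {λ j → 1ℤ * X (S-exp h 0ℤ (+ j)) i} (λ { (suc j) _ → *-zeroʳ′ {1ℤ} (off (s≤s z≤n) (exp₁ 0 (suc j))) }) (s≤s z≤n)) ⟩
    (((1ℤ * X (S-exp h 0ℤ 0ℤ) i) + 0ℤ) + 0ℤ) + 0ℤ
      ≡⟨ lemma (X (S-exp h 0ℤ 0ℤ) i) ⟩
    X (S-exp h 0ℤ 0ℤ) i
      ≡⟨ cong (λ e → X e i) (ℤ.*-zeroʳ (+ h)) ⟩
    X 0ℤ i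
      ≡⟨ X-zero i ⟩
    one i ∎
    where
    open ≡-Reasoning
    lemma : ∀ x → (((1ℤ * x) + 0ℤ) + 0ℤ) + 0ℤ ≡ x
    lemma = solve-∀
    off : ∀ {k e} → 1 ℕ.≤ k → e ≡ + (h ℕ.* k) → X e i ≡ 0ℤ
    off {k} 1≤k refl = X-off _ i λ p → ℕ.<-irrefl (sym (ℤ.+-injective p))
      (ℕ.≤-trans i<h (subst (ℕ._≤ h ℕ.* k) (ℕ.*-identityʳ h) (ℕ.*-monoʳ-≤ h 1≤k)))
    stuff : ∀ n j → 1 ℕ.≤ n ℕ.* suc n ℕ.+ suc (2 ℕ.* n) ℕ.* suc j
    stuff n j = ℕ.≤-trans (s≤s z≤n) (ℕ.m≤n+m _ (n ℕ.* suc n))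
    pos-stuff : ∀ n j → + h * (+ n * + suc n + (1ℤ + + 2 * + n) * + j) ≡ + (h ℕ.* (n ℕ.* suc n ℕ.+ suc (2 ℕ.* n) ℕ.* j))
    pos-stuff n j = sym (trans (ℤ.pos-* h _) (cong (+ h *_) (cong₂ _+_ (ℤ.pos-* n (suc n))
      (trans (ℤ.pos-* (suc (2 ℕ.* n)) j) (cong (λ x → (1ℤ + x) * + j) (ℤ.pos-* 2 n))))))
    exp₁ : ∀ n j → S-exp h (+ n) (+ j) ≡ + (h ℕ.* (n ℕ.* suc n ℕ.+ suc (2 ℕ.* n) ℕ.* j))
    exp₁ n j = trans (poly (+ h) (+ n) (+ j)) (pos-stuff n j)
      where
      poly : ∀ h n j → h * (n * (n + 1ℤ) + (+ 2 * n + 1ℤ) * j) ≡ h * (n * (1ℤ + n) + (1ℤ + + 2 * n) * j)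
      poly = solve-∀
    exp₂ : ∀ n j → S-exp h -[1+ n ] -[1+ j ] ≡ + (h ℕ.* (n ℕ.* suc n ℕ.+ suc (2 ℕ.* n) ℕ.* suc j))
    exp₂ n j = trans (poly (+ h) (+ n) (+ j)) (pos-stuff n (suc j))
      where
      poly : ∀ h n j → h * ((- (1ℤ + n)) * ((- (1ℤ + n)) + 1ℤ) + (+ 2 * (- (1ℤ + n)) + 1ℤ) * (- (1ℤ + j))) ≡
                       h * (n * (1ℤ + n) + (1ℤ + + 2 * n) * (1ℤ + j))
      poly = solve-∀

  -- At z = q^h in base q^(2h) the two theta series of Kronecker's formula have parameters h and 3h,
  -- which are reflections of each other, so they cancel.
  F⁺≗S : F 1ℤ (h ℕ.+ h) h ≗ S (h ℕ.+ h)
  F⁺≗S = ⊛-cancelˡ (Θ -1ℤ (h ℕ.+ h) h) constant λ m → trans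
    (kronecker 1ℤ refl (h ℕ.+ h) h 1≤h (ℕ.m≤m+n h h) m)
    (⊛-cong (Θ-reflect -1ℤ 1≤2h (ℕ.≤-trans 1≤h (ℕ.m≤m+n h _)) 1≤h sum₁) (≗-refl {S (h ℕ.+ h)}) m)
    where
    sum₁ : h ℕ.+ (h ℕ.+ h) ℕ.+ h ≡ (h ℕ.+ h) ℕ.+ (h ℕ.+ h)
    sum₁ = trans (cong (ℕ._+ h) (ℕ.+-comm h (h ℕ.+ h))) (ℕ.+-assoc (h ℕ.+ h) h h)
    constant : Θ -1ℤ (h ℕ.+ h) h 0 ≡ 1ℤ
    constant = Θ-low -1ℤ {a′ = h ℕ.+ (h ℕ.+ h)} 1≤2h 1≤h (ℕ.≤-trans 1≤h (ℕ.m≤m+n h _))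
      (trans (ℕ.+-comm h _) sum₁) 1≤h (ℕ.≤-trans 1≤h (ℕ.m≤m+n h _))

  -- This is Kronecker's formula at z = -q^h in base q^h. A factor 2 appears on both sides, from
  -- `F⁻≗2F⁺` and from `Θ-double`, and is cancelled.
  φS≗ψS : φᵗ h ⊛ S (h ℕ.+ h) ≗ ψᵗ (h ℕ.+ h) ⊛ S h
  φS≗ψS m = ℤ.*-cancelˡ-≡ (+ 2) _ _ $ begin
    + 2 * (φᵗ h ⊛ S (h ℕ.+ h)) m            ≡⟨ cong (+ 2 *_) (⊛-comm (φᵗ h) (S (h ℕ.+ h)) m) ⟩
    + 2 * (S (h ℕ.+ h) ⊛ φᵗ h) m            ≡⟨ ·-⊛ (+ 2) (S (h ℕ.+ h)) (φᵗ h) m ⟨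
    ((+ 2 · S (h ℕ.+ h)) ⊛ φᵗ h) m          ≡⟨ ⊛-cong (λ i → trans (F⁻≗2F⁺ i) (cong (+ 2 *_) (F⁺≗S i))) (≗-refl {φᵗ h}) m ⟨
    (F -1ℤ h h ⊛ φᵗ h) m                    ≡⟨ ⊛-comm (F -1ℤ h h) (φᵗ h) m ⟩
    (φᵗ h ⊛ F -1ℤ h h) m                    ≡⟨ kronecker -1ℤ refl h h 1≤h ℕ.≤-refl m ⟩
    (Θ 1ℤ h (h ℕ.+ h) ⊛ S h) m              ≡⟨ ⊛-cong (Θ-double 1≤h) (≗-refl {S h}) m ⟩
    ((+ 2 · ψᵗ (h ℕ.+ h)) ⊛ S h) m          ≡⟨ ·-⊛ (+ 2) (ψᵗ (h ℕ.+ h)) (S h) m ⟩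
    + 2 * (ψᵗ (h ℕ.+ h) ⊛ S h) m            ∎
    where open ≡-Reasoning

-- φ(q^h) S(2h) = ψ(q^2h) S(h) reduces S(h) = ψ(q^h)² to S(2h) = ψ(q^2h)²; both sides are 1 + O(q^h).
S≈ψ² : ∀ t {h m} → 1 ℕ.≤ h → m ℕ.< t ℕ.+ h → S h ≈[ m ] ψᵗ h ⊛ ψᵗ h
S≈ψ² zero    {h} {m} 1≤h m<h i i≤m = begin
  S h i               ≡⟨ S-low 1≤h (ℕ.≤-<-trans i≤m m<h) ⟩
  one i               ≡⟨ ⊛-identityˡ one i ⟨
  (one ⊛ one) i       ≡⟨ ⊛-cong-at i low low ⟨
  (ψᵗ h ⊛ ψᵗ h) i     ∎
  where
  open ≡-Reasoning
  low : ψᵗ h ≈[ i ] one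
  low j j≤i = ψᵗ-low 1≤h (ℕ.≤-<-trans j≤i (ℕ.≤-<-trans i≤m m<h))
S≈ψ² (suc t) {h} {m} 1≤h m<t+h = ⊛-cancelˡ≈ ψ₂ (ψᵗ-low 1≤2h 1≤2h) λ i i≤m → begin
  (ψ₂ ⊛ S h) i                ≡⟨ φS≗ψS 1≤h i ⟨
  (φᵗ h ⊛ S (h ℕ.+ h)) i      ≡⟨ ⊛-cong-at i (≈-refl {φᵗ h}) (≈-≤ i≤m (S≈ψ² t 1≤2h m<t+2h)) ⟩
  (φᵗ h ⊛ (ψ₂ ⊛ ψ₂)) i        ≡⟨ ⊛-assoc (φᵗ h) ψ₂ ψ₂ i ⟨
  ((φᵗ h ⊛ ψ₂) ⊛ ψ₂) i        ≡⟨ ⊛-cong (ψ²≗φψ 1≤h) (≗-refl {ψ₂}) i ⟨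
  ((ψᵗ h ⊛ ψᵗ h) ⊛ ψ₂) i      ≡⟨ ⊛-comm (ψᵗ h ⊛ ψᵗ h) ψ₂ i ⟩
  (ψ₂ ⊛ (ψᵗ h ⊛ ψᵗ h)) i      ∎
  where
  open ≡-Reasoning
  ψ₂ : Series
  ψ₂ = ψᵗ (h ℕ.+ h)
  1≤2h : 1 ℕ.≤ h ℕ.+ h
  1≤2h = ℕ.≤-trans 1≤h (ℕ.m≤m+n h h)
  m<t+2h : m ℕ.< t ℕ.+ (h ℕ.+ h)
  m<t+2h = ℕ.≤-trans m<t+h (ℕ.≤-trans (ℕ.≤-reflexive (sym (ℕ.+-suc t h))) (ℕ.+-monoʳ-≤ t (ℕ.+-monoˡ-≤ h 1≤h)))

S≗ψ² : ∀ {h} → 1 ℕ.≤ h → S h ≗ ψᵗ h ⊛ ψᵗ h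
S≗ψ² {h} 1≤h m = S≈ψ² (suc m) 1≤h (s≤s (ℕ.m≤m+n m h)) m ℕ.≤-refl

-- The triple product

module _ {c ℓ} (R : CommutativeSemiring c ℓ) where
  private module R = CommutativeSemiring R
  open R using (_≈_)
  open NaturalCoefficients R

  pascal-step : ∀ pk pl u v x g g′ →
    ((pk R.* u) R.* (pl R.* v)) R.* (g R.+ x R.* g′) ≈
    u R.* ((pk R.* (pl R.* v)) R.* g) R.+ (x R.* v) R.* (((pk R.* u) R.* pl) R.* g′)
  pascal-step = solve 7 (λ pk pl u v x g g′ →
    ((pk :* u) :* (pl :* v)) :* (g :+ x :* g′) :=
    u :* ((pk :* (pl :* v)) :* g) :+ (x :* v) :* (((pk :* u) :* pl) :* g′)) R.refl

  factor-step : ∀ a b c d → (a R.* b) R.* (c R.* d) ≈ (a R.* c) R.* (d R.* b)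
  factor-step = solve 4 (λ a b c d → (a :* b) :* (c :* d) := (a :* c) :* (d :* b)) R.refl

X-⊛-shift : ∀ k a m → (X (+ k) ⊛ a) (k ℕ.+ m) ≡ a m
X-⊛-shift zero    a m = trans (⊛-cong X-zero (≗-refl {a}) m) (⊛-identityˡ a m)
X-⊛-shift (suc k) a m = trans (⊛-suc (X (+ suc k)) a (k ℕ.+ m)) (trans (ℤ.+-identityˡ _) (X-⊛-shift k a m))

X-⊛-low : ∀ {k m} a → m ℕ.< k → (X (+ k) ⊛ a) m ≡ 0ℤ
X-⊛-low {suc k} {zero}  a _         = trans (⊛-0 (X (+ suc k)) a) refl
X-⊛-low {suc k} {suc m} a (s≤s m<k) = trans (⊛-suc (X (+ suc k)) a m) (trans (ℤ.+-identityˡ _) (X-⊛-low a m<k))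

factor : ℤ → ℕ → Series
factor ε k = one ⊕ ε · X (+ k)

Π : ℕ → ℤ → ℕ → ℕ → Series
Π c ε r zero    = one
Π c ε r (suc n) = Π c ε r n ⊛ factor ε (c ℕ.* n ℕ.+ r)

factor-low : ∀ {ε k m} → m ℕ.< k → factor ε k ≈[ m ] one
factor-low {ε} {k} {m} m<k i i≤m = trans
  (+-congˡ (one i) (*-zeroʳ′ {ε} (X-off (+ k) i λ p → ℕ.<-irrefl (sym (ℤ.+-injective p)) (ℕ.≤-<-trans i≤m m<k))))
  (ℤ.+-identityʳ _)

Π-stable : ∀ c ε r {m} n d → (∀ i → n ℕ.≤ i → m ℕ.< c ℕ.* i ℕ.+ r) → Π c ε r (d ℕ.+ n) ≈[ m ] Π c ε r n
Π-stable c ε r n zero    large = ≈-refl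
Π-stable c ε r {m} n (suc d) large i i≤m = begin
  (Π c ε r (d ℕ.+ n) ⊛ factor ε (c ℕ.* (d ℕ.+ n) ℕ.+ r)) i
    ≡⟨ ⊛-cong-at i (≈-≤ i≤m (Π-stable c ε r n d large)) (≈-≤ i≤m (factor-low {ε} (large (d ℕ.+ n) (ℕ.m≤n+m n d)))) ⟩
  (Π c ε r n ⊛ one) i
    ≡⟨ ⊛-identityʳ (Π c ε r n) i ⟩
  Π c ε r n i ∎
  where open ≡-Reasoning

Π-first : ∀ c ε r n → Π c ε r (suc n) ≗ factor ε r ⊛ Π c ε (c ℕ.+ r) n
Π-first c ε r zero    m = trans
  (⊛-cong (≗-refl {one}) (λ i → cong (λ k → factor ε (k ℕ.+ r) i) (ℕ.*-zeroʳ c)) m)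
  (⊛-comm one (factor ε r) m)
Π-first c ε r (suc n) m = begin
  (Π c ε r (suc n) ⊛ factor ε (c ℕ.* suc n ℕ.+ r)) m
    ≡⟨ ⊛-cong (Π-first c ε r n) (λ i → cong (λ k → factor ε k i) (shift c n r)) m ⟩
  ((factor ε r ⊛ Π c ε (c ℕ.+ r) n) ⊛ factor ε (c ℕ.* n ℕ.+ (c ℕ.+ r))) m
    ≡⟨ ⊛-assoc (factor ε r) (Π c ε (c ℕ.+ r) n) (factor ε (c ℕ.* n ℕ.+ (c ℕ.+ r))) m ⟩
  (factor ε r ⊛ Π c ε (c ℕ.+ r) (suc n)) m ∎
  where
  open ≡-Reasoning
  shift : ∀ c n r → c ℕ.* suc n ℕ.+ r ≡ c ℕ.* n ℕ.+ (c ℕ.+ r)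
  shift = ℕ-Solver.solve-∀

Π-head : ∀ {c ε r} → 1 ℕ.≤ r → ∀ n → Π c ε r n 0 ≡ 1ℤ
Π-head 1≤r zero    = refl
Π-head {c} {ε} {r} 1≤r (suc n) = trans
  (⊛-cong-at {a = Π c ε r n} {a′ = one} {b = factor ε (c ℕ.* n ℕ.+ r)} {b′ = one} 0 (λ { _ z≤n → Π-head {c} {ε} 1≤r n }) (factor-low {ε} {c ℕ.* n ℕ.+ r} (ℕ.≤-trans 1≤r (ℕ.m≤n+m r _))))
  (⊛-identityˡ one 0)

-- The antidiagonal k + l = n. Both indices are passed on, so that Gaussian binomials are handled
-- without truncated subtraction.
anti : ℕ → (ℕ → ℕ → Series) → Series
anti zero    f = f 0 0
anti (suc n) f = f 0 (suc n) ⊕ anti n (λ k l → f (suc k) l)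

anti-⊛ : ∀ n a f → a ⊛ anti n f ≗ anti n (λ k l → a ⊛ f k l)
anti-⊛ zero    a f m = refl
anti-⊛ (suc n) a f m = trans (⊛-distribˡ a (f 0 (suc n)) (anti n (λ k l → f (suc k) l)) m)
  (+-congˡ ((a ⊛ f 0 (suc n)) m) (anti-⊛ n a (λ k l → f (suc k) l) m))

anti-∑ : ∀ n f m → anti n f m ≡ ∑ℕ (suc n) (λ k → f k (n ℕ.∸ k) m)
anti-∑ zero    f m = sym (ℤ.+-identityʳ _)
anti-∑ (suc n) f m = +-congˡ (f 0 (suc n) m) (anti-∑ n (λ k l → f (suc k) l) m)

-- Pascal's rule summed along an antidiagonal: the second contribution is displaced by one place,
-- which leaves `y 0 n` over at the end.
anti-merge : ∀ n (f x y : ℕ → ℕ → Series) →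
  (∀ k l → f k (suc l) ≗ x k (suc l) ⊕ y (suc k) l) → (∀ k → f k 0 ≗ x k 0) →
  y 0 n ⊕ anti n f ≗ anti n x ⊕ anti n y
anti-merge zero    f x y p r m = trans (+-congˡ (y 0 0 m) (r 0 m)) (ℤ.+-comm (y 0 0 m) _)
anti-merge (suc n) f x y p r m = begin
  y 0 (suc n) m + (f 0 (suc n) m + F′)
    ≡⟨ cong (λ s → y 0 (suc n) m + (s + F′)) (p 0 n m) ⟩
  y 0 (suc n) m + ((x 0 (suc n) m + y 1 n m) + F′)
    ≡⟨ rearrange (y 0 (suc n) m) (x 0 (suc n) m) (y 1 n m) F′ ⟩
  (x 0 (suc n) m + y 0 (suc n) m) + (y 1 n m + F′)
    ≡⟨ +-congˡ (x 0 (suc n) m + y 0 (suc n) m) (anti-merge n _ (λ k l → x (suc k) l) (λ k l → y (suc k) l) (λ k → p (suc k)) (λ k → r (suc k)) m) ⟩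
  (x 0 (suc n) m + y 0 (suc n) m) + (anti n (λ k l → x (suc k) l) m + anti n (λ k l → y (suc k) l) m)
    ≡⟨ interchange (x 0 (suc n) m) _ _ _ ⟩
  (x 0 (suc n) m + anti n (λ k l → x (suc k) l) m) + (y 0 (suc n) m + anti n (λ k l → y (suc k) l) m) ∎
  where
  open ≡-Reasoning
  F′ = anti n (λ k l → f (suc k) l) m
  rearrange : ∀ a b c d → a + ((b + c) + d) ≡ (b + a) + (c + d)
  rearrange = solve-∀

module Gaussian (c : ℕ) where

  -- Gaussian binomial coefficient [k + l choose k] in the base q^c.
  gauss : ℕ → ℕ → Series
  gauss zero    l       = one
  gauss (suc k) zero    = one
  gauss (suc k) (suc l) = gauss k (suc l) ⊕ X (+ (c ℕ.* k ℕ.+ c)) ⊛ gauss (suc k) l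

  poch : ℕ → Series
  poch = Π c -1ℤ c

  private
    u : ℕ → Series
    u n = factor -1ℤ (c ℕ.* n ℕ.+ c)

    u-+ : ∀ k l → u k ⊕ X (+ (c ℕ.* k ℕ.+ c)) ⊛ u l ≗ u (suc (k ℕ.+ l))
    u-+ k l m = begin
      (one m + -1ℤ * x m) + (x ⊛ (one ⊕ -1ℤ · y)) m
        ≡⟨ +-congˡ (one m + -1ℤ * x m) (⊛-distribˡ x one (-1ℤ · y) m) ⟩
      (one m + -1ℤ * x m) + ((x ⊛ one) m + (x ⊛ (-1ℤ · y)) m)
        ≡⟨ cong₂ (λ s t → (one m + -1ℤ * x m) + (s + t)) (⊛-identityʳ x m)
             (trans (⊛-comm x (-1ℤ · y) m) (trans (·-⊛ -1ℤ y x m) (cong (-1ℤ *_) (trans (⊛-comm y x m) (X-+ℕ (c ℕ.* k ℕ.+ c) (c ℕ.* l ℕ.+ c) m))))) ⟩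
      (one m + -1ℤ * x m) + (x m + -1ℤ * X (+ (c ℕ.* k ℕ.+ c ℕ.+ (c ℕ.* l ℕ.+ c))) m)
        ≡⟨ cancel (one m) (x m) _ ⟩
      one m + -1ℤ * X (+ (c ℕ.* k ℕ.+ c ℕ.+ (c ℕ.* l ℕ.+ c))) m
        ≡⟨ cong (λ e → one m + -1ℤ * X (+ e) m) (exponent c k l) ⟩
      u (suc (k ℕ.+ l)) m ∎
      where
      open ≡-Reasoning
      x y : Series
      x = X (+ (c ℕ.* k ℕ.+ c))
      y = X (+ (c ℕ.* l ℕ.+ c))
      cancel : ∀ a b d → (a + -1ℤ * b) + (b + d) ≡ a + d
      cancel = solve-∀
      exponent : ∀ c k l → c ℕ.* k ℕ.+ c ℕ.+ (c ℕ.* l ℕ.+ c) ≡ c ℕ.* (1 ℕ.+ (k ℕ.+ l)) ℕ.+ c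
      exponent = ℕ-Solver.solve-∀

  -- The quotient formula for the Gaussian binomial, cleared of denominators because `gauss` is
  -- defined by Pascal's rule. The two summands of that rule pick up the factors `u k` and
  -- q^(c(k+1)) `u l`, whose sum telescopes to the next factor of `poch`.
  poch-gauss : ∀ k l → (poch k ⊛ poch l) ⊛ gauss k l ≗ poch (k ℕ.+ l)
  poch-gauss zero    l m = trans (⊛-identityʳ (poch 0 ⊛ poch l) m) (⊛-identityˡ (poch l) m)
  poch-gauss (suc k) zero m = trans (⊛-identityʳ (poch (suc k) ⊛ one) m) (trans (⊛-identityʳ (poch (suc k)) m)
    (cong (λ n → poch (suc n) m) (sym (ℕ.+-identityʳ k))))
  poch-gauss (suc k) (suc l) m = begin
    (((poch k ⊛ u k) ⊛ (poch l ⊛ u l)) ⊛ (gauss k (suc l) ⊕ x ⊛ gauss (suc k) l)) m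
      ≡⟨ pascal-step seriesSemiring (poch k) (poch l) (u k) (u l) x (gauss k (suc l)) (gauss (suc k) l) m ⟩
    (u k ⊛ ((poch k ⊛ poch (suc l)) ⊛ gauss k (suc l))) m + ((x ⊛ u l) ⊛ ((poch (suc k) ⊛ poch l) ⊛ gauss (suc k) l)) m
      ≡⟨ cong₂ _+_ (⊛-cong (≗-refl {u k}) (λ i → trans (poch-gauss k (suc l) i) (cong (λ n → poch n i) (ℕ.+-suc k l))) m)
                   (⊛-cong (≗-refl {x ⊛ u l}) (poch-gauss (suc k) l) m) ⟩
    (u k ⊛ P) m + ((x ⊛ u l) ⊛ P) m
      ≡⟨ ⊛-distribʳ P (u k) (x ⊛ u l) m ⟨
    ((u k ⊕ x ⊛ u l) ⊛ P) m
      ≡⟨ ⊛-comm (u k ⊕ x ⊛ u l) P m ⟩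
    (P ⊛ (u k ⊕ x ⊛ u l)) m
      ≡⟨ ⊛-cong (≗-refl {P}) (u-+ k l) m ⟩
    poch (suc (suc (k ℕ.+ l))) m
      ≡⟨ cong (λ n → poch (suc n) m) (ℕ.+-suc k l) ⟨
    poch (suc k ℕ.+ suc l) m ∎
    where
    open ≡-Reasoning
    x P : Series
    x = X (+ (c ℕ.* k ℕ.+ c))
    P = poch (suc (k ℕ.+ l))

∑ℕ-split : ∀ m n f → ∑ℕ (m ℕ.+ n) f ≡ ∑ℕ m f + ∑ℕ n (λ i → f (m ℕ.+ i))
∑ℕ-split zero    n f = sym (ℤ.+-identityˡ _)
∑ℕ-split (suc m) n f = trans (+-congˡ (f 0) (∑ℕ-split m n (f ∘ suc))) (sym (ℤ.+-assoc (f 0) _ _))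

∑ℕ-reverse : ∀ n f → ∑ℕ n f ≡ ∑ℕ n (λ i → f (n ℕ.∸ suc i))
∑ℕ-reverse zero    f = refl
∑ℕ-reverse (suc n) f = trans (∑ℕ-last n f)
  (trans (ℤ.+-comm (∑ℕ n f) (f n)) (+-congˡ (f n) (∑ℕ-reverse n f)))

∑ℕ-centre : ∀ n g → ∑ℕ (suc (n ℕ.+ n)) (λ k → g (+ k - + n)) ≡ ∑ℤ n g + g (+ n)
∑ℕ-centre n g = begin
  ∑ℕ (suc (n ℕ.+ n)) f
    ≡⟨ ∑ℕ-last (n ℕ.+ n) f ⟩
  ∑ℕ (n ℕ.+ n) f + f (n ℕ.+ n)
    ≡⟨ cong₂ _+_ (trans (∑ℕ-split n n f) (ℤ.+-comm (∑ℕ n f) _)) (cong g (above n)) ⟩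
  (∑ℕ n (λ i → f (n ℕ.+ i)) + ∑ℕ n f) + g (+ n)
    ≡⟨ cong (λ s → s + g (+ n)) (cong₂ _+_ (∑ℕ-cong n λ i → cong g (above i))
         (trans (∑ℕ-reverse n f) (∑ℕ-cong< n λ i i<n → cong g (below i i<n)))) ⟩
  ∑ℤ n g + g (+ n) ∎
  where
  open ≡-Reasoning
  f : ℕ → ℤ
  f k = g (+ k - + n)
  lemma : ∀ n i → (n + i) - n ≡ i
  lemma = solve-∀
  above : ∀ i → + (n ℕ.+ i) - + n ≡ + i
  above i = lemma (+ n) (+ i)
  lemma′ : ∀ d i → d - ((1ℤ + i) + d) ≡ - (1ℤ + i)
  lemma′ = solve-∀
  below : ∀ i → i ℕ.< n → + (n ℕ.∸ suc i) - + n ≡ -[1+ i ]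
  below i i<n = trans (cong (λ k → + (n ℕ.∸ suc i) - + k) (sym (ℕ.m+[n∸m]≡n i<n)))
    (lemma′ (+ (n ℕ.∸ suc i)) (+ i))

X-scale : ∀ d e x a → X (+ d) ⊛ (x · (X (+ e) ⊛ a)) ≗ x · (X (+ (d ℕ.+ e)) ⊛ a)
X-scale d e x a m = begin
  (X (+ d) ⊛ (x · (X (+ e) ⊛ a))) m   ≡⟨ ⊛-comm (X (+ d)) (x · (X (+ e) ⊛ a)) m ⟩
  ((x · (X (+ e) ⊛ a)) ⊛ X (+ d)) m   ≡⟨ ·-⊛ x (X (+ e) ⊛ a) (X (+ d)) m ⟩
  x * ((X (+ e) ⊛ a) ⊛ X (+ d)) m     ≡⟨ cong (x *_) (⊛-comm (X (+ e) ⊛ a) (X (+ d)) m) ⟩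
  x * (X (+ d) ⊛ (X (+ e) ⊛ a)) m     ≡⟨ cong (x *_) (⊛-assoc (X (+ d)) (X (+ e)) a m) ⟨
  x * ((X (+ d) ⊛ X (+ e)) ⊛ a) m     ≡⟨ cong (x *_) (⊛-cong (X-+ℕ d e) (≗-refl {a}) m) ⟩
  x * (X (+ (d ℕ.+ e)) ⊛ a) m         ∎
  where open ≡-Reasoning

X-scale′ : ∀ y d e x a → (y · X (+ d)) ⊛ (x · (X (+ e) ⊛ a)) ≗ (y * x) · (X (+ (d ℕ.+ e)) ⊛ a)
X-scale′ y d e x a m = trans (·-⊛ y (X (+ d)) (x · (X (+ e) ⊛ a)) m)
  (trans (cong (y *_) (X-scale d e x a m)) (sym (ℤ.*-assoc y x _)))

module TripleProduct (h : ℕ) (ε : ℤ) where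

  private
    c : ℕ
    c = h ℕ.+ h

  open Gaussian c public

  -- h k (k - 1)
  tri : ℕ → ℕ
  tri zero    = 0
  tri (suc k) = tri k ℕ.+ c ℕ.* k

  term : ℕ → ℕ → ℕ → ℕ → Series
  term a b k l = (ε ℤ.^ k) · (X (+ (tri k ℕ.+ a ℕ.* k ℕ.+ b ℕ.* l)) ⊛ gauss k l)

  -- A homogenised q-binomial product with factors q^b + ε q^(a + c i). The usual finite triple
  -- product has negative powers of q in one half; the second variable q^b, later with b = c M,
  -- keeps every exponent natural.
  lin : ℕ → ℕ → ℕ → Series
  lin a b zero    = one
  lin a b (suc n) = (X (+ b) ⊕ ε · X (+ a)) ⊛ lin (c ℕ.+ a) b n

  gauss-zeroʳ : ∀ k → gauss k 0 ≗ one
  gauss-zeroʳ zero    m = refl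
  gauss-zeroʳ (suc k) m = refl

  -- Taking off the first factor replaces a by c + a in the rest. Multiplying the rest by ε q^a or
  -- by q^b advances k or l, and `anti-merge` recombines the two by Pascal's rule.
  q-binomial : ∀ a b n → lin a b n ≗ anti n (term a b)
  q-binomial a b zero    m = sym (begin
    1ℤ * (X (+ (a ℕ.* 0 ℕ.+ b ℕ.* 0)) ⊛ one) m  ≡⟨ ℤ.*-identityˡ _ ⟩
    (X (+ (a ℕ.* 0 ℕ.+ b ℕ.* 0)) ⊛ one) m       ≡⟨ ⊛-identityʳ (X (+ (a ℕ.* 0 ℕ.+ b ℕ.* 0))) m ⟩
    X (+ (a ℕ.* 0 ℕ.+ b ℕ.* 0)) m               ≡⟨ cong (λ e → X (+ e) m) (cong₂ ℕ._+_ (ℕ.*-zeroʳ a) (ℕ.*-zeroʳ b)) ⟩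
    X 0ℤ m                                      ≡⟨ X-zero m ⟩
    one m                                       ∎)
    where open ≡-Reasoning
  q-binomial a b (suc n) m = begin
    ((X (+ b) ⊕ ε · X (+ a)) ⊛ lin (c ℕ.+ a) b n) m
      ≡⟨ ⊛-cong (≗-refl {X (+ b) ⊕ ε · X (+ a)}) (q-binomial (c ℕ.+ a) b n) m ⟩
    ((X (+ b) ⊕ ε · X (+ a)) ⊛ anti n T) m
      ≡⟨ ⊛-distribʳ (anti n T) (X (+ b)) (ε · X (+ a)) m ⟩
    (X (+ b) ⊛ anti n T) m + ((ε · X (+ a)) ⊛ anti n T) m
      ≡⟨ cong₂ _+_ (anti-⊛ n (X (+ b)) T m) (anti-⊛ n (ε · X (+ a)) T m) ⟩
    anti n y m + anti n x m
      ≡⟨ ℤ.+-comm (anti n y m) _ ⟩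
    anti n x m + anti n y m
      ≡⟨ anti-merge n (λ k l → term a b (suc k) l) x y split last m ⟨
    y 0 n m + anti n (λ k l → term a b (suc k) l) m
      ≡⟨ cong (λ s → s + anti n (λ k l → term a b (suc k) l) m) first ⟩
    anti (suc n) (term a b) m ∎
    where
    open ≡-Reasoning
    T x y : ℕ → ℕ → Series
    T = term (c ℕ.+ a) b
    x k l = (ε · X (+ a)) ⊛ T k l
    y k l = X (+ b) ⊛ T k l
    first : y 0 n m ≡ term a b 0 (suc n) m
    first = trans (X-scale b (0 ℕ.+ (c ℕ.+ a) ℕ.* 0 ℕ.+ b ℕ.* n) 1ℤ one m) (cong (λ e → 1ℤ * (X (+ e) ⊛ one) m) (exponent (c ℕ.+ a) a b n))
      where
      exponent : ∀ c a b n → b ℕ.+ (0 ℕ.+ c ℕ.* 0 ℕ.+ b ℕ.* n) ≡ 0 ℕ.+ a ℕ.* 0 ℕ.+ b ℕ.* (1 ℕ.+ n)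
      exponent = ℕ-Solver.solve-∀
    xe : ∀ k l → a ℕ.+ (tri k ℕ.+ (c ℕ.+ a) ℕ.* k ℕ.+ b ℕ.* l) ≡ tri (suc k) ℕ.+ a ℕ.* suc k ℕ.+ b ℕ.* l
    xe k l = poly (tri k) c a b k l
      where
      poly : ∀ t c a b k l → a ℕ.+ (t ℕ.+ (c ℕ.+ a) ℕ.* k ℕ.+ b ℕ.* l) ≡ t ℕ.+ c ℕ.* k ℕ.+ a ℕ.* (1 ℕ.+ k) ℕ.+ b ℕ.* l
      poly = ℕ-Solver.solve-∀
    x≡ : ∀ k l → x k l ≗ (ε ℤ.^ suc k) · (X (+ (tri (suc k) ℕ.+ a ℕ.* suc k ℕ.+ b ℕ.* l)) ⊛ gauss k l)
    x≡ k l m = trans (X-scale′ ε a (tri k ℕ.+ (c ℕ.+ a) ℕ.* k ℕ.+ b ℕ.* l) (ε ℤ.^ k) (gauss k l) m) (cong (λ e → ε ℤ.^ suc k * (X (+ e) ⊛ gauss k l) m) (xe k l))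
    last : ∀ k → term a b (suc k) 0 ≗ x k 0
    last k m = trans (cong (ε ℤ.^ suc k *_) (⊛-cong (≗-refl {X (+ (tri (suc k) ℕ.+ a ℕ.* suc k ℕ.+ b ℕ.* 0))}) (λ i → sym (gauss-zeroʳ k i)) m)) (sym (x≡ k 0 m))
    split : ∀ k l → term a b (suc k) (suc l) ≗ x k (suc l) ⊕ y (suc k) l
    split k l m = begin
      s * (X (+ e) ⊛ (gauss k (suc l) ⊕ X (+ d) ⊛ gauss (suc k) l)) m
        ≡⟨ cong (s *_) (⊛-distribˡ (X (+ e)) (gauss k (suc l)) (X (+ d) ⊛ gauss (suc k) l) m) ⟩
      s * ((X (+ e) ⊛ gauss k (suc l)) m + (X (+ e) ⊛ (X (+ d) ⊛ gauss (suc k) l)) m)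
        ≡⟨ ℤ.*-distribˡ-+ s _ _ ⟩
      s * (X (+ e) ⊛ gauss k (suc l)) m + s * (X (+ e) ⊛ (X (+ d) ⊛ gauss (suc k) l)) m
        ≡⟨ cong₂ _+_ (sym (x≡ k (suc l) m)) right ⟩
      x k (suc l) m + y (suc k) l m ∎
      where
      s : ℤ
      s = ε ℤ.^ suc k
      e d : ℕ
      e = tri (suc k) ℕ.+ a ℕ.* suc k ℕ.+ b ℕ.* suc l
      d = c ℕ.* k ℕ.+ c
      poly : ∀ t c a b k l → t ℕ.+ a ℕ.* (1 ℕ.+ k) ℕ.+ b ℕ.* (1 ℕ.+ l) ℕ.+ (c ℕ.* k ℕ.+ c) ≡ b ℕ.+ (t ℕ.+ (c ℕ.+ a) ℕ.* (1 ℕ.+ k) ℕ.+ b ℕ.* l)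
      poly = ℕ-Solver.solve-∀
      right : s * (X (+ e) ⊛ (X (+ d) ⊛ gauss (suc k) l)) m ≡ y (suc k) l m
      right = begin
        s * (X (+ e) ⊛ (X (+ d) ⊛ gauss (suc k) l)) m
          ≡⟨ cong (s *_) (⊛-assoc (X (+ e)) (X (+ d)) (gauss (suc k) l) m) ⟨
        s * ((X (+ e) ⊛ X (+ d)) ⊛ gauss (suc k) l) m
          ≡⟨ cong (s *_) (⊛-cong (X-+ℕ e d) (≗-refl {gauss (suc k) l}) m) ⟩
        s * (X (+ (e ℕ.+ d)) ⊛ gauss (suc k) l) m
          ≡⟨ cong (λ j → s * (X (+ j) ⊛ gauss (suc k) l) m) (poly (tri (suc k)) c a b k l) ⟩
        s * (X (+ (b ℕ.+ (tri (suc k) ℕ.+ (c ℕ.+ a) ℕ.* suc k ℕ.+ b ℕ.* l))) ⊛ gauss (suc k) l) m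
          ≡⟨ X-scale b (tri (suc k) ℕ.+ (c ℕ.+ a) ℕ.* suc k ℕ.+ b ℕ.* l) s (gauss (suc k) l) m ⟨
        y (suc k) l m ∎

  lin-split : ∀ s b m n → lin s b (m ℕ.+ n) ≗ lin s b m ⊛ lin (c ℕ.* m ℕ.+ s) b n
  lin-split s b zero    n i = trans (cong (λ k → lin (k ℕ.+ s) b n i) (sym (ℕ.*-zeroʳ c))) (sym (⊛-identityˡ (lin (c ℕ.* 0 ℕ.+ s) b n) i))
  lin-split s b (suc m) n i = begin
    (u ⊛ lin (c ℕ.+ s) b (m ℕ.+ n)) i
      ≡⟨ ⊛-cong (≗-refl {u}) (lin-split (c ℕ.+ s) b m n) i ⟩
    (u ⊛ (lin (c ℕ.+ s) b m ⊛ lin (c ℕ.* m ℕ.+ (c ℕ.+ s)) b n)) i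
      ≡⟨ ⊛-assoc u (lin (c ℕ.+ s) b m) (lin (c ℕ.* m ℕ.+ (c ℕ.+ s)) b n) i ⟨
    ((u ⊛ lin (c ℕ.+ s) b m) ⊛ lin (c ℕ.* m ℕ.+ (c ℕ.+ s)) b n) i
      ≡⟨ ⊛-cong (≗-refl {u ⊛ lin (c ℕ.+ s) b m}) (λ j → cong (λ k → lin k b n j) (poly c m s)) i ⟩
    (lin s b (suc m) ⊛ lin (c ℕ.* suc m ℕ.+ s) b n) i ∎
    where
    open ≡-Reasoning
    u : Series
    u = X (+ b) ⊕ ε · X (+ s)
    poly : ∀ c m s → c ℕ.* m ℕ.+ (c ℕ.+ s) ≡ c ℕ.* (1 ℕ.+ m) ℕ.+ s
    poly = ℕ-Solver.solve-∀

  lin-right : ∀ b n r → lin (b ℕ.+ r) b n ≗ X (+ (b ℕ.* n)) ⊛ Π c ε r n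
  lin-right b zero    r i = sym (trans (⊛-identityʳ (X (+ (b ℕ.* 0))) i) (trans (cong (λ k → X (+ k) i) (ℕ.*-zeroʳ b)) (X-zero i)))
  lin-right b (suc n) r i = begin
    ((X (+ b) ⊕ ε · X (+ (b ℕ.+ r))) ⊛ lin (c ℕ.+ (b ℕ.+ r)) b n) i
      ≡⟨ ⊛-cong first (λ j → trans (cong (λ k → lin k b n j) (poly c b r)) (lin-right b n (c ℕ.+ r) j)) i ⟩
    ((X (+ b) ⊛ factor ε r) ⊛ (X (+ (b ℕ.* n)) ⊛ Π c ε (c ℕ.+ r) n)) i
      ≡⟨ factor-step seriesSemiring (X (+ b)) (factor ε r) (X (+ (b ℕ.* n))) (Π c ε (c ℕ.+ r) n) i ⟩
    ((X (+ b) ⊛ X (+ (b ℕ.* n))) ⊛ (Π c ε (c ℕ.+ r) n ⊛ factor ε r)) i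
      ≡⟨ ⊛-cong (λ j → trans (X-+ℕ b (b ℕ.* n) j) (cong (λ k → X (+ k) j) (sym (ℕ.*-suc b n))))
           (λ j → trans (⊛-comm (Π c ε (c ℕ.+ r) n) (factor ε r) j) (sym (Π-first c ε r n j))) i ⟩
    (X (+ (b ℕ.* suc n)) ⊛ Π c ε r (suc n)) i ∎
    where
    open ≡-Reasoning
    poly : ∀ c b r → c ℕ.+ (b ℕ.+ r) ≡ b ℕ.+ (c ℕ.+ r)
    poly = ℕ-Solver.solve-∀
    first : X (+ b) ⊕ ε · X (+ (b ℕ.+ r)) ≗ X (+ b) ⊛ factor ε r
    first j = sym (trans (⊛-distribˡ (X (+ b)) one (ε · X (+ r)) j)
      (cong₂ _+_ (⊛-identityʳ (X (+ b)) j)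
        (trans (⊛-comm (X (+ b)) (ε · X (+ r)) j) (trans (·-⊛ ε (X (+ r)) (X (+ b)) j)
          (cong (ε *_) (trans (X-+ℕ r b j) (cong (λ k → X (+ k) j) (ℕ.+-comm r b))))))))

  module _ (ε²≡1 : ε * ε ≡ 1ℤ) {a a′ : ℕ} (a+a′≡c : a ℕ.+ a′ ≡ c) where

    -- Pulling ε q^(s + c i) out of each factor leaves 1 + ε q^(b - s - c i), because ε² = 1. The
    -- hypothesis makes these exponents c (n - 1 - i) + a′, so the factors of `Π c ε a′ n` appear in
    -- reversed order.
    lin-left : ∀ b n s → s ℕ.+ c ℕ.* n ≡ b ℕ.+ a →
      lin s b n ≗ (ε ℤ.^ n) · (X (+ (s ℕ.* n ℕ.+ tri n)) ⊛ Π c ε a′ n)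
    lin-left b zero    s p i = sym (trans (ℤ.*-identityˡ _) (trans (⊛-identityʳ (X (+ (s ℕ.* 0 ℕ.+ 0))) i)
      (trans (cong (λ k → X (+ k) i) (trans (ℕ.+-identityʳ (s ℕ.* 0)) (ℕ.*-zeroʳ s))) (X-zero i))))
    lin-left b (suc n) s p i = begin
      ((X (+ b) ⊕ ε · X (+ s)) ⊛ lin (c ℕ.+ s) b n) i
        ≡⟨ ⊛-cong first (lin-left b n (c ℕ.+ s) (trans (poly₁ c s n) p)) i ⟩
      ((ε · (X (+ s) ⊛ f)) ⊛ (εⁿ · (X (+ d) ⊛ P))) i
        ≡⟨ ·-⊛ ε (X (+ s) ⊛ f) (εⁿ · (X (+ d) ⊛ P)) i ⟩
      ε * ((X (+ s) ⊛ f) ⊛ (εⁿ · (X (+ d) ⊛ P))) i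
        ≡⟨ cong (ε *_) (trans (⊛-comm (X (+ s) ⊛ f) (εⁿ · (X (+ d) ⊛ P)) i) (trans (·-⊛ εⁿ (X (+ d) ⊛ P) (X (+ s) ⊛ f) i)
             (cong (εⁿ *_) (factor-step seriesSemiring (X (+ d)) P (X (+ s)) f i)))) ⟩
      ε * (εⁿ * ((X (+ d) ⊛ X (+ s)) ⊛ (f ⊛ P)) i)
        ≡⟨ ℤ.*-assoc ε εⁿ _ ⟨
      ε * εⁿ * ((X (+ d) ⊛ X (+ s)) ⊛ (f ⊛ P)) i
        ≡⟨ cong (ε * εⁿ *_) (⊛-cong (λ j → trans (X-+ℕ d s j) (cong (λ k → X (+ k) j) (poly₂ c s n (tri n)))) (⊛-comm f P) i) ⟩
      ε * εⁿ * (X (+ (s ℕ.* suc n ℕ.+ tri (suc n))) ⊛ Π c ε a′ (suc n)) i ∎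
      where
      open ≡-Reasoning
      εⁿ : ℤ
      εⁿ = ε ℤ.^ n
      d : ℕ
      d = (c ℕ.+ s) ℕ.* n ℕ.+ tri n
      f P : Series
      f = factor ε (c ℕ.* n ℕ.+ a′)
      P = Π c ε a′ n
      poly₁ : ∀ c s n → (c ℕ.+ s) ℕ.+ c ℕ.* n ≡ s ℕ.+ c ℕ.* (1 ℕ.+ n)
      poly₁ = ℕ-Solver.solve-∀
      poly₂ : ∀ c s n t → (c ℕ.+ s) ℕ.* n ℕ.+ t ℕ.+ s ≡ s ℕ.* (1 ℕ.+ n) ℕ.+ (t ℕ.+ c ℕ.* n)
      poly₂ = ℕ-Solver.solve-∀
      poly₃ : ∀ s c n a a′ → (s ℕ.+ (c ℕ.* n ℕ.+ a′)) ℕ.+ a ≡ s ℕ.+ (c ℕ.* n ℕ.+ (a ℕ.+ a′))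
      poly₃ = ℕ-Solver.solve-∀
      b≡ : s ℕ.+ (c ℕ.* n ℕ.+ a′) ≡ b
      b≡ = ℕ.+-cancelʳ-≡ a _ _ (trans (poly₃ s c n a a′)
        (trans (cong (λ k → s ℕ.+ (c ℕ.* n ℕ.+ k)) a+a′≡c)
          (trans (cong (s ℕ.+_) (trans (ℕ.+-comm (c ℕ.* n) c) (sym (ℕ.*-suc c n)))) p)))
      first : X (+ b) ⊕ ε · X (+ s) ≗ ε · (X (+ s) ⊛ f)
      first j = sym (begin
        ε * (X (+ s) ⊛ (one ⊕ ε · X (+ (c ℕ.* n ℕ.+ a′)))) j
          ≡⟨ cong (ε *_) (⊛-distribˡ (X (+ s)) one (ε · X (+ (c ℕ.* n ℕ.+ a′))) j) ⟩
        ε * ((X (+ s) ⊛ one) j + (X (+ s) ⊛ (ε · X (+ (c ℕ.* n ℕ.+ a′)))) j)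
          ≡⟨ cong₂ (λ x y → ε * (x + y)) (⊛-identityʳ (X (+ s)) j)
               (trans (⊛-comm (X (+ s)) (ε · X (+ (c ℕ.* n ℕ.+ a′))) j) (trans (·-⊛ ε (X (+ (c ℕ.* n ℕ.+ a′))) (X (+ s)) j)
                 (cong (ε *_) (trans (X-+ℕ (c ℕ.* n ℕ.+ a′) s j) (cong (λ k → X (+ k) j) (trans (ℕ.+-comm (c ℕ.* n ℕ.+ a′) s) b≡)))))) ⟩
        ε * (X (+ s) j + ε * X (+ b) j)
          ≡⟨ rearrange ε (X (+ s) j) (X (+ b) j) ⟩
        ε * ε * X (+ b) j + ε * X (+ s) j
          ≡⟨ cong (λ e → e * X (+ b) j + ε * X (+ s) j) ε²≡1 ⟩
        1ℤ * X (+ b) j + ε * X (+ s) j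
          ≡⟨ cong (λ x → x + ε * X (+ s) j) (ℤ.*-identityˡ (X (+ b) j)) ⟩
        X (+ b) j + ε * X (+ s) j ∎)
        where
        rearrange : ∀ e x y → e * (x + e * y) ≡ e * e * y + e * x
        rearrange = solve-∀

module _ {c ℓ} (R : CommutativeSemiring c ℓ) where
  private module R = CommutativeSemiring R
  open R using (_≈_)
  open NaturalCoefficients R

  left-commute : ∀ a b d → a R.* (b R.* d) ≈ b R.* (a R.* d)
  left-commute = solve 3 (λ a b d → a :* (b :* d) := b :* (a :* d)) R.refl

module _ (h : ℕ) (ε : ℤ) (ε²≡1 : ε * ε ≡ 1ℤ) {a a′ : ℕ}
         (1≤h : 1 ℕ.≤ h) (1≤a : 1 ℕ.≤ a) (1≤a′ : 1 ℕ.≤ a′) (a+a′≡2h : a ℕ.+ a′ ≡ h ℕ.+ h) where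

  private
    open TripleProduct h ε

    c : ℕ
    c = h ℕ.+ h

    bound : Bound₁ (θ-exp h a)
    bound = θ-bound 1≤h 1≤a (subst (a ℕ.≤_) a+a′≡2h (ℕ.m≤m+n a a′))

    tri-pos : ∀ n → + tri n ≡ + h * (+ n * (+ n - 1ℤ))
    tri-pos zero    = sym (ℤ.*-zeroʳ (+ h))
    tri-pos (suc n) = trans (cong₂ _+_ (tri-pos n) (ℤ.pos-* c n)) (lemma (+ h) (+ n))
      where
      lemma : ∀ h n → h * (n * (n - 1ℤ)) + (h + h) * n ≡ h * ((1ℤ + n) * ((1ℤ + n) - 1ℤ))
      lemma = solve-∀

    poch≈ : ∀ {m n} → m ℕ.≤ n → poch n ≈[ m ] poch m
    poch≈ {m} {n} m≤n = subst (λ k → poch k ≈[ m ] poch m) (ℕ.m∸n+n≡m m≤n)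
      (Π-stable c -1ℤ c m (n ℕ.∸ m) λ i m≤i → ℕ.≤-trans (s≤s m≤i) (ℕ.≤-trans
        (ℕ.≤-trans (ℕ.≤-reflexive (ℕ.+-comm 1 i)) (ℕ.+-mono-≤ (ℕ.m≤n*m i c {{ℕ.>-nonZero 1≤c}}) 1≤c)) ℕ.≤-refl))
      where
      1≤c : 1 ℕ.≤ c
      1≤c = ℕ.≤-trans 1≤h (ℕ.m≤m+n h h)

    poch-0 : ∀ n → poch n 0 ≡ 1ℤ
    poch-0 = Π-head {c} { -1ℤ} {c} (ℕ.≤-trans 1≤h (ℕ.m≤m+n h h))

    -- Below order m+1 all the Pochhammer products equal P = `poch m`, so `poch-gauss` reads P · P ·
    -- g = P there, and one P cancels.
    gauss≈ : ∀ {m M k l} → m ℕ.≤ M → m ℕ.≤ k → m ℕ.≤ l → poch M ⊛ gauss k l ≈[ m ] one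
    gauss≈ {m} {M} {k} {l} m≤M m≤k m≤l = ≈-trans {b = P ⊛ g}
      (⊛-cong≈ {a = poch M} {a′ = P} {b = g} {b′ = g} (poch≈ m≤M) ≈-refl)
      (⊛-cancelˡ≈ P (poch-0 m) λ i i≤m → begin
        (P ⊛ (P ⊛ g)) i              ≡⟨ ⊛-assoc P P g i ⟨
        ((P ⊛ P) ⊛ g) i              ≡⟨ ⊛-cong≈ {a = poch k ⊛ poch l} {a′ = P ⊛ P} {b = g} {b′ = g}
                                          (⊛-cong≈ {a = poch k} {a′ = P} {b = poch l} {b′ = P} (poch≈ m≤k) (poch≈ m≤l)) ≈-refl i i≤m ⟨
        ((poch k ⊛ poch l) ⊛ g) i    ≡⟨ poch-gauss k l i ⟩
        poch (k ℕ.+ l) i             ≡⟨ poch≈ (ℕ.≤-trans m≤k (ℕ.m≤m+n k l)) i i≤m ⟩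
        P i                          ≡⟨ ⊛-identityʳ P i ⟨
        (P ⊛ one) i                  ∎)
      where
      open ≡-Reasoning
      P g : Series
      P = poch m
      g = gauss k l

  module _ (m M : ℕ) (M-large : 2 ℕ.+ (m ℕ.+ m) ℕ.≤ M) where
    private
      open ≡-Reasoning

      Q : Series
      Q = Π c ε a M ⊛ Π c ε a′ M

      -- C is the exponent of the central term k = l = M of the expansion. Relative to it the other
      -- exponents are those of the theta series at n = k - M, so coefficients are compared at q^(C
      -- + m).
      C b : ℕ
      C = (a ℕ.* M ℕ.+ tri M) ℕ.+ c ℕ.* M ℕ.* M
      b = c ℕ.* M

      εᴹ : ℤ
      εᴹ = ε ℤ.^ M

      m≤M : m ℕ.≤ M
      m≤M = ℕ.≤-trans (ℕ.≤-trans (ℕ.m≤m+n m m) (ℕ.m≤n+m _ 2)) M-large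

      product : anti (M ℕ.+ M) (term a b) ≗ εᴹ · (X (+ C) ⊛ Q)
      product i = begin
        anti (M ℕ.+ M) (term a b) i
          ≡⟨ q-binomial a b (M ℕ.+ M) i ⟨
        lin a b (M ℕ.+ M) i
          ≡⟨ lin-split a b M M i ⟩
        (lin a b M ⊛ lin (c ℕ.* M ℕ.+ a) b M) i
          ≡⟨ ⊛-cong (lin-left ε²≡1 a+a′≡2h b M a (ℕ.+-comm a b)) (lin-right b M a) i ⟩
        ((εᴹ · (X (+ d) ⊛ Π c ε a′ M)) ⊛ (X (+ (b ℕ.* M)) ⊛ Π c ε a M)) i
          ≡⟨ ·-⊛ εᴹ (X (+ d) ⊛ Π c ε a′ M) (X (+ (b ℕ.* M)) ⊛ Π c ε a M) i ⟩
        εᴹ * ((X (+ d) ⊛ Π c ε a′ M) ⊛ (X (+ (b ℕ.* M)) ⊛ Π c ε a M)) i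
          ≡⟨ cong (εᴹ *_) (factor-step seriesSemiring (X (+ d)) (Π c ε a′ M) (X (+ (b ℕ.* M))) (Π c ε a M) i) ⟩
        εᴹ * ((X (+ d) ⊛ X (+ (b ℕ.* M))) ⊛ Q) i
          ≡⟨ cong (εᴹ *_) (⊛-cong (X-+ℕ d (b ℕ.* M)) (≗-refl {Q}) i) ⟩
        εᴹ * (X (+ C) ⊛ Q) i ∎
        where
        d : ℕ
        d = a ℕ.* M ℕ.+ tri M

      exponent : ∀ k l κ → k ℕ.+ l ≡ M ℕ.+ M → θ-exp h a (+ k - + M) ≡ + κ →
        tri k ℕ.+ a ℕ.* k ℕ.+ b ℕ.* l ≡ C ℕ.+ κ
      exponent k l κ p q = ℤ.+-injective $ begin
        + tri k + + (a ℕ.* k) + + (b ℕ.* l)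
          ≡⟨ cong₂ _+_ (cong₂ _+_ (tri-pos k) (ℤ.pos-* a k)) (trans (ℤ.pos-* b l) (cong (_* + l) (ℤ.pos-* c M))) ⟩
        + h * (+ k * (+ k - 1ℤ)) + + a * + k + (+ h + + h) * + M * + l
          ≡⟨ lemma (+ h) (+ a) (+ k) (+ M) (+ l) ⟩
        R + (+ h + + h) * + M * ((+ k + + l) - (+ M + + M))
          ≡⟨ cong (λ s → R + (+ h + + h) * + M * (+ s - (+ M + + M))) p ⟩
        R + (+ h + + h) * + M * ((+ M + + M) - (+ M + + M))
          ≡⟨ lemma′ R ((+ h + + h) * + M) (+ M + + M) ⟩
        R
          ≡⟨ cong₂ _+_ (cong₂ _+_ (cong₂ _+_ (ℤ.pos-* a M) (tri-pos M)) (trans (ℤ.pos-* b M) (cong (_* + M) (ℤ.pos-* c M)))) (sym q) ⟨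
        + C + + κ ∎
        where
        R : ℤ
        R = + a * + M + + h * (+ M * (+ M - 1ℤ)) + (+ h + + h) * + M * + M + θ-exp h a (+ k - + M)
        lemma : ∀ h a k M l → h * (k * (k - 1ℤ)) + a * k + (h + h) * M * l ≡
          (a * M + h * (M * (M - 1ℤ)) + (h + h) * M * M + (h * ((k - M) * ((k - M) - 1ℤ)) + a * (k - M))) +
          (h + h) * M * ((k + l) - (M + M))
        lemma = solve-∀
        lemma′ : ∀ x y z → x + y * (z - z) ≡ x
        lemma′ = solve-∀

      -- The reason for M ≥ 2m + 2: a term with theta exponent κ ≤ m lies within m + 1 of the
      -- centre, so both indices of its Gaussian binomial are at least m and `gauss≈` applies to it.
      near : ∀ k l κ → + M ≡ + k + l → ∣ l ∣ ℕ.≤ suc κ → κ ℕ.≤ m → m ℕ.≤ k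
      near k l κ p q κ≤m = ℕ.+-cancelʳ-≤ (suc m) m k (ℕ.≤-trans
        (ℕ.≤-trans (ℕ.≤-reflexive (ℕ.+-suc m m)) (ℕ.n≤1+n _))
        (ℕ.≤-trans M-large (subst (ℕ._≤ k ℕ.+ suc m) (cong ∣_∣ (sym p))
          (ℕ.≤-trans (ℤ.∣i+j∣≤∣i∣+∣j∣ (+ k) l) (ℕ.+-monoʳ-≤ k (ℕ.≤-trans q (s≤s κ≤m)))))))

      shifted : ∀ k l κ → k ℕ.+ l ≡ M ℕ.+ M → θ-exp h a (+ k - + M) ≡ + κ → ∣ + k - + M ∣ ℕ.≤ suc κ →
        (X (+ κ) ⊛ (poch M ⊛ gauss k l)) m ≡ X (+ κ) m
      shifted k l κ p q r with κ ℕ.≤? m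
      ... | yes κ≤m = trans
        (⊛-cong-at {a = X (+ κ)} {a′ = X (+ κ)} {b = poch M ⊛ gauss k l} {b′ = one} m ≈-refl (gauss≈ m≤M
          (near k (- (+ k - + M)) κ (lemma (+ M) (+ k)) (subst (ℕ._≤ suc κ) (sym (ℤ.∣-i∣≡∣i∣ (+ k - + M))) r) κ≤m)
          (near l (+ k - + M) κ (lemma″ (+ M) (+ k) (+ l) (cong +_ p)) r κ≤m)))
        (⊛-identityʳ (X (+ κ)) m)
        where
        lemma : ∀ M k → M ≡ k + - (k - M)
        lemma = solve-∀
        lemma′ : ∀ M k l → l + (k - M) ≡ (k + l) + (- M)
        lemma′ = solve-∀
        lemma‴ : ∀ M → (M + M) + (- M) ≡ M
        lemma‴ = solve-∀
        lemma″ : ∀ M k l → k + l ≡ M + M → M ≡ l + (k - M)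
        lemma″ M k l p = sym (trans (lemma′ M k l) (trans (cong (_+ - M) p) (lemma‴ M)))
      ... | no κ≰m = trans (X-⊛-low (poch M ⊛ gauss k l) (ℕ.≰⇒> κ≰m))
        (sym (X-off (+ κ) m λ e → κ≰m (ℕ.≤-reflexive (ℤ.+-injective e))))

      coefficient : ∀ k → k ℕ.≤ M ℕ.+ M →
        (poch M ⊛ term a b k (M ℕ.+ M ℕ.∸ k)) (C ℕ.+ m) ≡ εᴹ * (ε ↑ (+ k - + M) * X (θ-exp h a (+ k - + M)) m)
      coefficient k k≤2M with κ , q , r ← bound (+ k - + M) = begin
        (poch M ⊛ (εᵏ · (X (+ e) ⊛ g))) (C ℕ.+ m)
          ≡⟨ trans (⊛-comm (poch M) (εᵏ · (X (+ e) ⊛ g)) (C ℕ.+ m)) (trans (·-⊛ εᵏ (X (+ e) ⊛ g) (poch M) (C ℕ.+ m))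
               (cong (εᵏ *_) (⊛-comm (X (+ e) ⊛ g) (poch M) (C ℕ.+ m)))) ⟩
        εᵏ * (poch M ⊛ (X (+ e) ⊛ g)) (C ℕ.+ m)
          ≡⟨ cong (εᵏ *_) (left-commute seriesSemiring (poch M) (X (+ e)) g (C ℕ.+ m)) ⟩
        εᵏ * (X (+ e) ⊛ (poch M ⊛ g)) (C ℕ.+ m)
          ≡⟨ cong (λ e → εᵏ * (X (+ e) ⊛ (poch M ⊛ g)) (C ℕ.+ m)) (exponent k l κ k+l q) ⟩
        εᵏ * (X (+ (C ℕ.+ κ)) ⊛ (poch M ⊛ g)) (C ℕ.+ m)
          ≡⟨ cong (εᵏ *_) (⊛-cong (λ i → sym (X-+ℕ C κ i)) (≗-refl {poch M ⊛ g}) (C ℕ.+ m)) ⟩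
        εᵏ * ((X (+ C) ⊛ X (+ κ)) ⊛ (poch M ⊛ g)) (C ℕ.+ m)
          ≡⟨ cong (εᵏ *_) (⊛-assoc (X (+ C)) (X (+ κ)) (poch M ⊛ g) (C ℕ.+ m)) ⟩
        εᵏ * (X (+ C) ⊛ (X (+ κ) ⊛ (poch M ⊛ g))) (C ℕ.+ m)
          ≡⟨ cong (εᵏ *_) (X-⊛-shift C (X (+ κ) ⊛ (poch M ⊛ g)) m) ⟩
        εᵏ * (X (+ κ) ⊛ (poch M ⊛ g)) m
          ≡⟨ cong (εᵏ *_) (shifted k l κ k+l q r) ⟩
        εᵏ * X (+ κ) m
          ≡⟨ cong₂ (λ s e → s * X e m) signs (sym q) ⟩
        εᴹ * ε ↑ (+ k - + M) * X (θ-exp h a (+ k - + M)) m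
          ≡⟨ ℤ.*-assoc εᴹ _ _ ⟩
        εᴹ * (ε ↑ (+ k - + M) * X (θ-exp h a (+ k - + M)) m) ∎
        where
        l e : ℕ
        l = M ℕ.+ M ℕ.∸ k
        e = tri k ℕ.+ a ℕ.* k ℕ.+ b ℕ.* l
        g : Series
        g = gauss k l
        εᵏ : ℤ
        εᵏ = ε ℤ.^ k
        k+l : k ℕ.+ l ≡ M ℕ.+ M
        k+l = ℕ.m+[n∸m]≡n k≤2M
        lemma : ∀ k M → k ≡ M + (k - M)
        lemma = solve-∀
        signs : εᵏ ≡ εᴹ * ε ↑ (+ k - + M)
        signs = trans (cong (ε ↑_) (lemma (+ k) (+ M))) (↑-+ ε ε²≡1 (+ M) (+ k - + M))

      v : ℤ → ℤ
      v n = ε ↑ n * X (θ-exp h a n) m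

      2+m≤M : 2 ℕ.+ m ℕ.≤ M
      2+m≤M = ℕ.≤-trans (ℕ.+-monoʳ-≤ 2 (ℕ.m≤m+n m m)) M-large

      scaled : εᴹ * (poch M ⊛ Q) m ≡ εᴹ * Θ ε h a m
      scaled = begin
        εᴹ * (poch M ⊛ Q) m
          ≡⟨ cong (εᴹ *_) (X-⊛-shift C (poch M ⊛ Q) m) ⟨
        εᴹ * (X (+ C) ⊛ (poch M ⊛ Q)) (C ℕ.+ m)
          ≡⟨ cong (εᴹ *_) (trans (left-commute seriesSemiring (X (+ C)) (poch M) Q (C ℕ.+ m)) (⊛-comm (poch M) (X (+ C) ⊛ Q) (C ℕ.+ m))) ⟩
        εᴹ * ((X (+ C) ⊛ Q) ⊛ poch M) (C ℕ.+ m)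
          ≡⟨ ·-⊛ εᴹ (X (+ C) ⊛ Q) (poch M) (C ℕ.+ m) ⟨
        ((εᴹ · (X (+ C) ⊛ Q)) ⊛ poch M) (C ℕ.+ m)
          ≡⟨ ⊛-cong product (≗-refl {poch M}) (C ℕ.+ m) ⟨
        (anti (M ℕ.+ M) (term a b) ⊛ poch M) (C ℕ.+ m)
          ≡⟨ ⊛-comm (anti (M ℕ.+ M) (term a b)) (poch M) (C ℕ.+ m) ⟩
        (poch M ⊛ anti (M ℕ.+ M) (term a b)) (C ℕ.+ m)
          ≡⟨ anti-⊛ (M ℕ.+ M) (poch M) (term a b) (C ℕ.+ m) ⟩
        anti (M ℕ.+ M) (λ k l → poch M ⊛ term a b k l) (C ℕ.+ m)
          ≡⟨ anti-∑ (M ℕ.+ M) (λ k l → poch M ⊛ term a b k l) (C ℕ.+ m) ⟩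
        ∑ℕ (suc (M ℕ.+ M)) (λ k → (poch M ⊛ term a b k (M ℕ.+ M ℕ.∸ k)) (C ℕ.+ m))
          ≡⟨ ∑ℕ-cong< (suc (M ℕ.+ M)) (λ k k<1+2M → coefficient k (ℕ.≤-pred k<1+2M)) ⟩
        ∑ℕ (suc (M ℕ.+ M)) (λ k → εᴹ * v (+ k - + M))
          ≡⟨ ∑ℕ-* (suc (M ℕ.+ M)) εᴹ (λ k → v (+ k - + M)) ⟩
        εᴹ * ∑ℕ (suc (M ℕ.+ M)) (λ k → v (+ k - + M))
          ≡⟨ cong (εᴹ *_) (∑ℕ-centre M v) ⟩
        εᴹ * (∑ℤ M v + v (+ M))
          ≡⟨ cong₂ (λ x y → εᴹ * (x + y)) (sym (⟪⟫₁-extend {λ n → ε ↑ n} bound 2+m≤M)) (Supp₁ {λ n → ε ↑ n} bound ℕ.≤-refl (+ M) 2+m≤M) ⟩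
        εᴹ * (Θ ε h a m + 0ℤ)
          ≡⟨ cong (εᴹ *_) (ℤ.+-identityʳ _) ⟩
        εᴹ * Θ ε h a m ∎

    triple-product-finite : (poch M ⊛ Q) m ≡ Θ ε h a m
    triple-product-finite = begin
      (poch M ⊛ Q) m                  ≡⟨ unit ((poch M ⊛ Q) m) ⟩
      εᴹ * (εᴹ * (poch M ⊛ Q) m)      ≡⟨ cong (εᴹ *_) scaled ⟩
      εᴹ * (εᴹ * Θ ε h a m)           ≡⟨ unit (Θ ε h a m) ⟨
      Θ ε h a m                       ∎
      where
      unit : ∀ x → x ≡ εᴹ * (εᴹ * x)
      unit x = sym (trans (sym (ℤ.*-assoc εᴹ εᴹ x)) (trans (cong (_* x) (↑-square ε ε²≡1 (+ M))) (ℤ.*-identityˡ x)))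

-- The limit read off on the diagonal: for c, r ≥ 1 each factor of index i ≥ m is 1 modulo q^(m+1),
-- so m factors already determine the coefficient of q^m.
Π∞ : ℕ → ℤ → ℕ → Series
Π∞ c ε r m = Π c ε r m m

Π≈Π∞ : ∀ {c r m n} ε → 1 ℕ.≤ c → 1 ℕ.≤ r → m ℕ.≤ n → Π c ε r n ≈[ m ] Π∞ c ε r
Π≈Π∞ {c} {r} {m} {n} ε 1≤c 1≤r m≤n i i≤m = trans
  (cong (λ k → Π c ε r k i) (sym (ℕ.m∸n+n≡m i≤n)))
  (Π-stable c ε r i (n ℕ.∸ i) (λ j i≤j → ℕ.≤-trans (s≤s i≤j) (ℕ.≤-trans (ℕ.≤-reflexive (ℕ.+-comm 1 j))
    (ℕ.+-mono-≤ (ℕ.m≤n*m j c {{ℕ.>-nonZero 1≤c}}) 1≤r))) i ℕ.≤-refl)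
  where
  i≤n : i ℕ.≤ n
  i≤n = ℕ.≤-trans i≤m m≤n

jacobi : ∀ h ε → ε * ε ≡ 1ℤ → ∀ {a a′} → 1 ℕ.≤ h → 1 ℕ.≤ a → 1 ℕ.≤ a′ → a ℕ.+ a′ ≡ h ℕ.+ h →
  Θ ε h a ≗ Π∞ (h ℕ.+ h) -1ℤ (h ℕ.+ h) ⊛ (Π∞ (h ℕ.+ h) ε a ⊛ Π∞ (h ℕ.+ h) ε a′)
jacobi h ε ε²≡1 {a} {a′} 1≤h 1≤a 1≤a′ p m = trans
  (sym (triple-product-finite h ε ε²≡1 1≤h 1≤a 1≤a′ p m M ℕ.≤-refl))
  (⊛-cong-at {a = Π c -1ℤ c M} {a′ = Π∞ c -1ℤ c} {b = Π c ε a M ⊛ Π c ε a′ M} {b′ = Π∞ c ε a ⊛ Π∞ c ε a′} m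
    (Π≈Π∞ -1ℤ 1≤c 1≤c m≤M)
    (⊛-cong≈ {a = Π c ε a M} {a′ = Π∞ c ε a} {b = Π c ε a′ M} {b′ = Π∞ c ε a′}
      (Π≈Π∞ ε 1≤c 1≤a m≤M) (Π≈Π∞ ε 1≤c 1≤a′ m≤M)))
  where
  c M : ℕ
  c = h ℕ.+ h
  M = 2 ℕ.+ (m ℕ.+ m)
  1≤c : 1 ℕ.≤ c
  1≤c = ℕ.≤-trans 1≤h (ℕ.m≤m+n h h)
  m≤M : m ℕ.≤ M
  m≤M = ℕ.≤-trans (ℕ.m≤m+n m m) (ℕ.m≤n+m _ 2)

-- The theta quotient behind ψ⁵(q⁵)/ψ(q)

module MonoidIdentities {c ℓ} (M : CommutativeMonoid c ℓ) where
  open CommutativeMonoid M using (_∙_; _≈_; ∙-cong; ∙-congˡ) renaming (Carrier to A; refl to ≈refl; sym to ≈sym; setoid to ≈-setoid)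
  open CommutativeMonoidSolver M renaming (_⊕_ to _:∙_; var to v)
  open SetoidReasoning ≈-setoid

  merge₂ : ∀ a b f g → ((a ∙ b) ∙ f) ∙ g ≈ (a ∙ f) ∙ (b ∙ g)
  merge₂ a b f g = prove 4 (((v 0F :∙ v 1F) :∙ v 2F) :∙ v 3F) ((v 0F :∙ v 2F) :∙ (v 1F :∙ v 3F))
    (a ∷ b ∷ f ∷ g ∷ [])

  merge₅ : ∀ a b c d e f g h i j →
    (((((a ∙ (b ∙ (c ∙ (d ∙ e)))) ∙ f) ∙ g) ∙ h) ∙ i) ∙ j ≈ (a ∙ f) ∙ ((b ∙ g) ∙ ((c ∙ h) ∙ ((d ∙ i) ∙ (e ∙ j))))
  merge₅ a b c d e f g h i j = prove 10
    ((((((v 0F :∙ (v 1F :∙ (v 2F :∙ (v 3F :∙ v 4F)))) :∙ v 5F) :∙ v 6F) :∙ v 7F) :∙ v 8F) :∙ v 9F)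
    ((v 0F :∙ v 5F) :∙ ((v 1F :∙ v 6F) :∙ ((v 2F :∙ v 7F) :∙ ((v 3F :∙ v 8F) :∙ (v 4F :∙ v 9F)))))
    (a ∷ b ∷ c ∷ d ∷ e ∷ f ∷ g ∷ h ∷ i ∷ j ∷ [])

  pair : ∀ a b f g → (a ∙ b) ∙ (f ∙ g) ≈ (a ∙ f) ∙ (b ∙ g)
  pair a b f g = prove 4 ((v 0F :∙ v 1F) :∙ (v 2F :∙ v 3F)) ((v 0F :∙ v 2F) :∙ (v 1F :∙ v 3F))
    (a ∷ b ∷ f ∷ g ∷ [])

  -- Intended reading: aᵢ and cᵢ are the products of 1 - q^k over k ≡ i modulo 20 and 10, and p₄
  -- that over multiples of 4; bᵢ, oᵢ, eᵢ are the products of 1 + q^k over k ≡ i modulo 10, 4, 20,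
  -- and b that over all odd k. From (1 - q^k)(1 + q^k) = 1 - q^(2k) come the relations cᵢ bᵢ = a₂ᵢ,
  -- the rest regroup residue classes, and both sides expand to one product, so nothing has to be
  -- cancelled.
  product-identity :
    ∀ {a₂ a₄ a₆ a₈ a₁₂ a₁₄ a₁₆ a₁₈ a₂₀ b₁ b₃ b₅ b₇ b₉ c₁ c₂ c₃ c₄ c₆ c₇ c₈ c₉ c₁₀ p₄ o₁ o₃ e₅ e₁₅ θ₁ θ₂ θ₃ θ₄ ψ₁ ψ₅ b : A} →
    θ₁ ≈ c₁₀ ∙ (c₁ ∙ c₉) → θ₂ ≈ c₁₀ ∙ (c₂ ∙ c₈) → θ₃ ≈ c₁₀ ∙ (c₃ ∙ c₇) → θ₄ ≈ c₁₀ ∙ (c₄ ∙ c₆) →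
    ψ₁ ≈ p₄ ∙ (o₁ ∙ o₃) → ψ₅ ≈ a₂₀ ∙ (e₅ ∙ e₁₅) →
    p₄ ≈ a₄ ∙ (a₈ ∙ (a₁₂ ∙ (a₁₆ ∙ a₂₀))) →
    b ≈ o₁ ∙ o₃ → b ≈ b₁ ∙ (b₃ ∙ (b₅ ∙ (b₇ ∙ b₉))) → b₅ ≈ e₅ ∙ e₁₅ →
    c₁ ∙ b₁ ≈ a₂ → c₃ ∙ b₃ ≈ a₆ → c₇ ∙ b₇ ≈ a₁₄ → c₉ ∙ b₉ ≈ a₁₈ →
    c₂ ≈ a₂ ∙ a₁₂ → c₄ ≈ a₄ ∙ a₁₄ → c₆ ≈ a₆ ∙ a₁₆ → c₈ ≈ a₈ ∙ a₁₈ →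
    ψ₁ ∙ (θ₁ ∙ θ₃) ≈ ψ₅ ∙ (θ₂ ∙ θ₄)
  product-identity {a₂} {a₄} {a₆} {a₈} {a₁₂} {a₁₄} {a₁₆} {a₁₈} {a₂₀} {b₁} {b₃} {b₅} {b₇} {b₉} {c₁} {c₂} {c₃} {c₄} {c₆} {c₇} {c₈} {c₉} {c₁₀} {p₄} {o₁} {o₃} {e₅} {e₁₅} {θ₁} {θ₂} {θ₃} {θ₄} {ψ₁} {ψ₅} {b}
    t₁ t₂ t₃ t₄ s₁ s₅ q₄ odd odd₅ r₅ d₁ d₃ d₇ d₉ x₂ x₄ x₆ x₈ = begin
    ψ₁ ∙ (θ₁ ∙ θ₃)
      ≈⟨ ∙-cong s₁ (∙-cong t₁ t₃) ⟩
    (p₄ ∙ (o₁ ∙ o₃)) ∙ ((c₁₀ ∙ (c₁ ∙ c₉)) ∙ (c₁₀ ∙ (c₃ ∙ c₇)))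
      ≈⟨ ∙-cong (∙-congˡ (≈sym odd)) ≈refl ⟩
    (p₄ ∙ b) ∙ ((c₁₀ ∙ (c₁ ∙ c₉)) ∙ (c₁₀ ∙ (c₃ ∙ c₇)))
      ≈⟨ ∙-cong (∙-congˡ odd₅) ≈refl ⟩
    (p₄ ∙ (b₁ ∙ (b₃ ∙ (b₅ ∙ (b₇ ∙ b₉))))) ∙ ((c₁₀ ∙ (c₁ ∙ c₉)) ∙ (c₁₀ ∙ (c₃ ∙ c₇)))
      ≈⟨ prove 11
           ((v 0F :∙ (v 1F :∙ (v 2F :∙ (v 3F :∙ (v 4F :∙ v 5F))))) :∙ ((v 10F :∙ (v 6F :∙ v 9F)) :∙ (v 10F :∙ (v 7F :∙ v 8F))))
           ((v 0F :∙ v 3F) :∙ ((v 10F :∙ v 10F) :∙ (((v 6F :∙ v 1F) :∙ (v 7F :∙ v 2F)) :∙ ((v 8F :∙ v 4F) :∙ (v 9F :∙ v 5F)))))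
           (p₄ ∷ b₁ ∷ b₃ ∷ b₅ ∷ b₇ ∷ b₉ ∷ c₁ ∷ c₃ ∷ c₇ ∷ c₉ ∷ c₁₀ ∷ []) ⟩
    (p₄ ∙ b₅) ∙ ((c₁₀ ∙ c₁₀) ∙ (((c₁ ∙ b₁) ∙ (c₃ ∙ b₃)) ∙ ((c₇ ∙ b₇) ∙ (c₉ ∙ b₉))))
      ≈⟨ ∙-cong (∙-cong q₄ r₅) (∙-congˡ (∙-cong (∙-cong d₁ d₃) (∙-cong d₇ d₉))) ⟩
    ((a₄ ∙ (a₈ ∙ (a₁₂ ∙ (a₁₆ ∙ a₂₀)))) ∙ (e₅ ∙ e₁₅)) ∙ ((c₁₀ ∙ c₁₀) ∙ ((a₂ ∙ a₆) ∙ (a₁₄ ∙ a₁₈)))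
      ≈⟨ prove 12
           (((v 1F :∙ (v 3F :∙ (v 4F :∙ (v 6F :∙ v 8F)))) :∙ (v 9F :∙ v 10F)) :∙ ((v 11F :∙ v 11F) :∙ ((v 0F :∙ v 2F) :∙ (v 5F :∙ v 7F))))
           ((v 8F :∙ (v 9F :∙ v 10F)) :∙ ((v 11F :∙ ((v 0F :∙ v 4F) :∙ (v 3F :∙ v 7F))) :∙ (v 11F :∙ ((v 1F :∙ v 5F) :∙ (v 2F :∙ v 6F)))))
           (a₂ ∷ a₄ ∷ a₆ ∷ a₈ ∷ a₁₂ ∷ a₁₄ ∷ a₁₆ ∷ a₁₈ ∷ a₂₀ ∷ e₅ ∷ e₁₅ ∷ c₁₀ ∷ []) ⟩
    (a₂₀ ∙ (e₅ ∙ e₁₅)) ∙ ((c₁₀ ∙ ((a₂ ∙ a₁₂) ∙ (a₈ ∙ a₁₈))) ∙ (c₁₀ ∙ ((a₄ ∙ a₁₄) ∙ (a₆ ∙ a₁₆))))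
      ≈⟨ ∙-cong s₅ (∙-cong (∙-congˡ (∙-cong x₂ x₈)) (∙-congˡ (∙-cong x₄ x₆))) ⟨
    ψ₅ ∙ ((c₁₀ ∙ (c₂ ∙ c₈)) ∙ (c₁₀ ∙ (c₄ ∙ c₆)))
      ≈⟨ ∙-congˡ (∙-cong t₂ t₄) ⟨
    ψ₅ ∙ (θ₂ ∙ θ₄) ∎
    where
    pattern 10F = Fin.suc 9F
    pattern 11F = Fin.suc 10F

  -- A monoid has no division, and Kronecker's formula determines f and g only up to the factors θ₂
  -- and θ₄. These stay in place on both sides and are cancelled later as a series with constant
  -- term 1.
  eliminate : ∀ {θ₁ θ₂ θ₃ θ₄ f g s ψ₁ ψ₅} →
    θ₂ ∙ f ≈ θ₃ ∙ s → θ₄ ∙ g ≈ θ₁ ∙ s → s ≈ ψ₅ ∙ ψ₅ → ψ₁ ∙ (θ₁ ∙ θ₃) ≈ ψ₅ ∙ (θ₂ ∙ θ₄) →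
    (θ₂ ∙ θ₄) ∙ (ψ₁ ∙ (f ∙ g)) ≈ (θ₂ ∙ θ₄) ∙ (ψ₅ ∙ (ψ₅ ∙ (ψ₅ ∙ (ψ₅ ∙ ψ₅))))
  eliminate {θ₁} {θ₂} {θ₃} {θ₄} {f} {g} {s} {ψ₁} {ψ₅} p q r t = begin
    (θ₂ ∙ θ₄) ∙ (ψ₁ ∙ (f ∙ g))
      ≈⟨ prove 5 ((v 0F :∙ v 1F) :∙ (v 2F :∙ (v 3F :∙ v 4F))) (v 2F :∙ ((v 0F :∙ v 3F) :∙ (v 1F :∙ v 4F))) (θ₂ ∷ θ₄ ∷ ψ₁ ∷ f ∷ g ∷ []) ⟩
    ψ₁ ∙ ((θ₂ ∙ f) ∙ (θ₄ ∙ g))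
      ≈⟨ ∙-congˡ (∙-cong p q) ⟩
    ψ₁ ∙ ((θ₃ ∙ s) ∙ (θ₁ ∙ s))
      ≈⟨ prove 4 (v 0F :∙ ((v 2F :∙ v 3F) :∙ (v 1F :∙ v 3F))) ((v 0F :∙ (v 1F :∙ v 2F)) :∙ (v 3F :∙ v 3F)) (ψ₁ ∷ θ₁ ∷ θ₃ ∷ s ∷ []) ⟩
    (ψ₁ ∙ (θ₁ ∙ θ₃)) ∙ (s ∙ s)
      ≈⟨ ∙-cong t (∙-cong r r) ⟩
    (ψ₅ ∙ (θ₂ ∙ θ₄)) ∙ ((ψ₅ ∙ ψ₅) ∙ (ψ₅ ∙ ψ₅))
      ≈⟨ prove 3 ((v 0F :∙ (v 1F :∙ v 2F)) :∙ ((v 0F :∙ v 0F) :∙ (v 0F :∙ v 0F))) ((v 1F :∙ v 2F) :∙ (v 0F :∙ (v 0F :∙ (v 0F :∙ (v 0F :∙ v 0F))))) (ψ₅ ∷ θ₂ ∷ θ₄ ∷ []) ⟩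
    (θ₂ ∙ θ₄) ∙ (ψ₅ ∙ (ψ₅ ∙ (ψ₅ ∙ (ψ₅ ∙ ψ₅)))) ∎

open MonoidIdentities ⊛-commutativeMonoid

Π-split₂ : ∀ c ε r n → Π c ε r (n ℕ.* 2) ≗ Π (c ℕ.* 2) ε r n ⊛ Π (c ℕ.* 2) ε (c ℕ.+ r) n
Π-split₂ c ε r zero    m = sym (⊛-identityˡ one m)
Π-split₂ c ε r (suc n) m = begin
  ((Π c ε r (n ℕ.* 2) ⊛ factor ε (c ℕ.* (n ℕ.* 2) ℕ.+ r)) ⊛ factor ε (c ℕ.* suc (n ℕ.* 2) ℕ.+ r)) m
    ≡⟨ ⊛-cong (⊛-cong (Π-split₂ c ε r n) (λ i → cong (λ k → factor ε k i) (e₀ c r n))) (λ i → cong (λ k → factor ε k i) (e₁ c r n)) m ⟩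
  (((A ⊛ B) ⊛ f) ⊛ g) m
    ≡⟨ merge₂ A B f g m ⟩
  (Π (c ℕ.* 2) ε r (suc n) ⊛ Π (c ℕ.* 2) ε (c ℕ.+ r) (suc n)) m ∎
  where
  open ≡-Reasoning
  A B f g : Series
  A = Π (c ℕ.* 2) ε r n
  B = Π (c ℕ.* 2) ε (c ℕ.+ r) n
  f = factor ε (c ℕ.* 2 ℕ.* n ℕ.+ r)
  g = factor ε (c ℕ.* 2 ℕ.* n ℕ.+ (c ℕ.+ r))
  e₀ : ∀ c r n → c ℕ.* (n ℕ.* 2) ℕ.+ r ≡ c ℕ.* 2 ℕ.* n ℕ.+ r
  e₀ = ℕ-Solver.solve-∀
  e₁ : ∀ c r n → c ℕ.* (1 ℕ.+ n ℕ.* 2) ℕ.+ r ≡ c ℕ.* 2 ℕ.* n ℕ.+ (c ℕ.+ r)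
  e₁ = ℕ-Solver.solve-∀

Π-split₅ : ∀ c ε r n → let Π′ = λ i → Π (c ℕ.* 5) ε (c ℕ.* i ℕ.+ r) n in
  Π c ε r (n ℕ.* 5) ≗ Π′ 0 ⊛ (Π′ 1 ⊛ (Π′ 2 ⊛ (Π′ 3 ⊛ Π′ 4)))
Π-split₅ c ε r zero    m = sym (trans (⊛-identityˡ (one ⊛ (one ⊛ (one ⊛ one))) m) (trans (⊛-identityˡ (one ⊛ (one ⊛ one)) m)
  (trans (⊛-identityˡ (one ⊛ one) m) (⊛-identityˡ one m))))
Π-split₅ c ε r (suc n) m = begin
  Π c ε r (suc n ℕ.* 5) m
    ≡⟨ ⊛-cong (⊛-cong (⊛-cong (⊛-cong (⊛-cong (Π-split₅ c ε r n) (λ i → cong (λ k → factor ε k i) (e 0 c r n)))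
         (λ i → cong (λ k → factor ε k i) (e 1 c r n))) (λ i → cong (λ k → factor ε k i) (e 2 c r n)))
         (λ i → cong (λ k → factor ε k i) (e 3 c r n))) (λ i → cong (λ k → factor ε k i) (e 4 c r n)) m ⟩
  ((((((P 0 ⊛ (P 1 ⊛ (P 2 ⊛ (P 3 ⊛ P 4)))) ⊛ f 0) ⊛ f 1) ⊛ f 2) ⊛ f 3) ⊛ f 4) m
    ≡⟨ merge₅ (P 0) (P 1) (P 2) (P 3) (P 4) (f 0) (f 1) (f 2) (f 3) (f 4) m ⟩
  ((P 0 ⊛ f 0) ⊛ ((P 1 ⊛ f 1) ⊛ ((P 2 ⊛ f 2) ⊛ ((P 3 ⊛ f 3) ⊛ (P 4 ⊛ f 4))))) m ∎
  where
  open ≡-Reasoning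
  P f : ℕ → Series
  P i = Π (c ℕ.* 5) ε (c ℕ.* i ℕ.+ r) n
  f i = factor ε (c ℕ.* 5 ℕ.* n ℕ.+ (c ℕ.* i ℕ.+ r))
  e : ∀ j c r n → c ℕ.* (j ℕ.+ n ℕ.* 5) ℕ.+ r ≡ c ℕ.* 5 ℕ.* n ℕ.+ (c ℕ.* j ℕ.+ r)
  e = ℕ-Solver.solve-∀

factor-difference : ∀ k → factor -1ℤ k ⊛ factor 1ℤ k ≗ factor -1ℤ (k ℕ.* 2)
factor-difference k m = begin
  ((one ⊕ -1ℤ · x) ⊛ (one ⊕ 1ℤ · x)) m
    ≡⟨ ⊛-distribʳ (one ⊕ 1ℤ · x) one (-1ℤ · x) m ⟩
  (one ⊛ (one ⊕ 1ℤ · x)) m + ((-1ℤ · x) ⊛ (one ⊕ 1ℤ · x)) m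
    ≡⟨ cong₂ _+_ (⊛-identityˡ (one ⊕ 1ℤ · x) m) (trans (·-⊛ -1ℤ x (one ⊕ 1ℤ · x) m) (cong (-1ℤ *_)
         (trans (⊛-distribˡ x one (1ℤ · x) m) (cong₂ _+_ (⊛-identityʳ x m)
           (trans (⊛-comm x (1ℤ · x) m) (trans (·-⊛ 1ℤ x x m) (cong (1ℤ *_) (trans (X-+ℕ k k m) (cong (λ e → X (+ e) m) (double k)))))))))) ⟩
  (one m + 1ℤ * x m) + -1ℤ * (x m + 1ℤ * X (+ (k ℕ.* 2)) m)
    ≡⟨ lemma (one m) (x m) (X (+ (k ℕ.* 2)) m) ⟩
  one m + -1ℤ * X (+ (k ℕ.* 2)) m ∎
  where
  open ≡-Reasoning
  x : Series
  x = X (+ k)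
  double : ∀ k → k ℕ.+ k ≡ k ℕ.* 2
  double = ℕ-Solver.solve-∀
  lemma : ∀ a x y → (a + 1ℤ * x) + -1ℤ * (x + 1ℤ * y) ≡ a + -1ℤ * y
  lemma = solve-∀

Π-difference : ∀ c r n → Π c -1ℤ r n ⊛ Π c 1ℤ r n ≗ Π (c ℕ.* 2) -1ℤ (r ℕ.* 2) n
Π-difference c r zero    m = ⊛-identityˡ one m
Π-difference c r (suc n) m = trans
  (pair (Π c -1ℤ r n) (factor -1ℤ k) (Π c 1ℤ r n) (factor 1ℤ k) m)
  (⊛-cong (Π-difference c r n) (λ i → trans (factor-difference k i) (cong (λ e → factor -1ℤ e i) (exponent c r n))) m)
  where
  k : ℕ
  k = c ℕ.* n ℕ.+ r
  exponent : ∀ c r n → (c ℕ.* n ℕ.+ r) ℕ.* 2 ≡ c ℕ.* 2 ℕ.* n ℕ.+ r ℕ.* 2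
  exponent = ℕ-Solver.solve-∀

module _ (c′ r′ : ℕ) (ε : ℤ) where
  private
    c r : ℕ
    c = suc c′
    r = suc r′

    at : ∀ {m n d s} → m ℕ.≤ n → Π (suc d) ε (suc s) n ≈[ m ] Π∞ (suc d) ε (suc s)
    at m≤n = Π≈Π∞ ε (s≤s z≤n) (s≤s z≤n) m≤n

  Π∞-split₂ : Π∞ c ε r ≗ Π∞ (c ℕ.* 2) ε r ⊛ Π∞ (c ℕ.* 2) ε (c ℕ.+ r)
  Π∞-split₂ m = trans (sym (at (ℕ.m≤m*n m 2) m ℕ.≤-refl)) (trans (Π-split₂ c ε r m m) refl′)
    where
    refl′ : (Π (c ℕ.* 2) ε r m ⊛ Π (c ℕ.* 2) ε (c ℕ.+ r) m) m ≡ (Π∞ (c ℕ.* 2) ε r ⊛ Π∞ (c ℕ.* 2) ε (c ℕ.+ r)) m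
    refl′ = ⊛-cong-at {a = Π (c ℕ.* 2) ε r m} {a′ = Π∞ (c ℕ.* 2) ε r} {b = Π (c ℕ.* 2) ε (c ℕ.+ r) m} {b′ = Π∞ (c ℕ.* 2) ε (c ℕ.+ r)} m
      (at ℕ.≤-refl) (at ℕ.≤-refl)

  Π∞-split₅ : let Π′ = λ i → Π∞ (c ℕ.* 5) ε (c ℕ.* i ℕ.+ r) in
    Π∞ c ε r ≗ Π′ 0 ⊛ (Π′ 1 ⊛ (Π′ 2 ⊛ (Π′ 3 ⊛ Π′ 4)))
  Π∞-split₅ m = trans (sym (at (ℕ.m≤m*n m 5) m ℕ.≤-refl)) (trans (Π-split₅ c ε r m m)
    (⊛-cong-at {a = P 0} {a′ = P∞ 0} {b = P 1 ⊛ (P 2 ⊛ (P 3 ⊛ P 4))} {b′ = P∞ 1 ⊛ (P∞ 2 ⊛ (P∞ 3 ⊛ P∞ 4))} m (limit 0)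
      (⊛-cong≈ {a = P 1} {a′ = P∞ 1} {b = P 2 ⊛ (P 3 ⊛ P 4)} {b′ = P∞ 2 ⊛ (P∞ 3 ⊛ P∞ 4)} (limit 1)
        (⊛-cong≈ {a = P 2} {a′ = P∞ 2} {b = P 3 ⊛ P 4} {b′ = P∞ 3 ⊛ P∞ 4} (limit 2)
          (⊛-cong≈ {a = P 3} {a′ = P∞ 3} {b = P 4} {b′ = P∞ 4} (limit 3) (limit 4))))))
    where
    P P∞ : ℕ → Series
    P i = Π (c ℕ.* 5) ε (c ℕ.* i ℕ.+ r) m
    P∞ i = Π∞ (c ℕ.* 5) ε (c ℕ.* i ℕ.+ r)
    limit : ∀ i → P i ≈[ m ] P∞ i
    limit i = Π≈Π∞ ε (s≤s z≤n) (ℕ.≤-trans (s≤s z≤n) (ℕ.m≤n+m r (c ℕ.* i))) ℕ.≤-refl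

Π∞-difference : ∀ c′ r′ → let c = suc c′ ; r = suc r′ in Π∞ c -1ℤ r ⊛ Π∞ c 1ℤ r ≗ Π∞ (c ℕ.* 2) -1ℤ (r ℕ.* 2)
Π∞-difference c′ r′ m = trans
  (sym (⊛-cong-at {a = Π c -1ℤ r m} {a′ = Π∞ c -1ℤ r} {b = Π c 1ℤ r m} {b′ = Π∞ c 1ℤ r} m (at -1ℤ) (at 1ℤ)))
  (Π-difference c r m m)
  where
  c r : ℕ
  c = suc c′
  r = suc r′
  at : ∀ ε → Π c ε r m ≈[ m ] Π∞ c ε r
  at ε = Π≈Π∞ ε (s≤s z≤n) (s≤s z≤n) ℕ.≤-refl

private
  1≤suc : ∀ {n} → 1 ℕ.≤ suc n
  1≤suc = s≤s z≤n

theta-identity : ψᵗ 1 ⊛ (Θ -1ℤ 5 1 ⊛ Θ -1ℤ 5 3) ≗ ψᵗ 5 ⊛ (Θ -1ℤ 5 2 ⊛ Θ -1ℤ 5 4)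
theta-identity = product-identity
  {a₂ = Π∞ 20 -1ℤ 2} {a₄ = Π∞ 20 -1ℤ 4} {a₆ = Π∞ 20 -1ℤ 6} {a₈ = Π∞ 20 -1ℤ 8} {a₁₂ = Π∞ 20 -1ℤ 12}
  {a₁₄ = Π∞ 20 -1ℤ 14} {a₁₆ = Π∞ 20 -1ℤ 16} {a₁₈ = Π∞ 20 -1ℤ 18} {a₂₀ = Π∞ 20 -1ℤ 20}
  {b₁ = Π∞ 10 1ℤ 1} {b₃ = Π∞ 10 1ℤ 3} {b₅ = Π∞ 10 1ℤ 5} {b₇ = Π∞ 10 1ℤ 7} {b₉ = Π∞ 10 1ℤ 9}
  {c₁ = Π∞ 10 -1ℤ 1} {c₂ = Π∞ 10 -1ℤ 2} {c₃ = Π∞ 10 -1ℤ 3} {c₄ = Π∞ 10 -1ℤ 4} {c₆ = Π∞ 10 -1ℤ 6}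
  {c₇ = Π∞ 10 -1ℤ 7} {c₈ = Π∞ 10 -1ℤ 8} {c₉ = Π∞ 10 -1ℤ 9} {c₁₀ = Π∞ 10 -1ℤ 10}
  {p₄ = Π∞ 4 -1ℤ 4} {o₁ = Π∞ 4 1ℤ 1} {o₃ = Π∞ 4 1ℤ 3} {e₅ = Π∞ 20 1ℤ 5} {e₁₅ = Π∞ 20 1ℤ 15}
  {θ₁ = Θ -1ℤ 5 1} {θ₂ = Θ -1ℤ 5 2} {θ₃ = Θ -1ℤ 5 3} {θ₄ = Θ -1ℤ 5 4} {ψ₁ = ψᵗ 1} {ψ₅ = ψᵗ 5} {b = Π∞ 2 1ℤ 1}
  (jacobi 5 -1ℤ refl {1} {9} 1≤suc 1≤suc 1≤suc refl)
  (jacobi 5 -1ℤ refl {2} {8} 1≤suc 1≤suc 1≤suc refl)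
  (jacobi 5 -1ℤ refl {3} {7} 1≤suc 1≤suc 1≤suc refl)
  (jacobi 5 -1ℤ refl {4} {6} 1≤suc 1≤suc 1≤suc refl)
  (jacobi 2 1ℤ refl {1} {3} 1≤suc 1≤suc 1≤suc refl)
  (jacobi 10 1ℤ refl {5} {15} 1≤suc 1≤suc 1≤suc refl)
  (Π∞-split₅ 3 3 -1ℤ)
  (Π∞-split₂ 1 0 1ℤ)
  (Π∞-split₅ 1 0 1ℤ)
  (Π∞-split₂ 9 4 1ℤ)
  (Π∞-difference 9 0) (Π∞-difference 9 2) (Π∞-difference 9 6) (Π∞-difference 9 8)
  (Π∞-split₂ 9 1 -1ℤ) (Π∞-split₂ 9 3 -1ℤ) (Π∞-split₂ 9 5 -1ℤ) (Π∞-split₂ 9 7 -1ℤ)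

_⁵ : Series → Series
a ⁵ = a ⊛ (a ⊛ (a ⊛ (a ⊛ a)))

-- Kronecker's formula in base q⁵ at z = q² and z = q⁴ produces the parameters 2 + 5 = 7 and 4 + 5 =
-- 9, which reflect to 3 and 1: exactly the pair in `theta-identity`.
ψFF≗ψ⁵ : ψᵗ 1 ⊛ (F 1ℤ 5 2 ⊛ F 1ℤ 5 4) ≗ ψᵗ 5 ⁵
ψFF≗ψ⁵ = ⊛-cancelˡ {a = ψᵗ 1 ⊛ (F 1ℤ 5 2 ⊛ F 1ℤ 5 4)} {b = ψᵗ 5 ⁵} (Θ -1ℤ 5 2 ⊛ Θ -1ℤ 5 4) (⊛-0 (Θ -1ℤ 5 2) (Θ -1ℤ 5 4)) $ eliminate
  {θ₁ = Θ -1ℤ 5 1} {θ₂ = Θ -1ℤ 5 2} {θ₃ = Θ -1ℤ 5 3} {θ₄ = Θ -1ℤ 5 4} {f = F 1ℤ 5 2} {g = F 1ℤ 5 4} {s = S 5} {ψ₁ = ψᵗ 1} {ψ₅ = ψᵗ 5}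
  (λ m → trans (kronecker 1ℤ refl 5 2 1≤suc (s≤s (s≤s z≤n)) m) (⊛-cong (Θ-reflect -1ℤ {h = 5} {a = 7} {a′ = 3} 1≤suc 1≤suc 1≤suc refl) (≗-refl {S 5}) m))
  (λ m → trans (kronecker 1ℤ refl 5 4 1≤suc (s≤s (s≤s (s≤s (s≤s z≤n)))) m) (⊛-cong (Θ-reflect -1ℤ {h = 5} {a = 9} {a′ = 1} 1≤suc 1≤suc 1≤suc refl) (≗-refl {S 5}) m))
  (S≗ψ² {5} 1≤suc)
  theta-identity

-- Liouville's method

-- An indicator used as a weight, so that a triangular sum becomes rectangular and its order of
-- summation can be exchanged.
lt : ℕ → ℕ → ℤ
lt _       zero    = 0ℤ
lt zero    (suc i) = 1ℤ
lt (suc j) (suc i) = lt j i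

lt-< : ∀ {j i} → j ℕ.< i → lt j i ≡ 1ℤ
lt-< {zero}  {suc i} _         = refl
lt-< {suc j} {suc i} (s≤s j<i) = lt-< j<i

lt-≥ : ∀ {j i} → i ℕ.≤ j → lt j i ≡ 0ℤ
lt-≥ {j}     {zero}  _         = refl
lt-≥ {suc j} {suc i} (s≤s i≤j) = lt-≥ i≤j

∑ℕ-lt : ∀ {W i} g → i ℕ.≤ W → ∑ℕ W (λ j → lt j i * g j) ≡ ∑ℕ i g
∑ℕ-lt {W}     {zero}  g _         = ∑ℕ-zero W λ j → ℤ.*-zeroˡ (g j)
∑ℕ-lt {suc W} {suc i} g (s≤s i≤W) = cong₂ _+_ (ℤ.*-identityˡ (g 0)) (∑ℕ-lt (g ∘ suc) i≤W)

∑∑ : ℕ → (ℕ → ℕ → ℤ) → ℤ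
∑∑ W f = ∑ℕ W λ i → ∑ℕ W λ j → f (suc i) (suc j)

module _ (W : ℕ) where

  ∑∑-cong : ∀ {f g} → (∀ i j → f (suc i) (suc j) ≡ g (suc i) (suc j)) → ∑∑ W f ≡ ∑∑ W g
  ∑∑-cong p = ∑ℕ-cong W λ i → ∑ℕ-cong W λ j → p i j

  ∑∑-+ : ∀ f g → ∑∑ W (λ i j → f i j + g i j) ≡ ∑∑ W f + ∑∑ W g
  ∑∑-+ f g = trans (∑ℕ-cong W λ i → ∑ℕ-+ W (λ j → f (suc i) (suc j)) (λ j → g (suc i) (suc j)))
    (∑ℕ-+ W (λ i → ∑ℕ W λ j → f (suc i) (suc j)) (λ i → ∑ℕ W λ j → g (suc i) (suc j)))

  ∑∑-* : ∀ x f → ∑∑ W (λ i j → x * f i j) ≡ x * ∑∑ W f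
  ∑∑-* x f = trans (∑ℕ-cong W λ i → ∑ℕ-* W x (λ j → f (suc i) (suc j)))
    (∑ℕ-* W x (λ i → ∑ℕ W λ j → f (suc i) (suc j)))

  ∑∑-zero : ∀ {f} → (∀ i j → f (suc i) (suc j) ≡ 0ℤ) → ∑∑ W f ≡ 0ℤ
  ∑∑-zero p = ∑ℕ-zero W λ i → ∑ℕ-zero W λ j → p i j

  ∑∑-swap : ∀ f → ∑∑ W f ≡ ∑∑ W (λ i j → f j i)
  ∑∑-swap f = ∑ℕ-swap W W (λ i j → f (suc i) (suc j))

  ∑∑-∑ℕ-swap : ∀ (f : ℕ → ℕ → ℕ → ℤ) → ∑∑ W (λ i j → ∑ℕ W (f i j)) ≡ ∑ℕ W (λ k → ∑∑ W (λ i j → f i j k))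
  ∑∑-∑ℕ-swap f = trans (∑ℕ-cong W λ i → ∑ℕ-swap W W (λ j → f (suc i) (suc j)))
    (∑ℕ-swap W W (λ i k → ∑ℕ W λ j → f (suc i) (suc j) k))

  ∑∑-exchange : ∀ (f : ℕ → ℕ → ℕ → ℕ → ℤ) →
    ∑∑ W (λ a b → ∑∑ W (f a b)) ≡ ∑∑ W (λ x y → ∑∑ W (λ a b → f a b x y))
  ∑∑-exchange f = trans (∑∑-∑ℕ-swap (λ a b k → ∑ℕ W λ l → f a b (suc k) (suc l)))
    (∑ℕ-cong W λ k → ∑∑-∑ℕ-swap (λ a b l → f a b (suc k) (suc l)))

  private
    row : ∀ (g : ℕ → ℤ) → (∀ x → W ℕ.< x → g x ≡ 0ℤ) → ∀ i →
      ∑ℕ W (g ∘ suc) ≡ ∑ℕ i (g ∘ suc) + (g (suc i) + ∑ℕ W (λ j → g (suc i ℕ.+ suc j)))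
    row g p i = begin
      ∑ℕ W (g ∘ suc)
        ≡⟨ ∑ℕ-extend {f = g ∘ suc} (λ x W≤x → p (suc x) (s≤s W≤x)) (ℕ.≤-trans (ℕ.n≤1+n W) (ℕ.m≤n+m (suc W) i)) ⟨
      ∑ℕ (i ℕ.+ suc W) (g ∘ suc)
        ≡⟨ ∑ℕ-split i (suc W) (g ∘ suc) ⟩
      ∑ℕ i (g ∘ suc) + (g (suc (i ℕ.+ 0)) + ∑ℕ W (λ j → g (suc i ℕ.+ suc j)))
        ≡⟨ cong (λ k → ∑ℕ i (g ∘ suc) + (g (suc k) + ∑ℕ W (λ j → g (suc i ℕ.+ suc j)))) (ℕ.+-identityʳ i) ⟩
      ∑ℕ i (g ∘ suc) + (g (suc i) + ∑ℕ W (λ j → g (suc i ℕ.+ suc j))) ∎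
      where open ≡-Reasoning

  -- The regions x > y and x < y are reparametrised by the positive difference. Vanishing beyond W
  -- ensures that both may again be summed over the square of side W.
  ∑∑-trichotomy : ∀ (f : ℕ → ℕ → ℤ) →
    (∀ x y → W ℕ.< x → f x y ≡ 0ℤ) → (∀ x y → W ℕ.< y → f x y ≡ 0ℤ) →
    ∑∑ W f ≡ (∑∑ W (λ x y → f (x ℕ.+ y) y) + ∑∑ W (λ x y → f x (x ℕ.+ y))) + ∑ℕ W (λ i → f (suc i) (suc i))
  ∑∑-trichotomy f p q = begin
    ∑∑ W f
      ≡⟨ ∑ℕ-cong W (λ i → row (f (suc i)) (q (suc i)) i) ⟩
    ∑ℕ W (λ i → below i + (diagonal i + above i))
      ≡⟨ trans (∑ℕ-+ W below (λ i → diagonal i + above i)) (+-congˡ (∑ℕ W below) (∑ℕ-+ W diagonal above)) ⟩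
    ∑ℕ W below + (∑ℕ W diagonal + ∑ℕ W above)
      ≡⟨ cong (λ s → s + (∑ℕ W diagonal + ∑ℕ W above)) below≡ ⟩
    ∑∑ W (λ x y → f (x ℕ.+ y) y) + (∑ℕ W diagonal + ∑ℕ W above)
      ≡⟨ rearrange (∑∑ W (λ x y → f (x ℕ.+ y) y)) (∑ℕ W diagonal) (∑ℕ W above) ⟩
    (∑∑ W (λ x y → f (x ℕ.+ y) y) + ∑ℕ W above) + ∑ℕ W diagonal ∎
    where
    open ≡-Reasoning
    below diagonal above : ℕ → ℤ
    below i = ∑ℕ i (λ j → f (suc i) (suc j))
    diagonal i = f (suc i) (suc i)
    above i = ∑ℕ W (λ j → f (suc i) (suc i ℕ.+ suc j))
    rearrange : ∀ x y z → x + (y + z) ≡ (x + z) + y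
    rearrange = solve-∀
    column : ∀ j → ∑ℕ W (λ i → lt j i * f (suc i) (suc j)) ≡ ∑ℕ W (λ i → f (suc i ℕ.+ suc j) (suc j))
    column j = begin
      ∑ℕ W (λ i → lt j i * f (suc i) (suc j))
        ≡⟨ row (λ x → lt j (ℕ.pred x) * f x (suc j)) (λ x W<x → *-zeroʳ′ {lt j (ℕ.pred x)} (p x (suc j) W<x)) j ⟩
      ∑ℕ j (λ i → lt j i * f (suc i) (suc j)) + (lt j j * f (suc j) (suc j) + ∑ℕ W (λ i → lt j (j ℕ.+ suc i) * f (suc j ℕ.+ suc i) (suc j)))
        ≡⟨ cong₂ _+_ (trans (∑ℕ-cong< j λ i i<j → *-zeroˡ′ {f (suc i) (suc j)} (lt-≥ {j} (ℕ.<⇒≤ i<j))) (∑ℕ-zero j λ _ → refl))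
             (cong₂ _+_ (*-zeroˡ′ {f (suc j) (suc j)} (lt-≥ {j} ℕ.≤-refl))
               (∑ℕ-cong W λ i → cong₂ (λ s k → s * f k (suc j)) (lt-< (ℕ.m<m+n j (s≤s z≤n))) (ℕ.+-comm (suc j) (suc i)))) ⟩
      0ℤ + (0ℤ + ∑ℕ W (λ i → 1ℤ * f (suc i ℕ.+ suc j) (suc j)))
        ≡⟨ trans (ℤ.+-identityˡ _) (ℤ.+-identityˡ _) ⟩
      ∑ℕ W (λ i → 1ℤ * f (suc i ℕ.+ suc j) (suc j))
        ≡⟨ ∑ℕ-cong W (λ i → ℤ.*-identityˡ (f (suc i ℕ.+ suc j) (suc j))) ⟩
      ∑ℕ W (λ i → f (suc i ℕ.+ suc j) (suc j)) ∎
    below≡ : ∑ℕ W below ≡ ∑∑ W (λ x y → f (x ℕ.+ y) y)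
    below≡ = begin
      ∑ℕ W below
        ≡⟨ ∑ℕ-cong< W (λ i i<W → sym (∑ℕ-lt (λ j → f (suc i) (suc j)) (ℕ.<⇒≤ i<W))) ⟩
      ∑ℕ W (λ i → ∑ℕ W λ j → lt j i * f (suc i) (suc j))
        ≡⟨ ∑ℕ-swap W W (λ i j → lt j i * f (suc i) (suc j)) ⟩
      ∑ℕ W (λ j → ∑ℕ W λ i → lt j i * f (suc i) (suc j))
        ≡⟨ ∑ℕ-cong W column ⟩
      ∑ℕ W (λ j → ∑ℕ W λ i → f (suc i ℕ.+ suc j) (suc j))
        ≡⟨ ∑ℕ-swap W W (λ j i → f (suc i ℕ.+ suc j) (suc j)) ⟩
      ∑∑ W (λ x y → f (x ℕ.+ y) y) ∎

antiℤ : ℕ → (ℕ → ℕ → ℤ) → ℤ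
antiℤ zero    f = f 0 0
antiℤ (suc n) f = f 0 (suc n) + antiℤ n (λ i j → f (suc i) j)

∑-antiℤ : ∀ W (f : ℕ → ℕ → ℤ) → (∀ i j → W ℕ.≤ i ℕ.+ j → f i j ≡ 0ℤ) →
  ∑ℕ W (λ i → ∑ℕ W (f i)) ≡ ∑ℕ W (λ n → antiℤ n f)
∑-antiℤ zero    f p = refl
∑-antiℤ (suc W) f p = begin
  (f 0 0 + R) + ∑ℕ W (λ i → ∑ℕ (suc W) (f (suc i)))
    ≡⟨ +-congˡ (f 0 0 + R) (∑ℕ-cong W λ i → ∑ℕ-extend {W} {suc W} {f (suc i)} (λ j W≤j → p (suc i) j (s≤s (ℕ.≤-trans W≤j (ℕ.m≤n+m j i)))) (ℕ.n≤1+n W)) ⟩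
  (f 0 0 + R) + ∑ℕ W (λ i → ∑ℕ W (f (suc i)))
    ≡⟨ +-congˡ (f 0 0 + R) (∑-antiℤ W (f ∘ suc) (λ i j W≤ → p (suc i) j (s≤s W≤))) ⟩
  (f 0 0 + R) + ∑ℕ W (λ n → antiℤ n (f ∘ suc))
    ≡⟨ ℤ.+-assoc (f 0 0) R _ ⟩
  f 0 0 + (R + ∑ℕ W (λ n → antiℤ n (f ∘ suc)))
    ≡⟨ +-congˡ (f 0 0) (sym (∑ℕ-+ W (λ j → f 0 (suc j)) (λ n → antiℤ n (f ∘ suc)))) ⟩
  ∑ℕ (suc W) (λ n → antiℤ n f) ∎
  where
  open ≡-Reasoning
  R : ℤ
  R = ∑ℕ W (λ j → f 0 (suc j))

antiℤ-cong : ∀ n {f g} → (∀ i j → f i j ≡ g i j) → antiℤ n f ≡ antiℤ n g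
antiℤ-cong zero    p = p 0 0
antiℤ-cong (suc n) p = cong₂ _+_ (p 0 (suc n)) (antiℤ-cong n λ i j → p (suc i) j)

antiℤ-factor : ∀ n f (K : ℕ → ℤ) → antiℤ n (λ i j → f i j * K (i ℕ.+ j)) ≡ antiℤ n f * K n
antiℤ-factor zero    f K = refl
antiℤ-factor (suc n) f K = trans (+-congˡ (f 0 (suc n) * K (suc n)) (antiℤ-factor n (f ∘ suc) (K ∘ suc)))
  (sym (ℤ.*-distribʳ-+ (K (suc n)) (f 0 (suc n)) (antiℤ n (f ∘ suc))))

-- Parity weights and functions of residues modulo 5

odd : ℕ → ℤ
odd zero          = 0ℤ
odd (suc zero)    = 1ℤ
odd (suc (suc n)) = odd n

even : ℕ → ℤ
even n = odd (suc n)

odd-+ : ∀ a b → odd (a ℕ.+ b) ≡ odd a * even b + even a * odd b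
odd-+ zero          b             = sym (trans (cong₂ _+_ (ℤ.*-zeroˡ (even b)) (ℤ.*-identityˡ (odd b))) (ℤ.+-identityˡ (odd b)))
odd-+ (suc zero)    b             = sym (trans (cong₂ _+_ (ℤ.*-identityˡ (even b)) (ℤ.*-zeroˡ (odd b))) (ℤ.+-identityʳ (even b)))
odd-+ (suc (suc a)) b             = odd-+ a b

even-+ : ∀ a b → even (a ℕ.+ b) ≡ odd a * odd b + even a * even b
even-+ a b = trans (odd-+ (suc a) b) (ℤ.+-comm (even a * even b) (odd a * odd b))

parity : ∀ n → (odd n ≡ 0ℤ × even n ≡ 1ℤ) ⊎ (odd n ≡ 1ℤ × even n ≡ 0ℤ)
parity zero          = inj₁ (refl , refl)
parity (suc zero)    = inj₂ (refl , refl)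
parity (suc (suc n)) = parity n

suc₅ : Fin 5 → Fin 5
suc₅ 0F = 1F
suc₅ 1F = 2F
suc₅ 2F = 3F
suc₅ 3F = 4F
suc₅ 4F = 0F

-- Structural recursion lets the residue compute on successors, and a target with five constructors
-- lets identities on (ℤ/5)² be decided exhaustively.
mod₅ : ℕ → Fin 5
mod₅ zero    = 0F
mod₅ (suc n) = suc₅ (mod₅ n)

infixl 6 _⊞_
infixl 7 _⊠_

_⊞_ _⊠_ : Fin 5 → Fin 5 → Fin 5
i ⊞ j = mod₅ (Fin.toℕ i ℕ.+ Fin.toℕ j)
i ⊠ j = mod₅ (Fin.toℕ i ℕ.* Fin.toℕ j)

⊟_ : Fin 5 → Fin 5
⊟ i = 4F ⊠ i

suc₅-⊞ : ∀ i j → suc₅ i ⊞ j ≡ suc₅ (i ⊞ j)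
suc₅-⊞ = from-yes (all? λ i → all? λ j → suc₅ i ⊞ j Fin.≟ suc₅ (i ⊞ j))

mod₅-+ : ∀ m n → mod₅ (m ℕ.+ n) ≡ mod₅ m ⊞ mod₅ n
mod₅-+ zero    n = sym (from-yes (all? λ j → 0F ⊞ j Fin.≟ j) (mod₅ n))
mod₅-+ (suc m) n = trans (cong suc₅ (mod₅-+ m n)) (sym (suc₅-⊞ (mod₅ m) (mod₅ n)))

χ₅ : Fin 5 → ℤ
χ₅ 0F = 0ℤ
χ₅ 1F = 1ℤ
χ₅ 2F = -1ℤ
χ₅ 3F = -1ℤ
χ₅ 4F = 1ℤ

ε₁ ε₂ : Fin 5 → ℤ
ε₁ 1F = 1ℤ
ε₁ 4F = -1ℤ
ε₁ _  = 0ℤ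
ε₂ 2F = 1ℤ
ε₂ 3F = -1ℤ
ε₂ _  = 0ℤ

-- u(x, r x) = χ₅(x) ρ(r) for x ≠ 0.  This even function on (ℤ/5)² was found by linear algebra: it
-- makes the identities u-rest and u-main below hold.
ρ : Fin 5 → ℤ
ρ 0F = + 2
ρ 1F = + 2
ρ 2F = 1ℤ
ρ _  = 0ℤ

u u′ u″ g₁ g₂ g₃ : Fin 5 → Fin 5 → ℤ
u 0F y = - χ₅ y
u x  y = χ₅ x * ρ (x ⊠ x ⊠ x ⊠ y)

-- The map (x, y) ↦ (-y, x + y) has order 3 up to sign, and u is even, so u, u′, u″ are the three
-- transforms of u. The g's are forced: under (x + y, y) and (x, x + y), g₁ must yield u and u′, g₂
-- must yield u″ and u, and g₃ must yield u′ and u″. The last of these requirements is consistent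
-- because u is even.
u′ x y = u (⊟ y) (x ⊞ y)
u″ x y = u (x ⊞ y) (⊟ x)
g₁ x y = u (x ⊞ ⊟ y) y
g₂ x y = u x (y ⊞ ⊟ x)
g₃ x y = u (⊟ y) x

-- Exchanging (a, x) with (b, y) turns the weight `w₀₁` into `w₁₀`. After this exchange the identity
-- cancels all full sums of mixed parity.
u-rest : ∀ x y → g₂ x y + g₃ y x ≡ u x y + u′ y x
u-rest = from-yes (all? λ x → all? λ y → g₂ x y + g₃ y x ℤ.≟ u x y + u′ y x)

-- The weight `w₁₁` is symmetric, so only symmetric parts matter. For them, the difference of g₁ and
-- u″ is four times the wanted function ε₁ ⊗ ε₂.
u-main : ∀ x y → g₁ x y + g₁ y x ≡ (u″ x y + u″ y x) + + 4 * (ε₁ x * ε₂ y + ε₁ y * ε₂ x)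
u-main = from-yes (all? λ x → all? λ y → g₁ x y + g₁ y x ℤ.≟ (u″ x y + u″ y x) + + 4 * (ε₁ x * ε₂ y + ε₁ y * ε₂ x))

w₁₁ w₁₀ w₀₁ : ℕ → ℕ → ℤ
w₁₁ a b = odd a * odd b
w₁₀ a b = odd a * even b
w₀₁ a b = even a * odd b

private
  bit-lemma : ∀ {x y} → (x ≡ 0ℤ × y ≡ 1ℤ) ⊎ (x ≡ 1ℤ × y ≡ 0ℤ) → ∀ s t →
    (x * (x * s + y * t) ≡ x * s) × (y * (x * s + y * t) ≡ y * t)
  bit-lemma (inj₁ (refl , refl)) s t = refl , trans (ℤ.*-identityˡ _) (ℤ.+-identityˡ _)
  bit-lemma (inj₂ (refl , refl)) s t = trans (ℤ.*-identityˡ _) (ℤ.+-identityʳ _) , refl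

  odd-absorb : ∀ a s t → odd a * (odd a * s + even a * t) ≡ odd a * s
  odd-absorb a s t = proj₁ (bit-lemma (parity a) s t)

  even-absorb : ∀ a s t → even a * (odd a * s + even a * t) ≡ even a * t
  even-absorb a s t = proj₂ (bit-lemma (parity a) s t)

  odd*even : ∀ a → odd a * even a ≡ 0ℤ
  odd*even a with parity a
  ... | inj₁ (p , _) = *-zeroˡ′ {even a} p
  ... | inj₂ (_ , q) = *-zeroʳ′ {odd a} q

-- The sums below run over a, b, x, y ≥ 1 with a x + b y = N; Lo and Hi denote the parts of such a
-- sum with a < b and a > b (with b - a or a - b renamed), and equally those with x > y and x < y.
module Liouville (N : ℕ) where

  δ : ℕ → ℤ
  δ e = X (+ e) N

  δ-off : ∀ {e} → N ℕ.< e → δ e ≡ 0ℤ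
  δ-off {e} N<e = X-off (+ e) N λ p → ℕ.<-irrefl (sym (ℤ.+-injective p)) N<e

  Full Lo Hi : (ℕ → ℕ → ℤ) → (ℕ → ℕ → ℤ) → ℤ
  Full w g = ∑∑ N λ a b → ∑∑ N λ x y → w a b * (g x y * δ (a ℕ.* x ℕ.+ b ℕ.* y))
  Lo w g = ∑∑ N λ a b → ∑∑ N λ x y → w a b * (g x y * δ (a ℕ.* x ℕ.+ (a ℕ.+ b) ℕ.* y))
  Hi w g = ∑∑ N λ a b → ∑∑ N λ x y → w a b * (g x y * δ ((a ℕ.+ b) ℕ.* x ℕ.+ b ℕ.* y))

  Diagˣ Diagᵃ : (ℕ → ℕ → ℤ) → (ℕ → ℕ → ℤ) → ℤ
  Diagˣ w g = ∑∑ N λ a b → ∑ℕ N λ i → w a b * (g (suc i) (suc i) * δ (a ℕ.* suc i ℕ.+ b ℕ.* suc i))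
  Diagᵃ w g = ∑∑ N λ x y → ∑ℕ N λ i → w (suc i) (suc i) * (g x y * δ (suc i ℕ.* x ℕ.+ suc i ℕ.* y))

  open ≡-Reasoning

  private
    ∑⁴-cong : ∀ (f g : ℕ → ℕ → ℕ → ℕ → ℤ) → (∀ a b x y → f a b x y ≡ g a b x y) →
      ∑∑ N (λ a b → ∑∑ N (f a b)) ≡ ∑∑ N (λ a b → ∑∑ N (g a b))
    ∑⁴-cong f g p = ∑∑-cong N {λ a b → ∑∑ N (f a b)} {λ a b → ∑∑ N (g a b)} λ i j →
      ∑∑-cong N {f (suc i) (suc j)} {g (suc i) (suc j)} λ k l → p (suc i) (suc j) (suc k) (suc l)

  Full-cong : ∀ {w w′ g g′} → (∀ a b → w a b ≡ w′ a b) → (∀ x y → g x y ≡ g′ x y) → Full w g ≡ Full w′ g′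
  Full-cong {w} {w′} {g} {g′} p q = ∑⁴-cong (λ a b x y → w a b * (g x y * δ (a ℕ.* x ℕ.+ b ℕ.* y))) (λ a b x y → w′ a b * (g′ x y * δ (a ℕ.* x ℕ.+ b ℕ.* y)))
    λ a b x y → cong₂ (λ s t → s * (t * δ (a ℕ.* x ℕ.+ b ℕ.* y))) (p a b) (q x y)

  Lo-cong : ∀ {w w′ g g′} → (∀ a b → w a b ≡ w′ a b) → (∀ x y → g x y ≡ g′ x y) → Lo w g ≡ Lo w′ g′
  Lo-cong {w} {w′} {g} {g′} p q = ∑⁴-cong (λ a b x y → w a b * (g x y * δ (a ℕ.* x ℕ.+ (a ℕ.+ b) ℕ.* y))) (λ a b x y → w′ a b * (g′ x y * δ (a ℕ.* x ℕ.+ (a ℕ.+ b) ℕ.* y)))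
    λ a b x y → cong₂ (λ s t → s * (t * δ (a ℕ.* x ℕ.+ (a ℕ.+ b) ℕ.* y))) (p a b) (q x y)

  Hi-cong : ∀ {w w′ g g′} → (∀ a b → w a b ≡ w′ a b) → (∀ x y → g x y ≡ g′ x y) → Hi w g ≡ Hi w′ g′
  Hi-cong {w} {w′} {g} {g′} p q = ∑⁴-cong (λ a b x y → w a b * (g x y * δ ((a ℕ.+ b) ℕ.* x ℕ.+ b ℕ.* y))) (λ a b x y → w′ a b * (g′ x y * δ ((a ℕ.+ b) ℕ.* x ℕ.+ b ℕ.* y)))
    λ a b x y → cong₂ (λ s t → s * (t * δ ((a ℕ.+ b) ℕ.* x ℕ.+ b ℕ.* y))) (p a b) (q x y)

  private
    off : ∀ s t {e} → N ℕ.< e → s * (t * δ e) ≡ 0ℤ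
    off s t N<e = *-zeroʳ′ {s} (*-zeroʳ′ {t} (δ-off N<e))

    big₁ : ∀ i x {k} → N ℕ.< x → N ℕ.< suc i ℕ.* x ℕ.+ k
    big₁ i x N<x = ℕ.≤-trans N<x (ℕ.≤-trans (ℕ.m≤m+n x (i ℕ.* x)) (ℕ.m≤m+n _ _))

    big₂ : ∀ i x {k} → N ℕ.< x → N ℕ.< k ℕ.+ suc i ℕ.* x
    big₂ i x {k} N<x = ℕ.≤-trans N<x (ℕ.≤-trans (ℕ.m≤m+n x (i ℕ.* x)) (ℕ.m≤n+m (x ℕ.+ i ℕ.* x) k))

    big₃ : ∀ i x {k} → N ℕ.< x → N ℕ.< x ℕ.* suc i ℕ.+ k
    big₃ i x {k} N<x = subst (λ e → N ℕ.< e ℕ.+ k) (ℕ.*-comm (suc i) x) (big₁ i x {k} N<x)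

    big₄ : ∀ i x {k} → N ℕ.< x → N ℕ.< k ℕ.+ x ℕ.* suc i
    big₄ i x {k} N<x = subst (λ e → N ℕ.< k ℕ.+ e) (ℕ.*-comm (suc i) x) (big₂ i x {k} N<x)

    ∑∑-+₃ : ∀ f g h → ∑∑ N (λ i j → (f i j + g i j) + h i j) ≡ (∑∑ N f + ∑∑ N g) + ∑∑ N h
    ∑∑-+₃ f g h = trans (∑∑-+ N (λ i j → f i j + g i j) h) (cong (λ s → s + ∑∑ N h) (∑∑-+ N f g))

  split-xy : ∀ w g → Full w g ≡ (Lo w (λ x y → g (x ℕ.+ y) y) + Hi w (λ x y → g x (x ℕ.+ y))) + Diagˣ w g
  split-xy w g = begin
    Full w g
      ≡⟨ ∑∑-cong N {λ a b → ∑∑ N (f a b)} {λ a b → (lo a b + hi a b) + di a b} (λ i j → ∑∑-trichotomy N (f (suc i) (suc j))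
           (λ x y N<x → off (w (suc i) (suc j)) (g x y) (big₁ i x {suc j ℕ.* y} N<x))
           (λ x y N<y → off (w (suc i) (suc j)) (g x y) (big₂ j y {suc i ℕ.* x} N<y))) ⟩
    (∑∑ N λ a b → (lo a b + hi a b) + di a b)
      ≡⟨ ∑∑-+₃ lo hi di ⟩
    (∑∑ N lo + ∑∑ N hi) + Diagˣ w g
      ≡⟨ cong₂ (λ s t → (s + t) + Diagˣ w g)
           (∑⁴-cong (λ a b x y → f a b (x ℕ.+ y) y) (λ a b x y → w a b * (g (x ℕ.+ y) y * δ (a ℕ.* x ℕ.+ (a ℕ.+ b) ℕ.* y)))
             λ a b x y → cong (λ e → w a b * (g (x ℕ.+ y) y * δ e)) (e₁ a b x y))
           (∑⁴-cong (λ a b x y → f a b x (x ℕ.+ y)) (λ a b x y → w a b * (g x (x ℕ.+ y) * δ ((a ℕ.+ b) ℕ.* x ℕ.+ b ℕ.* y)))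
             λ a b x y → cong (λ e → w a b * (g x (x ℕ.+ y) * δ e)) (e₂ a b x y)) ⟩
    (Lo w (λ x y → g (x ℕ.+ y) y) + Hi w (λ x y → g x (x ℕ.+ y))) + Diagˣ w g ∎
    where
    f : ℕ → ℕ → ℕ → ℕ → ℤ
    f a b x y = w a b * (g x y * δ (a ℕ.* x ℕ.+ b ℕ.* y))
    lo hi di : ℕ → ℕ → ℤ
    lo a b = ∑∑ N λ x y → f a b (x ℕ.+ y) y
    hi a b = ∑∑ N λ x y → f a b x (x ℕ.+ y)
    di a b = ∑ℕ N λ i → f a b (suc i) (suc i)
    e₁ : ∀ a b x y → a ℕ.* (x ℕ.+ y) ℕ.+ b ℕ.* y ≡ a ℕ.* x ℕ.+ (a ℕ.+ b) ℕ.* y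
    e₁ = ℕ-Solver.solve-∀
    e₂ : ∀ a b x y → a ℕ.* x ℕ.+ b ℕ.* (x ℕ.+ y) ≡ (a ℕ.+ b) ℕ.* x ℕ.+ b ℕ.* y
    e₂ = ℕ-Solver.solve-∀

  split-ab : ∀ w g → Full w g ≡ (Lo (λ a b → w a (a ℕ.+ b)) g + Hi (λ a b → w (a ℕ.+ b) b) g) + Diagᵃ w g
  split-ab w g = begin
    Full w g
      ≡⟨ ∑∑-exchange N f ⟩
    (∑∑ N λ x y → ∑∑ N λ a b → f a b x y)
      ≡⟨ ∑∑-cong N {λ x y → ∑∑ N λ a b → f a b x y} {λ x y → (hi x y + lo x y) + di x y} (λ k l → ∑∑-trichotomy N (λ a b → f a b (suc k) (suc l))
           (λ a b N<a → off (w a b) (g (suc k) (suc l)) (big₃ k a {b ℕ.* suc l} N<a))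
           (λ a b N<b → off (w a b) (g (suc k) (suc l)) (big₄ l b {a ℕ.* suc k} N<b))) ⟩
    (∑∑ N λ x y → (hi x y + lo x y) + di x y)
      ≡⟨ ∑∑-+₃ hi lo di ⟩
    (∑∑ N hi + ∑∑ N lo) + Diagᵃ w g
      ≡⟨ cong (λ s → s + Diagᵃ w g) (trans (ℤ.+-comm (∑∑ N hi) (∑∑ N lo)) (cong₂ _+_
           (sym (∑∑-exchange N (λ a b x y → f a (a ℕ.+ b) x y)))
           (sym (∑∑-exchange N (λ a b x y → f (a ℕ.+ b) b x y))))) ⟩
    (Lo (λ a b → w a (a ℕ.+ b)) g + Hi (λ a b → w (a ℕ.+ b) b) g) + Diagᵃ w g ∎
    where
    f : ℕ → ℕ → ℕ → ℕ → ℤ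
    f a b x y = w a b * (g x y * δ (a ℕ.* x ℕ.+ b ℕ.* y))
    lo hi di : ℕ → ℕ → ℤ
    hi x y = ∑∑ N λ a b → f (a ℕ.+ b) b x y
    lo x y = ∑∑ N λ a b → f a (a ℕ.+ b) x y
    di x y = ∑ℕ N λ i → f (suc i) (suc i) x y

  Full-+ : ∀ w g g′ → Full w (λ x y → g x y + g′ x y) ≡ Full w g + Full w g′
  Full-+ w g g′ = trans
    (∑∑-cong N {λ a b → ∑∑ N (t (λ x y → g x y + g′ x y) a b)} {λ a b → ∑∑ N (t g a b) + ∑∑ N (t g′ a b)} λ i j → trans
      (∑∑-cong N {t (λ x y → g x y + g′ x y) (suc i) (suc j)} {λ x y → t g (suc i) (suc j) x y + t g′ (suc i) (suc j) x y}
        λ k l → lemma (w (suc i) (suc j)) (g (suc k) (suc l)) (g′ (suc k) (suc l)) (δ (suc i ℕ.* suc k ℕ.+ suc j ℕ.* suc l)))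
      (∑∑-+ N (t g (suc i) (suc j)) (t g′ (suc i) (suc j))))
    (∑∑-+ N (λ a b → ∑∑ N (t g a b)) (λ a b → ∑∑ N (t g′ a b)))
    where
    t : (ℕ → ℕ → ℤ) → ℕ → ℕ → ℕ → ℕ → ℤ
    t g a b x y = w a b * (g x y * δ (a ℕ.* x ℕ.+ b ℕ.* y))
    lemma : ∀ w x y d → w * ((x + y) * d) ≡ w * (x * d) + w * (y * d)
    lemma = solve-∀

  Full-* : ∀ w c g → Full w (λ x y → c * g x y) ≡ c * Full w g
  Full-* w c g = trans
    (∑∑-cong N {λ a b → ∑∑ N (t (λ x y → c * g x y) a b)} {λ a b → c * ∑∑ N (t g a b)} λ i j → trans
      (∑∑-cong N {t (λ x y → c * g x y) (suc i) (suc j)} {λ x y → c * t g (suc i) (suc j) x y}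
        λ k l → lemma (w (suc i) (suc j)) c (g (suc k) (suc l)) (δ (suc i ℕ.* suc k ℕ.+ suc j ℕ.* suc l)))
      (∑∑-* N c (t g (suc i) (suc j))))
    (∑∑-* N c (λ a b → ∑∑ N (t g a b)))
    where
    t : (ℕ → ℕ → ℤ) → ℕ → ℕ → ℕ → ℕ → ℤ
    t g a b x y = w a b * (g x y * δ (a ℕ.* x ℕ.+ b ℕ.* y))
    lemma : ∀ w c x d → w * (c * x * d) ≡ c * (w * (x * d))
    lemma = solve-∀

  Full-swap : ∀ w g → Full w g ≡ Full (λ a b → w b a) (λ x y → g y x)
  Full-swap w g = trans (∑∑-swap N (λ a b → ∑∑ N λ x y → w a b * (g x y * δ (a ℕ.* x ℕ.+ b ℕ.* y))))
    (∑∑-cong N {λ a b → ∑∑ N λ x y → w b a * (g x y * δ (b ℕ.* x ℕ.+ a ℕ.* y))} {λ a b → ∑∑ N λ x y → w b a * (g y x * δ (a ℕ.* x ℕ.+ b ℕ.* y))} λ i j → trans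
      (∑∑-swap N (λ x y → w (suc j) (suc i) * (g x y * δ (suc j ℕ.* x ℕ.+ suc i ℕ.* y))))
      (∑∑-cong N {λ x y → w (suc j) (suc i) * (g y x * δ (suc j ℕ.* y ℕ.+ suc i ℕ.* x))} {λ x y → w (suc j) (suc i) * (g y x * δ (suc i ℕ.* x ℕ.+ suc j ℕ.* y))} λ k l → cong (λ e → w (suc j) (suc i) * (g (suc l) (suc k) * δ e)) (ℕ.+-comm (suc j ℕ.* suc l) (suc i ℕ.* suc k))))

  lift : (Fin 5 → Fin 5 → ℤ) → ℕ → ℕ → ℤ
  lift f x y = f (mod₅ x) (mod₅ y)

  H : ℕ → ℕ → ℤ
  H = lift λ x y → ε₁ x * ε₂ y

  private
    lift-shiftˡ : ∀ {f g} → (∀ i j → f (i ⊞ j) j ≡ g i j) → ∀ x y → lift f (x ℕ.+ y) y ≡ lift g x y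
    lift-shiftˡ {f} p x y = trans (cong (λ i → f i (mod₅ y)) (mod₅-+ x y)) (p (mod₅ x) (mod₅ y))

    lift-shiftʳ : ∀ {f g} → (∀ i j → f i (i ⊞ j) ≡ g i j) → ∀ x y → lift f x (x ℕ.+ y) ≡ lift g x y
    lift-shiftʳ {f} p x y = trans (cong (f (mod₅ x)) (mod₅-+ x y)) (p (mod₅ x) (mod₅ y))

    w-same : ∀ (w : ℕ → ℕ → ℤ) a b → w a b ≡ w a b
    w-same w a b = refl

    -- The substitution (a, b) ↦ (a, a + b) permutes the parity types with at least one odd entry:
    -- it exchanges `w₁₀` with `w₁₁` and fixes `w₀₁`. Likewise (a, b) ↦ (a + b, b) exchanges `w₀₁`
    -- with `w₁₁` and fixes `w₁₀`.
    w₁₀> : ∀ a b → w₁₀ a (a ℕ.+ b) ≡ w₁₁ a b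
    w₁₀> a b = trans (cong (odd a *_) (even-+ a b)) (odd-absorb a (odd b) (even b))
    w₁₁> : ∀ a b → w₁₁ a (a ℕ.+ b) ≡ w₁₀ a b
    w₁₁> a b = trans (cong (odd a *_) (odd-+ a b)) (odd-absorb a (even b) (odd b))
    w₀₁> : ∀ a b → w₀₁ a (a ℕ.+ b) ≡ w₀₁ a b
    w₀₁> a b = trans (cong (even a *_) (odd-+ a b)) (even-absorb a (even b) (odd b))
    flip-w : ∀ (w v v′ : ℕ → ℕ → ℤ) → (∀ a b → w a b ≡ v b a) → (∀ a b → v a (a ℕ.+ b) ≡ v′ a b) → ∀ a b → w (a ℕ.+ b) b ≡ v′ b a
    flip-w w v v′ p q a b = trans (p (a ℕ.+ b) b) (trans (cong (v b) (ℕ.+-comm a b)) (q b a))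
    w₁₀< : ∀ a b → w₁₀ (a ℕ.+ b) b ≡ w₁₀ a b
    w₁₀< a b = trans (flip-w w₁₀ w₀₁ w₀₁ (λ a b → ℤ.*-comm (odd a) (even b)) w₀₁> a b) (ℤ.*-comm (even b) (odd a))
    w₀₁< : ∀ a b → w₀₁ (a ℕ.+ b) b ≡ w₁₁ a b
    w₀₁< a b = trans (flip-w w₀₁ w₁₀ w₁₁ (λ a b → ℤ.*-comm (even a) (odd b)) w₁₀> a b) (ℤ.*-comm (odd b) (odd a))
    w₁₁< : ∀ a b → w₁₁ (a ℕ.+ b) b ≡ w₀₁ a b
    w₁₁< a b = trans (flip-w w₁₁ w₁₁ w₁₀ (λ a b → ℤ.*-comm (odd a) (odd b)) w₁₁> a b) (ℤ.*-comm (odd b) (even a))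

    Diagᵃ-zero : ∀ w g → (∀ a → w a a ≡ 0ℤ) → Diagᵃ w g ≡ 0ℤ
    Diagᵃ-zero w g p = ∑∑-zero N {λ x y → ∑ℕ N λ i → w (suc i) (suc i) * (g x y * δ (suc i ℕ.* x ℕ.+ suc i ℕ.* y))} λ k l → ∑ℕ-zero N λ i → *-zeroˡ′ {g (suc k) (suc l) * δ (suc i ℕ.* suc k ℕ.+ suc i ℕ.* suc l)} (p (suc i))

  -- Three sums are cut by comparing x with y and three by comparing a with b. Both cuts produce the
  -- same six off-diagonal pieces, and `rest` removes the sums of mixed parity; the two sums of
  -- weight `w₁₁` and the diagonals remain.
  four-term : Full w₁₁ (lift g₁) ≡ Full w₁₁ (lift u″) +
    (((Diagˣ w₁₁ (lift g₁) + Diagˣ w₁₀ (lift g₂)) + Diagˣ w₀₁ (lift g₃)) - Diagᵃ w₁₁ (lift u″))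
  four-term = solveFor (Full w₁₁ (lift g₁)) (Full w₁₀ (lift g₂)) (Full w₀₁ (lift g₃)) (Full w₁₀ (lift u)) (Full w₀₁ (lift u′)) (Full w₁₁ (lift u″))
    (Lo w₁₁ (lift u)) (Hi w₁₁ (lift u′)) (Lo w₁₀ (lift u″)) (Hi w₁₀ (lift u)) (Lo w₀₁ (lift u′)) (Hi w₀₁ (lift u″))
    (Diagˣ w₁₁ (lift g₁)) (Diagˣ w₁₀ (lift g₂)) (Diagˣ w₀₁ (lift g₃)) (Diagᵃ w₁₁ (lift u″)) xy₁ xy₂ xy₃ ab₁ ab₂ ab₃ rest
    where
    xy₁ : Full w₁₁ (lift g₁) ≡ (Lo w₁₁ (lift u) + Hi w₁₁ (lift u′)) + Diagˣ w₁₁ (lift g₁)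
    xy₁ = trans (split-xy w₁₁ (lift g₁)) (cong₂ (λ s t → (s + t) + Diagˣ w₁₁ (lift g₁))
      (Lo-cong (w-same w₁₁) (lift-shiftˡ {g₁} {u} (from-yes (all? λ i → all? λ j → g₁ (i ⊞ j) j ℤ.≟ u i j))))
      (Hi-cong (w-same w₁₁) (lift-shiftʳ {g₁} {u′} (from-yes (all? λ i → all? λ j → g₁ i (i ⊞ j) ℤ.≟ u′ i j)))))
    xy₂ : Full w₁₀ (lift g₂) ≡ (Lo w₁₀ (lift u″) + Hi w₁₀ (lift u)) + Diagˣ w₁₀ (lift g₂)
    xy₂ = trans (split-xy w₁₀ (lift g₂)) (cong₂ (λ s t → (s + t) + Diagˣ w₁₀ (lift g₂))
      (Lo-cong (w-same w₁₀) (lift-shiftˡ {g₂} {u″} (from-yes (all? λ i → all? λ j → g₂ (i ⊞ j) j ℤ.≟ u″ i j))))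
      (Hi-cong (w-same w₁₀) (lift-shiftʳ {g₂} {u} (from-yes (all? λ i → all? λ j → g₂ i (i ⊞ j) ℤ.≟ u i j)))))
    xy₃ : Full w₀₁ (lift g₃) ≡ (Lo w₀₁ (lift u′) + Hi w₀₁ (lift u″)) + Diagˣ w₀₁ (lift g₃)
    xy₃ = trans (split-xy w₀₁ (lift g₃)) (cong₂ (λ s t → (s + t) + Diagˣ w₀₁ (lift g₃))
      (Lo-cong (w-same w₀₁) (lift-shiftˡ {g₃} {u′} (from-yes (all? λ i → all? λ j → g₃ (i ⊞ j) j ℤ.≟ u′ i j))))
      (Hi-cong (w-same w₀₁) (lift-shiftʳ {g₃} {u″} (from-yes (all? λ i → all? λ j → g₃ i (i ⊞ j) ℤ.≟ u″ i j)))))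
    ab₁ : Full w₁₀ (lift u) ≡ (Lo w₁₁ (lift u) + Hi w₁₀ (lift u)) + 0ℤ
    ab₁ = trans (split-ab w₁₀ (lift u)) (cong₂ _+_ (cong₂ _+_ (Lo-cong w₁₀> (λ x y → refl {x = lift u x y})) (Hi-cong w₁₀< (λ x y → refl {x = lift u x y}))) (Diagᵃ-zero w₁₀ (lift u) odd*even))
    ab₂ : Full w₀₁ (lift u′) ≡ (Lo w₀₁ (lift u′) + Hi w₁₁ (lift u′)) + 0ℤ
    ab₂ = trans (split-ab w₀₁ (lift u′)) (cong₂ _+_ (cong₂ _+_ (Lo-cong w₀₁> (λ x y → refl {x = lift u′ x y})) (Hi-cong w₀₁< (λ x y → refl {x = lift u′ x y}))) (Diagᵃ-zero w₀₁ (lift u′) (λ a → trans (ℤ.*-comm (even a) (odd a)) (odd*even a))))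
    ab₃ : Full w₁₁ (lift u″) ≡ (Lo w₁₀ (lift u″) + Hi w₀₁ (lift u″)) + Diagᵃ w₁₁ (lift u″)
    ab₃ = trans (split-ab w₁₁ (lift u″)) (cong (λ s → s + Diagᵃ w₁₁ (lift u″)) (cong₂ _+_ (Lo-cong w₁₁> (λ x y → refl {x = lift u″ x y})) (Hi-cong w₁₁< (λ x y → refl {x = lift u″ x y}))))
    swap₁₀ : ∀ g → Full w₀₁ g ≡ Full w₁₀ (λ x y → g y x)
    swap₁₀ g = trans (Full-swap w₀₁ g) (Full-cong (λ a b → ℤ.*-comm (even b) (odd a)) (λ x y → refl {x = g y x}))
    rest : Full w₁₀ (lift g₂) + Full w₀₁ (lift g₃) ≡ Full w₁₀ (lift u) + Full w₀₁ (lift u′)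
    rest = begin
      Full w₁₀ (lift g₂) + Full w₀₁ (lift g₃)                     ≡⟨ +-congˡ (Full w₁₀ (lift g₂)) (swap₁₀ (lift g₃)) ⟩
      Full w₁₀ (lift g₂) + Full w₁₀ (λ x y → lift g₃ y x)         ≡⟨ Full-+ w₁₀ (lift g₂) (λ x y → lift g₃ y x) ⟨
      Full w₁₀ (λ x y → lift g₂ x y + lift g₃ y x)                ≡⟨ Full-cong (w-same w₁₀) (λ x y → u-rest (mod₅ x) (mod₅ y)) ⟩
      Full w₁₀ (λ x y → lift u x y + lift u′ y x)                 ≡⟨ Full-+ w₁₀ (lift u) (λ x y → lift u′ y x) ⟩
      Full w₁₀ (lift u) + Full w₁₀ (λ x y → lift u′ y x)          ≡⟨ +-congˡ (Full w₁₀ (lift u)) (swap₁₀ (lift u′)) ⟨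
      Full w₁₀ (lift u) + Full w₀₁ (lift u′)                      ∎
    solveFor : ∀ p₁ p₂ p₃ q₁ q₂ q₃ a₁ a₂ a₃ a₄ a₅ a₆ d₁ d₂ d₃ e →
      p₁ ≡ (a₁ + a₂) + d₁ → p₂ ≡ (a₃ + a₄) + d₂ → p₃ ≡ (a₅ + a₆) + d₃ →
      q₁ ≡ (a₁ + a₄) + 0ℤ → q₂ ≡ (a₅ + a₂) + 0ℤ → q₃ ≡ (a₃ + a₆) + e → p₂ + p₃ ≡ q₁ + q₂ →
      p₁ ≡ q₃ + (((d₁ + d₂) + d₃) - e)
    solveFor p₁ p₂ p₃ q₁ q₂ q₃ a₁ a₂ a₃ a₄ a₅ a₆ d₁ d₂ d₃ e h₁ h₂ h₃ k₁ k₂ k₃ r =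
      +-cancelʳ (q₁ + q₂) p₁ _ (begin
        p₁ + (q₁ + q₂)                        ≡⟨ +-congˡ p₁ r ⟨
        p₁ + (p₂ + p₃)                        ≡⟨ cong₂ _+_ h₁ (cong₂ _+_ h₂ h₃) ⟩
        ((a₁ + a₂) + d₁) + (((a₃ + a₄) + d₂) + ((a₅ + a₆) + d₃))
          ≡⟨ lemma a₁ a₂ a₃ a₄ a₅ a₆ d₁ d₂ d₃ e ⟩
        ((a₃ + a₆) + e + (((d₁ + d₂) + d₃) - e)) + (((a₁ + a₄) + 0ℤ) + ((a₅ + a₂) + 0ℤ))
          ≡⟨ cong₂ (λ s t → (s + (((d₁ + d₂) + d₃) - e)) + t) k₃ (cong₂ _+_ k₁ k₂) ⟨
        (q₃ + (((d₁ + d₂) + d₃) - e)) + (q₁ + q₂) ∎)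
      where
      lemma : ∀ a₁ a₂ a₃ a₄ a₅ a₆ d₁ d₂ d₃ e →
        ((a₁ + a₂) + d₁) + (((a₃ + a₄) + d₂) + ((a₅ + a₆) + d₃)) ≡
        ((a₃ + a₆) + e + (((d₁ + d₂) + d₃) - e)) + (((a₁ + a₄) + 0ℤ) + ((a₅ + a₂) + 0ℤ))
      lemma = solve-∀

  -- Since `u-main` holds only after symmetrisation, the sums are doubled, symmetrised by exchanging
  -- (a, x) with (b, y), and halved again.
  four-c : + 4 * Full w₁₁ H ≡
    ((Diagˣ w₁₁ (lift g₁) + Diagˣ w₁₀ (lift g₂)) + Diagˣ w₀₁ (lift g₃)) - Diagᵃ w₁₁ (lift u″)
  four-c = +-cancelˡ (Full w₁₁ (lift u″)) _ _ (trans (sym main) four-term)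
    where
    +-cancelˡ : ∀ x y z → x + y ≡ x + z → y ≡ z
    +-cancelˡ x y z p = +-cancelʳ x y z (trans (ℤ.+-comm y x) (trans p (ℤ.+-comm x z)))
    swapped : ∀ g → Full w₁₁ g ≡ Full w₁₁ (λ x y → g y x)
    swapped g = trans (Full-swap w₁₁ g) (Full-cong (λ a b → ℤ.*-comm (odd b) (odd a)) (λ x y → refl {x = g y x}))
    twice : ∀ g → + 2 * Full w₁₁ g ≡ Full w₁₁ (λ x y → g x y + g y x)
    twice g = begin
      + 2 * Full w₁₁ g                            ≡⟨ double (Full w₁₁ g) ⟩
      Full w₁₁ g + Full w₁₁ g                     ≡⟨ +-congˡ (Full w₁₁ g) (swapped g) ⟩
      Full w₁₁ g + Full w₁₁ (λ x y → g y x)       ≡⟨ Full-+ w₁₁ g (λ x y → g y x) ⟨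
      Full w₁₁ (λ x y → g x y + g y x)            ∎
      where
      double : ∀ x → + 2 * x ≡ x + x
      double = solve-∀
    main : Full w₁₁ (lift g₁) ≡ Full w₁₁ (lift u″) + + 4 * Full w₁₁ H
    main = ℤ.*-cancelˡ-≡ (+ 2) _ _ (begin
      + 2 * Full w₁₁ (lift g₁)
        ≡⟨ twice (lift g₁) ⟩
      Full w₁₁ (λ x y → lift g₁ x y + lift g₁ y x)
        ≡⟨ Full-cong (w-same w₁₁) (λ x y → u-main (mod₅ x) (mod₅ y)) ⟩
      Full w₁₁ (λ x y → (lift u″ x y + lift u″ y x) + + 4 * (H x y + H y x))
        ≡⟨ Full-+ w₁₁ (λ x y → lift u″ x y + lift u″ y x) (λ x y → + 4 * (H x y + H y x)) ⟩
      Full w₁₁ (λ x y → lift u″ x y + lift u″ y x) + Full w₁₁ (λ x y → + 4 * (H x y + H y x))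
        ≡⟨ cong₂ _+_ (sym (twice (lift u″))) (trans (Full-* w₁₁ (+ 4) (λ x y → H x y + H y x)) (cong (+ 4 *_) (sym (twice H)))) ⟩
      + 2 * Full w₁₁ (lift u″) + + 4 * (+ 2 * Full w₁₁ H)
        ≡⟨ lemma (Full w₁₁ (lift u″)) (Full w₁₁ H) ⟩
      + 2 * (Full w₁₁ (lift u″) + + 4 * Full w₁₁ H) ∎)
      where
      lemma : ∀ x y → + 2 * x + + 4 * (+ 2 * y) ≡ + 2 * (x + + 4 * y)
      lemma = solve-∀

-- Diagonal terms as divisor sums

suc₅⁵ : ∀ i → suc₅ (suc₅ (suc₅ (suc₅ (suc₅ i)))) ≡ i
suc₅⁵ = from-yes (all? λ i → suc₅ (suc₅ (suc₅ (suc₅ (suc₅ i)))) Fin.≟ i)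

χ : ℕ → ℤ
χ n = χ₅ (mod₅ n)

-- The index n stands for s = n + 2, since both parts are at least 1. An even s is a sum of two odd
-- parts in s/2 ways, hence the doubling.
antiℤ-odd-odd : ∀ n → + 2 * antiℤ n (λ i j → w₁₁ (suc i) (suc j)) ≡ even (2 ℕ.+ n) * + (2 ℕ.+ n)
antiℤ-odd-odd zero          = refl
antiℤ-odd-odd (suc zero)    = refl
antiℤ-odd-odd (suc (suc n)) = trans (lemma (even n) (odd n) A) (trans (+-congˡ (+ 2 * even n) (antiℤ-odd-odd n)) (lemma′ (even n) (+ n)))
  where
  A : ℤ
  A = antiℤ n (λ i j → w₁₁ (suc i) (suc j))
  lemma : ∀ e o a → + 2 * (1ℤ * e + (0ℤ * o + a)) ≡ + 2 * e + + 2 * a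
  lemma = solve-∀
  lemma′ : ∀ e n → + 2 * e + e * (+ 2 + n) ≡ e * (+ 4 + n)
  lemma′ = solve-∀

-- An odd s is a sum of an odd part and a positive even part in (s - 1)/2 ways.
antiℤ-odd-even : ∀ n → + 2 * antiℤ n (λ i j → w₁₀ (suc i) (suc j)) ≡ odd (2 ℕ.+ n) * (+ (2 ℕ.+ n) - 1ℤ)
antiℤ-odd-even zero          = refl
antiℤ-odd-even (suc zero)    = refl
antiℤ-odd-even (suc (suc n)) = trans (lemma (odd n) (even n) A) (trans (+-congˡ (+ 2 * odd n) (antiℤ-odd-even n)) (lemma′ (odd n) (+ n)))
  where
  A : ℤ
  A = antiℤ n (λ i j → w₁₀ (suc i) (suc j))
  lemma : ∀ o e a → + 2 * (1ℤ * o + (0ℤ * e + a)) ≡ + 2 * o + + 2 * a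
  lemma = solve-∀
  lemma′ : ∀ o n → + 2 * o + o * (+ 2 + n - 1ℤ) ≡ o * (+ 4 + n - 1ℤ)
  lemma′ = solve-∀

-- Any five consecutive places of the antidiagonal contribute 5 χ(s), checked in `period≡`, so the
-- induction goes in steps of five. The factor `1ℤ` matches the shape expected by `by-sum`.
antiℤ-u″ : ∀ n → 1ℤ * antiℤ n (λ i j → u″ (mod₅ (suc i)) (mod₅ (suc j))) ≡ (+ (2 ℕ.+ n) - 1ℤ) * χ (2 ℕ.+ n)
antiℤ-u″ 0 = refl
antiℤ-u″ 1 = refl
antiℤ-u″ 2 = refl
antiℤ-u″ 3 = refl
antiℤ-u″ 4 = refl
antiℤ-u″ (suc (suc (suc (suc (suc n))))) = begin
  1ℤ * antiℤ (5 ℕ.+ n) f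
    ≡⟨ regroup (f 0 (5 ℕ.+ n)) (f 1 (4 ℕ.+ n)) (f 2 (3 ℕ.+ n)) (f 3 (2 ℕ.+ n)) (f 4 (1 ℕ.+ n)) _ ⟩
  period (mod₅ n) + 1ℤ * antiℤ n (λ i j → f (5 ℕ.+ i) j)
    ≡⟨ cong₂ (λ s t → s + 1ℤ * t) (period≡ (mod₅ n)) (antiℤ-cong n λ i j → cong (λ k → u″ (suc₅ k) (mod₅ (suc j))) (suc₅⁵ (mod₅ i))) ⟩
  + 5 * χ (2 ℕ.+ n) + 1ℤ * antiℤ n f
    ≡⟨ +-congˡ (+ 5 * χ (2 ℕ.+ n)) (antiℤ-u″ n) ⟩
  + 5 * χ (2 ℕ.+ n) + (+ (2 ℕ.+ n) - 1ℤ) * χ (2 ℕ.+ n)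
    ≡⟨ lemma (+ n) (χ (2 ℕ.+ n)) ⟩
  (+ (7 ℕ.+ n) - 1ℤ) * χ (2 ℕ.+ n)
    ≡⟨ cong (λ k → (+ (7 ℕ.+ n) - 1ℤ) * χ₅ (suc₅ (suc₅ k))) (suc₅⁵ (mod₅ n)) ⟨
  (+ (7 ℕ.+ n) - 1ℤ) * χ (7 ℕ.+ n) ∎
  where
  open ≡-Reasoning
  f : ℕ → ℕ → ℤ
  f i j = u″ (mod₅ (suc i)) (mod₅ (suc j))
  period : Fin 5 → ℤ
  period r = let r₁ = suc₅ r ; r₂ = suc₅ r₁ ; r₃ = suc₅ r₂ ; r₄ = suc₅ r₃ ; r₅ = suc₅ r₄ ; r₆ = suc₅ r₅ in
    u″ 1F r₆ + (u″ 2F r₅ + (u″ 3F r₄ + (u″ 4F r₃ + u″ 0F r₂)))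
  period≡ : ∀ r → period r ≡ + 5 * χ₅ (suc₅ (suc₅ r))
  period≡ = from-yes (all? λ r → period r ℤ.≟ + 5 * χ₅ (suc₅ (suc₅ r)))
  regroup : ∀ a b c d e x → 1ℤ * (a + (b + (c + (d + (e + x))))) ≡ (a + (b + (c + (d + e)))) + 1ℤ * x
  regroup = solve-∀
  lemma : ∀ n x → + 5 * x + (+ 2 + n - 1ℤ) * x ≡ (+ 7 + n - 1ℤ) * x
  lemma = solve-∀

module _ (N : ℕ) where
  open Liouville N
  open ≡-Reasoning

  private
    K : (ℕ → ℤ) → ℕ → ℤ
    K κ s = ∑ℕ N λ i → κ (suc i) * δ (s ℕ.* suc i)

    K-off : ∀ κ s → N ℕ.< s → K κ s ≡ 0ℤ
    K-off κ s N<s = ∑ℕ-zero N λ i → *-zeroʳ′ {κ (suc i)} (δ-off (ℕ.≤-trans N<s (ℕ.m≤m*n s (suc i))))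

    -- A diagonal term sees the pair only through s = a + b, so pairs are collected along
    -- antidiagonals. These begin at s = 2: the hypothesis on `t 1` adds s = 1 at no cost, and s = N
    -- + 1 contributes nothing.
    by-sum : ∀ c (p : ℕ → ℕ → ℤ) (t κ : ℕ → ℤ) → (∀ n → c * antiℤ n (λ i j → p (suc i) (suc j)) ≡ t (2 ℕ.+ n)) → t 1 ≡ 0ℤ →
      c * ∑∑ N (λ a b → p a b * K κ (a ℕ.+ b)) ≡ ∑∑ N (λ s x → t s * (κ x * δ (s ℕ.* x)))
    by-sum c p t κ count t₁ = begin
      c * ∑∑ N (λ a b → p a b * K κ (a ℕ.+ b))
        ≡⟨ cong (c *_) (∑-antiℤ N (λ i j → p (suc i) (suc j) * K κ (suc i ℕ.+ suc j)) λ i j N≤ →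
             *-zeroʳ′ {p (suc i) (suc j)} (K-off κ (suc i ℕ.+ suc j) (subst (N ℕ.<_) (sym (cong suc (ℕ.+-suc i j))) (ℕ.m≤n⇒m≤1+n (s≤s N≤))))) ⟩
      c * ∑ℕ N (λ n → antiℤ n (λ i j → p (suc i) (suc j) * K κ (suc i ℕ.+ suc j)))
        ≡⟨ ∑ℕ-* N c (λ n → antiℤ n (λ i j → p (suc i) (suc j) * K κ (suc i ℕ.+ suc j))) ⟨
      ∑ℕ N (λ n → c * antiℤ n (λ i j → p (suc i) (suc j) * K κ (suc i ℕ.+ suc j)))
        ≡⟨ ∑ℕ-cong N (λ n → begin
             c * antiℤ n (λ i j → p (suc i) (suc j) * K κ (suc i ℕ.+ suc j))
               ≡⟨ cong (c *_) (antiℤ-cong n λ i j → cong (λ s → p (suc i) (suc j) * K κ s) (cong suc (ℕ.+-suc i j))) ⟩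
             c * antiℤ n (λ i j → p (suc i) (suc j) * K κ (2 ℕ.+ (i ℕ.+ j)))
               ≡⟨ cong (c *_) (antiℤ-factor n (λ i j → p (suc i) (suc j)) (λ s → K κ (2 ℕ.+ s))) ⟩
             c * (antiℤ n (λ i j → p (suc i) (suc j)) * K κ (2 ℕ.+ n))
               ≡⟨ ℤ.*-assoc c (antiℤ n (λ i j → p (suc i) (suc j))) (K κ (2 ℕ.+ n)) ⟨
             c * antiℤ n (λ i j → p (suc i) (suc j)) * K κ (2 ℕ.+ n)
               ≡⟨ cong (_* K κ (2 ℕ.+ n)) (count n) ⟩
             f (2 ℕ.+ n) ∎) ⟩
      ∑ℕ N (λ n → f (2 ℕ.+ n))
        ≡⟨ reindex ⟩
      ∑ℕ N (f ∘ suc)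
        ≡⟨ ∑ℕ-cong N (λ i → ∑ℕ-* N (t (suc i)) (λ j → κ (suc j) * δ (suc i ℕ.* suc j))) ⟨
      ∑∑ N (λ s x → t s * (κ x * δ (s ℕ.* x))) ∎
      where
      f : ℕ → ℤ
      f s = t s * K κ s
      reindex : ∑ℕ N (λ n → f (2 ℕ.+ n)) ≡ ∑ℕ N (f ∘ suc)
      reindex = begin
        ∑ℕ N (λ n → f (2 ℕ.+ n))           ≡⟨ ℤ.+-identityˡ _ ⟨
        0ℤ + ∑ℕ N (λ n → f (2 ℕ.+ n))      ≡⟨ cong (λ x → x + ∑ℕ N (λ n → f (2 ℕ.+ n))) (*-zeroˡ′ {K κ 1} t₁) ⟨
        ∑ℕ (suc N) (f ∘ suc)               ≡⟨ ∑ℕ-last N (f ∘ suc) ⟩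
        ∑ℕ N (f ∘ suc) + f (suc N)         ≡⟨ +-congˡ (∑ℕ N (f ∘ suc)) (*-zeroʳ′ {t (suc N)} (K-off κ (suc N) ℕ.≤-refl)) ⟩
        ∑ℕ N (f ∘ suc) + 0ℤ                ≡⟨ ℤ.+-identityʳ _ ⟩
        ∑ℕ N (f ∘ suc)                     ∎

    Diagˣ≡ : ∀ w g (κ : ℕ → ℤ) → (∀ x → g x x ≡ κ x) → Diagˣ w g ≡ ∑∑ N (λ a b → w a b * K κ (a ℕ.+ b))
    Diagˣ≡ w g κ p = ∑∑-cong N {λ a b → ∑ℕ N λ i → w a b * (g (suc i) (suc i) * δ (a ℕ.* suc i ℕ.+ b ℕ.* suc i))} {λ a b → w a b * K κ (a ℕ.+ b)}
      λ i j → trans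
        (∑ℕ-cong N λ k → cong₂ (λ s e → w (suc i) (suc j) * (s * δ e)) (p (suc k)) (sym (ℕ.*-distribʳ-+ (suc k) (suc i) (suc j))))
        (∑ℕ-* N (w (suc i) (suc j)) (λ k → κ (suc k) * δ ((suc i ℕ.+ suc j) ℕ.* suc k)))

    Diagᵃ≡ : Diagᵃ w₁₁ (lift u″) ≡ ∑∑ N (λ x y → lift u″ x y * K odd (x ℕ.+ y))
    Diagᵃ≡ = ∑∑-cong N {λ x y → ∑ℕ N λ i → w₁₁ (suc i) (suc i) * (lift u″ x y * δ (suc i ℕ.* x ℕ.+ suc i ℕ.* y))} {λ x y → lift u″ x y * K odd (x ℕ.+ y)}
      λ i j → trans
        (∑ℕ-cong N λ k → trans (cong₂ (λ s e → s * (lift u″ (suc i) (suc j) * δ e)) (odd-idem (suc k))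
            (trans (sym (ℕ.*-distribˡ-+ (suc k) (suc i) (suc j))) (ℕ.*-comm (suc k) (suc i ℕ.+ suc j))))
          (lemma (odd (suc k)) (lift u″ (suc i) (suc j)) (δ ((suc i ℕ.+ suc j) ℕ.* suc k))))
        (∑ℕ-* N (lift u″ (suc i) (suc j)) (λ k → odd (suc k) * δ ((suc i ℕ.+ suc j) ℕ.* suc k)))
      where
      lemma : ∀ x y z → x * (y * z) ≡ y * (x * z)
      lemma = solve-∀
      odd-idem : ∀ a → w₁₁ a a ≡ odd a
      odd-idem a with odd a | parity a
      ... | _ | inj₁ (refl , _) = refl
      ... | _ | inj₂ (refl , _) = refl

    D₁ : + 2 * Diagˣ w₁₁ (lift g₁) ≡ ∑∑ N (λ s x → even s * + s * (- χ x * δ (s ℕ.* x)))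
    D₁ = trans (cong (+ 2 *_) (Diagˣ≡ w₁₁ (lift g₁) (λ x → - χ x) λ x → from-yes (all? λ i → g₁ i i ℤ.≟ - χ₅ i) (mod₅ x)))
      (by-sum (+ 2) w₁₁ (λ s → even s * + s) (λ x → - χ x) antiℤ-odd-odd refl)

    D₂ : + 2 * Diagˣ w₁₀ (lift g₂) ≡ ∑∑ N (λ s x → odd s * (+ s - 1ℤ) * (+ 2 * χ x * δ (s ℕ.* x)))
    D₂ = trans (cong (+ 2 *_) (Diagˣ≡ w₁₀ (lift g₂) (λ x → + 2 * χ x) λ x → from-yes (all? λ i → g₂ i i ℤ.≟ + 2 * χ₅ i) (mod₅ x)))
      (by-sum (+ 2) w₁₀ (λ s → odd s * (+ s - 1ℤ)) (λ x → + 2 * χ x) antiℤ-odd-even refl)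

    D₃ : Diagˣ w₀₁ (lift g₃) ≡ 0ℤ
    D₃ = ∑∑-zero N {λ a b → ∑ℕ N λ i → w₀₁ a b * (lift g₃ (suc i) (suc i) * δ (a ℕ.* suc i ℕ.+ b ℕ.* suc i))} λ i j →
      ∑ℕ-zero N λ k → *-zeroʳ′ {w₀₁ (suc i) (suc j)} (*-zeroˡ′ {δ (suc i ℕ.* suc k ℕ.+ suc j ℕ.* suc k)} (from-yes (all? λ i → g₃ i i ℤ.≟ 0ℤ) (mod₅ (suc k))))

    E₁ : Diagᵃ w₁₁ (lift u″) ≡ ∑∑ N (λ s x → (+ x - 1ℤ) * χ x * (odd s * δ (s ℕ.* x)))
    E₁ = begin
      Diagᵃ w₁₁ (lift u″)
        ≡⟨ Diagᵃ≡ ⟩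
      ∑∑ N (λ x y → lift u″ x y * K odd (x ℕ.+ y))
        ≡⟨ ℤ.*-identityˡ _ ⟨
      1ℤ * ∑∑ N (λ x y → lift u″ x y * K odd (x ℕ.+ y))
        ≡⟨ by-sum 1ℤ (lift u″) (λ d → (+ d - 1ℤ) * χ d) odd antiℤ-u″ refl ⟩
      ∑∑ N (λ x s → (+ x - 1ℤ) * χ x * (odd s * δ (x ℕ.* s)))
        ≡⟨ ∑∑-swap N (λ x s → (+ x - 1ℤ) * χ x * (odd s * δ (x ℕ.* s))) ⟩
      ∑∑ N (λ s x → (+ x - 1ℤ) * χ x * (odd s * δ (x ℕ.* s)))
        ≡⟨ ∑∑-cong N {λ s x → (+ x - 1ℤ) * χ x * (odd s * δ (x ℕ.* s))} {λ s x → (+ x - 1ℤ) * χ x * (odd s * δ (s ℕ.* x))}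
             (λ i j → cong (λ e → (+ suc j - 1ℤ) * χ (suc j) * (odd (suc i) * δ e)) (ℕ.*-comm (suc j) (suc i))) ⟩
      ∑∑ N (λ s x → (+ x - 1ℤ) * χ x * (odd s * δ (s ℕ.* x))) ∎

  coeff : ℕ → ℕ → ℤ
  coeff s x = (+ 2 * odd s * (+ s - + x) - even s * + s) * χ x

  -- With A and B as below, 4 c(N) = A(N) - 3 A(N/2) - B(N) + B(N/2) for c(N) = Full w₁₁ H.
  eight-c : + 8 * Full w₁₁ H ≡ ∑∑ N (λ s x → coeff s x * δ (s ℕ.* x))
  eight-c = begin
    + 8 * Full w₁₁ H
      ≡⟨ lemma₁ (Full w₁₁ H) ⟩
    + 2 * (+ 4 * Full w₁₁ H)
      ≡⟨ cong (+ 2 *_) four-c ⟩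
    + 2 * (((Diagˣ w₁₁ (lift g₁) + Diagˣ w₁₀ (lift g₂)) + Diagˣ w₀₁ (lift g₃)) - Diagᵃ w₁₁ (lift u″))
      ≡⟨ lemma₂ (Diagˣ w₁₁ (lift g₁)) (Diagˣ w₁₀ (lift g₂)) (Diagˣ w₀₁ (lift g₃)) (Diagᵃ w₁₁ (lift u″)) ⟩
    (+ 2 * Diagˣ w₁₁ (lift g₁) + + 2 * Diagˣ w₁₀ (lift g₂)) + + 2 * Diagˣ w₀₁ (lift g₃) + - (+ 2) * Diagᵃ w₁₁ (lift u″)
      ≡⟨ cong₂ _+_ (cong₂ _+_ (cong₂ _+_ D₁ D₂) (cong (+ 2 *_) D₃)) (trans (cong (- (+ 2) *_) E₁) (sym (∑∑-* N (- (+ 2)) e))) ⟩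
    (∑∑ N d₁ + ∑∑ N d₂) + 0ℤ + ∑∑ N (λ s x → - (+ 2) * e s x)
      ≡⟨ cong (λ t → t + ∑∑ N (λ s x → - (+ 2) * e s x)) (trans (ℤ.+-identityʳ _) (sym (∑∑-+ N d₁ d₂))) ⟩
    ∑∑ N (λ s x → d₁ s x + d₂ s x) + ∑∑ N (λ s x → - (+ 2) * e s x)
      ≡⟨ ∑∑-+ N (λ s x → d₁ s x + d₂ s x) (λ s x → - (+ 2) * e s x) ⟨
    ∑∑ N (λ s x → (d₁ s x + d₂ s x) + - (+ 2) * e s x)
      ≡⟨ ∑∑-cong N {λ s x → (d₁ s x + d₂ s x) + - (+ 2) * e s x} {λ s x → coeff s x * δ (s ℕ.* x)}
           (λ i j → lemma₃ (odd (suc i)) (even (suc i)) (+ suc i) (+ suc j) (χ (suc j)) (δ (suc i ℕ.* suc j))) ⟩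
    ∑∑ N (λ s x → coeff s x * δ (s ℕ.* x)) ∎
    where
    d₁ d₂ e : ℕ → ℕ → ℤ
    d₁ s x = even s * + s * (- χ x * δ (s ℕ.* x))
    d₂ s x = odd s * (+ s - 1ℤ) * (+ 2 * χ x * δ (s ℕ.* x))
    e s x = (+ x - 1ℤ) * χ x * (odd s * δ (s ℕ.* x))
    lemma₁ : ∀ x → + 8 * x ≡ + 2 * (+ 4 * x)
    lemma₁ = solve-∀
    lemma₂ : ∀ a b c d → + 2 * (((a + b) + c) - d) ≡ (+ 2 * a + + 2 * b) + + 2 * c + - (+ 2) * d
    lemma₂ = solve-∀
    lemma₃ : ∀ o e s x c d → (e * s * (- c * d) + o * (s - 1ℤ) * (+ 2 * c * d)) + - (+ 2) * ((x - 1ℤ) * c * (o * d)) ≡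
                             (+ 2 * o * (s - x) - e * s) * c * d
    lemma₃ = solve-∀

-- Divisor sums

DS : ℕ → (ℕ → ℕ → ℤ) → ℤ
DS N f = ∑∑ N λ s x → f s x * X (+ (s ℕ.* x)) N

DS-cong : ∀ N {f g} → (∀ s x → s ℕ.* x ≡ N → f s x ≡ g s x) → DS N f ≡ DS N g
DS-cong N {f} {g} p = ∑∑-cong N {λ s x → f s x * X (+ (s ℕ.* x)) N} {λ s x → g s x * X (+ (s ℕ.* x)) N} λ i j → term (suc i) (suc j)
  where
  term : ∀ s x → f s x * X (+ (s ℕ.* x)) N ≡ g s x * X (+ (s ℕ.* x)) N
  term s x with s ℕ.* x ℕ.≟ N
  ... | yes q = cong (_* X (+ (s ℕ.* x)) N) (p s x q)
  ... | no ¬q = trans (zero-at (f s x)) (sym (zero-at (g s x)))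
    where
    zero-at : ∀ y → y * X (+ (s ℕ.* x)) N ≡ 0ℤ
    zero-at y = *-zeroʳ′ {y} (X-off (+ (s ℕ.* x)) N (¬q ∘ ℤ.+-injective))

DS-+ : ∀ N f g → DS N (λ s x → f s x + g s x) ≡ DS N f + DS N g
DS-+ N f g = trans
  (∑∑-cong N {λ s x → (f s x + g s x) * X (+ (s ℕ.* x)) N} {λ s x → f s x * X (+ (s ℕ.* x)) N + g s x * X (+ (s ℕ.* x)) N}
    λ i j → ℤ.*-distribʳ-+ (X (+ (suc i ℕ.* suc j)) N) (f (suc i) (suc j)) (g (suc i) (suc j)))
  (∑∑-+ N (λ s x → f s x * X (+ (s ℕ.* x)) N) (λ s x → g s x * X (+ (s ℕ.* x)) N))

DS-* : ∀ N c f → DS N (λ s x → c * f s x) ≡ c * DS N f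
DS-* N c f = trans
  (∑∑-cong N {λ s x → c * f s x * X (+ (s ℕ.* x)) N} {λ s x → c * (f s x * X (+ (s ℕ.* x)) N)}
    λ i j → ℤ.*-assoc c (f (suc i) (suc j)) (X (+ (suc i ℕ.* suc j)) N))
  (∑∑-* N c (λ s x → f s x * X (+ (s ℕ.* x)) N))

DS-swap : ∀ N f → DS N f ≡ DS N (λ s x → f x s)
DS-swap N f = trans (∑∑-swap N (λ s x → f s x * X (+ (s ℕ.* x)) N))
  (∑∑-cong N {λ s x → f x s * X (+ (x ℕ.* s)) N} {λ s x → f x s * X (+ (s ℕ.* x)) N}
    λ i j → cong (λ e → f (suc j) (suc i) * X (+ e) N) (ℕ.*-comm (suc j) (suc i)))

∑ℕ-multiples : ∀ p W (g : ℕ → ℤ) → (∀ s → ¬ suc p ∣ s → g s ≡ 0ℤ) →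
  ∑ℕ (W ℕ.* suc p) (g ∘ suc) ≡ ∑ℕ W (λ i → g (suc i ℕ.* suc p))
∑ℕ-multiples p zero    g off = refl
∑ℕ-multiples p (suc W) g off = begin
  ∑ℕ (suc p ℕ.+ W ℕ.* suc p) (g ∘ suc)
    ≡⟨ ∑ℕ-split (suc p) (W ℕ.* suc p) (g ∘ suc) ⟩
  ∑ℕ (suc p) (g ∘ suc) + ∑ℕ (W ℕ.* suc p) (λ i → g (suc (suc p ℕ.+ i)))
    ≡⟨ cong₂ _+_ block (trans
         (∑ℕ-cong (W ℕ.* suc p) λ i → cong g (sym (ℕ.+-suc (suc p) i)))
         (∑ℕ-multiples p W (λ s → g (suc p ℕ.+ s)) λ s ¬d → off _ λ d → ¬d (∣m+n∣m⇒∣n d ∣-refl))) ⟩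
  g (suc p) + ∑ℕ W (λ i → g (suc p ℕ.+ suc i ℕ.* suc p))
    ≡⟨ cong (λ s → g s + ∑ℕ W (λ i → g (suc p ℕ.+ suc i ℕ.* suc p))) (sym (ℕ.+-identityʳ (suc p))) ⟩
  ∑ℕ (suc W) (λ i → g (suc i ℕ.* suc p)) ∎
  where
  open ≡-Reasoning
  block : ∑ℕ (suc p) (g ∘ suc) ≡ g (suc p)
  block = trans (∑ℕ-last p (g ∘ suc)) (trans
    (cong (λ s → s + g (suc p)) (trans (∑ℕ-cong< p λ i i<p → off (suc i) λ d → ℕ.<-irrefl refl (ℕ.≤-trans (s≤s i<p) (∣⇒≤ d))) (∑ℕ-zero p λ _ → refl)))
    (ℤ.+-identityˡ _))

X-scale-index : ∀ p k n → X (+ (suc p ℕ.* k)) (suc p ℕ.* n) ≡ X (+ k) n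
X-scale-index p k n with k ℕ.≟ n
... | yes refl = trans (X-diag (suc p ℕ.* k)) (sym (X-diag k))
... | no k≢n = trans (X-off (+ (suc p ℕ.* k)) (suc p ℕ.* n) λ e → k≢n (ℕ.*-cancelˡ-≡ k n (suc p) (ℤ.+-injective e)))
  (sym (X-off (+ k) n (k≢n ∘ ℤ.+-injective)))

DS-scaleˢ : ∀ p n f → (∀ s x → s ℕ.* x ≡ suc p ℕ.* n → ¬ suc p ∣ s → f s x ≡ 0ℤ) →
  DS (suc p ℕ.* n) f ≡ DS n (λ s x → f (s ℕ.* suc p) x)
DS-scaleˢ p n f off = begin
  ∑ℕ N (λ i → row (suc i))
    ≡⟨ cong (λ W → ∑ℕ W (λ i → row (suc i))) (ℕ.*-comm (suc p) n) ⟩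
  ∑ℕ (n ℕ.* suc p) (λ i → row (suc i))
    ≡⟨ ∑ℕ-multiples p n row row-off ⟩
  ∑ℕ n (λ i → row (suc i ℕ.* suc p))
    ≡⟨ ∑ℕ-cong n (λ i → trans
         (∑ℕ-cong N λ j → cong (f (suc i ℕ.* suc p) (suc j) *_) (trans (cong (λ e → X (+ e) N) (exponent p (suc i) (suc j))) (X-scale-index p (suc i ℕ.* suc j) n)))
         (∑ℕ-extend {n} {N} {λ j → f (suc i ℕ.* suc p) (suc j) * X (+ (suc i ℕ.* suc j)) n}
           (λ j n≤j → *-zeroʳ′ {f (suc i ℕ.* suc p) (suc j)} (X-off (+ (suc i ℕ.* suc j)) n λ e →
             ℕ.<-irrefl (sym (ℤ.+-injective e)) (ℕ.≤-trans (s≤s n≤j) (ℕ.m≤n*m (suc j) (suc i)))))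
           (ℕ.m≤n*m n (suc p)))) ⟩
  DS n (λ s x → f (s ℕ.* suc p) x) ∎
  where
  open ≡-Reasoning
  N : ℕ
  N = suc p ℕ.* n
  row : ℕ → ℤ
  row s = ∑ℕ N λ j → f s (suc j) * X (+ (s ℕ.* suc j)) N
  row-off : ∀ s → ¬ suc p ∣ s → row s ≡ 0ℤ
  row-off s ¬d = ∑ℕ-zero N λ j → term (suc j)
    where
    term : ∀ x → f s x * X (+ (s ℕ.* x)) N ≡ 0ℤ
    term x with s ℕ.* x ℕ.≟ N
    ... | yes q = *-zeroˡ′ {X (+ (s ℕ.* x)) N} (off s x q ¬d)
    ... | no ¬q = *-zeroʳ′ {f s x} (X-off (+ (s ℕ.* x)) N (¬q ∘ ℤ.+-injective))
  exponent : ∀ p i j → i ℕ.* (1 ℕ.+ p) ℕ.* j ≡ (1 ℕ.+ p) ℕ.* (i ℕ.* j)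
  exponent = ℕ-Solver.solve-∀

DS-scaleˣ : ∀ p n f → (∀ s x → s ℕ.* x ≡ suc p ℕ.* n → ¬ suc p ∣ x → f s x ≡ 0ℤ) →
  DS (suc p ℕ.* n) f ≡ DS n (λ s x → f s (x ℕ.* suc p))
DS-scaleˣ p n f off = trans (DS-swap (suc p ℕ.* n) f) (trans
  (DS-scaleˢ p n (λ s x → f x s) (λ s x e → off x s (trans (ℕ.*-comm x s) e)))
  (DS-swap n (λ s x → f x (s ℕ.* suc p))))

free : ℕ → ℕ → ℤ
free p x = if ⌊ p ∣? x ⌋ then 0ℤ else 1ℤ

free-∣ : ∀ {p x} → p ∣ x → free p x ≡ 0ℤ
free-∣ {p} {x} d with p ∣? x
... | yes _ = refl
... | no ¬d = contradiction d ¬d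

free-∤ : ∀ {p x} → ¬ p ∣ x → free p x ≡ 1ℤ
free-∤ {p} {x} ¬d with p ∣? x
... | yes d = contradiction d ¬d
... | no _  = refl

module Hecke (p′ : ℕ) (p-prime : Prime (suc p′)) (f : ℕ → ℕ → ℤ) (α β : ℤ)
  (f-x : ∀ s x → f s (x ℕ.* suc p′) ≡ α * f s x) (f-s : ∀ s x → f (s ℕ.* suc p′) x ≡ β * f s x) where

  private
    p : ℕ
    p = suc p′

  -- Setting aside the pairs with p ∤ x gives a two-term recursion along powers of p, without
  -- valuations or division by a local factor.
  coprime-part : ℕ → ℤ
  coprime-part n = DS n (λ s x → free p x * f s x)

  coprime-part-∤ : ∀ n → ¬ p ∣ n → coprime-part n ≡ DS n f
  coprime-part-∤ n ¬d = DS-cong n λ s x e → trans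
    (cong (_* f s x) (free-∤ {p} λ d → ¬d (subst (p ∣_) e (∣-trans d (n∣m*n s))))) (ℤ.*-identityˡ (f s x))

  private
    split : ∀ n → DS (p ℕ.* n) f ≡ α * DS n f + coprime-part (p ℕ.* n)
    split n = begin
      DS (p ℕ.* n) f
        ≡⟨ DS-cong (p ℕ.* n) (λ s x _ → lemma (free p x) (f s x)) ⟩
      DS (p ℕ.* n) (λ s x → (1ℤ - free p x) * f s x + free p x * f s x)
        ≡⟨ DS-+ (p ℕ.* n) (λ s x → (1ℤ - free p x) * f s x) (λ s x → free p x * f s x) ⟩
      DS (p ℕ.* n) (λ s x → (1ℤ - free p x) * f s x) + coprime-part (p ℕ.* n)
        ≡⟨ cong (λ t → t + coprime-part (p ℕ.* n)) (trans
             (DS-scaleˣ p′ n (λ s x → (1ℤ - free p x) * f s x) λ s x _ ¬d → *-zeroˡ′ {f s x} (cong (λ t → 1ℤ - t) (free-∤ {p} ¬d)))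
             (trans (DS-cong n λ s x _ → trans (cong₂ (λ t y → (1ℤ - t) * y) (free-∣ {p} (n∣m*n x)) (f-x s x)) (ℤ.*-identityˡ (α * f s x)))
               (DS-* n α f))) ⟩
      α * DS n f + coprime-part (p ℕ.* n) ∎
      where
      open ≡-Reasoning
      lemma : ∀ t y → y ≡ (1ℤ - t) * y + t * y
      lemma = solve-∀

  coprime-part-p : ∀ n → coprime-part (p ℕ.* n) ≡ DS (p ℕ.* n) f - α * DS n f
  coprime-part-p n = trans (lemma (α * DS n f) (coprime-part (p ℕ.* n))) (cong (λ t → t - α * DS n f) (sym (split n)))
    where
    lemma : ∀ x y → y ≡ (x + y) - x
    lemma = solve-∀

  -- Among the pairs with s x = p n, those with p ∣ x yield the first term; if p ∤ x then p ∣ s by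
  -- primality, which yields the second.
  hecke : ∀ n → DS (p ℕ.* n) f ≡ α * DS n f + β * coprime-part n
  hecke n = trans (split n) (+-congˡ (α * DS n f) (trans
    (DS-scaleˢ p′ n (λ s x → free p x * f s x) off)
    (trans (DS-cong n λ s x _ → trans (cong (free p x *_) (f-s s x)) (lemma (free p x) β (f s x)))
      (DS-* n β (λ s x → free p x * f s x)))))
    where
    lemma : ∀ x y z → x * (y * z) ≡ y * (x * z)
    lemma = solve-∀
    off : ∀ s x → s ℕ.* x ≡ p ℕ.* n → ¬ p ∣ s → free p x * f s x ≡ 0ℤ
    off s x e ¬d with euclidsLemma s x p-prime (subst (p ∣_) (sym e) (m∣m*n n))
    ... | inj₁ d = contradiction d ¬d
    ... | inj₂ d = *-zeroˡ′ {f s x} (free-∣ {p} d)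

suc₅-⊠ : ∀ i j → suc₅ i ⊠ j ≡ j ⊞ i ⊠ j
suc₅-⊠ = from-yes (all? λ i → all? λ j → suc₅ i ⊠ j Fin.≟ j ⊞ i ⊠ j)

mod₅-* : ∀ m n → mod₅ (m ℕ.* n) ≡ mod₅ m ⊠ mod₅ n
mod₅-* zero    n = refl
mod₅-* (suc m) n = trans (mod₅-+ n (m ℕ.* n)) (trans (cong (mod₅ n ⊞_) (mod₅-* m n)) (sym (suc₅-⊠ (mod₅ m) (mod₅ n))))

χ-* : ∀ m n → χ (m ℕ.* n) ≡ χ m * χ n
χ-* m n = trans (cong χ₅ (mod₅-* m n)) (from-yes (all? λ i → all? λ j → χ₅ (i ⊠ j) ℤ.≟ χ₅ i * χ₅ j) (mod₅ m) (mod₅ n))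

-- The Eisenstein series Σ A(N) q^N and Σ B(N) q^N of weight 2 and character χ.
f-A f-B : ℕ → ℕ → ℤ
f-A s x = + s * χ x
f-B s x = + x * χ x

A B : ℕ → ℤ
A N = DS N f-A
B N = DS N f-B

f-A-x : ∀ p s x → f-A s (x ℕ.* p) ≡ χ p * f-A s x
f-A-x p s x = trans (cong (+ s *_) (χ-* x p)) (lemma (+ s) (χ x) (χ p))
  where
  lemma : ∀ s x c → s * (x * c) ≡ c * (s * x)
  lemma = solve-∀

f-A-s : ∀ p s x → f-A (s ℕ.* p) x ≡ + p * f-A s x
f-A-s p s x = trans (cong (_* χ x) (ℤ.pos-* s p)) (lemma (+ s) (+ p) (χ x))
  where
  lemma : ∀ s p c → s * p * c ≡ p * (s * c)
  lemma = solve-∀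

f-B-x : ∀ p s x → f-B s (x ℕ.* p) ≡ + p * χ p * f-B s x
f-B-x p s x = trans (cong₂ _*_ (ℤ.pos-* x p) (χ-* x p)) (lemma (+ x) (+ p) (χ x) (χ p))
  where
  lemma : ∀ x p c d → x * p * (c * d) ≡ p * d * (x * c)
  lemma = solve-∀

f-B-s : ∀ p s x → f-B (s ℕ.* p) x ≡ 1ℤ * f-B s x
f-B-s p s x = sym (ℤ.*-identityˡ (+ x * χ x))

module HeckeA (p′ : ℕ) (p-prime : Prime (suc p′)) =
  Hecke p′ p-prime f-A (χ (suc p′)) (+ suc p′) (f-A-x (suc p′)) (f-A-s (suc p′))

module HeckeB (p′ : ℕ) (p-prime : Prime (suc p′)) =
  Hecke p′ p-prime f-B (+ suc p′ * χ (suc p′)) 1ℤ (f-B-x (suc p′)) (f-B-s (suc p′))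

0≤* : ∀ {x y} → 0ℤ ℤ.≤ x → 0ℤ ℤ.≤ y → 0ℤ ℤ.≤ x * y
0≤* {+ m} {+ n} _ _ = subst (0ℤ ℤ.≤_) (ℤ.pos-* m n) (ℤ.+≤+ z≤n)

0<* : ∀ {x y} → 0ℤ ℤ.< x → 0ℤ ℤ.< y → 0ℤ ℤ.< x * y
0<* {+ suc m} {+ suc n} _ _ = ℤ.+<+ (s≤s z≤n)
0<* {+ zero} (ℤ.+<+ ()) _
0<* {+ suc m} {+ zero} _ (ℤ.+<+ ())

≤-by : ∀ {x y z} → 0ℤ ℤ.≤ z → y ≡ x + z → x ℤ.≤ y
≤-by {x} {_} {z} 0≤z refl = subst (ℤ._≤ x + z) (ℤ.+-identityʳ x) (ℤ.+-monoʳ-≤ x 0≤z)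

private
  prime-2 : Prime 2
  prime-2 = from-yes (prime? 2)
  prime-5 : Prime 5
  prime-5 = from-yes (prime? 5)

  module A₂ = HeckeA 1 prime-2
  module B₂ = HeckeB 1 prime-2
  module A₅ = HeckeA 4 prime-5
  module B₅ = HeckeB 4 prime-5

A-4m : ∀ m → A (2 ℕ.* (2 ℕ.* m)) ≡ A (2 ℕ.* m) + + 2 * A m
A-4m m = trans (A₂.hecke (2 ℕ.* m)) (trans (cong (λ t → -1ℤ * A (2 ℕ.* m) + + 2 * t) (A₂.coprime-part-p m))
  (lemma (A (2 ℕ.* m)) (A m)))
  where
  lemma : ∀ x y → -1ℤ * x + + 2 * (x - -1ℤ * y) ≡ x + + 2 * y
  lemma = solve-∀

A-2m : ∀ m → ¬ 2 ∣ m → A (2 ℕ.* m) ≡ A m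
A-2m m ¬2 = trans (A₂.hecke m) (trans (cong (λ t → -1ℤ * A m + + 2 * t) (A₂.coprime-part-∤ m ¬2)) (lemma (A m)))
  where
  lemma : ∀ x → -1ℤ * x + + 2 * x ≡ x
  lemma = solve-∀

B-2m : ∀ m → ¬ 2 ∣ m → B (2 ℕ.* m) ≡ - B m
B-2m m ¬2 = trans (B₂.hecke m) (trans (cong (λ t → + 2 * -1ℤ * B m + 1ℤ * t) (B₂.coprime-part-∤ m ¬2)) (lemma (B m)))
  where
  lemma : ∀ x → + 2 * -1ℤ * x + 1ℤ * x ≡ - x
  lemma = solve-∀

χ-5 : ∀ {x} → 5 ∣ x → χ x ≡ 0ℤ
χ-5 (divides k refl) = trans (χ-* k 5) (ℤ.*-zeroʳ (χ k))

free-χ : ∀ y x → free 5 x * (y * χ x) ≡ y * χ x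
free-χ y x with 5 ∣? x
... | yes d = sym (*-zeroʳ′ {y} (χ-5 d))
... | no _  = ℤ.*-identityˡ (y * χ x)

-- As χ(5) = 0, the first term of the recursion disappears; as χ kills multiples of 5, the coprime
-- part is the whole of A(m).
A-5m : ∀ m → A (5 ℕ.* m) ≡ + 5 * A m
A-5m m = trans (A₅.hecke m) (trans (cong (λ t → 0ℤ * A m + + 5 * t) (DS-cong m λ s x _ → free-χ (+ s) x)) (lemma (A m)))
  where
  lemma : ∀ x → 0ℤ * x + + 5 * x ≡ + 5 * x
  lemma = solve-∀

B-5m : ∀ m → B (5 ℕ.* m) ≡ B m
B-5m m = trans (B₅.hecke m) (trans (cong (λ t → + 5 * 0ℤ * B m + 1ℤ * t) (DS-cong m λ s x _ → free-χ (+ x) x)) (lemma (B m)))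
  where
  lemma : ∀ x → + 5 * 0ℤ * x + 1ℤ * x ≡ x
  lemma = solve-∀

-- For s x = N prime to 5, χ(s) = χ(N) χ(x) because the values are ±1. Exchanging the complementary
-- divisors then converts B into A.
B≡χA : ∀ N → χ N * χ N ≡ 1ℤ → B N ≡ χ N * A N
B≡χA N unit = trans (DS-swap N f-B) (trans (DS-cong N {λ s x → f-B x s} {λ s x → χ N * f-A s x} step) (DS-* N (χ N) f-A))
  where
  legendre : ∀ i j → (χ₅ i * χ₅ j) * (χ₅ i * χ₅ j) ≡ 1ℤ → χ₅ i ≡ (χ₅ i * χ₅ j) * χ₅ j
  legendre = from-yes (all? λ i → all? λ j → ((χ₅ i * χ₅ j) * (χ₅ i * χ₅ j) ℤ.≟ 1ℤ) →-dec (χ₅ i ℤ.≟ (χ₅ i * χ₅ j) * χ₅ j))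
  lemma : ∀ s n x → s * (n * x) ≡ n * (s * x)
  lemma = solve-∀
  step : ∀ s x → s ℕ.* x ≡ N → + s * χ s ≡ χ N * (+ s * χ x)
  step s x e = trans (cong (+ s *_) (trans (legendre (mod₅ s) (mod₅ x) (trans (cong₂ _*_ (sym χN) (sym χN)) unit)) (cong (_* χ x) (sym χN)))) (lemma (+ s) (χ N) (χ x))
    where
    χN : χ N ≡ χ s * χ x
    χN = trans (cong χ (sym e)) (χ-* s x)

χ-cases : ∀ n → χ n ≡ 0ℤ ⊎ (χ n ≡ 1ℤ ⊎ χ n ≡ -1ℤ)
χ-cases n with mod₅ n
... | 0F = inj₁ refl
... | 1F = inj₂ (inj₁ refl)
... | 2F = inj₂ (inj₂ refl)
... | 3F = inj₂ (inj₂ refl)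
... | 4F = inj₂ (inj₁ refl)

private
  module _ (p′ : ℕ) (p-prime : Prime (suc p′)) (1≤p′ : 1 ℕ.≤ p′) where
    open HeckeA p′ p-prime

    p : ℕ
    p = suc p′

    0≤p′-1 : 0ℤ ℤ.≤ + p′ - 1ℤ
    0≤p′-1 = ℤ.i≤j⇒0≤j-i (ℤ.+≤+ 1≤p′)

    bound-step : ∀ x → 0ℤ ℤ.≤ x → ∀ {c} → c ≡ 0ℤ ⊎ (c ≡ 1ℤ ⊎ c ≡ -1ℤ) → + p′ * x ℤ.≤ c * x + + p * x
    bound-step x 0≤x (inj₁ refl)        = ≤-by 0≤x (lemma (+ p′) x)
      where
      lemma : ∀ p x → 0ℤ * x + (1ℤ + p) * x ≡ p * x + x
      lemma = solve-∀
    bound-step x 0≤x (inj₂ (inj₁ refl)) = ≤-by (0≤* {+ 2} (ℤ.+≤+ z≤n) 0≤x) (lemma (+ p′) x)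
      where
      lemma : ∀ p x → 1ℤ * x + (1ℤ + p) * x ≡ p * x + + 2 * x
      lemma = solve-∀
    bound-step x 0≤x (inj₂ (inj₂ refl)) = ≤-by {z = 0ℤ} ℤ.≤-refl (lemma (+ p′) x)
      where
      lemma : ∀ p x → -1ℤ * x + (1ℤ + p) * x ≡ p * x + 0ℤ
      lemma = solve-∀

    -- For x = A(p q) and y = A(q), the values 0, 1, -1 of χ(p) leave the remainders x, 2 (x - (p -
    -- 1) y) + (p - 2) y and p y. Only χ(p) = 1 draws on the inductive bound (p - 1) y ≤ x.
    bound-step² : ∀ x y → 0ℤ ℤ.≤ y → + p′ * y ℤ.≤ x → ∀ {c} → c ≡ 0ℤ ⊎ (c ≡ 1ℤ ⊎ c ≡ -1ℤ) → 0ℤ ℤ.≤ x →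
      + p′ * x ℤ.≤ c * x + + p * (x - c * y)
    bound-step² x y 0≤y y≤x (inj₁ refl) 0≤x = ≤-by 0≤x (lemma (+ p′) x y)
      where
      lemma : ∀ p x y → 0ℤ * x + (1ℤ + p) * (x - 0ℤ * y) ≡ p * x + x
      lemma = solve-∀
    bound-step² x y 0≤y y≤x (inj₂ (inj₁ refl)) 0≤x =
      ≤-by (ℤ.+-mono-≤ {0ℤ} {_} {0ℤ} (0≤* {+ 2} (ℤ.+≤+ z≤n) (ℤ.i≤j⇒0≤j-i y≤x)) (0≤* 0≤p′-1 0≤y)) (lemma (+ p′) x y)
      where
      lemma : ∀ p x y → 1ℤ * x + (1ℤ + p) * (x - 1ℤ * y) ≡ p * x + (+ 2 * (x - p * y) + (p - 1ℤ) * y)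
      lemma = solve-∀
    bound-step² x y 0≤y y≤x (inj₂ (inj₂ refl)) 0≤x =
      ≤-by (0≤* {+ p} (ℤ.+≤+ z≤n) 0≤y) (lemma (+ p′) x y)
      where
      lemma : ∀ p x y → -1ℤ * x + (1ℤ + p) * (x - -1ℤ * y) ≡ p * x + (1ℤ + p) * y
      lemma = solve-∀

    -- A substitute for the local factors of a multiplicative function: the induction descends
    -- through the powers of p dividing m. Positivity is assumed only up to m, so that the bound is
    -- available inside the induction proving it.
    A-grows : ∀ m → (∀ j → 1 ℕ.≤ j → j ℕ.≤ m → 0ℤ ℤ.< A j) → 1 ℕ.≤ m → + p′ * A m ℤ.≤ A (p ℕ.* m)
    A-grows = <-rec (λ m → (∀ j → 1 ℕ.≤ j → j ℕ.≤ m → 0ℤ ℤ.< A j) → 1 ℕ.≤ m → + p′ * A m ℤ.≤ A (p ℕ.* m)) step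
      where
      step : ∀ m → (∀ {q} → q ℕ.< m → (∀ j → 1 ℕ.≤ j → j ℕ.≤ q → 0ℤ ℤ.< A j) → 1 ℕ.≤ q → + p′ * A q ℤ.≤ A (p ℕ.* q)) →
        (∀ j → 1 ℕ.≤ j → j ℕ.≤ m → 0ℤ ℤ.< A j) → 1 ℕ.≤ m → + p′ * A m ℤ.≤ A (p ℕ.* m)
      step m rec positive 1≤m with p ∣? m
      ... | no ¬d = subst (+ p′ * A m ℤ.≤_) (sym (trans (hecke m) (cong (λ t → χ p * A m + + p * t) (coprime-part-∤ m ¬d))))
        (bound-step (A m) (ℤ.<⇒≤ (positive m 1≤m ℕ.≤-refl)) (χ-cases p))
      ... | yes (divides zero refl) = contradiction 1≤m λ ()
      ... | yes (divides q@(suc _) m≡qp) = subst (λ m → + p′ * A m ℤ.≤ A (p ℕ.* m)) (sym m≡pq)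
        (subst (+ p′ * A (p ℕ.* q) ℤ.≤_) (sym (trans (hecke (p ℕ.* q)) (cong (λ t → χ p * A (p ℕ.* q) + + p * t) (coprime-part-p q))))
          (bound-step² (A (p ℕ.* q)) (A q) (ℤ.<⇒≤ (positive q (s≤s z≤n) (ℕ.<⇒≤ q<m)))
            (rec q<m (λ j 1≤j j≤q → positive j 1≤j (ℕ.≤-trans j≤q (ℕ.<⇒≤ q<m))) (s≤s z≤n)) (χ-cases p)
            (ℤ.<⇒≤ (subst (λ m → 0ℤ ℤ.< A m) m≡pq (positive m 1≤m ℕ.≤-refl)))))
        where
        m≡pq : m ≡ p ℕ.* q
        m≡pq = trans m≡qp (ℕ.*-comm q p)
        q<m : q ℕ.< m
        q<m = subst (q ℕ.<_) (sym m≡qp) (ℕ.m<m*n q p (s≤s 1≤p′))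

-- One prime factor is split off, n = p m, and `A-grows` bounds A(n) below by (p - 1) A(m) > 0.
A-positive : ∀ n → 1 ℕ.≤ n → 0ℤ ℤ.< A n
A-positive = <-rec (λ n → 1 ℕ.≤ n → 0ℤ ℤ.< A n) step
  where
  step : ∀ n → (∀ {m} → m ℕ.< n → 1 ℕ.≤ m → 0ℤ ℤ.< A m) → 1 ℕ.≤ n → 0ℤ ℤ.< A n
  step n@(suc _) rec 1≤n with factorise n
  ... | record { factors = [] ; isFactorisation = e } = subst (λ n → 0ℤ ℤ.< A n) (sym e) (ℤ.+<+ (s≤s z≤n))
  ... | record { factors = p ∷ ps ; isFactorisation = e ; factorsPrime = prime-p ∷ _ } = split p prime-p (List.product ps) e
    where
    split : ∀ p → Prime p → ∀ m → n ≡ p ℕ.* m → 0ℤ ℤ.< A n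
    split zero          prime-p m e with () ← prime⇒nonTrivial prime-p
    split (suc zero)    prime-p m e with () ← prime⇒nonTrivial prime-p
    split (suc p′@(suc _)) prime-p zero e = contradiction (trans e (ℕ.*-zeroʳ (suc p′))) λ ()
    split (suc p′@(suc _)) prime-p m@(suc _) e = subst (λ n → 0ℤ ℤ.< A n) (sym e)
      (ℤ.<-≤-trans (0<* {+ p′} (ℤ.+<+ (s≤s z≤n)) (rec m<n (s≤s z≤n)))
        (A-grows p′ prime-p (s≤s z≤n) m (λ j 1≤j j≤m → rec (ℕ.≤-<-trans j≤m m<n) 1≤j) (s≤s z≤n)))
      where
      m<n : m ℕ.< n
      m<n = subst (m ℕ.<_) (sym (trans e (ℕ.*-comm (suc p′) m))) (ℕ.m<m*n m (suc p′) (s≤s (s≤s z≤n)))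

-- When 5 ∤ n, B(n) is A(n) or -A(n). When 5 ∣ n no such relation is available, but B(5k) = B(k) ≤
-- A(k) ≤ 5 A(k) = A(5k).
B≤A : ∀ n → 1 ℕ.≤ n → B n ℤ.≤ A n
B≤A = <-rec (λ n → 1 ℕ.≤ n → B n ℤ.≤ A n) step
  where
  0≤A : ∀ n → 1 ℕ.≤ n → 0ℤ ℤ.≤ A n
  0≤A n 1≤n = ℤ.<⇒≤ (A-positive n 1≤n)
  nonzero : ∀ i → χ₅ i ≡ 0ℤ → i ≡ 0F
  nonzero = from-yes (all? λ i → (χ₅ i ℤ.≟ 0ℤ) →-dec (i Fin.≟ 0F))
  mod₅-0 : ∀ n → mod₅ n ≡ 0F → 5 ∣ n
  mod₅-0 0 _ = divides 0 refl
  mod₅-0 1 ()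
  mod₅-0 2 ()
  mod₅-0 3 ()
  mod₅-0 4 ()
  mod₅-0 (suc (suc (suc (suc (suc n))))) p with divides k refl ← mod₅-0 n (trans (sym (suc₅⁵ (mod₅ n))) p) = divides (suc k) refl
  step : ∀ n → (∀ {m} → m ℕ.< n → 1 ℕ.≤ m → B m ℤ.≤ A m) → 1 ℕ.≤ n → B n ℤ.≤ A n
  step n rec 1≤n with χ-cases n
  ... | inj₂ (inj₁ q) = ℤ.≤-reflexive (trans (B≡χA n (cong (λ c → c * c) q)) (trans (cong (_* A n) q) (ℤ.*-identityˡ (A n))))
  ... | inj₂ (inj₂ q) = ≤-by (0≤* {+ 2} (ℤ.+≤+ z≤n) (0≤A n 1≤n)) (trans (lemma (A n)) (cong (λ t → t + + 2 * A n) (sym (trans (B≡χA n (cong (λ c → c * c) q)) (cong (_* A n) q)))))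
    where
    lemma : ∀ x → x ≡ -1ℤ * x + + 2 * x
    lemma = solve-∀
  ... | inj₁ q with mod₅-0 n (nonzero (mod₅ n) q)
  ...   | divides zero refl = contradiction 1≤n λ ()
  ...   | divides k@(suc _) refl = subst (λ n → B n ℤ.≤ A n) (ℕ.*-comm 5 k) (subst₂ ℤ._≤_ (sym (B-5m k)) (sym (A-5m k))
      (≤-by (ℤ.+-mono-≤ {0ℤ} {_} {0ℤ} (ℤ.i≤j⇒0≤j-i (rec (ℕ.m<m*n k 5 (s≤s (s≤s z≤n))) (s≤s z≤n))) (0≤* {+ 4} (ℤ.+≤+ z≤n) (0≤A k (s≤s z≤n)))) (lemma (A k) (B k))))
    where
    lemma : ∀ x y → + 5 * x ≡ y + ((x - y) + + 4 * x)
    lemma = solve-∀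

-- The sign of T(N) = 8 c(N) on residue classes

odd-∣ : ∀ {s} → 2 ∣ s → odd s ≡ 0ℤ
odd-∣ (divides k refl) = double k
  where
  double : ∀ k → odd (k ℕ.* 2) ≡ 0ℤ
  double zero    = refl
  double (suc k) = double k

odd-∤ : ∀ s → ¬ 2 ∣ s → odd s ≡ 1ℤ
odd-∤ zero          ¬d = contradiction (divides 0 refl) ¬d
odd-∤ (suc zero)    ¬d = refl
odd-∤ (suc (suc s)) ¬d = odd-∤ s λ { (divides k refl) → ¬d (divides (suc k) refl) }

even≡1-odd : ∀ s → even s ≡ 1ℤ - odd s
even≡1-odd s with odd s | even s | parity s
... | _ | _ | inj₁ (refl , refl) = refl
... | _ | _ | inj₂ (refl , refl) = refl

T : ℕ → ℤ
T N = DS N (coeff N)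

T-odd : ∀ N → ¬ 2 ∣ N → T N ≡ + 2 * (A N - B N)
T-odd N ¬2 = begin
  T N
    ≡⟨ DS-cong N {coeff N} {λ s x → + 2 * f-A s x + - (+ 2) * f-B s x} step ⟩
  DS N (λ s x → + 2 * f-A s x + - (+ 2) * f-B s x)
    ≡⟨ DS-+ N (λ s x → + 2 * f-A s x) (λ s x → - (+ 2) * f-B s x) ⟩
  DS N (λ s x → + 2 * f-A s x) + DS N (λ s x → - (+ 2) * f-B s x)
    ≡⟨ cong₂ _+_ (DS-* N (+ 2) f-A) (DS-* N (- (+ 2)) f-B) ⟩
  + 2 * A N + - (+ 2) * B N
    ≡⟨ lemma (A N) (B N) ⟩
  + 2 * (A N - B N) ∎
  where
  open ≡-Reasoning
  lemma : ∀ x y → + 2 * x + - (+ 2) * y ≡ + 2 * (x - y)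
  lemma = solve-∀
  lemma′ : ∀ s x c → (+ 2 * 1ℤ * (s - x) - (1ℤ - 1ℤ) * s) * c ≡ + 2 * (s * c) + - (+ 2) * (x * c)
  lemma′ = solve-∀
  step : ∀ s x → s ℕ.* x ≡ N → coeff N s x ≡ + 2 * f-A s x + - (+ 2) * f-B s x
  step s x e = trans (cong₂ (λ o v → (+ 2 * o * (+ s - + x) - v * + s) * χ x) o (trans (even≡1-odd s) (cong (λ t → 1ℤ - t) o))) (lemma′ (+ s) (+ x) (χ x))
    where
    o : odd s ≡ 1ℤ
    o = odd-∤ s λ d → ¬2 (subst (2 ∣_) e (∣-trans d (m∣m*n x)))

-- Replacing `even s` by 1 - odd s separates the expression found for odd N from a correction
-- supported on even s; putting s = 2 s′ turns this correction into divisor sums of n.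
T-even : ∀ n → T (2 ℕ.* n) ≡ + 2 * (A (2 ℕ.* n) - B (2 ℕ.* n)) - + 6 * A n + + 2 * B n
T-even n = begin
  T N
    ≡⟨ DS-cong N {coeff N} {λ s x → (+ 2 * f-A s x + - (+ 2) * f-B s x) + g s x} (λ s x _ → trans
         (cong (λ v → (+ 2 * odd s * (+ s - + x) - v * + s) * χ x) (even≡1-odd s)) (lemma₁ (odd s) (+ s) (+ x) (χ x))) ⟩
  DS N (λ s x → (+ 2 * f-A s x + - (+ 2) * f-B s x) + g s x)
    ≡⟨ trans (DS-+ N (λ s x → + 2 * f-A s x + - (+ 2) * f-B s x) g) (cong₂ _+_
         (trans (DS-+ N (λ s x → + 2 * f-A s x) (λ s x → - (+ 2) * f-B s x)) (cong₂ _+_ (DS-* N (+ 2) f-A) (DS-* N (- (+ 2)) f-B))) halves) ⟩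
  (+ 2 * A N + - (+ 2) * B N) + (- (+ 6) * A n + + 2 * B n)
    ≡⟨ lemma₂ (A N) (B N) (A n) (B n) ⟩
  + 2 * (A N - B N) - + 6 * A n + + 2 * B n ∎
  where
  open ≡-Reasoning
  N : ℕ
  N = 2 ℕ.* n
  g : ℕ → ℕ → ℤ
  g s x = (1ℤ - odd s) * ((+ 2 * + x - + 3 * + s) * χ x)
  lemma₁ : ∀ o s x c → (+ 2 * o * (s - x) - (1ℤ - o) * s) * c ≡
    (+ 2 * (s * c) + - (+ 2) * (x * c)) + (1ℤ - o) * ((+ 2 * x - + 3 * s) * c)
  lemma₁ = solve-∀
  lemma₂ : ∀ x y z w → (+ 2 * x + - (+ 2) * y) + (- (+ 6) * z + + 2 * w) ≡ + 2 * (x - y) - + 6 * z + + 2 * w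
  lemma₂ = solve-∀
  lemma₃ : ∀ s x c → (1ℤ - 0ℤ) * ((+ 2 * x - + 3 * (s * + 2)) * c) ≡ - (+ 6) * (s * c) + + 2 * (x * c)
  lemma₃ = solve-∀
  halves : DS N g ≡ - (+ 6) * A n + + 2 * B n
  halves = begin
    DS N g
      ≡⟨ DS-scaleˢ 1 n g (λ s x _ ¬d → *-zeroˡ′ {(+ 2 * + x - + 3 * + s) * χ x} (cong (λ t → 1ℤ - t) (odd-∤ s ¬d))) ⟩
    DS n (λ s x → g (s ℕ.* 2) x)
      ≡⟨ DS-cong n {λ s x → g (s ℕ.* 2) x} {λ s x → - (+ 6) * f-A s x + + 2 * f-B s x} (λ s x _ → trans
           (cong₂ (λ o t → (1ℤ - o) * ((+ 2 * + x - + 3 * t) * χ x)) (odd-∣ (n∣m*n s)) (ℤ.pos-* s 2)) (lemma₃ (+ s) (+ x) (χ x))) ⟩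
    DS n (λ s x → - (+ 6) * f-A s x + + 2 * f-B s x)
      ≡⟨ DS-+ n (λ s x → - (+ 6) * f-A s x) (λ s x → + 2 * f-B s x) ⟩
    DS n (λ s x → - (+ 6) * f-A s x) + DS n (λ s x → + 2 * f-B s x)
      ≡⟨ cong₂ _+_ (DS-* n (- (+ 6)) f-A) (DS-* n (+ 2) f-B) ⟩
    - (+ 6) * A n + + 2 * B n ∎

private
  B≡A : ∀ N → χ N ≡ 1ℤ → B N ≡ A N
  B≡A N q = trans (B≡χA N (cong (λ c → c * c) q)) (trans (cong (_* A N) q) (ℤ.*-identityˡ (A N)))

  B≡-A : ∀ N → χ N ≡ -1ℤ → B N ≡ - A N
  B≡-A N q = trans (B≡χA N (cong (λ c → c * c) q)) (trans (cong (_* A N) q) (ℤ.-1*i≡-i (A N)))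

  <-neg : ∀ {x} → 0ℤ ℤ.< x → - x ℤ.< 0ℤ
  <-neg = ℤ.neg-mono-<

  5A-B : ∀ k → 1 ℕ.≤ k → 0ℤ ℤ.< + 5 * A k - B k
  5A-B k 1≤k = subst (0ℤ ℤ.<_) (lemma (A k) (B k)) (ℤ.+-mono-≤-< {0ℤ} {_} {0ℤ} (ℤ.i≤j⇒0≤j-i (B≤A k 1≤k)) (0<* {+ 4} (ℤ.+<+ (s≤s z≤n)) (A-positive k 1≤k)))
    where
    lemma : ∀ x y → (x - y) + + 4 * x ≡ + 5 * x - y
    lemma = solve-∀

  T-2m : ∀ m → ¬ 2 ∣ m → T (2 ℕ.* m) ≡ - (+ 4 * (A m - B m))
  T-2m m ¬2 = trans (T-even m) (trans (cong₂ (λ x y → + 2 * (x - y) - + 6 * A m + + 2 * B m) (A-2m m ¬2) (B-2m m ¬2)) (lemma (A m) (B m)))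
    where
    lemma : ∀ x y → + 2 * (x - (- y)) - + 6 * x + + 2 * y ≡ - (+ 4 * (x - y))
    lemma = solve-∀

T-odd-zero : ∀ N → ¬ 2 ∣ N → χ N ≡ 1ℤ → T N ≡ 0ℤ
T-odd-zero N ¬2 q = trans (T-odd N ¬2) (trans (cong (λ y → + 2 * (A N - y)) (B≡A N q)) (lemma (A N)))
  where
  lemma : ∀ x → + 2 * (x - x) ≡ 0ℤ
  lemma = solve-∀

T-2m-zero : ∀ m → ¬ 2 ∣ m → χ m ≡ 1ℤ → T (2 ℕ.* m) ≡ 0ℤ
T-2m-zero m ¬2 q = trans (T-2m m ¬2) (trans (cong (λ y → - (+ 4 * (A m - y))) (B≡A m q)) (lemma (A m)))
  where
  lemma : ∀ x → - (+ 4 * (x - x)) ≡ 0ℤ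
  lemma = solve-∀

T-odd-positive : ∀ N → 1 ℕ.≤ N → ¬ 2 ∣ N → χ N ≡ -1ℤ → 0ℤ ℤ.< T N
T-odd-positive N 1≤N ¬2 q = subst (0ℤ ℤ.<_) (sym (trans (T-odd N ¬2) (trans (cong (λ y → + 2 * (A N - y)) (B≡-A N q)) (lemma (A N)))))
  (0<* {+ 4} (ℤ.+<+ (s≤s z≤n)) (A-positive N 1≤N))
  where
  lemma : ∀ x → + 2 * (x - (- x)) ≡ + 4 * x
  lemma = solve-∀

T-2m-negative : ∀ m → 1 ℕ.≤ m → ¬ 2 ∣ m → χ m ≡ -1ℤ → T (2 ℕ.* m) ℤ.< 0ℤ
T-2m-negative m 1≤m ¬2 q = subst (ℤ._< 0ℤ) (sym (trans (T-2m m ¬2) (trans (cong (λ y → - (+ 4 * (A m - y))) (B≡-A m q)) (lemma (A m)))))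
  (<-neg (0<* {+ 8} (ℤ.+<+ (s≤s z≤n)) (A-positive m 1≤m)))
  where
  lemma : ∀ x → - (+ 4 * (x - (- x))) ≡ - (+ 8 * x)
  lemma = solve-∀

T-5k-positive : ∀ k → 1 ℕ.≤ k → ¬ 2 ∣ 5 ℕ.* k → 0ℤ ℤ.< T (5 ℕ.* k)
T-5k-positive k 1≤k ¬2 = subst (0ℤ ℤ.<_) (sym (trans (T-odd (5 ℕ.* k) ¬2) (cong₂ (λ x y → + 2 * (x - y)) (A-5m k) (B-5m k))))
  (0<* {+ 2} (ℤ.+<+ (s≤s z≤n)) (5A-B k 1≤k))

T-10k-negative : ∀ k → 1 ℕ.≤ k → ¬ 2 ∣ 5 ℕ.* k → T (2 ℕ.* (5 ℕ.* k)) ℤ.< 0ℤ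
T-10k-negative k 1≤k ¬2 = subst (ℤ._< 0ℤ) (sym (trans (T-2m (5 ℕ.* k) ¬2) (cong₂ (λ x y → - (+ 4 * (x - y))) (A-5m k) (B-5m k))))
  (<-neg (0<* {+ 4} (ℤ.+<+ (s≤s z≤n)) (5A-B k 1≤k)))

-- Here B(4m) = A(4m) removes the leading difference, and B(2m) = -A(2m) leaves T(4m) = -8 A(2m).
T-4m-negative : ∀ m → 1 ℕ.≤ m → χ (2 ℕ.* (2 ℕ.* m)) ≡ 1ℤ → χ (2 ℕ.* m) ≡ -1ℤ → T (2 ℕ.* (2 ℕ.* m)) ℤ.< 0ℤ
T-4m-negative m 1≤m q r = subst (ℤ._< 0ℤ) (sym (trans (T-even (2 ℕ.* m))
  (trans (cong₂ (λ x y → + 2 * (A (2 ℕ.* (2 ℕ.* m)) - x) - + 6 * A (2 ℕ.* m) + + 2 * y) (B≡A (2 ℕ.* (2 ℕ.* m)) q) (B≡-A (2 ℕ.* m) r)) (lemma (A (2 ℕ.* (2 ℕ.* m))) (A (2 ℕ.* m))))))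
  (<-neg (0<* {+ 8} (ℤ.+<+ (s≤s z≤n)) (A-positive (2 ℕ.* m) (ℕ.≤-trans 1≤m (ℕ.m≤n*m m 2)))))
  where
  lemma : ∀ x y → + 2 * (x - x) - + 6 * y + + 2 * (- y) ≡ - (+ 8 * y)
  lemma = solve-∀

-- Here T(4m) = 4 (A(4m) - A(2m)), a difference of positive terms; the recursion at 2 settles it as
-- 8 A(m).
T-4m-positive : ∀ m → 1 ℕ.≤ m → χ (2 ℕ.* (2 ℕ.* m)) ≡ -1ℤ → χ (2 ℕ.* m) ≡ 1ℤ → 0ℤ ℤ.< T (2 ℕ.* (2 ℕ.* m))
T-4m-positive m 1≤m q r = subst (0ℤ ℤ.<_) (sym (trans (T-even (2 ℕ.* m))
  (trans (cong₂ (λ x y → + 2 * (A (2 ℕ.* (2 ℕ.* m)) - x) - + 6 * A (2 ℕ.* m) + + 2 * y) (B≡-A (2 ℕ.* (2 ℕ.* m)) q) (B≡A (2 ℕ.* m) r))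
    (trans (cong (λ x → + 2 * (x - (- x)) - + 6 * A (2 ℕ.* m) + + 2 * A (2 ℕ.* m)) (A-4m m)) (lemma (A (2 ℕ.* m)) (A m))))))
  (0<* {+ 8} (ℤ.+<+ (s≤s z≤n)) (A-positive m 1≤m))
  where
  lemma : ∀ x y → + 2 * ((x + + 2 * y) - (- (x + + 2 * y))) - + 6 * x + + 2 * x ≡ + 8 * y
  lemma = solve-∀

-- The two factors as Eisenstein series of weight 1

∑ℕ-quintuple : ∀ n f → ∑ℕ (n ℕ.* 5) f ≡
  ∑ℕ n (λ i → f (i ℕ.* 5) + (f (1 ℕ.+ i ℕ.* 5) + (f (2 ℕ.+ i ℕ.* 5) + (f (3 ℕ.+ i ℕ.* 5) + f (4 ℕ.+ i ℕ.* 5)))))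
∑ℕ-quintuple zero    f = refl
∑ℕ-quintuple (suc n) f = trans
  (cong (λ s → f 0 + (f 1 + (f 2 + (f 3 + (f 4 + s))))) (∑ℕ-quintuple n (λ i → f (5 ℕ.+ i))))
  (lemma (f 0) (f 1) (f 2) (f 3) (f 4) _)
  where
  lemma : ∀ a b c d e x → a + (b + (c + (d + (e + x)))) ≡ (a + (b + (c + (d + e)))) + x
  lemma = solve-∀

X-shift-index : ∀ r e m → X e m ≡ X (+ r + e) (r ℕ.+ m)
X-shift-index zero    e m = cong (λ e → X e m) (sym (ℤ.+-identityˡ e))
X-shift-index (suc r) e m = trans (X-shift-index r e m) (trans (step (+ r + e) (r ℕ.+ m))
  (cong (λ e → X e (suc (r ℕ.+ m))) (sym (ℤ.+-assoc 1ℤ (+ r) e))))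
  where
  step : ∀ e m → X e m ≡ X (1ℤ + e) (suc m)
  step (+ k)        m = refl
  step -[1+ zero ]  m = refl
  step -[1+ suc k ] m = refl

DS-extend : ∀ {N V W} f → N ℕ.≤ V → N ℕ.≤ W →
  DS N f ≡ ∑ℕ V (λ i → ∑ℕ W λ j → f (suc i) (suc j) * X (+ (suc i ℕ.* suc j)) N)
DS-extend {N} {V} {W} f N≤V N≤W = sym (trans
  (∑ℕ-cong V λ i → ∑ℕ-extend {N} {W} {λ j → f (suc i) (suc j) * X (+ (suc i ℕ.* suc j)) N}
    (λ j N≤j → off i j (ℕ.≤-trans (s≤s N≤j) (ℕ.m≤n*m (suc j) (suc i)))) N≤W)
  (∑ℕ-extend {N} {V} {λ i → ∑ℕ N λ j → f (suc i) (suc j) * X (+ (suc i ℕ.* suc j)) N}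
    (λ i N≤i → ∑ℕ-zero N λ j → off i j (ℕ.≤-trans (s≤s N≤i) (ℕ.m≤m*n (suc i) (suc j)))) N≤V))
  where
  off : ∀ i j → N ℕ.< suc i ℕ.* suc j → f (suc i) (suc j) * X (+ (suc i ℕ.* suc j)) N ≡ 0ℤ
  off i j N< = *-zeroʳ′ {f (suc i) (suc j)} (X-off (+ (suc i ℕ.* suc j)) N λ e → ℕ.<-irrefl (sym (ℤ.+-injective e)) N<)

G : (Fin 5 → ℤ) → Series
G ε N = DS N λ a x → odd a * ε (mod₅ x)

mod₅-5k : ∀ k → mod₅ (k ℕ.* 5) ≡ 0F
mod₅-5k zero    = refl
mod₅-5k (suc k) = cong (λ i → suc₅ (suc₅ (suc₅ (suc₅ (suc₅ i))))) (mod₅-5k k)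

module _ (ε : Fin 5 → ℤ) (r r′ : ℕ) (r+r′≡5 : r ℕ.+ r′ ≡ 5) (r≤2 : r ℕ.≤ 2)
  -- This says ε = [r] - [r′]. Divisors start at 1, so a block of five runs over the residues 1, 2,
  -- 3, 4, 0.
  (pick : ∀ (h : ℕ → ℤ) → ε 1F * h 1 + (ε 2F * h 2 + (ε 3F * h 3 + (ε 4F * h 4 + ε 0F * h 5))) ≡ h r + - h r′)
  (low : ∀ {N} → N ℕ.< r → G ε N ≡ 0ℤ) where

  private
    module _ (m : ℕ) where
      open ≡-Reasoning

      N W : ℕ
      N = r ℕ.+ m
      W = 2 ℕ.+ m

      N≤W : N ℕ.≤ W
      N≤W = ℕ.+-monoˡ-≤ m r≤2

      Z : ℕ → ℕ → ℤ
      Z a x = X (+ (a ℕ.* x)) N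

      G-expand : G ε N ≡ ∑ℕ W (λ n → ∑ℕ W λ j → Z (suc (n ℕ.* 2)) (r ℕ.+ j ℕ.* 5) + - Z (suc (n ℕ.* 2)) (r′ ℕ.+ j ℕ.* 5))
      G-expand = begin
        G ε N
          ≡⟨ DS-extend (λ a x → odd a * ε (mod₅ x)) (ℕ.≤-trans N≤W (ℕ.m≤m*n W 2)) (ℕ.≤-trans N≤W (ℕ.m≤m*n W 5)) ⟩
        ∑ℕ (W ℕ.* 2) (λ i → row (suc i))
          ≡⟨ ∑ℕ-double W (row ∘ suc) ⟩
        ∑ℕ W (λ n → row (suc (n ℕ.* 2))) + ∑ℕ W (λ n → row (2 ℕ.+ n ℕ.* 2))
          ≡⟨ cong₂ _+_ (∑ℕ-cong W λ n → odd-row n) (∑ℕ-zero W λ n → ∑ℕ-zero (W ℕ.* 5) λ j →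
               *-zeroˡ′ {Z (2 ℕ.+ n ℕ.* 2) (suc j)} (*-zeroˡ′ {ε (mod₅ (suc j))} (odd-∣ (divides (suc n) refl)))) ⟩
        ∑ℕ W (λ n → ∑ℕ W λ j → Z (suc (n ℕ.* 2)) (r ℕ.+ j ℕ.* 5) + - Z (suc (n ℕ.* 2)) (r′ ℕ.+ j ℕ.* 5)) + 0ℤ
          ≡⟨ ℤ.+-identityʳ _ ⟩
        ∑ℕ W (λ n → ∑ℕ W λ j → Z (suc (n ℕ.* 2)) (r ℕ.+ j ℕ.* 5) + - Z (suc (n ℕ.* 2)) (r′ ℕ.+ j ℕ.* 5)) ∎
        where
        row : ℕ → ℤ
        row a = ∑ℕ (W ℕ.* 5) λ j → odd a * ε (mod₅ (suc j)) * Z a (suc j)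
        odd-one : ∀ n → odd (suc (n ℕ.* 2)) ≡ 1ℤ
        odd-one zero    = refl
        odd-one (suc n) = odd-one n
        odd-row : ∀ n → row (suc (n ℕ.* 2)) ≡ ∑ℕ W (λ j → Z (suc (n ℕ.* 2)) (r ℕ.+ j ℕ.* 5) + - Z (suc (n ℕ.* 2)) (r′ ℕ.+ j ℕ.* 5))
        odd-row n = begin
          row a
            ≡⟨ ∑ℕ-cong (W ℕ.* 5) (λ j → cong (_* Z a (suc j)) (trans (cong (_* ε (mod₅ (suc j))) (odd-one n)) (ℤ.*-identityˡ (ε (mod₅ (suc j)))))) ⟩
          ∑ℕ (W ℕ.* 5) (λ j → ε (mod₅ (suc j)) * Z a (suc j))
            ≡⟨ ∑ℕ-quintuple W (λ j → ε (mod₅ (suc j)) * Z a (suc j)) ⟩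
          ∑ℕ W (λ j → block (mod₅ (j ℕ.* 5)) j)
            ≡⟨ ∑ℕ-cong W (λ j → trans (cong (λ i → block i j) (mod₅-5k j)) (pick (λ s → Z a (s ℕ.+ j ℕ.* 5)))) ⟩
          ∑ℕ W (λ j → Z a (r ℕ.+ j ℕ.* 5) + - Z a (r′ ℕ.+ j ℕ.* 5)) ∎
          where
          a : ℕ
          a = suc (n ℕ.* 2)
          block : Fin 5 → ℕ → ℤ
          block i j = let k = j ℕ.* 5 in
            ε (suc₅ i) * Z a (1 ℕ.+ k) + (ε (suc₅ (suc₅ i)) * Z a (2 ℕ.+ k) + (ε (suc₅ (suc₅ (suc₅ i))) * Z a (3 ℕ.+ k) +
              (ε (suc₅ (suc₅ (suc₅ (suc₅ i)))) * Z a (4 ℕ.+ k) + ε (suc₅ (suc₅ (suc₅ (suc₅ (suc₅ i))))) * Z a (5 ℕ.+ k))))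

      pos-index : ∀ n j s → + (suc (n ℕ.* 2) ℕ.* (s ℕ.+ j ℕ.* 5)) ≡ (1ℤ + + n * + 2) * (+ s + + j * + 5)
      pos-index n j s = trans (ℤ.pos-* (suc (n ℕ.* 2)) (s ℕ.+ j ℕ.* 5)) (cong₂ (λ x y → (1ℤ + x) * (+ s + y)) (ℤ.pos-* n 2) (ℤ.pos-* j 5))

      -- The shift by q^r completes the exponent to (2n + 1)(r + 5j). At n = -1 - n′ and j = -1 - j′
      -- both factors change sign and the exponent becomes (2n′ + 1)(r′ + 5j′), so the negative
      -- quadrant supplies the residue r′ with sign -1.
      F-expand : F 1ℤ 5 (2 ℕ.* r) m ≡ ∑ℕ W (λ n → ∑ℕ W λ j → Z (suc (n ℕ.* 2)) (r ℕ.+ j ℕ.* 5) + - Z (suc (n ℕ.* 2)) (r′ ℕ.+ j ℕ.* 5))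
      F-expand = begin
        F 1ℤ 5 (2 ℕ.* r) m
          ≡⟨ sgn-split (1ℤ ↑_) (F-exp 5 (2 ℕ.* r)) W m ⟩
        ∑ℕ W (λ n → ∑ℕ W λ j → 1ℤ ↑ (+ n) * X (F-exp 5 (2 ℕ.* r) (+ n) (+ j)) m) +
        ∑ℕ W (λ n → ∑ℕ W λ j → - (1ℤ ↑ -[1+ n ]) * X (F-exp 5 (2 ℕ.* r) -[1+ n ] -[1+ j ]) m)
          ≡⟨ ∑ℕ-+ W (λ n → ∑ℕ W λ j → 1ℤ ↑ (+ n) * X (F-exp 5 (2 ℕ.* r) (+ n) (+ j)) m) (λ n → ∑ℕ W λ j → - (1ℤ ↑ -[1+ n ]) * X (F-exp 5 (2 ℕ.* r) -[1+ n ] -[1+ j ]) m) ⟨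
        ∑ℕ W (λ n → ∑ℕ W (λ j → 1ℤ ↑ (+ n) * X (F-exp 5 (2 ℕ.* r) (+ n) (+ j)) m) + ∑ℕ W (λ j → - (1ℤ ↑ -[1+ n ]) * X (F-exp 5 (2 ℕ.* r) -[1+ n ] -[1+ j ]) m))
          ≡⟨ ∑ℕ-cong W (λ n → trans
               (sym (∑ℕ-+ W (λ j → 1ℤ ↑ (+ n) * X (F-exp 5 (2 ℕ.* r) (+ n) (+ j)) m) (λ j → - (1ℤ ↑ -[1+ n ]) * X (F-exp 5 (2 ℕ.* r) -[1+ n ] -[1+ j ]) m)))
               (∑ℕ-cong W λ j → cong₂ _+_ (upper n j) (lower n j))) ⟩
        ∑ℕ W (λ n → ∑ℕ W λ j → Z (suc (n ℕ.* 2)) (r ℕ.+ j ℕ.* 5) + - Z (suc (n ℕ.* 2)) (r′ ℕ.+ j ℕ.* 5)) ∎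
        where
        upper : ∀ n j → 1ℤ ↑ (+ n) * X (F-exp 5 (2 ℕ.* r) (+ n) (+ j)) m ≡ Z (suc (n ℕ.* 2)) (r ℕ.+ j ℕ.* 5)
        upper n j = trans (cong (_* X (F-exp 5 (2 ℕ.* r) (+ n) (+ j)) m) (1↑ (+ n))) (trans (ℤ.*-identityˡ _)
          (trans (X-shift-index r (F-exp 5 (2 ℕ.* r) (+ n) (+ j)) m) (cong (λ e → X e N) exponent)))
          where
          poly : ∀ r n j → r + (+ 2 * r * n + + 5 * ((+ 2 * n + 1ℤ) * j)) ≡ (1ℤ + n * + 2) * (r + j * + 5)
          poly = solve-∀
          exponent : + r + F-exp 5 (2 ℕ.* r) (+ n) (+ j) ≡ + (suc (n ℕ.* 2) ℕ.* (r ℕ.+ j ℕ.* 5))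
          exponent = trans (cong (λ c → + r + (c * + n + + 5 * ((+ 2 * + n + 1ℤ) * + j))) (ℤ.pos-* 2 r))
            (trans (poly (+ r) (+ n) (+ j)) (sym (pos-index n j r)))
        lower : ∀ n j → - (1ℤ ↑ -[1+ n ]) * X (F-exp 5 (2 ℕ.* r) -[1+ n ] -[1+ j ]) m ≡ - Z (suc (n ℕ.* 2)) (r′ ℕ.+ j ℕ.* 5)
        lower n j = trans (cong (λ s → - s * X (F-exp 5 (2 ℕ.* r) -[1+ n ] -[1+ j ]) m) (1↑ -[1+ n ])) (trans (ℤ.-1*i≡-i _)
          (cong -_ (trans (X-shift-index r (F-exp 5 (2 ℕ.* r) -[1+ n ] -[1+ j ]) m) (cong (λ e → X e N) exponent))))
          where
          poly : ∀ r r′ n j → r + (+ 2 * r * (- (1ℤ + n)) + (r + r′) * ((+ 2 * (- (1ℤ + n)) + 1ℤ) * (- (1ℤ + j)))) ≡ (1ℤ + n * + 2) * (r′ + j * (r + r′))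
          poly = solve-∀
          exponent : + r + F-exp 5 (2 ℕ.* r) -[1+ n ] -[1+ j ] ≡ + (suc (n ℕ.* 2) ℕ.* (r′ ℕ.+ j ℕ.* 5))
          exponent = begin
            + r + F-exp 5 (2 ℕ.* r) -[1+ n ] -[1+ j ]
              ≡⟨ cong₂ (λ c d → + r + (c * -[1+ n ] + + d * ((+ 2 * -[1+ n ] + 1ℤ) * -[1+ j ]))) (ℤ.pos-* 2 r) (sym r+r′≡5) ⟩
            + r + (+ 2 * + r * -[1+ n ] + (+ r + + r′) * ((+ 2 * -[1+ n ] + 1ℤ) * -[1+ j ]))
              ≡⟨ poly (+ r) (+ r′) (+ n) (+ j) ⟩
            (1ℤ + + n * + 2) * (+ r′ + + j * (+ r + + r′))
              ≡⟨ cong (λ d → (1ℤ + + n * + 2) * (+ r′ + + j * + d)) r+r′≡5 ⟩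
            (1ℤ + + n * + 2) * (+ r′ + + j * + 5)
              ≡⟨ pos-index n j r′ ⟨
            + (suc (n ℕ.* 2) ℕ.* (r′ ℕ.+ j ℕ.* 5)) ∎

  XF≗G : X (+ r) ⊛ F 1ℤ 5 (2 ℕ.* r) ≗ G ε
  XF≗G i with i ℕ.<? r
  ... | yes i<r = trans (X-⊛-low (F 1ℤ 5 (2 ℕ.* r)) i<r) (sym (low i<r))
  ... | no i≮r = subst (λ i → (X (+ r) ⊛ F 1ℤ 5 (2 ℕ.* r)) i ≡ G ε i) (ℕ.m+[n∸m]≡n (ℕ.≮⇒≥ i≮r))
    (trans (X-⊛-shift r (F 1ℤ 5 (2 ℕ.* r)) (i ℕ.∸ r)) (trans (F-expand (i ℕ.∸ r)) (sym (G-expand (i ℕ.∸ r)))))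

XF₁≗G₁ : X (+ 1) ⊛ F 1ℤ 5 2 ≗ G ε₁
XF₁≗G₁ = XF≗G ε₁ 1 4 refl (s≤s z≤n) (λ h → lemma (h 1) (h 2) (h 3) (h 4) (h 5)) λ { (s≤s z≤n) → refl }
  where
  lemma : ∀ a b c d e → 1ℤ * a + (0ℤ * b + (0ℤ * c + (-1ℤ * d + 0ℤ * e))) ≡ a + - d
  lemma = solve-∀

XF₂≗G₂ : X (+ 2) ⊛ F 1ℤ 5 4 ≗ G ε₂
XF₂≗G₂ = XF≗G ε₂ 2 3 refl (s≤s (s≤s z≤n)) (λ h → lemma (h 1) (h 2) (h 3) (h 4) (h 5)) λ { {zero} _ → refl ; {suc zero} _ → refl ; {suc (suc _)} (s≤s (s≤s ())) }
  where
  lemma : ∀ a b c d e → 0ℤ * a + (1ℤ * b + (-1ℤ * c + (0ℤ * d + 0ℤ * e))) ≡ b + - c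
  lemma = solve-∀

DS-⊛ : ∀ f b N → ((λ i → DS i f) ⊛ b) N ≡ ∑∑ N (λ s x → f s x * (X (+ (s ℕ.* x)) ⊛ b) N)
DS-⊛ f b N = begin
  ((λ i → DS i f) ⊛ b) N
    ≡⟨ ⊛-cong-at {a = λ i → DS i f} {a′ = λ i → ∑ℕ N λ k → ∑ℕ N λ l → f (suc k) (suc l) * X (+ (suc k ℕ.* suc l)) i} {b = b} {b′ = b} N
         (λ i i≤N → DS-extend f i≤N i≤N) ≈-refl ⟩
  ((λ i → ∑ℕ N λ k → ∑ℕ N λ l → f (suc k) (suc l) * X (+ (suc k ℕ.* suc l)) i) ⊛ b) N
    ≡⟨ ∑ℕ-⊛ N (λ k i → ∑ℕ N λ l → f (suc k) (suc l) * X (+ (suc k ℕ.* suc l)) i) b N ⟩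
  ∑ℕ N (λ k → ((λ i → ∑ℕ N λ l → f (suc k) (suc l) * X (+ (suc k ℕ.* suc l)) i) ⊛ b) N)
    ≡⟨ ∑ℕ-cong N (λ k → trans (∑ℕ-⊛ N (λ l → f (suc k) (suc l) · X (+ (suc k ℕ.* suc l))) b N)
         (∑ℕ-cong N λ l → ·-⊛ (f (suc k) (suc l)) (X (+ (suc k ℕ.* suc l))) b N)) ⟩
  ∑∑ N (λ s x → f s x * (X (+ (s ℕ.* x)) ⊛ b) N) ∎
  where open ≡-Reasoning

G₁⊛G₂ : ∀ N → (G ε₁ ⊛ G ε₂) N ≡ Liouville.Full N w₁₁ (Liouville.H N)
G₁⊛G₂ N = begin
  (G ε₁ ⊛ G ε₂) N
    ≡⟨ DS-⊛ f (G ε₂) N ⟩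
  ∑∑ N (λ a x → f a x * (X (+ (a ℕ.* x)) ⊛ G ε₂) N)
    ≡⟨ ∑∑-cong N {λ a x → f a x * (X (+ (a ℕ.* x)) ⊛ G ε₂) N} {λ a x → ∑∑ N (t a x)} (λ i j → inner (suc i) (suc j)) ⟩
  ∑ℕ N (λ i → ∑ℕ N λ j → ∑ℕ N λ k → ∑ℕ N λ l → t (suc i) (suc j) (suc k) (suc l))
    ≡⟨ ∑ℕ-cong N (λ i → ∑ℕ-swap N N (λ j k → ∑ℕ N λ l → t (suc i) (suc j) (suc k) (suc l))) ⟩
  ∑∑ N (λ a b → ∑∑ N (λ x y → t a x b y))
    ≡⟨ ∑∑-cong N {λ a b → ∑∑ N (λ x y → t a x b y)} {λ a b → ∑∑ N λ x y → w₁₁ a b * (H x y * X (+ (a ℕ.* x ℕ.+ b ℕ.* y)) N)}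
         (λ i j → ∑∑-cong N {λ x y → t (suc i) x (suc j) y} {λ x y → w₁₁ (suc i) (suc j) * (H x y * X (+ (suc i ℕ.* x ℕ.+ suc j ℕ.* y)) N)}
           λ k l → regroup (odd (suc i)) (ε₁ (mod₅ (suc k))) (odd (suc j)) (ε₂ (mod₅ (suc l))) (X (+ (suc i ℕ.* suc k ℕ.+ suc j ℕ.* suc l)) N)) ⟩
  Liouville.Full N w₁₁ H ∎
  where
  open ≡-Reasoning
  open Liouville N using (H)
  f g : ℕ → ℕ → ℤ
  f a x = odd a * ε₁ (mod₅ x)
  g b y = odd b * ε₂ (mod₅ y)
  t : ℕ → ℕ → ℕ → ℕ → ℤ
  t a x b y = f a x * (g b y * X (+ (a ℕ.* x ℕ.+ b ℕ.* y)) N)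
  regroup : ∀ a x b y d → a * x * (b * y * d) ≡ a * b * (x * y * d)
  regroup = solve-∀
  inner : ∀ a x → f a x * (X (+ (a ℕ.* x)) ⊛ G ε₂) N ≡ ∑∑ N (t a x)
  inner a x = trans (cong (f a x *_) (trans (⊛-comm (X (+ (a ℕ.* x))) (G ε₂) N) (trans (DS-⊛ g (X (+ (a ℕ.* x))) N)
      (∑∑-cong N {λ b y → g b y * (X (+ (b ℕ.* y)) ⊛ X (+ (a ℕ.* x))) N} {λ b y → g b y * X (+ (a ℕ.* x ℕ.+ b ℕ.* y)) N}
        λ k l → cong (g (suc k) (suc l) *_) (trans (X-+ℕ (suc k ℕ.* suc l) (a ℕ.* x) N) (cong (λ e → X (+ e) N) (ℕ.+-comm (suc k ℕ.* suc l) (a ℕ.* x))))))))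
    (sym (∑∑-* N (f a x) (λ b y → g b y * X (+ (a ℕ.* x ℕ.+ b ℕ.* y)) N)))

FF≡T : ∀ n → + 8 * (F 1ℤ 5 2 ⊛ F 1ℤ 5 4) n ≡ T (3 ℕ.+ n)
FF≡T n = begin
  + 8 * (F 1ℤ 5 2 ⊛ F 1ℤ 5 4) n
    ≡⟨ cong (+ 8 *_) (X-⊛-shift 3 (F 1ℤ 5 2 ⊛ F 1ℤ 5 4) n) ⟨
  + 8 * (X (+ 3) ⊛ (F 1ℤ 5 2 ⊛ F 1ℤ 5 4)) (3 ℕ.+ n)
    ≡⟨ cong (+ 8 *_) (⊛-cong (λ i → sym (X-+ℕ 1 2 i)) (≗-refl {F 1ℤ 5 2 ⊛ F 1ℤ 5 4}) (3 ℕ.+ n)) ⟩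
  + 8 * ((X (+ 1) ⊛ X (+ 2)) ⊛ (F 1ℤ 5 2 ⊛ F 1ℤ 5 4)) (3 ℕ.+ n)
    ≡⟨ cong (+ 8 *_) (pair (X (+ 1)) (X (+ 2)) (F 1ℤ 5 2) (F 1ℤ 5 4) (3 ℕ.+ n)) ⟩
  + 8 * ((X (+ 1) ⊛ F 1ℤ 5 2) ⊛ (X (+ 2) ⊛ F 1ℤ 5 4)) (3 ℕ.+ n)
    ≡⟨ cong (+ 8 *_) (⊛-cong XF₁≗G₁ XF₂≗G₂ (3 ℕ.+ n)) ⟩
  + 8 * (G ε₁ ⊛ G ε₂) (3 ℕ.+ n)
    ≡⟨ cong (+ 8 *_) (G₁⊛G₂ (3 ℕ.+ n)) ⟩
  + 8 * Liouville.Full (3 ℕ.+ n) w₁₁ (Liouville.H (3 ℕ.+ n))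
    ≡⟨ eight-c (3 ℕ.+ n) ⟩
  T (3 ℕ.+ n) ∎
  where open ≡-Reasoning

-- Identification of b̄₅ with the product of the two factors

sum≡∑ℕ : ∀ n (f : ℕ → ℤ) → sum {n} (λ i → f (Fin.toℕ i)) ≡ ∑ℕ n f
sum≡∑ℕ zero    f = refl
sum≡∑ℕ (suc n) f = +-congˡ (f 0) (sum≡∑ℕ n (f ∘ suc))

triangular-even : ∀ i → triangular (i ℕ.* 2) ≡ i ℕ.* suc (i ℕ.* 2)
triangular-even i = trans (cong (ℕ._/ 2) (lemma i)) (ℕ.m*n/n≡m (i ℕ.* suc (i ℕ.* 2)) 2)
  where
  lemma : ∀ i → (i ℕ.* 2) ℕ.* (1 ℕ.+ i ℕ.* 2) ≡ i ℕ.* (1 ℕ.+ i ℕ.* 2) ℕ.* 2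
  lemma = ℕ-Solver.solve-∀

triangular-odd : ∀ i → triangular (suc (i ℕ.* 2)) ≡ suc (i ℕ.* 2) ℕ.* suc i
triangular-odd i = trans (cong (ℕ._/ 2) (lemma i)) (ℕ.m*n/n≡m (suc (i ℕ.* 2) ℕ.* suc i) 2)
  where
  lemma : ∀ i → (1 ℕ.+ i ℕ.* 2) ℕ.* (2 ℕ.+ i ℕ.* 2) ≡ (1 ℕ.+ i ℕ.* 2) ℕ.* (1 ℕ.+ i) ℕ.* 2
  lemma = ℕ-Solver.solve-∀

n≤triangular : ∀ n → n ℕ.≤ triangular n
n≤triangular zero    = z≤n
n≤triangular (suc n) = subst (ℕ._≤ triangular (suc n)) (ℕ.m*n/n≡m (suc n) 2)
  (ℕ./-monoˡ-≤ 2 (ℕ.*-monoʳ-≤ (suc n) (s≤s (s≤s (z≤n {n})))))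

triangular-off : ∀ h {m} k → 1 ℕ.≤ h → m ℕ.< k → X (+ (h ℕ.* triangular k)) m ≡ 0ℤ
triangular-off h {m} k 1≤h m<k = X-off (+ (h ℕ.* triangular k)) m λ e → ℕ.<-irrefl (sym (ℤ.+-injective e))
  (ℕ.≤-trans m<k (ℕ.≤-trans (n≤triangular k) (ℕ.m≤n*m (triangular k) h {{ℕ.>-nonZero 1≤h}})))

-- In the reflected form n = i ≥ 0 gives the triangular number of index 2i and n = -1 - i that of
-- index 2i + 1, so the two halves of the bilateral sum interleave into one sum over ℕ.
ψᵗ≡∑ : ∀ h → 1 ℕ.≤ h → ∀ m {W} → suc m ℕ.≤ W → ψᵗ h m ≡ ∑ℕ W (λ k → X (+ (h ℕ.* triangular k)) m)
ψᵗ≡∑ h 1≤h m {W} m<W = begin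
  ψᵗ h m
    ≡⟨ Θ-reflect 1ℤ {h = h ℕ.+ h} {a = h} {a′ = h ℕ.+ h ℕ.+ h} (ℕ.≤-trans 1≤h (ℕ.m≤m+n h h)) 1≤h (ℕ.≤-trans 1≤h (ℕ.m≤n+m h _)) (four h) m ⟩
  ∑ℕ V (λ i → 1ℤ ↑ (+ i) * X (θ-exp (h ℕ.+ h) (h ℕ.+ h ℕ.+ h) (+ i)) m) + ∑ℕ V (λ i → 1ℤ ↑ -[1+ i ] * X (θ-exp (h ℕ.+ h) (h ℕ.+ h ℕ.+ h) -[1+ i ]) m)
    ≡⟨ cong₂ _+_ (∑ℕ-cong V λ i → trans (cong₂ (λ s e → s * X e m) (1↑ (+ i)) (exp₁ i)) (ℤ.*-identityˡ (f (i ℕ.* 2))))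
                 (∑ℕ-cong V λ i → trans (cong₂ (λ s e → s * X e m) (1↑ -[1+ i ]) (exp₂ i)) (ℤ.*-identityˡ (f (suc (i ℕ.* 2))))) ⟩
  ∑ℕ V (λ i → f (i ℕ.* 2)) + ∑ℕ V (λ i → f (suc (i ℕ.* 2)))
    ≡⟨ ∑ℕ-double V f ⟨
  ∑ℕ (V ℕ.* 2) f
    ≡⟨ ∑ℕ-extend {suc m} {V ℕ.* 2} {f} (λ k → triangular-off h k 1≤h) (ℕ.≤-trans (ℕ.n≤1+n _) (ℕ.m≤m*n V 2)) ⟩
  ∑ℕ (suc m) f
    ≡⟨ ∑ℕ-extend {suc m} {W} {f} (λ k → triangular-off h k 1≤h) m<W ⟨
  ∑ℕ W f ∎
  where
  open ≡-Reasoning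
  V : ℕ
  V = 2 ℕ.+ m
  f : ℕ → ℤ
  f k = X (+ (h ℕ.* triangular k)) m
  four : ∀ h → h ℕ.+ (h ℕ.+ h ℕ.+ h) ≡ h ℕ.+ h ℕ.+ (h ℕ.+ h)
  four = ℕ-Solver.solve-∀
  poly₁ : ∀ h i → (h + h) * (i * (i - 1ℤ)) + (h + h + h) * i ≡ h * (i * (1ℤ + i * + 2))
  poly₁ = solve-∀
  poly₂ : ∀ h i → (h + h) * ((- (1ℤ + i)) * ((- (1ℤ + i)) - 1ℤ)) + (h + h + h) * (- (1ℤ + i)) ≡ h * ((1ℤ + i * + 2) * (1ℤ + i))
  poly₂ = solve-∀
  exp₁ : ∀ i → θ-exp (h ℕ.+ h) (h ℕ.+ h ℕ.+ h) (+ i) ≡ + (h ℕ.* triangular (i ℕ.* 2))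
  exp₁ i = trans (poly₁ (+ h) (+ i)) (sym (trans (cong (λ t → + (h ℕ.* t)) (triangular-even i))
    (trans (ℤ.pos-* h _) (cong (+ h *_) (trans (ℤ.pos-* i (suc (i ℕ.* 2))) (cong (λ t → + i * (1ℤ + t)) (ℤ.pos-* i 2)))))))
  exp₂ : ∀ i → θ-exp (h ℕ.+ h) (h ℕ.+ h ℕ.+ h) -[1+ i ] ≡ + (h ℕ.* triangular (suc (i ℕ.* 2)))
  exp₂ i = trans (poly₂ (+ h) (+ i)) (sym (trans (cong (λ t → + (h ℕ.* t)) (triangular-odd i))
    (trans (ℤ.pos-* h _) (cong (+ h *_) (trans (ℤ.pos-* (suc (i ℕ.* 2)) (suc i)) (cong (λ t → (1ℤ + t) * + suc i) (ℤ.pos-* i 2)))))))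

ψ≡∑ : ∀ m → ψ m ≡ ∑ℕ (suc m) (λ k → X (+ triangular k) m)
ψ≡∑ m = trans (sum≡∑ℕ (suc m) (λ k → if ⌊ triangular k ℕ.≟ m ⌋ then 1ℤ else 0ℤ)) (∑ℕ-cong (suc m) λ k → indicator (triangular k))
  where
  indicator : ∀ t → (if ⌊ t ℕ.≟ m ⌋ then 1ℤ else 0ℤ) ≡ X (+ t) m
  indicator t with t ℕ.≟ m
  ... | yes refl = sym (X-diag m)
  ... | no t≢m   = sym (X-off (+ t) m (t≢m ∘ ℤ.+-injective))

ψ≗ψᵗ : ψ ≗ ψᵗ 1
ψ≗ψᵗ m = trans (ψ≡∑ m) (trans (∑ℕ-cong (suc m) λ k → cong (λ t → X (+ t) m) (sym (ℕ.*-identityˡ (triangular k))))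
  (sym (ψᵗ≡∑ 1 ℕ.≤-refl m ℕ.≤-refl)))

powVarψ≗ψᵗ : powVar 5 ψ ≗ ψᵗ 5
powVarψ≗ψᵗ m with 5 ∣? m
... | yes (divides k refl) = begin
  ψ (k ℕ.* 5 ℕ./ 5)
    ≡⟨ cong ψ (ℕ.m*n/n≡m k 5) ⟩
  ψ k
    ≡⟨ ψ≡∑ k ⟩
  ∑ℕ (suc k) (λ i → X (+ triangular i) k)
    ≡⟨ ∑ℕ-cong (suc k) (λ i → X-scale-index 4 (triangular i) k) ⟨
  ∑ℕ (suc k) (λ i → X (+ (5 ℕ.* triangular i)) (5 ℕ.* k))
    ≡⟨ cong (λ m → ∑ℕ (suc k) (λ i → X (+ (5 ℕ.* triangular i)) m)) (ℕ.*-comm 5 k) ⟩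
  ∑ℕ (suc k) (λ i → X (+ (5 ℕ.* triangular i)) (k ℕ.* 5))
    ≡⟨ ∑ℕ-extend {suc k} {suc (k ℕ.* 5)} {λ i → X (+ (5 ℕ.* triangular i)) (k ℕ.* 5)} (λ i k<i →
         X-off (+ (5 ℕ.* triangular i)) (k ℕ.* 5) λ e → ℕ.<-irrefl (sym (ℕ.*-cancelʳ-≡ (triangular i) k 5 (trans (ℕ.*-comm (triangular i) 5) (ℤ.+-injective e))))
           (ℕ.≤-trans k<i (n≤triangular i))) (s≤s (ℕ.m≤m*n k 5)) ⟨
  ∑ℕ (suc (k ℕ.* 5)) (λ i → X (+ (5 ℕ.* triangular i)) (k ℕ.* 5))
    ≡⟨ ψᵗ≡∑ 5 (s≤s z≤n) (k ℕ.* 5) ℕ.≤-refl ⟨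
  ψᵗ 5 (k ℕ.* 5) ∎
  where open ≡-Reasoning
... | no ¬d = sym (trans (ψᵗ≡∑ 5 (s≤s z≤n) m ℕ.≤-refl) (∑ℕ-zero (suc m) λ i →
  X-off (+ (5 ℕ.* triangular i)) m λ e → ¬d (divides (triangular i) (trans (sym (ℤ.+-injective e)) (ℕ.*-comm 5 (triangular i))))))

negVar-⊛ : ∀ a b → negVar (a ⊛ b) ≗ negVar a ⊛ negVar b
negVar-⊛ a b zero    = begin
  1ℤ * (a ⊛ b) 0             ≡⟨ cong (1ℤ *_) (⊛-0 a b) ⟩
  1ℤ * (a 0 * b 0)           ≡⟨ lemma (a 0) (b 0) ⟩
  1ℤ * a 0 * (1ℤ * b 0)      ≡⟨ ⊛-0 (negVar a) (negVar b) ⟨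
  (negVar a ⊛ negVar b) 0    ∎
  where
  open ≡-Reasoning
  lemma : ∀ x y → 1ℤ * (x * y) ≡ 1ℤ * x * (1ℤ * y)
  lemma = solve-∀
negVar-⊛ a b (suc n) = begin
  -1ℤ * s * (a ⊛ b) (suc n)
    ≡⟨ cong (-1ℤ * s *_) (⊛-suc a b n) ⟩
  -1ℤ * s * (a 0 * b (suc n) + (tail a ⊛ b) n)
    ≡⟨ lemma s (a 0) (b (suc n)) ((tail a ⊛ b) n) ⟩
  1ℤ * a 0 * (-1ℤ * s * b (suc n)) + -1ℤ * (s * (tail a ⊛ b) n)
    ≡⟨ +-congˡ (1ℤ * a 0 * (-1ℤ * s * b (suc n))) (trans (cong (-1ℤ *_) (negVar-⊛ (tail a) b n)) (sym (·-⊛ -1ℤ (negVar (tail a)) (negVar b) n))) ⟩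
  1ℤ * a 0 * (-1ℤ * s * b (suc n)) + ((-1ℤ · negVar (tail a)) ⊛ negVar b) n
    ≡⟨ +-congˡ (1ℤ * a 0 * (-1ℤ * s * b (suc n))) (⊛-cong (λ i → sym (ℤ.*-assoc -1ℤ (-1ℤ ℤ.^ i) (a (suc i)))) (≗-refl {negVar b}) n) ⟩
  negVar a 0 * negVar b (suc n) + (tail (negVar a) ⊛ negVar b) n
    ≡⟨ ⊛-suc (negVar a) (negVar b) n ⟨
  (negVar a ⊛ negVar b) (suc n) ∎
  where
  open ≡-Reasoning
  s : ℤ
  s = -1ℤ ℤ.^ n
  lemma : ∀ s x y z → -1ℤ * s * (x * y + z) ≡ 1ℤ * x * (-1ℤ * s * y) + -1ℤ * (s * z)
  lemma = solve-∀

-- Holds because 5 is odd: (-1)^(5k) = (-1)^k.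
negVar-powVar : ∀ a → negVar (powVar 5 a) ≗ powVar 5 (negVar a)
negVar-powVar a m with 5 ∣? m
... | yes (divides k refl) = begin
  -1ℤ ℤ.^ (k ℕ.* 5) * a (k ℕ.* 5 ℕ./ 5)                     ≡⟨ cong (λ i → -1ℤ ℤ.^ (k ℕ.* 5) * a i) (ℕ.m*n/n≡m k 5) ⟩
  -1ℤ ℤ.^ (k ℕ.* 5) * a k                                   ≡⟨ cong (_* a k) (sign k) ⟩
  -1ℤ ℤ.^ k * a k                                           ≡⟨ cong (negVar a) (ℕ.m*n/n≡m k 5) ⟨
  negVar a (k ℕ.* 5 ℕ./ 5)                                  ∎
  where
  open ≡-Reasoning
  lemma : ∀ x → -1ℤ * (-1ℤ * (-1ℤ * (-1ℤ * (-1ℤ * x)))) ≡ -1ℤ * x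
  lemma = solve-∀
  sign : ∀ k → -1ℤ ℤ.^ (k ℕ.* 5) ≡ -1ℤ ℤ.^ k
  sign zero    = refl
  sign (suc k) = trans (lemma (-1ℤ ℤ.^ (k ℕ.* 5))) (cong (-1ℤ *_) (sign k))
... | no _ = ℤ.*-zeroʳ (-1ℤ ℤ.^ m)

⁵-cong : ∀ {a b} → a ≗ b → a ⁵ ≗ b ⁵
⁵-cong p = ⊛-cong p (⊛-cong p (⊛-cong p (⊛-cong p p)))

opaque
  unfolding _⊛_

  ^ˢ-5 : ∀ a → a ^ˢ 5 ≗ a ⁵
  ^ˢ-5 a = ⊛-cong (≗-refl {a}) (⊛-cong (≗-refl {a}) (⊛-cong (≗-refl {a}) (⊛-cong (≗-refl {a}) (⊛-identityʳ a))))

  ψb̄≗ψ⁵ : ψ[-q] ⊛ b̄₅ ≗ ψ[-q⁵] ^ˢ 5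
  ψb̄≗ψ⁵ = b̄₅-defining

-- The substitution q ↦ -q respects products, so it carries `ψFF≗ψ⁵` to the defining equation of
-- b̄₅; ψ(-q) has constant term 1 and cancels.
b̄₅≗negVar : b̄₅ ≗ negVar (F 1ℤ 5 2 ⊛ F 1ℤ 5 4)
b̄₅≗negVar = ⊛-cancelˡ ψ[-q] refl λ n → begin
  (ψ[-q] ⊛ b̄₅) n
    ≡⟨ ψb̄≗ψ⁵ n ⟩
  (ψ[-q⁵] ^ˢ 5) n
    ≡⟨ ^ˢ-5 ψ[-q⁵] n ⟩
  (ψ[-q⁵] ⁵) n
    ≡⟨ ⁵-cong (λ i → trans (sym (negVar-powVar ψ i)) (cong (-1ℤ ℤ.^ i *_) (powVarψ≗ψᵗ i))) n ⟩
  (negVar (ψᵗ 5) ⁵) n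
    ≡⟨ negVar-⁵ (ψᵗ 5) n ⟨
  negVar (ψᵗ 5 ⁵) n
    ≡⟨ cong (-1ℤ ℤ.^ n *_) (ψFF≗ψ⁵ n) ⟨
  negVar (ψᵗ 1 ⊛ L) n
    ≡⟨ negVar-⊛ (ψᵗ 1) L n ⟩
  (negVar (ψᵗ 1) ⊛ negVar L) n
    ≡⟨ ⊛-cong (λ i → cong (-1ℤ ℤ.^ i *_) (sym (ψ≗ψᵗ i))) (≗-refl {negVar L}) n ⟩
  (ψ[-q] ⊛ negVar L) n ∎
  where
  open ≡-Reasoning
  L : Series
  L = F 1ℤ 5 2 ⊛ F 1ℤ 5 4
  negVar-⁵ : ∀ a → negVar (a ⁵) ≗ negVar a ⁵
  negVar-⁵ a = ≗-trans (negVar-⊛ a (a ⊛ (a ⊛ (a ⊛ a)))) (⊛-cong ≗-refl (≗-trans (negVar-⊛ a (a ⊛ (a ⊛ a))) (⊛-cong ≗-refl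
    (≗-trans (negVar-⊛ a (a ⊛ a)) (⊛-cong ≗-refl (negVar-⊛ a a))))))

b̄₅≡T : ∀ n → + 8 * b̄₅ n ≡ -1ℤ ℤ.^ n * T (3 ℕ.+ n)
b̄₅≡T n = trans (cong (+ 8 *_) (b̄₅≗negVar n)) (trans (lemma (-1ℤ ℤ.^ n) ((F 1ℤ 5 2 ⊛ F 1ℤ 5 4) n)) (cong (-1ℤ ℤ.^ n *_) (FF≡T n)))
  where
  lemma : ∀ s x → + 8 * (s * x) ≡ s * (+ 8 * x)
  lemma = solve-∀

-- Densities

χ-shift : ∀ r q → χ (r ℕ.+ q ℕ.* 5) ≡ χ r
χ-shift r q = cong χ₅ (trans (mod₅-+ r (q ℕ.* 5)) (trans (cong (mod₅ r ⊞_) (mod₅-5k q))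
  (from-yes (all? λ i → i ⊞ 0F Fin.≟ i) (mod₅ r))))

χ-shift₂₀ : ∀ r q → χ (r ℕ.+ q ℕ.* 20) ≡ χ r
χ-shift₂₀ r q = trans (cong (λ k → χ (r ℕ.+ k)) (lemma q)) (χ-shift r (q ℕ.* 4))
  where
  lemma : ∀ q → q ℕ.* 20 ≡ q ℕ.* 4 ℕ.* 5
  lemma = ℕ-Solver.solve-∀

χ-shift₁₀ : ∀ r q → χ (r ℕ.+ q ℕ.* 10) ≡ χ r
χ-shift₁₀ r q = trans (cong (λ k → χ (r ℕ.+ k)) (lemma q)) (χ-shift r (q ℕ.* 2))
  where
  lemma : ∀ q → q ℕ.* 10 ≡ q ℕ.* 2 ℕ.* 5
  lemma = ℕ-Solver.solve-∀

odd⇒∤ : ∀ {n} → odd n ≡ 1ℤ → ¬ 2 ∣ n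
odd⇒∤ p d with () ← trans (sym p) (odd-∣ d)

∤-shift : ∀ r q k → odd r ≡ 1ℤ → ¬ 2 ∣ r ℕ.+ q ℕ.* (k ℕ.* 2)
∤-shift r q k p = odd⇒∤ (trans (odd-+ r (q ℕ.* (k ℕ.* 2))) (trans
  (cong₂ (λ x y → odd r * x + even r * y) (trans (even≡1-odd (q ℕ.* (k ℕ.* 2))) (cong (λ t → 1ℤ - t) zero-odd)) zero-odd)
  (trans (lemma (odd r) (even r)) p)))
  where
  lemma : ∀ x y → x * (1ℤ - 0ℤ) + y * 0ℤ ≡ x
  lemma = solve-∀
  zero-odd : odd (q ℕ.* (k ℕ.* 2)) ≡ 0ℤ
  zero-odd = odd-∣ (divides (q ℕ.* k) (sym (ℕ.*-assoc q k 2)))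

sign-shift : ∀ j q → -1ℤ ℤ.^ (j ℕ.+ q ℕ.* 20) ≡ -1ℤ ℤ.^ j
sign-shift j q = trans (ℤ.^-distribˡ-+-* -1ℤ j (q ℕ.* 20)) (trans
  (cong (-1ℤ ℤ.^ j *_) (trans (cong (-1ℤ ℤ.^_) (ℕ.*-comm q 20)) (trans (sym (ℤ.^-*-assoc -1ℤ 20 q)) (ℤ.^-zeroˡ q))))
  (ℤ.*-identityʳ (-1ℤ ℤ.^ j)))

private
  zero-8 : ∀ b → + 8 * b ≡ 0ℤ → b ≡ 0ℤ
  zero-8 (+ zero) _ = refl

  positive-8 : ∀ b → 0ℤ ℤ.< + 8 * b → 0ℤ ℤ.< b
  positive-8 (+ zero)  (ℤ.+<+ ())
  positive-8 (+ suc b) _ = ℤ.+<+ (s≤s z≤n)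

  negative-8 : ∀ b → + 8 * b ℤ.< 0ℤ → b ℤ.< 0ℤ
  negative-8 (+ zero)  (ℤ.+<+ ())
  negative-8 (+ suc b) (ℤ.+<+ ())
  negative-8 -[1+ b ]  _ = ℤ.-<+

  module _ (j q : ℕ) {N : ℕ} (N≡ : 3 ℕ.+ (j ℕ.+ q ℕ.* 20) ≡ N) where
    n : ℕ
    n = j ℕ.+ q ℕ.* 20

    b̄≡ : + 8 * b̄₅ n ≡ -1ℤ ℤ.^ j * T N
    b̄≡ = trans (b̄₅≡T n) (cong₂ _*_ (sign-shift j q) (cong T N≡))

    is-zero : T N ≡ 0ℤ → b̄₅ n ≡ 0ℤ
    is-zero p = zero-8 (b̄₅ n) (trans b̄≡ (*-zeroʳ′ { -1ℤ ℤ.^ j} p))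

    even-positive : -1ℤ ℤ.^ j ≡ 1ℤ → 0ℤ ℤ.< T N → 0ℤ ℤ.< b̄₅ n
    even-positive s p = positive-8 (b̄₅ n) (subst (0ℤ ℤ.<_) (sym (trans b̄≡ (trans (cong (_* T N) s) (ℤ.*-identityˡ (T N))))) p)

    odd-≡ : -1ℤ ℤ.^ j ≡ -1ℤ → + 8 * b̄₅ n ≡ - T N
    odd-≡ s = trans b̄≡ (trans (cong (_* T N) s) (ℤ.-1*i≡-i (T N)))

    odd-positive : -1ℤ ℤ.^ j ≡ -1ℤ → T N ℤ.< 0ℤ → 0ℤ ℤ.< b̄₅ n
    odd-positive s p = positive-8 (b̄₅ n) (subst (0ℤ ℤ.<_) (sym (odd-≡ s)) (ℤ.neg-mono-< p))

    odd-negative : -1ℤ ℤ.^ j ≡ -1ℤ → 0ℤ ℤ.< T N → b̄₅ n ℤ.< 0ℤ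
    odd-negative s p = negative-8 (b̄₅ n) (subst (ℤ._< 0ℤ) (sym (odd-≡ s)) (ℤ.neg-mono-< p))

  shape₁₀ : ∀ r q → 2 ℕ.* (r ℕ.+ q ℕ.* 10) ≡ 2 ℕ.* r ℕ.+ q ℕ.* 20
  shape₁₀ = ℕ-Solver.solve-∀
  shape₄ : ∀ r q → 2 ℕ.* (2 ℕ.* (r ℕ.+ q ℕ.* 5)) ≡ 4 ℕ.* r ℕ.+ q ℕ.* 20
  shape₄ = ℕ-Solver.solve-∀
  shape₅ : ∀ r q → 5 ℕ.* (r ℕ.+ q ℕ.* 4) ≡ 5 ℕ.* r ℕ.+ q ℕ.* 20
  shape₅ = ℕ-Solver.solve-∀
  shape₂₅ : ∀ r q → 2 ℕ.* (5 ℕ.* (r ℕ.+ q ℕ.* 2)) ≡ 10 ℕ.* r ℕ.+ q ℕ.* 20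
  shape₂₅ = ℕ-Solver.solve-∀
  shape₂₅′ : ∀ r q → 5 ℕ.* (r ℕ.+ q ℕ.* 2) ≡ 5 ℕ.* r ℕ.+ q ℕ.* 10
  shape₂₅′ = ℕ-Solver.solve-∀
  shape₂ : ∀ r q → 2 ℕ.* (r ℕ.+ q ℕ.* 5) ≡ 2 ℕ.* r ℕ.+ q ℕ.* 2 ℕ.* 5
  shape₂ = ℕ-Solver.solve-∀

  -- N = 3 + n = r + 20 q, where j = r - 3.
  zero-odd : ∀ r j → 3 ℕ.+ j ≡ r → odd r ≡ 1ℤ → χ r ≡ 1ℤ → ∀ q → b̄₅ (j ℕ.+ q ℕ.* 20) ≡ 0ℤ
  zero-odd r j refl o c q = is-zero j q refl (T-odd-zero (r ℕ.+ q ℕ.* 20) (∤-shift r q 10 o) (trans (χ-shift₂₀ r q) c))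

  zero-2m : ∀ r j → 3 ℕ.+ j ≡ 2 ℕ.* r → odd r ≡ 1ℤ → χ r ≡ 1ℤ → ∀ q → b̄₅ (j ℕ.+ q ℕ.* 20) ≡ 0ℤ
  zero-2m r j e o c q = is-zero j q (trans (cong (ℕ._+ q ℕ.* 20) e) (sym (shape₁₀ r q)))
    (T-2m-zero (r ℕ.+ q ℕ.* 10) (∤-shift r q 5 o) (trans (χ-shift₁₀ r q) c))

  positive-odd : ∀ r j → 3 ℕ.+ j ≡ r → -1ℤ ℤ.^ j ≡ 1ℤ → odd r ≡ 1ℤ → χ r ≡ -1ℤ → ∀ q → 0ℤ ℤ.< b̄₅ (j ℕ.+ q ℕ.* 20)
  positive-odd r j refl s o c q = even-positive j q refl s (T-odd-positive (r ℕ.+ q ℕ.* 20) (s≤s z≤n) (∤-shift r q 10 o) (trans (χ-shift₂₀ r q) c))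

  positive-5k : ∀ r j → 3 ℕ.+ j ≡ 5 ℕ.* suc r → -1ℤ ℤ.^ j ≡ 1ℤ → odd (5 ℕ.* suc r) ≡ 1ℤ → ∀ q → 0ℤ ℤ.< b̄₅ (j ℕ.+ q ℕ.* 20)
  positive-5k r j e s o q = even-positive j q (trans (cong (ℕ._+ q ℕ.* 20) e) (sym (shape₅ (suc r) q))) s
    (T-5k-positive (suc r ℕ.+ q ℕ.* 4) (s≤s z≤n) (subst (λ n → ¬ 2 ∣ n) (sym (shape₅ (suc r) q)) (∤-shift (5 ℕ.* suc r) q 10 o)))

  positive-2m : ∀ r j → 3 ℕ.+ j ≡ 2 ℕ.* suc r → -1ℤ ℤ.^ j ≡ -1ℤ → odd (suc r) ≡ 1ℤ → χ (suc r) ≡ -1ℤ → ∀ q → 0ℤ ℤ.< b̄₅ (j ℕ.+ q ℕ.* 20)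
  positive-2m r j e s o c q = odd-positive j q (trans (cong (ℕ._+ q ℕ.* 20) e) (sym (shape₁₀ (suc r) q))) s
    (T-2m-negative (suc r ℕ.+ q ℕ.* 10) (s≤s z≤n) (∤-shift (suc r) q 5 o) (trans (χ-shift₁₀ (suc r) q) c))

  positive-10k : ∀ r j → 3 ℕ.+ j ≡ 10 ℕ.* suc r → -1ℤ ℤ.^ j ≡ -1ℤ → odd (5 ℕ.* suc r) ≡ 1ℤ → ∀ q → 0ℤ ℤ.< b̄₅ (j ℕ.+ q ℕ.* 20)
  positive-10k r j e s o q = odd-positive j q (trans (cong (ℕ._+ q ℕ.* 20) e) (sym (shape₂₅ (suc r) q))) s
    (T-10k-negative (suc r ℕ.+ q ℕ.* 2) (s≤s z≤n) (subst (λ n → ¬ 2 ∣ n) (sym (shape₂₅′ (suc r) q)) (∤-shift (5 ℕ.* suc r) q 5 o)))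

  χ-4m : ∀ r q → χ (2 ℕ.* (2 ℕ.* (r ℕ.+ q ℕ.* 5))) ≡ χ (4 ℕ.* r)
  χ-4m r q = trans (cong χ (shape₄ r q)) (χ-shift₂₀ (4 ℕ.* r) q)

  χ-2m : ∀ r q → χ (2 ℕ.* (r ℕ.+ q ℕ.* 5)) ≡ χ (2 ℕ.* r)
  χ-2m r q = trans (cong χ (shape₂ r q)) (χ-shift (2 ℕ.* r) (q ℕ.* 2))

  positive-4m : ∀ r j → 3 ℕ.+ j ≡ 4 ℕ.* suc r → -1ℤ ℤ.^ j ≡ -1ℤ → χ (4 ℕ.* suc r) ≡ 1ℤ → χ (2 ℕ.* suc r) ≡ -1ℤ → ∀ q → 0ℤ ℤ.< b̄₅ (j ℕ.+ q ℕ.* 20)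
  positive-4m r j e s c d q = odd-positive j q (trans (cong (ℕ._+ q ℕ.* 20) e) (sym (shape₄ (suc r) q))) s
    (T-4m-negative (suc r ℕ.+ q ℕ.* 5) (s≤s z≤n) (trans (χ-4m (suc r) q) c) (trans (χ-2m (suc r) q) d))

  negative-4m : ∀ r j → 3 ℕ.+ j ≡ 4 ℕ.* suc r → -1ℤ ℤ.^ j ≡ -1ℤ → χ (4 ℕ.* suc r) ≡ -1ℤ → χ (2 ℕ.* suc r) ≡ 1ℤ → ∀ q → b̄₅ (j ℕ.+ q ℕ.* 20) ℤ.< 0ℤ
  negative-4m r j e s c d q = odd-negative j q (trans (cong (ℕ._+ q ℕ.* 20) e) (sym (shape₄ (suc r) q))) s
    (T-4m-positive (suc r ℕ.+ q ℕ.* 5) (s≤s z≤n) (trans (χ-4m (suc r) q) c) (trans (χ-2m (suc r) q) d))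

-- j stands for the class of 1 + j modulo 20.
zeros positives negatives : List ℕ
zeros     = 5 ∷ 7 ∷ 14 ∷ 15 ∷ 17 ∷ 18 ∷ []
positives = 0 ∷ 1 ∷ 2 ∷ 3 ∷ 6 ∷ 9 ∷ 10 ∷ 11 ∷ 12 ∷ 13 ∷ 19 ∷ []
negatives = 4 ∷ 8 ∷ []

zeros-correct : All (λ j → ∀ q → b̄₅ (suc (j ℕ.+ q ℕ.* 20)) ≡ 0ℤ) zeros
zeros-correct = zero-odd 9 6 refl refl refl ∷ zero-odd 11 8 refl refl refl ∷ zero-2m 9 15 refl refl refl ∷
  zero-odd 19 16 refl refl refl ∷ zero-odd 21 18 refl refl refl ∷ zero-2m 11 19 refl refl refl ∷ []

positives-correct : All (λ j → ∀ q → 0ℤ ℤ.< b̄₅ (suc (j ℕ.+ q ℕ.* 20))) positives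
positives-correct = positive-4m 0 1 refl refl refl refl ∷ positive-5k 0 2 refl refl refl ∷
  positive-2m 2 3 refl refl refl refl ∷ positive-odd 7 4 refl refl refl refl ∷ positive-10k 0 7 refl refl refl ∷
  positive-odd 13 10 refl refl refl refl ∷ positive-2m 6 11 refl refl refl refl ∷ positive-5k 2 12 refl refl refl ∷
  positive-4m 3 13 refl refl refl refl ∷ positive-odd 17 14 refl refl refl refl ∷
  -- The class of n = 20 (q + 1) is n ≡ 0 with its first member n = 0 skipped, hence `suc q`.
  (λ q → positive-odd 3 0 refl refl refl refl (suc q)) ∷ []

negatives-correct : All (λ j → ∀ q → b̄₅ (suc (j ℕ.+ q ℕ.* 20)) ℤ.< 0ℤ) negatives
negatives-correct = negative-4m 1 5 refl refl refl refl ∷ negative-4m 2 9 refl refl refl refl ∷ []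

-- Lower density of a union of residue classes

tally : (ℕ → Bool) → ℕ → ℕ
tally g zero    = 0
tally g (suc n) = (if g 0 then 1 else 0) ℕ.+ tally (g ∘ suc) n

tally-+ : ∀ g m n → tally g (m ℕ.+ n) ≡ tally g m ℕ.+ tally (λ i → g (m ℕ.+ i)) n
tally-+ g zero    n = refl
tally-+ g (suc m) n = trans (cong ((if g 0 then 1 else 0) ℕ.+_) (tally-+ (g ∘ suc) m n))
  (sym (ℕ.+-assoc (if g 0 then 1 else 0) (tally (g ∘ suc) m) _))

tally-cong : ∀ {g h} n → (∀ i → g i ≡ h i) → tally g n ≡ tally h n
tally-cong zero    p = refl
tally-cong (suc n) p = cong₂ ℕ._+_ (cong (if_then 1 else 0) (p 0)) (tally-cong n (p ∘ suc))

tally-periodic : ∀ g → (∀ i → g (20 ℕ.+ i) ≡ g i) → ∀ q → tally g (q ℕ.* 20) ≡ q ℕ.* tally g 20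
tally-periodic g p zero    = refl
tally-periodic g p (suc q) = trans (tally-+ g 20 (q ℕ.* 20))
  (cong (tally g 20 ℕ.+_) (trans (tally-cong (q ℕ.* 20) p) (tally-periodic g p q)))

module _ {ℓ} {P : Pred ℕ ℓ} (P? : Decidable P) where

  tally≤filter : ∀ n (g : ℕ → Bool) (f : ℕ → ℕ) → (∀ i → g i ≡ true → P (f i)) →
    tally g n ℕ.≤ length (filter P? (applyUpTo f n))
  tally≤filter zero    g f p = z≤n
  tally≤filter (suc n) g f p with g 0 in eq | P? (f 0)
  ... | false | yes _ = ℕ.m≤n⇒m≤1+n (tally≤filter n (g ∘ suc) (f ∘ suc) (p ∘ suc))
  ... | false | no _  = tally≤filter n (g ∘ suc) (f ∘ suc) (p ∘ suc)
  ... | true  | yes _ = s≤s (tally≤filter n (g ∘ suc) (f ∘ suc) (p ∘ suc))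
  ... | true  | no ¬P = contradiction (p 0 eq) ¬P

  module _ (classes : List ℕ) (correct : All (λ j → ∀ q → P (suc (j ℕ.+ q ℕ.* 20))) classes) where

    private
      member : ℕ → Bool
      member i = ⌊ i ℕ.% 20 ∈? classes ⌋

      member-correct : ∀ i → member i ≡ true → P (suc i)
      member-correct i e with i ℕ.% 20 ∈? classes
      ... | yes i∈ = subst (λ k → P (suc k)) (sym (ℕ.m≡m%n+[m/n]*n i 20)) (All.lookup correct i∈ (i ℕ./ 20))

      member-periodic : ∀ i → member (20 ℕ.+ i) ≡ member i
      member-periodic i = cong (λ r → ⌊ r ∈? classes ⌋) (trans (cong (ℕ._% 20) (ℕ.+-comm 20 i)) (ℕ.[m+n]%n≡m%n i 20))

    size : ℕ
    size = tally member 20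

    -- Complete periods are counted exactly and an incomplete one is ignored, which costs a loss
    -- bounded independently of N.
    count-bound : ∀ N → N ℕ.* size ℕ.≤ count P? N ℕ.* 20 ℕ.+ 20 ℕ.* size
    count-bound N = begin
      N ℕ.* size
        ≤⟨ ℕ.*-monoˡ-≤ size (ℕ.≤-trans (ℕ.≤-reflexive (ℕ.m≡m%n+[m/n]*n N 20)) (ℕ.+-monoˡ-≤ (q ℕ.* 20) (ℕ.<⇒≤ (ℕ.m%n<n N 20)))) ⟩
      (20 ℕ.+ q ℕ.* 20) ℕ.* size
        ≡⟨ lemma q size ⟩
      q ℕ.* size ℕ.* 20 ℕ.+ 20 ℕ.* size
        ≤⟨ ℕ.+-monoˡ-≤ (20 ℕ.* size) (ℕ.*-monoˡ-≤ 20 lower) ⟩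
      count P? N ℕ.* 20 ℕ.+ 20 ℕ.* size ∎
      where
      open ℕ.≤-Reasoning
      q : ℕ
      q = N ℕ./ 20
      lemma : ∀ q s → (20 ℕ.+ q ℕ.* 20) ℕ.* s ≡ q ℕ.* s ℕ.* 20 ℕ.+ 20 ℕ.* s
      lemma = ℕ-Solver.solve-∀
      lower : q ℕ.* size ℕ.≤ count P? N
      lower = begin
        q ℕ.* size
          ≡⟨ tally-periodic member member-periodic q ⟨
        tally member (q ℕ.* 20)
          ≤⟨ ℕ.m≤m+n _ _ ⟩
        tally member (q ℕ.* 20) ℕ.+ tally (λ i → member (q ℕ.* 20 ℕ.+ i)) (N ℕ.% 20)
          ≡⟨ tally-+ member (q ℕ.* 20) (N ℕ.% 20) ⟨
        tally member (q ℕ.* 20 ℕ.+ N ℕ.% 20)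
          ≡⟨ cong (tally member) (trans (ℕ.+-comm (q ℕ.* 20) (N ℕ.% 20)) (sym (ℕ.m≡m%n+[m/n]*n N 20))) ⟩
        tally member N
          ≤⟨ tally≤filter N member suc member-correct ⟩
        count P? N ∎

    -- The fraction a/(b + 1) is given unnormalised, so that the inequality can be cross-multiplied
    -- in ℕ; a denominator of 100 therefore appears as b = 99.
    density-bound : ∀ a b → a ℕ.* 20 ℕ.≤ size ℕ.* suc b → size ℕ.≤ 20 →
      ℚ.fromℚᵘ (mkℚᵘ (+ a) b) ≤liminf frequency P?
    density-bound a b a/b≤ size≤20 ε@(mkℚ (+ zero) d _) (ℚ.*<* (ℤ.+<+ ()))
    -- The count falls short of N · size / 20 by at most size ≤ 20. Since ε is at least 1/(d + 1), ε
    -- N ≥ 20 as soon as N ≥ 20 (d + 1).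
    density-bound a b a/b≤ size≤20 ε@(mkℚ (+ suc p) d _) 0<ε = 20 ℕ.* suc d , bound
      where
      bound : ∀ (N : ℕ) .{{_ : ℕ.NonZero N}} → 20 ℕ.* suc d ℕ.≤ N → ℚ.fromℚᵘ (mkℚᵘ (+ a) b) ℚ.- ε ℚ.≤ frequency P? N
      bound (suc N′) large = subst (c ℚ.- ε ℚ.≤_) cancel (ℚ.+-monoˡ-≤ (ℚ.- ε) (ℚ.toℚᵘ-cancel-≤ (ℚᵘ.≤-respˡ-≃ (ℚᵘ.≃-sym (ℚ.toℚᵘ-fromℚᵘ (mkℚᵘ (+ a) b)))
          (ℚᵘ.≤-respʳ-≃ (ℚᵘ.≃-sym (ℚᵘ.≃-trans (ℚ.toℚᵘ-homo-+ freq ε) (ℚᵘ.+-congˡ (ℚ.toℚᵘ ε) (ℚ.toℚᵘ-fromℚᵘ (mkℚᵘ (+ C) N′)))))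
            (ℚᵘ.*≤* cross)))))
        where
        N C D : ℕ
        N = suc N′
        C = count P? N
        D = suc d
        c freq : ℚ
        c = ℚ.fromℚᵘ (mkℚᵘ (+ a) b)
        freq = frequency P? N
        cancel : (freq ℚ.+ ε) ℚ.- ε ≡ freq
        cancel = trans (ℚ.+-assoc freq ε (ℚ.- ε)) (trans (cong (freq ℚ.+_) (ℚ.+-inverseʳ ε)) (ℚ.+-identityʳ freq))
        main : a ℕ.* (N ℕ.* D) ℕ.≤ (C ℕ.* D ℕ.+ suc p ℕ.* N) ℕ.* suc b
        main = ℕ.*-cancelʳ-≤ _ _ 20 (begin
          a ℕ.* (N ℕ.* D) ℕ.* 20
            ≡⟨ lemma₁ a N D ⟩
          a ℕ.* 20 ℕ.* (N ℕ.* D)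
            ≤⟨ ℕ.*-monoˡ-≤ (N ℕ.* D) a/b≤ ⟩
          size ℕ.* suc b ℕ.* (N ℕ.* D)
            ≡⟨ lemma₂ size (suc b) N D ⟩
          N ℕ.* size ℕ.* (suc b ℕ.* D)
            ≤⟨ ℕ.*-monoˡ-≤ (suc b ℕ.* D) (ℕ.≤-trans (count-bound N) (ℕ.+-monoʳ-≤ (C ℕ.* 20) (ℕ.*-monoʳ-≤ 20 size≤20))) ⟩
          (C ℕ.* 20 ℕ.+ 20 ℕ.* 20) ℕ.* (suc b ℕ.* D)
            ≡⟨ lemma₃ C (suc b) D ⟩
          (C ℕ.* D ℕ.+ 20 ℕ.* D) ℕ.* suc b ℕ.* 20
            ≤⟨ ℕ.*-monoˡ-≤ 20 (ℕ.*-monoˡ-≤ (suc b) (ℕ.+-monoʳ-≤ (C ℕ.* D) (ℕ.≤-trans large (ℕ.m≤n*m N (suc p))))) ⟩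
          (C ℕ.* D ℕ.+ suc p ℕ.* N) ℕ.* suc b ℕ.* 20 ∎)
          where
          open ℕ.≤-Reasoning
          lemma₁ : ∀ a N D → a ℕ.* (N ℕ.* D) ℕ.* 20 ≡ a ℕ.* 20 ℕ.* (N ℕ.* D)
          lemma₁ = ℕ-Solver.solve-∀
          lemma₂ : ∀ s b N D → s ℕ.* b ℕ.* (N ℕ.* D) ≡ N ℕ.* s ℕ.* (b ℕ.* D)
          lemma₂ = ℕ-Solver.solve-∀
          lemma₃ : ∀ C b D → (C ℕ.* 20 ℕ.+ 20 ℕ.* 20) ℕ.* (b ℕ.* D) ≡ (C ℕ.* D ℕ.+ 20 ℕ.* D) ℕ.* b ℕ.* 20
          lemma₃ = ℕ-Solver.solve-∀
        cross : + a * (+ N * + D) ℤ.≤ (+ C * + D + + suc p * + N) * + suc b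
        cross = subst₂ ℤ._≤_
          (trans (ℤ.pos-* a (N ℕ.* D)) (cong (+ a *_) (ℤ.pos-* N D)))
          (trans (ℤ.pos-* (C ℕ.* D ℕ.+ suc p ℕ.* N) (suc b)) (cong (_* + suc b) (cong₂ _+_ (ℤ.pos-* C D) (ℤ.pos-* (suc p) N))))
          (ℤ.+≤+ main)

corollary6 : ((+ 30 / 100) ≤liminf frequency (λ n → b̄₅ n ≟ 0ℤ))
    × ((+ 52 / 100) ≤liminf frequency (λ n → 0ℤ <? b̄₅ n))
    × ((+ 10 / 100) ≤liminf frequency (λ n → b̄₅ n <? 0ℤ))
corollary6 =
    -- Cross-multiplied comparisons: 30 · 20 = 6 · 100, 52 · 20 ≤ 11 · 100 and 10 · 20 = 2 · 100.
    density-bound (λ n → b̄₅ n ≟ 0ℤ) zeros zeros-correct 30 99 (ℕ.≤ᵇ⇒≤ 600 600 _) (ℕ.≤ᵇ⇒≤ 6 20 _)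
  , density-bound (λ n → 0ℤ <? b̄₅ n) positives positives-correct 52 99 (ℕ.≤ᵇ⇒≤ 1040 1100 _) (ℕ.≤ᵇ⇒≤ 11 20 _)
  , density-bound (λ n → b̄₅ n <? 0ℤ) negatives negatives-correct 10 99 (ℕ.≤ᵇ⇒≤ 200 200 _) (ℕ.≤ᵇ⇒≤ 2 20 _)
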